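{- Let $\ell$ be a prime. The algorithm described in the context, run on input $\ell$, determines all temperaments $\tau$ with $\tau^2\in[\frac34\ell,\ell]$ that come from $3$-and-$1$ forms of index $\ell$: its output set $T$ is exactly the set of numbers $\tau^2\in[\frac34\ell,\ell]$ such that $\tau$ is the temperament of some $3$-and-$1$ form of index $\ell$.
   Context: Tempered perfect forms. A lattice in $\mathbb{R}^2\cong\mathbb{C}$ is the $\mathbb{Z}$-span of an $\mathbb{R}$-basis; $\langle\,,\rangle$ is the standard dot product. Let $\ell$ be a prime, $L$ a lattice and $M\subset L$ a sublattice of index $\ell$. The pair $(L,M)$ is a tempered perfect lattice (or form) of index $\ell$ if, after rescaling $L$ and $M$ by a common positive scalar, there exist non-empty sets $S\subset L-M$ and $S'\subset M-\{0\}$ such that, with $A(v)=\langle v,v\rangle$: (i) $A(v)=1$ for all $v\in S$; (ii) $A(v)>1$ for all $v\in L-M$ with $v\notin S$; (iii) $A(v)$ has a common value $u\geqslant 1$ for all $v\in S'$; (iv) $A(v)>u$ for all $v\in M-\{0\}$ with $v\notin S'$; (v) if $B$ is any positive definite quadratic form on $\mathbb{R}^2$ satisfying (i)--(iv) in place of $A$ with the same $S,S'$ and with common value $u'$ on $S'$, then $B=A$ and $u'=u$. The temperament is $\tau=\sqrt u$. It is called an $s$-and-$s'$ form if $S$ consists of $s$ pairs $\pm v$ and $S'$ consists of $s'$ pairs $\pm v$. The algorithm. Let $\omega=e^{2\pi i/3}$; the norm on $\mathbb{Z}[\omega]$ is $N(a+b\omega)=a^2-ab+b^2$ (the squared length),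 and $a+b\omega$ is primitive if $\gcd(a,b)=1$. The units of $\mathbb{Z}[\omega]$ are $\pm1,\pm\omega,\pm\omega^2$. Let $\beta_1=1<\beta_2=3<\beta_3=7<\cdots$ be the ordered list of integers that are norms of primitive elements of $\mathbb{Z}[\omega]$. Let $n$ be the last index (possibly none) with $\beta_n<\frac34\ell$ and $N$ the last index with $\beta_N<\ell$. Step 1. Let $\mathcal{L}=\{\beta_{n+1},\dots,\beta_N\}$. Make a table with one column for each norm in $\mathcal{L}$; under each norm list all primitive $v\in\mathbb{Z}[\omega]$ of that norm, up to multiplication by units (so each entry is a $\mathbb{Z}/6\mathbb{Z}$-orbit). Set $T=\emptyset$. Step 2. If $\mathcal{L}$ is empty, output $T$ and stop. Otherwise choose a (not crossed-out) $v$ under the smallest norm $\beta_{\alpha_0}$ in $\mathcal{L}$. Compute a second vector $\hat w$ as follows: write $v=a+b\omega$, take $c,d\in\mathbb{Z}$ with $ad-bc=1$, put $w=c+d\omega$, so that $v$ and $\ell w$ generate the unique index-$\ell$ sublattice $M$ of $\mathbb{Z}[\omega]$ containing $v$; let $z\in\mathbb{C}$ be perpendicular to $v$, on the same side of the line $\mathbb{R}v$ as $w$, with $|z|=\frac{\sqrt3\,\ell}{2|v|}$; then $t_0=(z-\ell w)/v\in\mathbb{R}$, $t$ is a nearest integer to $t_0$, and $\hat w=\ell w+tv$. Let $\beta_{\alpha_1}$ denote the norm of $\hat w$. Step 3. Add $\beta_{\alpha_0}$ to $T$. Step 4. Cross out the orbits of $v$ and $\hat w$ under the norms $\beta_{\alpha_0}$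 and $\beta_{\alpha_1}$ respectively; if the norm of $\hat w$ is not on the list, cross out only the orbit of $v$. If a column is then completely crossed out, delete its norm from $\mathcal{L}$. Go to Step 2. -}

module Defs where

import Algebra.Properties.Ring
open import Data.Fin.Base using (Fin)
open import Data.Integer.Base as ℤ using (ℤ; +_; -[1+_])
import Data.Integer.GCD as ℤ
import Data.Integer.Properties as ℤ
import Data.Integer.Tactic.RingSolver as ℤ-Solver
open import Data.List.Base
  using (List; []; _∷_; _++_; map; filter; upTo; dropWhile; deduplicate; cartesianProduct)
open import Data.List.Membership.Propositional using (_∈_)
open import Data.List.Membership.Propositional.Properties
  using (∈-filter⁺; ∈-filter⁻; ∈-map⁺; ∈-++⁺ˡ; ∈-++⁺ʳ; ∈-upTo⁺; ∈-cartesianProduct⁺)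
open import Data.List.Relation.Unary.All using (All)
open import Data.List.Relation.Unary.Any using (Any; any?; here)
open import Data.Nat.Base as ℕ using (ℕ; suc)
import Data.Nat.Properties as ℕ
import Data.Nat.Tactic.RingSolver as ℕ-Solver
open import Data.Product using (Σ-syntax; ∃; ∃₂; ∃!; _×_; _,_; proj₁; proj₂; map₂)
import Data.Product.Properties as Product
open import Data.Rational.Base as ℚ using (ℚ; 0ℚ; 1ℚ; ½)
import Data.Rational.Properties as ℚ
open import Data.Rational.Solver using (module +-*-Solver)
open import Data.Sum.Base using (_⊎_; inj₁; inj₂)
open import Function.Base using (_∘_)
open import Function.Bundles using (_⇔_; mk⇔; module Equivalence)
open import Level using (0ℓ)
open import Relation.Binary.Construct.Closure.ReflexiveTransitive using (Star)
open import Relation.Binary.Core using (Rel)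
open import Relation.Binary.Definitions using (Decidable)
open import Relation.Binary.PropositionalEquality
  using (_≡_; _≢_; refl; sym; trans; cong; cong₂; subst; subst₂)
open import Relation.Nullary.Decidable using (Dec; yes; no; ¬?; _×-dec_)
open import Relation.Nullary.Negation using (¬_; contradiction)
open import Relation.Unary using (Pred; _⊆_)
import Relation.Unary as Unary

IsCauchy : (ℕ → ℚ) → Set
IsCauchy s = ∀ {ε} → 0ℚ ℚ.< ε →
  ∃ λ N → ∀ {m n} → N ℕ.≤ m → N ℕ.≤ n → ℚ.∣ s m ℚ.- s n ∣ ℚ.< ε

private
  module Ring = Algebra.Properties.Ring ℚ.+-*-ring

  abstract
    const-cauchy : ∀ q → IsCauchy (λ _ → q)
    const-cauchy q {ε} 0<ε =
      0 , λ _ _ → subst (λ d → ℚ.∣ d ∣ ℚ.< ε) (sym (ℚ.+-inverseʳ q)) 0<ε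

    0<½* : ∀ {ε} → 0ℚ ℚ.< ε → 0ℚ ℚ.< ½ ℚ.* ε
    0<½* {ε} 0<ε = subst (ℚ._< ½ ℚ.* ε) (ℚ.*-zeroʳ ½) (ℚ.*-monoʳ-<-pos ½ 0<ε)

    ½*-+-½* : ∀ ε → ½ ℚ.* ε ℚ.+ ½ ℚ.* ε ≡ ε
    ½*-+-½* ε = trans (sym (ℚ.*-distribʳ-+ ε ½ ½)) (ℚ.*-identityˡ ε)

    +-cauchy : ∀ s t → IsCauchy s → IsCauchy t → IsCauchy (λ n → s n ℚ.+ t n)
    +-cauchy s t cs ct {ε} 0<ε with cs (0<½* 0<ε) | ct (0<½* 0<ε)
    ... | N₁ , p | N₂ , q = N₁ ℕ.⊔ N₂ , λ {m} {n} N≤m N≤n →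
      let open ℚ.≤-Reasoning in begin-strict
      ℚ.∣ (s m ℚ.+ t m) ℚ.- (s n ℚ.+ t n) ∣
        ≡⟨ cong ℚ.∣_∣ (rearrange (s m) (t m) (s n) (t n)) ⟩
      ℚ.∣ (s m ℚ.- s n) ℚ.+ (t m ℚ.- t n) ∣
        ≤⟨ ℚ.∣p+q∣≤∣p∣+∣q∣ (s m ℚ.- s n) (t m ℚ.- t n) ⟩
      ℚ.∣ s m ℚ.- s n ∣ ℚ.+ ℚ.∣ t m ℚ.- t n ∣
        <⟨ ℚ.+-mono-< (p (ℕ.m⊔n≤o⇒m≤o N₁ N₂ N≤m) (ℕ.m⊔n≤o⇒m≤o N₁ N₂ N≤n))
                      (q (ℕ.m⊔n≤o⇒n≤o N₁ N₂ N≤m) (ℕ.m⊔n≤o⇒n≤o N₁ N₂ N≤n)) ⟩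
      ½ ℚ.* ε ℚ.+ ½ ℚ.* ε
        ≡⟨ ½*-+-½* ε ⟩
      ε ∎
      where
      open +-*-Solver
      rearrange : ∀ a b c d → (a ℚ.+ b) ℚ.- (c ℚ.+ d) ≡ (a ℚ.- c) ℚ.+ (b ℚ.- d)
      rearrange = solve 4 (λ a b c d → (a :+ b) :- (c :+ d) := (a :- c) :+ (b :- d)) refl

    neg-cauchy : ∀ s → IsCauchy s → IsCauchy (λ n → ℚ.- s n)
    neg-cauchy s cs {ε} 0<ε with cs 0<ε
    ... | N , p = N , λ {m} {n} N≤m N≤n →
      subst (ℚ._< ε)
        (trans (sym (ℚ.∣-p∣≡∣p∣ (s m ℚ.- s n))) (cong ℚ.∣_∣ (rearrange (s m) (s n))))
        (p N≤m N≤n)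
      where
      open +-*-Solver
      rearrange : ∀ a b → ℚ.- (a ℚ.- b) ≡ (ℚ.- a) ℚ.- (ℚ.- b)
      rearrange = solve 2 (λ a b → :- (a :- b) := (:- a) :- (:- b)) refl

    ∣p∣≤∣q∣+∣p-q∣ : ∀ p q → ℚ.∣ p ∣ ℚ.≤ ℚ.∣ q ∣ ℚ.+ ℚ.∣ p ℚ.- q ∣
    ∣p∣≤∣q∣+∣p-q∣ p q =
      subst (λ x → ℚ.∣ x ∣ ℚ.≤ ℚ.∣ q ∣ ℚ.+ ℚ.∣ p ℚ.- q ∣) (rearrange p q)
        (ℚ.∣p+q∣≤∣p∣+∣q∣ q (p ℚ.- q))
      where
      open +-*-Solver
      rearrange : ∀ a b → b ℚ.+ (a ℚ.- b) ≡ a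
      rearrange = solve 2 (λ a b → b :+ (a :- b) := a) refl

    ∣p∣-∣q∣≤∣p-q∣ : ∀ p q → ℚ.∣ p ∣ ℚ.- ℚ.∣ q ∣ ℚ.≤ ℚ.∣ p ℚ.- q ∣
    ∣p∣-∣q∣≤∣p-q∣ p q =
      subst (ℚ.∣ p ∣ ℚ.- ℚ.∣ q ∣ ℚ.≤_) (rearrange ℚ.∣ q ∣ ℚ.∣ p ℚ.- q ∣)
        (ℚ.+-monoˡ-≤ (ℚ.- ℚ.∣ q ∣) (∣p∣≤∣q∣+∣p-q∣ p q))
      where
      open +-*-Solver
      rearrange : ∀ a b → (a ℚ.+ b) ℚ.- a ≡ b
      rearrange = solve 2 (λ a b → (a :+ b) :- a := b) refl

    ∣p-q∣≡∣q-p∣ : ∀ p q → ℚ.∣ p ℚ.- q ∣ ≡ ℚ.∣ q ℚ.- p ∣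
    ∣p-q∣≡∣q-p∣ p q =
      trans (sym (ℚ.∣-p∣≡∣p∣ (p ℚ.- q))) (cong ℚ.∣_∣ (rearrange p q))
      where
      open +-*-Solver
      rearrange : ∀ a b → ℚ.- (a ℚ.- b) ≡ b ℚ.- a
      rearrange = solve 2 (λ a b → :- (a :- b) := b :- a) refl

    ∣∣p∣-∣q∣∣≤∣p-q∣ : ∀ p q → ℚ.∣ ℚ.∣ p ∣ ℚ.- ℚ.∣ q ∣ ∣ ℚ.≤ ℚ.∣ p ℚ.- q ∣
    ∣∣p∣-∣q∣∣≤∣p-q∣ p q with ℚ.∣p∣≡p∨∣p∣≡-p (ℚ.∣ p ∣ ℚ.- ℚ.∣ q ∣)
    ... | inj₁ eq = subst (ℚ._≤ ℚ.∣ p ℚ.- q ∣) (sym eq) (∣p∣-∣q∣≤∣p-q∣ p q)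
    ... | inj₂ eq = subst₂ ℚ._≤_ (sym (trans eq (rearrange ℚ.∣ p ∣ ℚ.∣ q ∣)))
                      (∣p-q∣≡∣q-p∣ q p) (∣p∣-∣q∣≤∣p-q∣ q p)
      where
      open +-*-Solver
      rearrange : ∀ a b → ℚ.- (a ℚ.- b) ≡ b ℚ.- a
      rearrange = solve 2 (λ a b → :- (a :- b) := b :- a) refl

    abs-cauchy : ∀ s → IsCauchy s → IsCauchy (λ n → ℚ.∣ s n ∣)
    abs-cauchy s cs 0<ε with cs 0<ε
    ... | N , p = N , λ {m} {n} N≤m N≤n →
      ℚ.≤-<-trans (∣∣p∣-∣q∣∣≤∣p-q∣ (s m) (s n)) (p N≤m N≤n)

    eventually-bounded : ∀ s → IsCauchy s →
      ∃₂ λ B N → ℚ.Positive B × (∀ {n} → N ℕ.≤ n → ℚ.∣ s n ∣ ℚ.≤ B)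
    eventually-bounded s cs with cs (ℚ.positive⁻¹ 1ℚ)
    ... | N , p =
      ℚ.∣ s N ∣ ℚ.+ 1ℚ , N ,
      ℚ.nonNeg+pos⇒pos ℚ.∣ s N ∣ {{ℚ.∣-∣-nonNeg (s N)}} 1ℚ ,
      λ {n} N≤n → ℚ.≤-trans (∣p∣≤∣q∣+∣p-q∣ (s n) (s N))
                    (ℚ.+-monoʳ-≤ ℚ.∣ s N ∣ (ℚ.<⇒≤ (p N≤n ℕ.≤-refl)))

    ∣p*q∣<½*ε : ∀ ε D .{{_ : ℚ.Positive D}} x y → ℚ.∣ x ∣ ℚ.≤ D →
                ℚ.∣ y ∣ ℚ.< ℚ.1/_ D {{ℚ.pos⇒nonZero D}} ℚ.* (½ ℚ.* ε) →
                ℚ.∣ x ℚ.* y ∣ ℚ.< ½ ℚ.* ε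
    ∣p*q∣<½*ε ε D x y x≤D y<δ = begin-strict
      ℚ.∣ x ℚ.* y ∣
        ≡⟨ ℚ.∣p*q∣≡∣p∣*∣q∣ x y ⟩
      ℚ.∣ x ∣ ℚ.* ℚ.∣ y ∣
        ≤⟨ ℚ.*-monoʳ-≤-nonNeg ℚ.∣ y ∣ {{ℚ.∣-∣-nonNeg y}} x≤D ⟩
      D ℚ.* ℚ.∣ y ∣
        <⟨ ℚ.*-monoʳ-<-pos D y<δ ⟩
      D ℚ.* (ℚ.1/ D ℚ.* (½ ℚ.* ε))
        ≡⟨ ℚ.*-assoc D (ℚ.1/ D) (½ ℚ.* ε) ⟨
      D ℚ.* ℚ.1/ D ℚ.* (½ ℚ.* ε)
        ≡⟨ cong (ℚ._* (½ ℚ.* ε)) (ℚ.*-inverseʳ D) ⟩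
      1ℚ ℚ.* (½ ℚ.* ε)
        ≡⟨ ℚ.*-identityˡ (½ ℚ.* ε) ⟩
      ½ ℚ.* ε ∎
      where
      open ℚ.≤-Reasoning
      instance
        D≢0 : ℚ.NonZero D
        D≢0 = ℚ.pos⇒nonZero D

    0<1/D*½*ε : ∀ {ε} D .{{_ : ℚ.Positive D}} → 0ℚ ℚ.< ε →
                0ℚ ℚ.< ℚ.1/_ D {{ℚ.pos⇒nonZero D}} ℚ.* (½ ℚ.* ε)
    0<1/D*½*ε {ε} D 0<ε =
      subst (ℚ._< 1/D ℚ.* (½ ℚ.* ε)) (ℚ.*-zeroʳ 1/D)
        (ℚ.*-monoʳ-<-pos 1/D {{ℚ.1/pos⇒pos D}} (0<½* 0<ε))
      where
      1/D : ℚ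
      1/D = ℚ.1/_ D {{ℚ.pos⇒nonZero D}}

    telescope : ∀ p q r → p ℚ.- r ≡ (p ℚ.- q) ℚ.+ (q ℚ.- r)
    telescope = solve 3 (λ p q r → p :- r := (p :- q) :+ (q :- r)) refl
      where open +-*-Solver

    product-difference : ∀ a b c d →
      a ℚ.* b ℚ.- c ℚ.* d ≡ a ℚ.* (b ℚ.- d) ℚ.+ d ℚ.* (a ℚ.- c)
    product-difference a b c d =
      trans (telescope (a ℚ.* b) (a ℚ.* d) (c ℚ.* d))
        (sym (cong₂ ℚ._+_ (Ring.x[y-z]≈xy-xz a b d)
          (trans (ℚ.*-comm d (a ℚ.- c)) (Ring.[y-z]x≈yx-zx d a c))))

    *-close : ∀ {ε} a b c d →
      ℚ.∣ a ℚ.* (b ℚ.- d) ∣ ℚ.< ½ ℚ.* ε → ℚ.∣ d ℚ.* (a ℚ.- c) ∣ ℚ.< ½ ℚ.* ε →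
      ℚ.∣ a ℚ.* b ℚ.- c ℚ.* d ∣ ℚ.< ε
    *-close {ε} a b c d p q = begin-strict
      ℚ.∣ a ℚ.* b ℚ.- c ℚ.* d ∣
        ≡⟨ cong ℚ.∣_∣ (product-difference a b c d) ⟩
      ℚ.∣ a ℚ.* (b ℚ.- d) ℚ.+ d ℚ.* (a ℚ.- c) ∣
        ≤⟨ ℚ.∣p+q∣≤∣p∣+∣q∣ (a ℚ.* (b ℚ.- d)) (d ℚ.* (a ℚ.- c)) ⟩
      ℚ.∣ a ℚ.* (b ℚ.- d) ∣ ℚ.+ ℚ.∣ d ℚ.* (a ℚ.- c) ∣
        <⟨ ℚ.+-mono-< p q ⟩
      ½ ℚ.* ε ℚ.+ ½ ℚ.* ε
        ≡⟨ ½*-+-½* ε ⟩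
      ε ∎
      where open ℚ.≤-Reasoning

    *-cauchy : ∀ s t → IsCauchy s → IsCauchy t → IsCauchy (λ n → s n ℚ.* t n)
    *-cauchy s t cs ct {ε} 0<ε =
      let
        B , N₁ , 0<B , s≤B = eventually-bounded s cs
        C , N₂ , 0<C , t≤C = eventually-bounded t ct
        N₃ , t-close = ct (0<1/D*½*ε B {{0<B}} 0<ε)
        N₄ , s-close = cs (0<1/D*½*ε C {{0<C}} 0<ε)
        N₁₂ = N₁ ℕ.⊔ N₂
        N₃₄ = N₃ ℕ.⊔ N₄
      in N₁₂ ℕ.⊔ N₃₄ , λ {m} {n} N≤m N≤n →
      let
        12≤m = ℕ.m⊔n≤o⇒m≤o N₁₂ N₃₄ N≤m
        12≤n = ℕ.m⊔n≤o⇒m≤o N₁₂ N₃₄ N≤n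
        34≤m = ℕ.m⊔n≤o⇒n≤o N₁₂ N₃₄ N≤m
        34≤n = ℕ.m⊔n≤o⇒n≤o N₁₂ N₃₄ N≤n
      in *-close (s m) (t m) (s n) (t n)
        (∣p*q∣<½*ε ε B {{0<B}} (s m) (t m ℚ.- t n)
          (s≤B (ℕ.m⊔n≤o⇒m≤o N₁ N₂ 12≤m))
          (t-close (ℕ.m⊔n≤o⇒m≤o N₃ N₄ 34≤m) (ℕ.m⊔n≤o⇒m≤o N₃ N₄ 34≤n)))
        (∣p*q∣<½*ε ε C {{0<C}} (t n) (s m ℚ.- s n)
          (t≤C (ℕ.m⊔n≤o⇒n≤o N₁ N₂ 12≤n))
          (s-close (ℕ.m⊔n≤o⇒n≤o N₃ N₄ 34≤m) (ℕ.m⊔n≤o⇒n≤o N₃ N₄ 34≤n)))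

-- Equality of reals is _≈_.
record ℝ : Set where
  constructor mkℝ
  field
    seq    : ℕ → ℚ
    cauchy : IsCauchy seq

open ℝ public

infix  4 _≈_ _<_ _≤_
infixl 6 _+_ _-_
infixl 7 _*_
infix  8 -_

record _≈_ (x y : ℝ) : Set where
  constructor mk≈
  field
    close : ∀ {ε} → 0ℚ ℚ.< ε →
      ∃ λ N → ∀ {n} → N ℕ.≤ n → ℚ.∣ seq x n ℚ.- seq y n ∣ ℚ.< ε

record _<_ (x y : ℝ) : Set where
  constructor mk<
  field
    gap   : ℚ
    0<gap : 0ℚ ℚ.< gap
    from  : ℕ
    apart : ∀ {n} → from ℕ.≤ n → seq x n ℚ.+ gap ℚ.< seq y n

_≤_ : Rel ℝ 0ℓ
x ≤ y = ¬ (y < x)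

fromℚ : ℚ → ℝ
fromℚ q = mkℝ (λ _ → q) (const-cauchy q)

fromℤ : ℤ → ℝ
fromℤ i = fromℚ (i ℚ./ 1)

fromℕ : ℕ → ℝ
fromℕ n = fromℤ (+ n)

0ℝ 1ℝ : ℝ
0ℝ = fromℚ 0ℚ
1ℝ = fromℚ 1ℚ

_+_ _*_ : ℝ → ℝ → ℝ
x + y = mkℝ (λ n → seq x n ℚ.+ seq y n) (+-cauchy (seq x) (seq y) (cauchy x) (cauchy y))
x * y = mkℝ (λ n → seq x n ℚ.* seq y n) (*-cauchy (seq x) (seq y) (cauchy x) (cauchy y))

-_ ∣_∣ : ℝ → ℝ
- x = mkℝ (λ n → ℚ.- seq x n) (neg-cauchy (seq x) (cauchy x))
∣ x ∣ = mkℝ (λ n → ℚ.∣ seq x n ∣) (abs-cauchy (seq x) (cauchy x))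

_-_ : ℝ → ℝ → ℝ
x - y = x + (- y)

-- y = √x
IsSqrt : ℝ → ℝ → Set
IsSqrt x y = 0ℝ ≤ y × y * y ≈ x

-- Also used for ℂ.
ℝ² : Set
ℝ² = ℝ × ℝ

infix  4 _≈₂_
infixl 6 _+₂_ _-₂_
infixl 7 _·_
infix  8 -₂_

_≈₂_ : Rel ℝ² 0ℓ
(x₁ , x₂) ≈₂ (y₁ , y₂) = x₁ ≈ y₁ × x₂ ≈ y₂

0₂ : ℝ²
0₂ = 0ℝ , 0ℝ

_+₂_ : ℝ² → ℝ² → ℝ²
(x₁ , x₂) +₂ (y₁ , y₂) = x₁ + y₁ , x₂ + y₂

-₂_ : ℝ² → ℝ²
-₂ (x₁ , x₂) = - x₁ , - x₂

_-₂_ : ℝ² → ℝ² → ℝ²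
x -₂ y = x +₂ (-₂ y)

_·_ : ℝ → ℝ² → ℝ²
r · (x₁ , x₂) = r * x₁ , r * x₂

⟨_,_⟩ : ℝ² → ℝ² → ℝ
⟨ (x₁ , x₂) , (y₁ , y₂) ⟩ = x₁ * y₁ + x₂ * y₂

det : ℝ² → ℝ² → ℝ
det (x₁ , x₂) (y₁ , y₂) = x₁ * y₂ - x₂ * y₁

Subset : Set₁
Subset = Pred ℝ² 0ℓ

record IsBasis (b₁ b₂ : ℝ²) : Set where
  field
    spanning    : ∀ x → ∃₂ λ p q → x ≈₂ p · b₁ +₂ q · b₂
    independent : ∀ p q → p · b₁ +₂ q · b₂ ≈₂ 0₂ → p ≈ 0ℝ × q ≈ 0ℝ

ℤ-Span : ℝ² → ℝ² → Subset
ℤ-Span b₁ b₂ x = ∃₂ λ m n → x ≈₂ fromℤ m · b₁ +₂ fromℤ n · b₂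

IsLattice : Subset → Set
IsLattice L = ∃₂ λ b₁ b₂ → IsBasis b₁ b₂ × (∀ x → L x ⇔ ℤ-Span b₁ b₂ x)

-- [L : M] = k, witnessed by a complete system of coset representatives.
HasIndex : Subset → Subset → ℕ → Set
HasIndex L M k = Σ[ r ∈ (Fin k → ℝ²) ]
  (∀ i → L (r i)) × (∀ x → L x → ∃! _≡_ (λ i → M (x -₂ r i)))

scale : ℝ → Subset → Subset
scale c P x = ∃ λ y → P y × x ≈₂ c · y

-- (a , b , c) stands for ax² + bxy + cy².
QuadraticForm : Set
QuadraticForm = ℝ × ℝ × ℝ

eval : QuadraticForm → ℝ² → ℝ
eval (a , b , c) (x , y) = a * (x * x) + b * (x * y) + c * (y * y)

-- x ≠ 0 is taken in the apartness sense, as is usual constructively.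
PositiveDefinite : QuadraticForm → Set
PositiveDefinite B = ∀ x → 0ℝ < ⟨ x , x ⟩ → 0ℝ < eval B x

A : ℝ² → ℝ
A v = ⟨ v , v ⟩

-- Q is A or a competing quadratic form; u is its common value on S′.
record Satisfies (L M S S′ : Subset) (Q : ℝ² → ℝ) (u : ℝ) : Set where
  field
    on-S   : ∀ v → S v → Q v ≈ 1ℝ
    off-S  : ∀ v → L v → ¬ M v → ¬ S v → 1ℝ < Q v
    on-S′  : 1ℝ ≤ u × (∀ v → S′ v → Q v ≈ u)
    off-S′ : ∀ v → M v → ¬ (v ≈₂ 0₂) → ¬ S′ v → u < Q v

record TemperedPerfect (ℓ : ℕ) (L M : Subset) : Set₁ where
  field
    L-isLattice : IsLattice L
    M-isLattice : IsLattice M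
    M⊆L         : M ⊆ L
    index       : HasIndex L M ℓ

    scalar   : ℝ
    0<scalar : 0ℝ < scalar

  L₁ : Subset
  L₁ = scale scalar L

  M₁ : Subset
  M₁ = scale scalar M

  field
    S S′        : Subset
    S-respects  : ∀ {v w} → v ≈₂ w → S v → S w
    S′-respects : ∀ {v w} → v ≈₂ w → S′ v → S′ w
    S-nonempty  : ∃ S
    S′-nonempty : ∃ S′
    S⊆L−M       : ∀ v → S v → L₁ v × ¬ M₁ v
    S′⊆M−0      : ∀ v → S′ v → M₁ v × ¬ (v ≈₂ 0₂)

    u         : ℝ
    satisfies : Satisfies L₁ M₁ S S′ A u
    perfect   : ∀ B u′ → PositiveDefinite B → Satisfies L₁ M₁ S S′ (eval B) u′ →
                (∀ v → eval B v ≈ A v) × u′ ≈ u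

ConsistsOfPairs : ℕ → Subset → Set
ConsistsOfPairs s P = Σ[ v ∈ (Fin s → ℝ²) ]
  (∀ i → ¬ (v i ≈₂ -₂ v i)) ×
  (∀ i j → i ≢ j → ¬ (v i ≈₂ v j ⊎ v i ≈₂ -₂ v j)) ×
  (∀ x → P x ⇔ ∃ λ i → x ≈₂ v i ⊎ x ≈₂ -₂ v i)

-- τ is the temperament of some s-and-s′ form of index ℓ.
IsTemperament : (s s′ ℓ : ℕ) → ℝ → Set₁
IsTemperament s s′ ℓ τ =
  Σ[ L ∈ Subset ] Σ[ M ∈ Subset ] Σ[ F ∈ TemperedPerfect ℓ L M ]
    let open TemperedPerfect F in
    ConsistsOfPairs s S × ConsistsOfPairs s′ S′ × IsSqrt u τ

-- (a , b) stands for a + bω.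
ℤ[ω] : Set
ℤ[ω] = ℤ × ℤ

_≟_ : Decidable {A = ℤ[ω]} _≡_
_≟_ = Product.≡-dec ℤ._≟_ ℤ._≟_

norm : ℤ[ω] → ℤ
norm (a , b) = a ℤ.* a ℤ.- a ℤ.* b ℤ.+ b ℤ.* b

Primitive : ℤ[ω] → Set
Primitive (a , b) = ℤ.gcd a b ≡ + 1

primitive? : Unary.Decidable Primitive
primitive? (a , b) = ℤ.gcd a b ℤ.≟ + 1

-- Uses ω² = -1 - ω.
_⊗_ : ℤ[ω] → ℤ[ω] → ℤ[ω]
(a , b) ⊗ (c , d) = a ℤ.* c ℤ.- b ℤ.* d , a ℤ.* d ℤ.+ b ℤ.* c ℤ.- b ℤ.* d

-- 1, -1, ω, -ω, ω², -ω²
units : List ℤ[ω]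
units = (+ 1 , + 0) ∷ (-[1+ 0 ] , + 0) ∷
        (+ 0 , + 1) ∷ (+ 0 , -[1+ 0 ]) ∷
        (-[1+ 0 ] , -[1+ 0 ]) ∷ (+ 1 , + 1) ∷ []

Associated : Rel ℤ[ω] 0ℓ
Associated v w = Any (λ ε → w ≡ ε ⊗ v) units

associated? : Decidable Associated
associated? v w = any? (λ ε → w ≟ (ε ⊗ v)) units

-- The inclusion ℤ[ω] ⊂ ℂ, given √3: ω = -1/2 + (√3/2)i.
embed : (√3 : ℝ) → ℤ[ω] → ℝ²
embed √3 (a , b) =
  fromℤ a · (1ℝ , 0ℝ) +₂ fromℤ b · (fromℚ (ℚ.- ½) , fromℚ ½ * √3)

HasPrimitiveNorm : ℕ → ℤ[ω] → Set
HasPrimitiveNorm k v = Primitive v × norm v ≡ + k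

hasPrimitiveNorm? : ∀ k → Unary.Decidable (HasPrimitiveNorm k)
hasPrimitiveNorm? k v = primitive? v ×-dec (norm v ℤ.≟ + k)

IsPrimitiveNorm : ℕ → Set
IsPrimitiveNorm k = ∃ (HasPrimitiveNorm k)

interval : ℕ → List ℤ
interval k = map +_ (upTo (suc k)) ++ map -[1+_] (upTo k)

-- All primitive elements of norm k. Their coordinates have absolute value at
-- most k because 4N(a + bω) = 3a² + (2b - a)².
primitivesOfNorm : ℕ → List ℤ[ω]
primitivesOfNorm k =
  filter (hasPrimitiveNorm? k) (cartesianProduct (interval k) (interval k))

private
  ∈-interval : ∀ {k} i → ℤ.∣ i ∣ ℕ.≤ k → i ∈ interval k
  ∈-interval (+ n)    n≤k = ∈-++⁺ˡ (∈-map⁺ +_ (∈-upTo⁺ (ℕ.s≤s n≤k)))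
  ∈-interval -[1+ n ] n<k = ∈-++⁺ʳ _ (∈-map⁺ -[1+_] (∈-upTo⁺ n<k))

  square : ∀ i → i ℤ.* i ≡ + (ℤ.∣ i ∣ ℕ.* ℤ.∣ i ∣)
  square (+ n)    = sym (ℤ.pos-* n n)
  square -[1+ n ] = refl

  coordinate-bound : ∀ {k} i j →
    + 4 ℤ.* + k ≡ + 3 ℤ.* (i ℤ.* i) ℤ.+ j ℤ.* j → ℤ.∣ i ∣ ℕ.≤ k
  coordinate-bound {k} i j eq = ℕ.≮⇒≥ λ k<∣i∣ → ℕ.<-irrefl refl (begin-strict
    4 ℕ.* k                              <⟨ ℕ.s≤s (ℕ.m≤m+n (4 ℕ.* k) (3 ℕ.* k ℕ.* k ℕ.+ 2 ℕ.* k ℕ.+ 2)) ⟩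
    suc (4 ℕ.* k ℕ.+ (3 ℕ.* k ℕ.* k ℕ.+ 2 ℕ.* k ℕ.+ 2))
                                         ≡⟨ expand k ⟩
    3 ℕ.* (suc k ℕ.* suc k)              ≤⟨ ℕ.*-monoʳ-≤ 3 (ℕ.*-mono-≤ k<∣i∣ k<∣i∣) ⟩
    3 ℕ.* (ℤ.∣ i ∣ ℕ.* ℤ.∣ i ∣)          ≤⟨ ℕ.m≤m+n _ _ ⟩
    3 ℕ.* (ℤ.∣ i ∣ ℕ.* ℤ.∣ i ∣) ℕ.+ ℤ.∣ j ∣ ℕ.* ℤ.∣ j ∣ ≡⟨ eqℕ ⟨
    4 ℕ.* k                              ∎)
    where
    open ℕ.≤-Reasoning
    expand : ∀ k → suc (4 ℕ.* k ℕ.+ (3 ℕ.* k ℕ.* k ℕ.+ 2 ℕ.* k ℕ.+ 2)) ≡ 3 ℕ.* (suc k ℕ.* suc k)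
    expand = ℕ-Solver.solve-∀
    eqℕ : 4 ℕ.* k ≡ 3 ℕ.* (ℤ.∣ i ∣ ℕ.* ℤ.∣ i ∣) ℕ.+ ℤ.∣ j ∣ ℕ.* ℤ.∣ j ∣
    eqℕ = ℤ.+-injective (trans (ℤ.pos-* 4 k) (trans eq
            (cong₂ ℤ._+_
              (trans (cong (+ 3 ℤ.*_) (square i)) (sym (ℤ.pos-* 3 (ℤ.∣ i ∣ ℕ.* ℤ.∣ i ∣))))
              (square j))))

  norm-bound : ∀ {k} a b → norm (a , b) ≡ + k → ℤ.∣ a ∣ ℕ.≤ k × ℤ.∣ b ∣ ℕ.≤ k
  norm-bound a b eq =
    coordinate-bound a (+ 2 ℤ.* b ℤ.- a) (trans (cong (+ 4 ℤ.*_) (sym eq)) (lemma₁ a b)) ,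
    coordinate-bound b (+ 2 ℤ.* a ℤ.- b) (trans (cong (+ 4 ℤ.*_) (sym eq)) (lemma₂ a b))
    where
    lemma₁ : ∀ a b → + 4 ℤ.* (a ℤ.* a ℤ.- a ℤ.* b ℤ.+ b ℤ.* b) ≡
             + 3 ℤ.* (a ℤ.* a) ℤ.+ (+ 2 ℤ.* b ℤ.- a) ℤ.* (+ 2 ℤ.* b ℤ.- a)
    lemma₁ = ℤ-Solver.solve-∀
    lemma₂ : ∀ a b → + 4 ℤ.* (a ℤ.* a ℤ.- a ℤ.* b ℤ.+ b ℤ.* b) ≡
             + 3 ℤ.* (b ℤ.* b) ℤ.+ (+ 2 ℤ.* a ℤ.- b) ℤ.* (+ 2 ℤ.* a ℤ.- b)
    lemma₂ = ℤ-Solver.solve-∀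

∈-primitivesOfNorm : ∀ {k v} → v ∈ primitivesOfNorm k ⇔ HasPrimitiveNorm k v
∈-primitivesOfNorm {k} {a , b} = mk⇔
  (λ v∈ → proj₂ (∈-filter⁻ (hasPrimitiveNorm? k) {xs = box} v∈))
  (λ (p , eq) → ∈-filter⁺ (hasPrimitiveNorm? k)
    (∈-cartesianProduct⁺ (∈-interval a (proj₁ (norm-bound a b eq)))
                         (∈-interval b (proj₂ (norm-bound a b eq))))
    (p , eq))
  where box = cartesianProduct (interval k) (interval k)

isPrimitiveNorm? : Unary.Decidable IsPrimitiveNorm
isPrimitiveNorm? k = decide _ refl
  where
  open Equivalence
  decide : ∀ vs → vs ≡ primitivesOfNorm k → Dec (IsPrimitiveNorm k)
  decide (v ∷ _) eq = yes (v , to ∈-primitivesOfNorm (subst (v ∈_) eq (here refl)))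
  decide []      eq = no λ (v , p) →
    case-[] (subst (v ∈_) (sym eq) (from ∈-primitivesOfNorm p))
    where
    case-[] : ∀ {v : ℤ[ω]} → ¬ (v ∈ [])
    case-[] ()

-- β₁, …, β_N in increasing order.
normsBelow : ℕ → List ℕ
normsBelow ℓ = filter isPrimitiveNorm? (upTo ℓ)

-- β_{n+1}, …, β_N: the initial β₁, …, βₙ, which are those below ¾ℓ, are dropped.
normsInRange : ℕ → List ℕ
normsInRange ℓ = dropWhile (λ β → 4 ℕ.* β ℕ.<? 3 ℕ.* ℓ) (normsBelow ℓ)

-- A norm together with the entries under it that are not crossed out, one
-- representative for each orbit.
Column : Set
Column = ℕ × List ℤ[ω]

record State : Set where
  constructor state
  field
    table  : List Column
    output : List ℕ

column : ℕ → Column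
column β = β , deduplicate associated? (primitivesOfNorm β)

-- The list 𝓛 is not stored separately: it consists of the norms of the
-- columns.
start : ℕ → State
start ℓ = state (map column (normsInRange ℓ)) []

-- The entries associated to x all lie under the norm of x; there are none when
-- that norm is not on the list.
crossOut : ℤ[ω] → List Column → List Column
crossOut x = map (map₂ (filter (¬? ∘ associated? x)))

NonEmpty : Column → Set
NonEmpty (_ , entries) = entries ≢ []

nonEmpty? : Unary.Decidable NonEmpty
nonEmpty? (_ , [])    = no λ ≢[] → ≢[] refl
nonEmpty? (_ , _ ∷ _) = yes λ ()

deleteEmptyColumns : List Column → List Column
deleteEmptyColumns = filter nonEmpty?

-- ŵ is a possible value of the second vector computed from v; w and t need not
-- be unique. The quotients |z| = √3ℓ/(2|v|) and t₀ = (z - ℓw)/v are written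
-- without division.
record SecondVector (ℓ : ℕ) (v ŵ : ℤ[ω]) : Set where
  field
    w     : ℤ[ω]
    det≡1 : proj₁ v ℤ.* proj₂ w ℤ.- proj₂ v ℤ.* proj₁ w ≡ + 1

    √3    : ℝ
    √3-eq : IsSqrt (fromℕ 3) √3

  v′ : ℝ²
  v′ = embed √3 v

  w′ : ℝ²
  w′ = embed √3 w

  field
    z             : ℝ²
    perpendicular : ⟨ z , v′ ⟩ ≈ 0ℝ
    sameSide      : 0ℝ < det v′ z * det v′ w′

    ∣v∣ ∣z∣ : ℝ
    ∣v∣-eq  : IsSqrt ⟨ v′ , v′ ⟩ ∣v∣
    ∣z∣-eq  : IsSqrt ⟨ z , z ⟩ ∣z∣
    length  : ∣z∣ * (fromℕ 2 * ∣v∣) ≈ √3 * fromℕ ℓ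

    t₀      : ℝ
    t₀-eq   : t₀ · v′ ≈₂ z -₂ fromℕ ℓ · w′
    t       : ℤ
    nearest : ∀ m → ∣ fromℤ t - t₀ ∣ ≤ ∣ fromℤ m - t₀ ∣

    ŵ-eq : ŵ ≡ (+ ℓ ℤ.* proj₁ w ℤ.+ t ℤ.* proj₁ v , + ℓ ℤ.* proj₂ w ℤ.+ t ℤ.* proj₂ v)

-- One pass through the loop, for any permitted choice of v, w and t. Since v may
-- be any element of its orbit, it is only associated to an entry of the table.
data _⊢_⟶_ (ℓ : ℕ) : Rel State 0ℓ where
  pass : ∀ {table T β entries v ŵ} →
         (β , entries) ∈ table →
         All (λ col → β ℕ.≤ proj₁ col) table →
         Any (Associated v) entries →
         SecondVector ℓ v ŵ →
         ℓ ⊢ state table T ⟶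
             state (deleteEmptyColumns (crossOut ŵ (crossOut v table))) (β ∷ T)

-- Every run of the algorithm from the given state stops with an output.
data Halts (ℓ : ℕ) : State → Set where
  stop : ∀ {T} → Halts ℓ (state [] T)
  go   : ∀ {σ} → ∃ (ℓ ⊢ σ ⟶_) → (∀ {σ′} → ℓ ⊢ σ ⟶ σ′ → Halts ℓ σ′) → Halts ℓ σ

Outputs : ℕ → List ℕ → Set
Outputs ℓ T = Star (ℓ ⊢_⟶_) (start ℓ) (state [] T)

{-# OPTIONS --safe #-}

-- If a lattice has three pairs of minimal vectors, the vanishing of their Gram determinant forces the angles to be 60°,
-- so the lattice is Z[ω]. By Lagrange's theorem M contains ℓ Z[ω], hence its minimal vector v is primitive and
-- M = {y : ℓ ∣ v ∧ y}, where v ∧ y is the determinant. Thus 3-and-1 forms correspond to primitive v that are, up to sign,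
-- the unique shortest vectors of this sublattice, and u = N v.
--
-- Two vectors with ∣v ∧ p∣ = ℓ and norms n, m < ℓ satisfy 4nm - x² = 3ℓ², where x is twice their inner product. This
-- forces ∣x∣ < n and n ≠ m, so the sublattice has at most two pairs of vectors of norm < ℓ; if v is one of them, the
-- second vector ŵ of the algorithm is the other up to sign. The norm of ŵ is at least ¾ℓ, so both orbits are in the table
-- and they are crossed out together, when the shorter one is chosen. Hence every chosen v is the shorter of its pair, and
-- every such orbit is chosen.

module Submission where

open import Defs
import Algebra.Properties.CommutativeMonoid.Sum as FiniteSum
open import Algebra.Bundles using (CommutativeRing)
import Algebra.Solver.Ring as RingSolver
import Algebra.Solver.Ring.AlmostCommutativeRing as ACR
open import Data.Empty using (⊥; ⊥-elim)
open import Data.Fin.Base using (Fin; zero; suc; toℕ; fromℕ<)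
import Data.Fin.Properties as Fin
open import Data.Integer.Base as ℤ using (ℤ; +_; -[1+_])
import Data.Integer.DivMod as ℤ
import Data.Integer.Divisibility.Signed as ℤ∣
open import Data.Integer.Divisibility.Signed using (_∣_; divides)
import Data.Integer.GCD as ℤ
import Data.Integer.Properties as ℤ
import Data.Integer.Tactic.RingSolver as ℤ-Solver
open import Data.List.Base using (List; []; _∷_; filter; upTo; dropWhile; deduplicate; length)
import Data.List.Properties as List
open import Data.List.Membership.Propositional as ∈ using (_∈_)
import Data.List.Membership.Propositional.Properties as ∈
open import Data.List.Relation.Unary.All as All using (All; []; _∷_)
import Data.List.Relation.Unary.All.Properties as All
open import Data.List.Relation.Unary.AllPairs using (AllPairs; []; _∷_)
import Data.List.Relation.Unary.AllPairs.Properties as AllPairs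
open import Data.List.Relation.Unary.Any as Any using (Any; here; there)
import Data.List.Relation.Unary.Any.Properties as Any
open import Data.Maybe.Base as Maybe using (Maybe)
open import Data.Nat.Base as ℕ using (ℕ; suc; zero)
import Data.Nat.Coprimality as Coprime
import Data.Nat.Divisibility as ℕ
import Data.Nat.GCD as ℕ
open import Data.Nat.Induction using (<-wellFounded)
open import Data.Nat.Primality as Prime using (Prime; euclidsLemma; prime⇒nonZero; prime⇒nonTrivial)
import Data.Nat.Properties as ℕ
import Data.Nat.Tactic.RingSolver as ℕ-Solver
open import Data.Product.Base using (Σ-syntax; ∃; ∃₂; _×_; _,_; proj₁; proj₂)
open import Data.Rational.Base as ℚ using (ℚ; 0ℚ; 1ℚ; ½; _/_)
import Data.Rational.Properties as ℚ
open import Data.Rational.Solver using (module +-*-Solver)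
import Data.Rational.Unnormalised.Base as ℚᵘ
import Data.Rational.Unnormalised.Properties as ℚᵘ
open import Data.Sum.Base as Sum using (_⊎_; inj₁; inj₂; [_,_]′; swap)
open import Function.Base using (_∘_; id; case_of_)
open import Function.Bundles using (_⇔_; mk⇔; mk↔ₛ′; module Equivalence)
open import Induction.WellFounded using (Acc; acc)
open import Level using (0ℓ)
open import Relation.Binary.Bundles using (Setoid)
open import Relation.Binary.Construct.Closure.ReflexiveTransitive using (Star; _◅_) renaming (ε to done)
open import Relation.Binary.PropositionalEquality
  using (_≡_; _≢_; refl; sym; trans; cong; cong₂; subst; subst₂; module ≡-Reasoning)
import Relation.Binary.Reasoning.Setoid as SetoidReasoning
open import Relation.Nullary.Decidable using (Dec; yes; no; ¬?; dec⇒maybe)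
open import Relation.Nullary.Decidable.Core using (¬¬-excluded-middle)
open import Relation.Nullary.Negation using (¬_; contradiction)

-- Rational inequalities

-- Reals are Cauchy sequences without decidable order, and `L`, `M`, `S`, `S′` are arbitrary
-- predicates. The argument survives this because `_≤_` is a negation and `_≈_` is stable under
-- double negation: case distinctions on membership are harmless while such a conclusion is being
-- proved. Decisions that matter are taken on integers, once lengths have been identified with
-- norms, or by cotransitivity of `_<_`. Primality of ℓ rules out ties between the two short vectors
-- of a sublattice. A tie would give two pairs of minimal vectors, hence no 3-and-1 form, and yet
-- the algorithm would add the norm to its output. It also makes short partners primitive, since a
-- common divisor of the coordinates divides ℓ. The interval of the theorem is closed, whereas the
-- table stops before ℓ; that the value ℓ never occurs needs an argument of its own. A run is free
-- in its choice of v, w and t, so correctness is an invariant of every possible pass, and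
-- termination is proved for all choices at once.

module ℚₛ = +-*-Solver

¼ : ℚ
¼ = ½ ℚ.* ½

0<½* : ∀ {p} → 0ℚ ℚ.< p → 0ℚ ℚ.< ½ ℚ.* p
0<½* {p} 0<p = subst (ℚ._< ½ ℚ.* p) (ℚ.*-zeroʳ ½) (ℚ.*-monoʳ-<-pos ½ 0<p)

0<¼* : ∀ {p} → 0ℚ ℚ.< p → 0ℚ ℚ.< ¼ ℚ.* p
0<¼* {p} 0<p = subst (0ℚ ℚ.<_) (sym (ℚ.*-assoc ½ ½ p)) (0<½* (0<½* 0<p))

p≤∣p∣ : ∀ p → p ℚ.≤ ℚ.∣ p ∣
p≤∣p∣ p with ℚ.≤-total 0ℚ p
... | inj₁ 0≤p = ℚ.≤-reflexive (sym (ℚ.0≤p⇒∣p∣≡p 0≤p))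
... | inj₂ p≤0 = ℚ.≤-trans p≤0 (ℚ.0≤∣p∣ p)

-p≤∣p∣ : ∀ p → ℚ.- p ℚ.≤ ℚ.∣ p ∣
-p≤∣p∣ p = subst (ℚ.- p ℚ.≤_) (ℚ.∣-p∣≡∣p∣ p) (p≤∣p∣ (ℚ.- p))

p<q⇒0<q-p : ∀ {p q} → p ℚ.< q → 0ℚ ℚ.< q ℚ.- p
p<q⇒0<q-p {p} {q} p<q = subst (ℚ._< q ℚ.- p) (ℚ.+-inverseʳ p) (ℚ.+-monoˡ-< (ℚ.- p) p<q)

p≤q⇒0≤q-p : ∀ {p q} → p ℚ.≤ q → 0ℚ ℚ.≤ q ℚ.- p
p≤q⇒0≤q-p {p} {q} p≤q = subst (ℚ._≤ q ℚ.- p) (ℚ.+-inverseʳ p) (ℚ.+-monoˡ-≤ (ℚ.- p) p≤q)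

0<q-p⇒p<q : ∀ {p q} → 0ℚ ℚ.< q ℚ.- p → p ℚ.< q
0<q-p⇒p<q {p} {q} 0<q-p =
  subst₂ ℚ._<_ (ℚ.+-identityˡ p) (cancel q p) (ℚ.+-monoˡ-< p 0<q-p)
  where
  cancel : ∀ q p → q ℚ.- p ℚ.+ p ≡ q
  cancel = ℚₛ.solve 2 (λ q p → q ℚₛ.:- p ℚₛ.:+ p ℚₛ.:= q) refl

∣p-q∣<r⇒p<q+r : ∀ p q {r} → ℚ.∣ p ℚ.- q ∣ ℚ.< r → p ℚ.< q ℚ.+ r
∣p-q∣<r⇒p<q+r p q {r} lt =
  subst (ℚ._< q ℚ.+ r) (cancel q p) (ℚ.+-monoʳ-< q (ℚ.≤-<-trans (p≤∣p∣ (p ℚ.- q)) lt))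
  where
  cancel : ∀ q p → q ℚ.+ (p ℚ.- q) ≡ p
  cancel = ℚₛ.solve 2 (λ q p → q ℚₛ.:+ (p ℚₛ.:- q) ℚₛ.:= p) refl

∣p∣<r : ∀ p {r} → p ℚ.< r → ℚ.- p ℚ.< r → ℚ.∣ p ∣ ℚ.< r
∣p∣<r p {r} p<r -p<r with ℚ.∣p∣≡p∨∣p∣≡-p p
... | inj₁ eq = subst (ℚ._< r) (sym eq) p<r
... | inj₂ eq = subst (ℚ._< r) (sym eq) -p<r

-- Null sequences

Null : (ℕ → ℚ) → Set
Null s = ∀ {ε} → 0ℚ ℚ.< ε → ∃ λ N → ∀ {n} → N ℕ.≤ n → ℚ.∣ s n ∣ ℚ.< ε

null-0 : Null (λ _ → 0ℚ)
null-0 0<ε = 0 , λ _ → 0<ε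

null-resp : ∀ {s t} → (∀ n → s n ≡ t n) → Null s → Null t
null-resp s≡t null 0<ε with null 0<ε
... | N , p = N , λ {n} N≤n → subst (λ q → ℚ.∣ q ∣ ℚ.< _) (s≡t n) (p N≤n)

null-neg : ∀ {s} → Null s → Null (λ n → ℚ.- s n)
null-neg {s} null 0<ε with null 0<ε
... | N , p = N , λ {n} N≤n → subst (ℚ._< _) (sym (ℚ.∣-p∣≡∣p∣ (s n))) (p N≤n)

null-+ : ∀ {s t} → Null s → Null t → Null (λ n → s n ℚ.+ t n)
null-+ {s} {t} null-s null-t {ε} 0<ε with null-s (0<½* 0<ε) | null-t (0<½* 0<ε)
... | N₁ , p | N₂ , q = N₁ ℕ.⊔ N₂ , λ {n} N≤n → begin-strict
  ℚ.∣ s n ℚ.+ t n ∣ ≤⟨ ℚ.∣p+q∣≤∣p∣+∣q∣ (s n) (t n) ⟩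
  ℚ.∣ s n ∣ ℚ.+ ℚ.∣ t n ∣ <⟨ ℚ.+-mono-< (p (ℕ.m⊔n≤o⇒m≤o N₁ N₂ N≤n)) (q (ℕ.m⊔n≤o⇒n≤o N₁ N₂ N≤n)) ⟩
  ½ ℚ.* ε ℚ.+ ½ ℚ.* ε ≡⟨ halves ε ⟩
  ε ∎
  where
  open ℚ.≤-Reasoning
  halves : ∀ ε → ½ ℚ.* ε ℚ.+ ½ ℚ.* ε ≡ ε
  halves = ℚₛ.solve 1 (λ ε → ℚₛ.con ½ ℚₛ.:* ε ℚₛ.:+ ℚₛ.con ½ ℚₛ.:* ε ℚₛ.:= ε) refl

-- A Cauchy sequence is bounded from some index on, here by `B`, the absolute value of its term at
-- `N₁` plus 1; it is then enough that `t` falls below ε divided by `B`.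
null-* : ∀ {s t} → IsCauchy s → Null t → Null (λ n → s n ℚ.* t n)
null-* {s} {t} cs null {ε} 0<ε with cs (ℚ.positive⁻¹ 1ℚ)
... | N₁ , near with null {ℚ.1/_ B {{ℚ.pos⇒nonZero B {{0<B}}}} ℚ.* ε} 0<δ
  where
  B : ℚ
  B = ℚ.∣ s N₁ ∣ ℚ.+ 1ℚ
  0<B : ℚ.Positive B
  0<B = ℚ.nonNeg+pos⇒pos ℚ.∣ s N₁ ∣ {{ℚ.∣-∣-nonNeg (s N₁)}} 1ℚ
  1/B : ℚ
  1/B = ℚ.1/_ B {{ℚ.pos⇒nonZero B {{0<B}}}}
  0<δ : 0ℚ ℚ.< 1/B ℚ.* ε
  0<δ = subst (ℚ._< 1/B ℚ.* ε) (ℚ.*-zeroʳ 1/B) (ℚ.*-monoʳ-<-pos 1/B {{ℚ.1/pos⇒pos B {{0<B}}}} 0<ε)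
... | N₂ , small = N₁ ℕ.⊔ N₂ , λ {n} N≤n → begin-strict
  ℚ.∣ s n ℚ.* t n ∣ ≡⟨ ℚ.∣p*q∣≡∣p∣*∣q∣ (s n) (t n) ⟩
  ℚ.∣ s n ∣ ℚ.* ℚ.∣ t n ∣ ≤⟨ ℚ.*-monoʳ-≤-nonNeg ℚ.∣ t n ∣ {{ℚ.∣-∣-nonNeg (t n)}}
                                   (bounded (ℕ.m⊔n≤o⇒m≤o N₁ N₂ N≤n)) ⟩
  B ℚ.* ℚ.∣ t n ∣ <⟨ ℚ.*-monoʳ-<-pos B (small (ℕ.m⊔n≤o⇒n≤o N₁ N₂ N≤n)) ⟩
  B ℚ.* (ℚ.1/ B ℚ.* ε) ≡⟨ ℚ.*-assoc B (ℚ.1/ B) ε ⟨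
  B ℚ.* ℚ.1/ B ℚ.* ε ≡⟨ cong (ℚ._* ε) (ℚ.*-inverseʳ B) ⟩
  1ℚ ℚ.* ε ≡⟨ ℚ.*-identityˡ ε ⟩
  ε ∎
  where
  open ℚ.≤-Reasoning
  B : ℚ
  B = ℚ.∣ s N₁ ∣ ℚ.+ 1ℚ
  instance
    0<B : ℚ.Positive B
    0<B = ℚ.nonNeg+pos⇒pos ℚ.∣ s N₁ ∣ {{ℚ.∣-∣-nonNeg (s N₁)}} 1ℚ
    B≢0 : ℚ.NonZero B
    B≢0 = ℚ.pos⇒nonZero B
  cancel : ∀ p q → q ℚ.+ (p ℚ.- q) ≡ p
  cancel = ℚₛ.solve 2 (λ p q → q ℚₛ.:+ (p ℚₛ.:- q) ℚₛ.:= p) refl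
  bounded : ∀ {n} → N₁ ℕ.≤ n → ℚ.∣ s n ∣ ℚ.≤ B
  bounded {n} N≤n = begin
    ℚ.∣ s n ∣ ≡⟨ cong ℚ.∣_∣ (cancel (s n) (s N₁)) ⟨
    ℚ.∣ s N₁ ℚ.+ (s n ℚ.- s N₁) ∣ ≤⟨ ℚ.∣p+q∣≤∣p∣+∣q∣ (s N₁) (s n ℚ.- s N₁) ⟩
    ℚ.∣ s N₁ ∣ ℚ.+ ℚ.∣ s n ℚ.- s N₁ ∣ ≤⟨ ℚ.+-monoʳ-≤ ℚ.∣ s N₁ ∣ (ℚ.<⇒≤ (near N≤n ℕ.≤-refl)) ⟩
    B ∎

-- The commutative ring of reals

pointwise : ∀ {x y} → (∀ n → seq x n ≡ seq y n) → x ≈ y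
pointwise {x} {y} x≡y = mk≈ (null-resp (λ n → sym (trans (cong (λ q → seq x n ℚ.- q) (sym (x≡y n)))
  (ℚ.+-inverseʳ (seq x n)))) null-0)

≈-refl : ∀ {x} → x ≈ x
≈-refl = pointwise λ _ → refl

≈-sym : ∀ {x y} → x ≈ y → y ≈ x
≈-sym {x} {y} (mk≈ null) = mk≈ (null-resp (λ n → flip-sign (seq x n) (seq y n)) (null-neg null))
  where
  flip-sign : ∀ p q → ℚ.- (p ℚ.- q) ≡ q ℚ.- p
  flip-sign = ℚₛ.solve 2 (λ p q → ℚₛ.:- (p ℚₛ.:- q) ℚₛ.:= q ℚₛ.:- p) refl

≈-trans : ∀ {x y z} → x ≈ y → y ≈ z → x ≈ z
≈-trans {x} {y} {z} (mk≈ p) (mk≈ q) =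
  mk≈ (null-resp (λ n → telescope (seq x n) (seq y n) (seq z n)) (null-+ p q))
  where
  telescope : ∀ p q r → (p ℚ.- q) ℚ.+ (q ℚ.- r) ≡ p ℚ.- r
  telescope = ℚₛ.solve 3 (λ p q r → (p ℚₛ.:- q) ℚₛ.:+ (q ℚₛ.:- r) ℚₛ.:= p ℚₛ.:- r) refl

+-cong : ∀ {x x′ y y′} → x ≈ x′ → y ≈ y′ → x + y ≈ x′ + y′
+-cong {x} {x′} {y} {y′} (mk≈ p) (mk≈ q) =
  mk≈ (null-resp (λ n → rearrange (seq x n) (seq x′ n) (seq y n) (seq y′ n)) (null-+ p q))
  where
  rearrange : ∀ p p′ q q′ → (p ℚ.- p′) ℚ.+ (q ℚ.- q′) ≡ (p ℚ.+ q) ℚ.- (p′ ℚ.+ q′)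
  rearrange = ℚₛ.solve 4 (λ p p′ q q′ → (p ℚₛ.:- p′) ℚₛ.:+ (q ℚₛ.:- q′) ℚₛ.:= (p ℚₛ.:+ q) ℚₛ.:- (p′ ℚₛ.:+ q′)) refl

-‿cong : ∀ {x y} → x ≈ y → - x ≈ - y
-‿cong {x} {y} (mk≈ p) = mk≈ (null-resp (λ n → rearrange (seq x n) (seq y n)) (null-neg p))
  where
  rearrange : ∀ p q → ℚ.- (p ℚ.- q) ≡ ℚ.- p ℚ.- ℚ.- q
  rearrange = ℚₛ.solve 2 (λ p q → ℚₛ.:- (p ℚₛ.:- q) ℚₛ.:= ℚₛ.:- p ℚₛ.:- ℚₛ.:- q) refl

minus-cong : ∀ {x x′ y y′} → x ≈ x′ → y ≈ y′ → x - y ≈ x′ - y′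
minus-cong {x} {x′} {y} {y′} x≈x′ y≈y′ = +-cong {x} {x′} {y = - y} {y′ = - y′} x≈x′ (-‿cong {y} {y′} y≈y′)

*-cong : ∀ {x x′ y y′} → x ≈ x′ → y ≈ y′ → x * y ≈ x′ * y′
*-cong {x} {x′} {y} {y′} (mk≈ p) (mk≈ q) =
  mk≈ (null-resp (λ n → rearrange (seq x n) (seq x′ n) (seq y n) (seq y′ n))
    (null-+ {λ n → seq x n ℚ.* (seq y n ℚ.- seq y′ n)} {λ n → seq y′ n ℚ.* (seq x n ℚ.- seq x′ n)}
      (null-* {seq x} (cauchy x) q) (null-* {seq y′} (cauchy y′) p)))
  where
  rearrange : ∀ p p′ q q′ → p ℚ.* (q ℚ.- q′) ℚ.+ q′ ℚ.* (p ℚ.- p′) ≡ p ℚ.* q ℚ.- p′ ℚ.* q′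
  rearrange = ℚₛ.solve 4 (λ p p′ q q′ → p ℚₛ.:* (q ℚₛ.:- q′) ℚₛ.:+ q′ ℚₛ.:* (p ℚₛ.:- p′) ℚₛ.:= p ℚₛ.:* q ℚₛ.:- p′ ℚₛ.:* q′) refl

ℝ-commutativeRing : CommutativeRing 0ℓ 0ℓ
ℝ-commutativeRing = record
  { Carrier = ℝ ; _≈_ = _≈_ ; _+_ = _+_ ; _*_ = _*_ ; -_ = -_ ; 0# = 0ℝ ; 1# = 1ℝ
  ; isCommutativeRing = record
    { isRing = record
      { +-isAbelianGroup = record
        { isGroup = record
          { isMonoid = record
            { isSemigroup = record
              { isMagma = record
                { isEquivalence = record { refl = ≈-refl ; sym = ≈-sym ; trans = ≈-trans }
                ; ∙-cong = +-cong
                }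
              ; assoc = λ x y z → pointwise λ n → ℚ.+-assoc (seq x n) (seq y n) (seq z n)
              }
            ; identity = (λ x → pointwise λ n → ℚ.+-identityˡ (seq x n))
                       , (λ x → pointwise λ n → ℚ.+-identityʳ (seq x n))
            }
          ; inverse = (λ x → pointwise λ n → ℚ.+-inverseˡ (seq x n))
                    , (λ x → pointwise λ n → ℚ.+-inverseʳ (seq x n))
          ; ⁻¹-cong = -‿cong
          }
        ; comm = λ x y → pointwise λ n → ℚ.+-comm (seq x n) (seq y n)
        }
      ; *-cong = *-cong
      ; *-assoc = λ x y z → pointwise λ n → ℚ.*-assoc (seq x n) (seq y n) (seq z n)
      ; *-identity = (λ x → pointwise λ n → ℚ.*-identityˡ (seq x n))
                   , (λ x → pointwise λ n → ℚ.*-identityʳ (seq x n))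
      ; distrib = (λ x y z → pointwise λ n → ℚ.*-distribˡ-+ (seq x n) (seq y n) (seq z n))
                , (λ x y z → pointwise λ n → ℚ.*-distribʳ-+ (seq x n) (seq y n) (seq z n))
      }
    ; *-comm = λ x y → pointwise λ n → ℚ.*-comm (seq x n) (seq y n)
    }
  }

ℝ-setoid : Setoid 0ℓ 0ℓ
ℝ-setoid = CommutativeRing.setoid ℝ-commutativeRing

module ℝ-Reasoning = SetoidReasoning ℝ-setoid

ℝ-acr : ACR.AlmostCommutativeRing 0ℓ 0ℓ
ℝ-acr = ACR.fromCommutativeRing ℝ-commutativeRing

fromℚ-morphism : ℚ.+-*-rawRing ACR.-Raw-AlmostCommutative⟶ ℝ-acr
fromℚ-morphism = record
  { ⟦_⟧    = fromℚ
  ; +-homo = λ _ _ → pointwise λ _ → refl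
  ; *-homo = λ _ _ → pointwise λ _ → refl
  ; -‿homo = λ _ → pointwise λ _ → refl
  ; 0-homo = ≈-refl
  ; 1-homo = ≈-refl
  }

fromℚ-≈? : ∀ p q → Maybe (fromℚ p ≈ fromℚ q)
fromℚ-≈? p q = Maybe.map (λ { refl → ≈-refl }) (dec⇒maybe (p ℚ.≟ q))

-- Equality of reals is not decidable, so the coefficients are rationals; this lets the solver
-- normalise constants such as ½ and 4/3.
module ℝ-Solver = RingSolver ℚ.+-*-rawRing ℝ-acr fromℚ-morphism fromℚ-≈?

-- The ordered field structure of the reals

open ℝ-Solver using (solve; con; _:=_; _:+_; _:*_; _:-_; :-_)

fromℚ-pos : ∀ {q} → 0ℚ ℚ.< q → 0ℝ < fromℚ q
-- The gap is half of `q` because `_<_` asks for a strict inequality even after the gap has been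
-- added.
fromℚ-pos {q} 0<q = mk< (½ ℚ.* q) (0<½* 0<q) 0 λ _ →
  subst₂ ℚ._<_ (sym (ℚ.+-identityˡ (½ ℚ.* q))) (ℚ.*-identityˡ q) (ℚ.*-monoˡ-<-pos q {{ℚ.positive 0<q}} ½<1)
  where
  ½<1 : ½ ℚ.< 1ℚ
  ½<1 = ℚ.*<* (ℤ.+<+ (ℕ.s≤s (ℕ.s≤s ℕ.z≤n)))

<⇒0<- : ∀ {x y} → x < y → 0ℝ < y - x
<⇒0<- {x} {y} (mk< g 0<g N apart) = mk< g 0<g N λ {n} N≤n →
  subst₂ ℚ._<_ (drop (seq x n) g) refl (ℚ.+-monoˡ-< (ℚ.- seq x n) (apart N≤n))
  where
  drop : ∀ p g → p ℚ.+ g ℚ.- p ≡ 0ℚ ℚ.+ g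
  drop = ℚₛ.solve 2 (λ p g → p ℚₛ.:+ g ℚₛ.:- p ℚₛ.:= ℚₛ.con 0ℚ ℚₛ.:+ g) refl

0<-⇒< : ∀ {x y} → 0ℝ < y - x → x < y
0<-⇒< {x} {y} (mk< g 0<g N apart) = mk< g 0<g N λ {n} N≤n →
  subst₂ ℚ._<_ (move (seq x n) g) (cancel (seq x n) (seq y n)) (ℚ.+-monoˡ-< (seq x n) (apart N≤n))
  where
  move : ∀ p g → 0ℚ ℚ.+ g ℚ.+ p ≡ p ℚ.+ g
  move = ℚₛ.solve 2 (λ p g → ℚₛ.con 0ℚ ℚₛ.:+ g ℚₛ.:+ p ℚₛ.:= p ℚₛ.:+ g) refl
  cancel : ∀ p q → q ℚ.- p ℚ.+ p ≡ q
  cancel = ℚₛ.solve 2 (λ p q → q ℚₛ.:- p ℚₛ.:+ p ℚₛ.:= q) refl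

-- Half of the gap is given up: from some index on the two sequences differ by less than that.
0<-resp-≈ : ∀ {x y} → x ≈ y → 0ℝ < x → 0ℝ < y
0<-resp-≈ {x} {y} (mk≈ close) (mk< g 0<g N₁ apart) with close (0<½* 0<g)
... | N₂ , near = mk< (½ ℚ.* g) (0<½* 0<g) (N₁ ℕ.⊔ N₂) λ {n} N≤n → 0<q-p⇒p<q (subst (0ℚ ℚ.<_)
  (rearrange (seq x n) (seq y n) g)
  (ℚ.+-mono-< (p<q⇒0<q-p (apart (ℕ.m⊔n≤o⇒m≤o N₁ N₂ N≤n)))
              (p<q⇒0<q-p (∣p-q∣<r⇒p<q+r (seq x n) (seq y n) (near (ℕ.m⊔n≤o⇒n≤o N₁ N₂ N≤n))))))
  where
  rearrange : ∀ p q g → p ℚ.- (0ℚ ℚ.+ g) ℚ.+ (q ℚ.+ ½ ℚ.* g ℚ.- p) ≡ q ℚ.- (0ℚ ℚ.+ ½ ℚ.* g)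
  rearrange = ℚₛ.solve 3 (λ p q g → p ℚₛ.:- (ℚₛ.con 0ℚ ℚₛ.:+ g) ℚₛ.:+ (q ℚₛ.:+ ℚₛ.con ½ ℚₛ.:* g ℚₛ.:- p) ℚₛ.:= q ℚₛ.:- (ℚₛ.con 0ℚ ℚₛ.:+ ℚₛ.con ½ ℚₛ.:* g)) refl

0<+ : ∀ {x y} → 0ℝ < x → 0ℝ < y → 0ℝ < x + y
0<+ {x} {y} (mk< g 0<g N₁ p) (mk< h 0<h N₂ q) = mk< (g ℚ.+ h) (ℚ.+-mono-< 0<g 0<h) (N₁ ℕ.⊔ N₂)
  λ {n} N≤n → subst (ℚ._< seq x n ℚ.+ seq y n) (rearrange g h)
    (ℚ.+-mono-< (p (ℕ.m⊔n≤o⇒m≤o N₁ N₂ N≤n)) (q (ℕ.m⊔n≤o⇒n≤o N₁ N₂ N≤n)))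
  where
  rearrange : ∀ g h → 0ℚ ℚ.+ g ℚ.+ (0ℚ ℚ.+ h) ≡ 0ℚ ℚ.+ (g ℚ.+ h)
  rearrange = ℚₛ.solve 2 (λ g h → ℚₛ.con 0ℚ ℚₛ.:+ g ℚₛ.:+ (ℚₛ.con 0ℚ ℚₛ.:+ h) ℚₛ.:= ℚₛ.con 0ℚ ℚₛ.:+ (g ℚₛ.:+ h)) refl

0<* : ∀ {x y} → 0ℝ < x → 0ℝ < y → 0ℝ < x * y
0<* {x} {y} (mk< g 0<g N₁ p) (mk< h 0<h N₂ q) =
  mk< (g ℚ.* h) 0<gh (N₁ ℕ.⊔ N₂) λ {n} N≤n →
  let
    g<x = subst (ℚ._< seq x n) (ℚ.+-identityˡ g) (p (ℕ.m⊔n≤o⇒m≤o N₁ N₂ N≤n))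
    h<y = subst (ℚ._< seq y n) (ℚ.+-identityˡ h) (q (ℕ.m⊔n≤o⇒n≤o N₁ N₂ N≤n))
  in begin-strict
    0ℚ ℚ.+ g ℚ.* h ≡⟨ ℚ.+-identityˡ (g ℚ.* h) ⟩
    g ℚ.* h <⟨ ℚ.*-monoʳ-<-pos g {{ℚ.positive 0<g}} h<y ⟩
    g ℚ.* seq y n <⟨ ℚ.*-monoˡ-<-pos (seq y n) {{ℚ.positive (ℚ.<-trans 0<h h<y)}} g<x ⟩
    seq x n ℚ.* seq y n ∎
  where
  open ℚ.≤-Reasoning
  0<gh : 0ℚ ℚ.< g ℚ.* h
  0<gh = subst (ℚ._< g ℚ.* h) (ℚ.*-zeroʳ g) (ℚ.*-monoʳ-<-pos g {{ℚ.positive 0<g}} 0<h)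

0≮0 : ¬ (0ℝ < 0ℝ)
0≮0 (mk< g 0<g N apart) = ℚ.<-irrefl refl
  (ℚ.<-trans 0<g (subst (ℚ._< 0ℚ) (ℚ.+-identityˡ g) (apart ℕ.≤-refl)))

-- A single approximation above ½g certifies a positive real if all later ones stay within ¼g of it:
-- they keep exceeding ¼g.
drift : ∀ g p q → ℚ.∣ p ℚ.- q ∣ ℚ.< ¼ ℚ.* g → ½ ℚ.* g ℚ.< p → 0ℚ ℚ.+ ¼ ℚ.* g ℚ.< q
drift g p q near ½g<p = 0<q-p⇒p<q (subst (0ℚ ℚ.<_) (combine p q g)
  (ℚ.+-mono-< (p<q⇒0<q-p (∣p-q∣<r⇒p<q+r p q near)) (p<q⇒0<q-p ½g<p)))
  where
  combine : ∀ p q g → q ℚ.+ ¼ ℚ.* g ℚ.- p ℚ.+ (p ℚ.- ½ ℚ.* g) ≡ q ℚ.- (0ℚ ℚ.+ ¼ ℚ.* g)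
  combine = ℚₛ.solve 3 (λ p q g → q ℚₛ.:+ ℚₛ.con ¼ ℚₛ.:* g ℚₛ.:- p ℚₛ.:+ (p ℚₛ.:- ℚₛ.con ½ ℚₛ.:* g) ℚₛ.:=
    q ℚₛ.:- (ℚₛ.con 0ℚ ℚₛ.:+ ℚₛ.con ¼ ℚₛ.:* g)) refl

-- The decision is made on rationals: at an index `M` beyond which both sequences move by less than
-- ¼g, either the term of `x` exceeds ½g or the term of `y` does, and `drift` carries this to all
-- later indices.
0<+⇒ : ∀ {x y} → 0ℝ < x + y → 0ℝ < x ⊎ 0ℝ < y
0<+⇒ {x} {y} (mk< g 0<g N apart) with cauchy x (0<¼* 0<g) | cauchy y (0<¼* 0<g)
... | N₁ , near-x | N₂ , near-y = case ½ ℚ.* g ℚ.<? seq x M of λ where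
    (yes ½g<x) → inj₁ (mk< (¼ ℚ.* g) (0<¼* 0<g) M λ {n} M≤n →
      drift g (seq x M) (seq x n) (near-x N₁≤M (ℕ.≤-trans N₁≤M M≤n)) ½g<x)
    (no ½g≮x) → inj₂ (mk< (¼ ℚ.* g) (0<¼* 0<g) M λ {n} M≤n →
      drift g (seq y M) (seq y n) (near-y N₂≤M (ℕ.≤-trans N₂≤M M≤n))
        (0<q-p⇒p<q (subst (0ℚ ℚ.<_) (rest (seq x M) (seq y M) g)
          (ℚ.+-mono-<-≤ (p<q⇒0<q-p (apart N≤M)) (p≤q⇒0≤q-p (ℚ.≮⇒≥ ½g≮x))))))
  where
  M : ℕ
  M = N ℕ.⊔ (N₁ ℕ.⊔ N₂)
  N≤M : N ℕ.≤ M
  N≤M = ℕ.m≤m⊔n N _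
  N₁≤M : N₁ ℕ.≤ M
  N₁≤M = ℕ.≤-trans (ℕ.m≤m⊔n N₁ N₂) (ℕ.m≤n⊔m N _)
  N₂≤M : N₂ ℕ.≤ M
  N₂≤M = ℕ.≤-trans (ℕ.m≤n⊔m N₁ N₂) (ℕ.m≤n⊔m N _)
  rest : ∀ p q g → p ℚ.+ q ℚ.- (0ℚ ℚ.+ g) ℚ.+ (½ ℚ.* g ℚ.- p) ≡ q ℚ.- ½ ℚ.* g
  rest = ℚₛ.solve 3 (λ p q g → p ℚₛ.:+ q ℚₛ.:- (ℚₛ.con 0ℚ ℚₛ.:+ g) ℚₛ.:+ (ℚₛ.con ½ ℚₛ.:* g ℚₛ.:- p) ℚₛ.:= q ℚₛ.:- ℚₛ.con ½ ℚₛ.:* g) refl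

-- Where the sequence moves by less than ¼ε, a term above ½ε would make `x` positive by `drift`, and
-- one below -½ε would make it negative; so all later terms are smaller than ε.
≯0∧≮0⇒≈0 : ∀ {x} → ¬ (0ℝ < x) → ¬ (0ℝ < - x) → x ≈ 0ℝ
≯0∧≮0⇒≈0 {x} x≯0 x≮0 = mk≈ λ {ε} 0<ε → case cauchy x (0<¼* 0<ε) of λ where
    (N , near) → N , λ {n} N≤n → subst (ℚ._< ε) (cong ℚ.∣_∣ (sym (ℚ.+-identityʳ (seq x n))))
      (∣p∣<r (seq x n)
        (bounded ε (seq x N) (seq x n) 0<ε (near N≤n ℕ.≤-refl) (ℚ.≮⇒≥ λ ½ε<x → x≯0 (mk< (¼ ℚ.* ε) (0<¼* 0<ε) N λ {m} N≤m →
          drift ε (seq x N) (seq x m) (near ℕ.≤-refl N≤m) ½ε<x)))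
        (bounded ε (ℚ.- seq x N) (ℚ.- seq x n) 0<ε (near′ ε (seq x n) (seq x N) (near N≤n ℕ.≤-refl))
          (ℚ.≮⇒≥ λ ½ε<-x → x≮0 (mk< (¼ ℚ.* ε) (0<¼* 0<ε) N λ {m} N≤m →
          drift ε (ℚ.- seq x N) (ℚ.- seq x m) (near′ ε (seq x N) (seq x m) (near ℕ.≤-refl N≤m)) ½ε<-x))))
  where
  combine′ : ∀ p q g → p ℚ.+ ¼ ℚ.* g ℚ.- q ℚ.+ ¼ ℚ.* g ℚ.+ (½ ℚ.* g ℚ.- p) ≡ g ℚ.- q
  combine′ = ℚₛ.solve 3 (λ p q g → p ℚₛ.:+ ℚₛ.con ¼ ℚₛ.:* g ℚₛ.:- q ℚₛ.:+ ℚₛ.con ¼ ℚₛ.:* g ℚₛ.:+ (ℚₛ.con ½ ℚₛ.:* g ℚₛ.:- p) ℚₛ.:= g ℚₛ.:- q) refl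
  negate : ∀ p q → ℚ.- (p ℚ.- q) ≡ ℚ.- p ℚ.- ℚ.- q
  negate = ℚₛ.solve 2 (λ p q → ℚₛ.:- (p ℚₛ.:- q) ℚₛ.:= ℚₛ.:- p ℚₛ.:- ℚₛ.:- q) refl
  near′ : ∀ g p q → ℚ.∣ p ℚ.- q ∣ ℚ.< ¼ ℚ.* g → ℚ.∣ ℚ.- p ℚ.- ℚ.- q ∣ ℚ.< ¼ ℚ.* g
  near′ g p q = subst (ℚ._< ¼ ℚ.* g) (trans (sym (ℚ.∣-p∣≡∣p∣ (p ℚ.- q))) (cong ℚ.∣_∣ (negate p q)))
  bounded : ∀ g p q → 0ℚ ℚ.< g → ℚ.∣ q ℚ.- p ∣ ℚ.< ¼ ℚ.* g → p ℚ.≤ ½ ℚ.* g → q ℚ.< g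
  bounded g p q 0<g near p≤½g = 0<q-p⇒p<q (subst (0ℚ ℚ.<_) (combine′ p q g)
    (ℚ.+-mono-<-≤ (ℚ.+-mono-< (p<q⇒0<q-p (∣p-q∣<r⇒p<q+r q p near)) (0<¼* 0<g)) (p≤q⇒0≤q-p p≤½g)))

neg-swap : ∀ x y → - (x - y) ≈ y - x
neg-swap = solve 2 (λ x y → :- (x :- y) := y :- x) ≈-refl

0-neg : ∀ x → 0ℝ - x ≈ - x
0-neg = solve 1 (λ x → con 0ℚ :- x := :- x) ≈-refl

x-0≈x : ∀ x → x - 0ℝ ≈ x
x-0≈x = solve 1 (λ x → x :- con 0ℚ := x) ≈-refl

telescope : ∀ x y z → (y - x) + (z - y) ≈ z - x
telescope = solve 3 (λ x y z → (y :- x) :+ (z :- y) := z :- x) ≈-refl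

x-y+y≈x : ∀ x y → (x - y) + y ≈ x
x-y+y≈x = solve 2 (λ x y → (x :- y) :+ y := x) ≈-refl

neg-+ : ∀ x y → - (x + y) ≈ - x + - y
neg-+ = solve 2 (λ x y → :- (x :+ y) := :- x :+ :- y) ≈-refl

1*x≈x : ∀ x → 1ℝ * x ≈ x
1*x≈x = solve 1 (λ x → con 1ℚ :* x := x) ≈-refl

x*1≈x : ∀ x → x * 1ℝ ≈ x
x*1≈x = solve 1 (λ x → x :* con 1ℚ := x) ≈-refl

x*-y : ∀ x y → x * (- y) ≈ - (x * y)
x*-y = solve 2 (λ x y → x :* (:- y) := :- (x :* y)) ≈-refl

-x*-y : ∀ x y → (- x) * (- y) ≈ x * y
-x*-y = solve 2 (λ x y → (:- x) :* (:- y) := x :* y) ≈-refl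

x-x≈0 : ∀ x → x - x ≈ 0ℝ
x-x≈0 = solve 1 (λ x → x :- x := con 0ℚ) ≈-refl

0+x≈x : ∀ x → 0ℝ + x ≈ x
0+x≈x = solve 1 (λ x → con 0ℚ :+ x := x) ≈-refl

0*x≈0 : ∀ x → 0ℝ * x ≈ 0ℝ
0*x≈0 = solve 1 (λ x → con 0ℚ :* x := con 0ℚ) ≈-refl

x*0≈0 : ∀ x → x * 0ℝ ≈ 0ℝ
x*0≈0 = solve 1 (λ x → x :* con 0ℚ := con 0ℚ) ≈-refl

<-irrefl : ∀ {x y} → x ≈ y → ¬ (x < y)
<-irrefl {x} {y} x≈y x<y = 0≮0 (0<-resp-≈ {y - x} {0ℝ} (≈-trans (minus-cong (≈-sym x≈y) (≈-refl {x})) (x-x≈0 x))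
  (<⇒0<- x<y))

<-resp-≈ : ∀ {x x′ y y′} → x ≈ x′ → y ≈ y′ → x < y → x′ < y′
<-resp-≈ {x} {x′} {y} {y′} x≈x′ y≈y′ x<y =
  0<-⇒< (0<-resp-≈ {y - x} {y′ - x′} (minus-cong y≈y′ x≈x′) (<⇒0<- x<y))

<-trans : ∀ {x y z} → x < y → y < z → x < z
<-trans {x} {y} {z} x<y y<z = 0<-⇒< (0<-resp-≈ {(y - x) + (z - y)} {z - x} (telescope x y z)
  (0<+ {y - x} {z - y} (<⇒0<- x<y) (<⇒0<- y<z)))

-- Replaces trichotomy, which constructive reals lack; the transitivity laws that involve `_≤_` rest
-- on it.
<-cotrans : ∀ {x y} → x < y → ∀ z → x < z ⊎ z < y
<-cotrans {x} {y} x<y z = Sum.map 0<-⇒< 0<-⇒<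
  (0<+⇒ {z - x} {y - z} (0<-resp-≈ {y - x} {(z - x) + (y - z)} (≈-sym (telescope x z y)) (<⇒0<- x<y)))

<⇒≤ : ∀ {x y} → x < y → x ≤ y
<⇒≤ x<y y<x = <-irrefl ≈-refl (<-trans x<y y<x)

≤-reflexive : ∀ {x y} → x ≈ y → x ≤ y
≤-reflexive x≈y = <-irrefl (≈-sym x≈y)

≤-trans : ∀ {x y z} → x ≤ y → y ≤ z → x ≤ z
≤-trans {y = y} x≤y y≤z z<x = [ y≤z , x≤y ]′ (<-cotrans z<x y)

<-≤-trans : ∀ {x y z} → x < y → y ≤ z → x < z
<-≤-trans {z = z} x<y y≤z = [ id , ⊥-elim ∘ y≤z ]′ (<-cotrans x<y z)

≤-<-trans : ∀ {x y z} → x ≤ y → y < z → x < z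
≤-<-trans {x} x≤y y<z = [ ⊥-elim ∘ x≤y , id ]′ (<-cotrans y<z x)

≤-resp-≈ : ∀ {x x′ y y′} → x ≈ x′ → y ≈ y′ → x ≤ y → x′ ≤ y′
≤-resp-≈ x≈x′ y≈y′ x≤y y′<x′ = x≤y (<-resp-≈ (≈-sym y≈y′) (≈-sym x≈x′) y′<x′)

x<0⇒0<-x : ∀ {x} → x < 0ℝ → 0ℝ < - x
x<0⇒0<-x {x} x<0 = 0<-resp-≈ {0ℝ - x} { - x} (0-neg x) (<⇒0<- x<0)

0<-x⇒x<0 : ∀ {x} → 0ℝ < - x → x < 0ℝ
0<-x⇒x<0 {x} 0<-x = 0<-⇒< (0<-resp-≈ { - x} {0ℝ - x} (≈-sym (0-neg x)) 0<-x)

≤⇒0≤- : ∀ {x y} → x ≤ y → 0ℝ ≤ y - x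
≤⇒0≤- {x} {y} x≤y y-x<0 = x≤y (0<-⇒< (0<-resp-≈ { - (y - x)} {x - y} (neg-swap y x) (x<0⇒0<-x y-x<0)))

0≤-⇒≤ : ∀ {x y} → 0ℝ ≤ y - x → x ≤ y
0≤-⇒≤ {x} {y} 0≤y-x y<x =
  0≤y-x (0<-x⇒x<0 (0<-resp-≈ {x - y} { - (y - x)} (≈-sym (neg-swap y x)) (<⇒0<- y<x)))

≤-antisym : ∀ {x y} → x ≤ y → y ≤ x → x ≈ y
≤-antisym {x} {y} x≤y y≤x =
  ≈-trans (≈-sym (x-y+y≈x x y)) (≈-trans (+-cong {x - y} {0ℝ} {y} {y} x-y≈0 ≈-refl) (0+x≈x y))
  where
  x-y≈0 : x - y ≈ 0ℝ
  x-y≈0 = ≯0∧≮0⇒≈0 (λ 0<x-y → x≤y (0<-⇒< 0<x-y))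
    λ 0<-[x-y] → y≤x (0<-⇒< (0<-resp-≈ { - (x - y)} {y - x} (neg-swap x y) 0<-[x-y]))

-- Equality amounts to the absence of both strict inequalities. Hence undecidable case distinctions
-- are permitted in the proof of an equality of reals.
≈-stable : ∀ {x y} → ¬ ¬ (x ≈ y) → x ≈ y
≈-stable ¬¬x≈y = ≤-antisym
  (λ y<x → ¬¬x≈y λ x≈y → <-irrefl (≈-sym x≈y) y<x)
  (λ x<y → ¬¬x≈y λ x≈y → <-irrefl x≈y x<y)

0≤+ : ∀ {x y} → 0ℝ ≤ x → 0ℝ ≤ y → 0ℝ ≤ x + y
0≤+ {x} {y} 0≤x 0≤y x+y<0 = [ 0≤x ∘ 0<-x⇒x<0 , 0≤y ∘ 0<-x⇒x<0 ]′
  (0<+⇒ { - x} { - y} (0<-resp-≈ { - (x + y)} { - x + - y} (neg-+ x y) (x<0⇒0<-x x+y<0)))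

-- The conclusion is a negation, so each factor may be taken to be either positive or zero although
-- this cannot be decided.
0≤* : ∀ {x y} → 0ℝ ≤ x → 0ℝ ≤ y → 0ℝ ≤ x * y
0≤* {x} {y} 0≤x 0≤y xy<0 = vanishes 0≤x
  (λ 0<x → vanishes 0≤y
    (λ 0<y → <⇒≤ (0<* 0<x 0<y) xy<0)
    (λ y≈0 → <-irrefl (≈-trans (*-cong {x} {x} {y} {0ℝ} ≈-refl y≈0) (x*0≈0 x)) xy<0))
  (λ x≈0 → <-irrefl (≈-trans (*-cong {x} {0ℝ} {y} {y} x≈0 ≈-refl) (0*x≈0 y)) xy<0)
  where
  vanishes : ∀ {z} → 0ℝ ≤ z → ¬ (0ℝ < z) → ¬ ¬ (z ≈ 0ℝ)
  vanishes 0≤z z≯0 z≉0 = z≉0 (≤-antisym z≯0 0≤z)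

0≤x*x : ∀ x → 0ℝ ≤ x * x
0≤x*x x xx<0 = <-irrefl (≈-trans (*-cong {x} {0ℝ} {x} {x} x≈0 ≈-refl) (0*x≈0 x)) xx<0
  where
  x≈0 : x ≈ 0ℝ
  x≈0 = ≯0∧≮0⇒≈0
    (λ 0<x → <⇒≤ (0<* 0<x 0<x) xx<0)
    (λ 0<-x → <⇒≤ (0<-resp-≈ {(- x) * (- x)} {x * x} (-x*-y x x) (0<* 0<-x 0<-x)) xx<0)

0<x∧x*y≈0⇒y≈0 : ∀ {x y} → 0ℝ < x → x * y ≈ 0ℝ → y ≈ 0ℝ
0<x∧x*y≈0⇒y≈0 {x} {y} 0<x xy≈0 = ≯0∧≮0⇒≈0
  (λ 0<y → 0≮0 (0<-resp-≈ xy≈0 (0<* 0<x 0<y)))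
  (λ 0<-y → <-irrefl xy≈0 (0<-x⇒x<0 (0<-resp-≈ {x * (- y)} { - (x * y)} (x*-y x y) (0<* 0<x 0<-y))))

0<x∧0≤x*y⇒0≤y : ∀ {x y} → 0ℝ < x → 0ℝ ≤ x * y → 0ℝ ≤ y
0<x∧0≤x*y⇒0≤y {x} {y} 0<x 0≤xy y<0 = 0≤xy
  (0<-x⇒x<0 (0<-resp-≈ {x * (- y)} { - (x * y)} (x*-y x y) (0<* 0<x (x<0⇒0<-x y<0))))

-- Integers, absolute values and square roots

-- A rational `i / 1` is put in lowest terms by a gcd computation that does not reduce for a
-- variable `i`; the homomorphism laws are therefore proved for unnormalised rationals and
-- transported along this equivalence.
toℚᵘ-/1 : ∀ i → ℚ.toℚᵘ (i ℚ./ 1) ℚᵘ.≃ ℚᵘ.mkℚᵘ i 0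
toℚᵘ-/1 i = ℚ.toℚᵘ-fromℚᵘ (ℚᵘ.mkℚᵘ i 0)

/1-+ : ∀ i j → (i ℤ.+ j) ℚ./ 1 ≡ i ℚ./ 1 ℚ.+ j ℚ./ 1
/1-+ i j = ℚ.toℚᵘ-injective (begin
  ℚ.toℚᵘ ((i ℤ.+ j) ℚ./ 1) ≈⟨ toℚᵘ-/1 (i ℤ.+ j) ⟩
  ℚᵘ.mkℚᵘ (i ℤ.+ j) 0 ≈⟨ ℚᵘ.*≡* (identity i j) ⟩
  ℚᵘ.mkℚᵘ i 0 ℚᵘ.+ ℚᵘ.mkℚᵘ j 0 ≈⟨ ℚᵘ.+-cong (ℚᵘ.≃-sym (toℚᵘ-/1 i)) (ℚᵘ.≃-sym (toℚᵘ-/1 j)) ⟩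
  ℚ.toℚᵘ (i ℚ./ 1) ℚᵘ.+ ℚ.toℚᵘ (j ℚ./ 1) ≈⟨ ℚ.toℚᵘ-homo-+ (i ℚ./ 1) (j ℚ./ 1) ⟨
  ℚ.toℚᵘ (i ℚ./ 1 ℚ.+ j ℚ./ 1) ∎)
  where
  open SetoidReasoning ℚᵘ.≃-setoid
  identity : ∀ i j → (i ℤ.+ j) ℤ.* + 1 ≡ (i ℤ.* + 1 ℤ.+ j ℤ.* + 1) ℤ.* + 1
  identity = ℤ-Solver.solve-∀

/1-* : ∀ i j → (i ℤ.* j) ℚ./ 1 ≡ (i ℚ./ 1) ℚ.* (j ℚ./ 1)
/1-* i j = ℚ.toℚᵘ-injective (begin
  ℚ.toℚᵘ ((i ℤ.* j) ℚ./ 1) ≈⟨ toℚᵘ-/1 (i ℤ.* j) ⟩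
  ℚᵘ.mkℚᵘ (i ℤ.* j) 0 ≈⟨ ℚᵘ.*≡* refl ⟩
  ℚᵘ.mkℚᵘ i 0 ℚᵘ.* ℚᵘ.mkℚᵘ j 0 ≈⟨ ℚᵘ.*-cong (ℚᵘ.≃-sym (toℚᵘ-/1 i)) (ℚᵘ.≃-sym (toℚᵘ-/1 j)) ⟩
  ℚ.toℚᵘ (i ℚ./ 1) ℚᵘ.* ℚ.toℚᵘ (j ℚ./ 1) ≈⟨ ℚ.toℚᵘ-homo-* (i ℚ./ 1) (j ℚ./ 1) ⟨
  ℚ.toℚᵘ ((i ℚ./ 1) ℚ.* (j ℚ./ 1)) ∎)
  where open SetoidReasoning ℚᵘ.≃-setoid

/1-neg : ∀ i → (ℤ.- i) ℚ./ 1 ≡ ℚ.- (i ℚ./ 1)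
/1-neg i = ℚ.toℚᵘ-injective (begin
  ℚ.toℚᵘ ((ℤ.- i) ℚ./ 1) ≈⟨ toℚᵘ-/1 (ℤ.- i) ⟩
  ℚᵘ.- (ℚᵘ.mkℚᵘ i 0) ≈⟨ ℚᵘ.-‿cong (ℚᵘ.≃-sym (toℚᵘ-/1 i)) ⟩
  ℚᵘ.- ℚ.toℚᵘ (i ℚ./ 1) ≈⟨ ℚ.toℚᵘ-homo‿- (i ℚ./ 1) ⟨
  ℚ.toℚᵘ (ℚ.- (i ℚ./ 1)) ∎)
  where open SetoidReasoning ℚᵘ.≃-setoid

/1-mono-< : ∀ {i j} → i ℤ.< j → i ℚ./ 1 ℚ.< j ℚ./ 1
/1-mono-< {i} {j} i<j = ℚ.toℚᵘ-cancel-< (ℚᵘ.<-respˡ-≃ (ℚᵘ.≃-sym (toℚᵘ-/1 i)) (ℚᵘ.<-respʳ-≃ (ℚᵘ.≃-sym (toℚᵘ-/1 j))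
  (ℚᵘ.*<* (subst₂ ℤ._<_ (sym (ℤ.*-identityʳ i)) (sym (ℤ.*-identityʳ j)) i<j))))

/1-mono-≤ : ∀ {i j} → i ℤ.≤ j → i ℚ./ 1 ℚ.≤ j ℚ./ 1
/1-mono-≤ {i} {j} i≤j = case i ℤ.≟ j of λ where
  (yes refl) → ℚ.≤-refl
  (no  i≢j)  → ℚ.<⇒≤ (/1-mono-< (ℤ.≤∧≢⇒< i≤j i≢j))

p*denominator : ∀ p → p ℚ.* (ℚ.denominator p ℚ./ 1) ≡ ℚ.numerator p ℚ./ 1
p*denominator p@(ℚ.mkℚ n d-1 _) = ℚ.toℚᵘ-injective (begin
  ℚ.toℚᵘ (p ℚ.* (d ℚ./ 1)) ≈⟨ ℚ.toℚᵘ-homo-* p (d ℚ./ 1) ⟩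
  ℚᵘ.mkℚᵘ n d-1 ℚᵘ.* ℚ.toℚᵘ (d ℚ./ 1) ≈⟨ ℚᵘ.*-cong (ℚᵘ.≃-refl {ℚᵘ.mkℚᵘ n d-1}) (toℚᵘ-/1 d) ⟩
  ℚᵘ.mkℚᵘ n d-1 ℚᵘ.* ℚᵘ.mkℚᵘ d 0 ≈⟨ ℚᵘ.*≡* (trans (ℤ.*-identityʳ (n ℤ.* d))
                                             (cong (λ z → n ℤ.* + z) (sym (ℕ.*-identityʳ (suc d-1))))) ⟩
  ℚᵘ.mkℚᵘ n 0 ≈⟨ toℚᵘ-/1 n ⟨
  ℚ.toℚᵘ (n ℚ./ 1) ∎)
  where
  open SetoidReasoning ℚᵘ.≃-setoid
  d : ℤ
  d = + suc d-1

fromℤ-+ : ∀ i j → fromℤ (i ℤ.+ j) ≈ fromℤ i + fromℤ j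
fromℤ-+ i j = pointwise λ _ → /1-+ i j

fromℤ-* : ∀ i j → fromℤ (i ℤ.* j) ≈ fromℤ i * fromℤ j
fromℤ-* i j = pointwise λ _ → /1-* i j

fromℤ-neg : ∀ i → fromℤ (ℤ.- i) ≈ - fromℤ i
fromℤ-neg i = pointwise λ _ → /1-neg i

fromℤ-- : ∀ i j → fromℤ (i ℤ.- j) ≈ fromℤ i - fromℤ j
fromℤ-- i j = ≈-trans (fromℤ-+ i (ℤ.- j)) (+-cong (≈-refl {fromℤ i}) (fromℤ-neg j))

fromℚ-mono-< : ∀ {p q} → p ℚ.< q → fromℚ p < fromℚ q
fromℚ-mono-< {p} {q} p<q = 0<-⇒< (0<-resp-≈ {fromℚ (q ℚ.- p)} {fromℚ q - fromℚ p}
  (pointwise λ _ → refl) (fromℚ-pos (p<q⇒0<q-p p<q)))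

fromℤ-mono-< : ∀ {i j} → i ℤ.< j → fromℤ i < fromℤ j
fromℤ-mono-< i<j = fromℚ-mono-< (/1-mono-< i<j)

fromℤ-cancel-≤ : ∀ {i j} → fromℤ i ≤ fromℤ j → i ℤ.≤ j
fromℤ-cancel-≤ i≤j = ℤ.≮⇒≥ λ j<i → i≤j (fromℤ-mono-< j<i)

fromℤ-mono-≤ : ∀ {i j} → i ℤ.≤ j → fromℤ i ≤ fromℤ j
fromℤ-mono-≤ {i} {j} i≤j j<i = case i ℤ.≟ j of λ where
  (yes refl) → <-irrefl ≈-refl j<i
  (no  i≢j)  → <⇒≤ (fromℤ-mono-< (ℤ.≤∧≢⇒< i≤j i≢j)) j<i

fromℤ-cancel-< : ∀ {i j} → fromℤ i < fromℤ j → i ℤ.< j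
fromℤ-cancel-< i<j = ℤ.≰⇒> λ j≤i → fromℤ-mono-≤ j≤i i<j

fromℤ-injective : ∀ {i j} → fromℤ i ≈ fromℤ j → i ≡ j
fromℤ-injective i≈j = ℤ.≤-antisym (fromℤ-cancel-≤ (≤-reflexive i≈j)) (fromℤ-cancel-≤ (≤-reflexive (≈-sym i≈j)))

∣x∣<y : ∀ {x y} → x < y → - x < y → ∣ x ∣ < y
∣x∣<y {x} {y} (mk< g 0<g N₁ p) (mk< h 0<h N₂ q) = mk< (g ℚ.⊓ h) 0<g⊓h (N₁ ℕ.⊔ N₂) λ {n} N≤n →
  case ℚ.∣p∣≡p∨∣p∣≡-p (seq x n) of λ where
    (inj₁ eq) → ℚ.≤-<-trans (ℚ.+-mono-≤ (ℚ.≤-reflexive eq) (ℚ.p⊓q≤p g h)) (p (ℕ.m⊔n≤o⇒m≤o N₁ N₂ N≤n))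
    (inj₂ eq) → ℚ.≤-<-trans (ℚ.+-mono-≤ (ℚ.≤-reflexive eq) (ℚ.p⊓q≤q g h)) (q (ℕ.m⊔n≤o⇒n≤o N₁ N₂ N≤n))
  where
  0<g⊓h : 0ℚ ℚ.< g ℚ.⊓ h
  0<g⊓h = case ℚ.⊓-sel g h of λ where
    (inj₁ eq) → subst (0ℚ ℚ.<_) (sym eq) 0<g
    (inj₂ eq) → subst (0ℚ ℚ.<_) (sym eq) 0<h

pointwise-≤ : ∀ {x y} → (∀ n → seq x n ℚ.≤ seq y n) → x ≤ y
pointwise-≤ {x} {y} x≤y (mk< g 0<g N apart) = ℚ.<-irrefl refl (ℚ.<-≤-trans (apart ℕ.≤-refl)
  (ℚ.≤-trans (x≤y N) (subst (ℚ._≤ seq y N ℚ.+ g) (ℚ.+-identityʳ (seq y N)) (ℚ.+-monoʳ-≤ (seq y N) (ℚ.<⇒≤ 0<g)))))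

x≤∣x∣ : ∀ x → x ≤ ∣ x ∣
x≤∣x∣ x = pointwise-≤ λ n → p≤∣p∣ (seq x n)

-x≤∣x∣ : ∀ x → - x ≤ ∣ x ∣
-x≤∣x∣ x = pointwise-≤ λ n → -p≤∣p∣ (seq x n)

∣∣-cong : ∀ {x y} → x ≈ y → ∣ x ∣ ≤ ∣ y ∣
∣∣-cong {x} {y} x≈y ∣y∣<∣x∣ = <-irrefl ≈-refl (∣x∣<y {x} {∣ x ∣}
  (≤-<-trans (≤-trans (≤-reflexive x≈y) (x≤∣x∣ y)) ∣y∣<∣x∣)
  (≤-<-trans (≤-trans (≤-reflexive (-‿cong x≈y)) (-x≤∣x∣ y)) ∣y∣<∣x∣))

-- Square roots of natural numbers

isqrt : ∀ m → ∃ λ s → s ℕ.* s ℕ.≤ m × m ℕ.< suc s ℕ.* suc s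
isqrt zero    = 0 , ℕ.z≤n , ℕ.s≤s ℕ.z≤n
isqrt (suc m) = case isqrt m of λ where
  (s , lower , upper) → case suc s ℕ.* suc s ℕ.≤? suc m of λ where
    -- `upper` and `reached` pin `suc m` to the square of `suc s`, so the next square exceeds it.
    (yes reached) → suc s , reached , ℕ.≤-<-trans upper (ℕ.*-mono-< (ℕ.n<1+n (suc s)) (ℕ.n<1+n (suc s)))
    (no ¬reached) → s , ℕ.m≤n⇒m≤1+n lower , ℕ.≰⇒> ¬reached

sq-cancel-< : ∀ {m n} → m ℕ.* m ℕ.< n ℕ.* n → m ℕ.< n
sq-cancel-< mm<nn = ℕ.≰⇒> λ n≤m → ℕ.<⇒≱ mm<nn (ℕ.*-mono-≤ n≤m n≤m)

-- The k-th approximation to √n is ⌊√(n(k+1)²)⌋ / (k+1).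
module √ (n : ℕ) where

  s : ℕ → ℕ
  s k = proj₁ (isqrt (n ℕ.* (suc k ℕ.* suc k)))

  s-lower : ∀ k → s k ℕ.* s k ℕ.≤ n ℕ.* (suc k ℕ.* suc k)
  s-lower k = proj₁ (proj₂ (isqrt (n ℕ.* (suc k ℕ.* suc k))))

  s-upper : ∀ k → n ℕ.* (suc k ℕ.* suc k) ℕ.< suc (s k) ℕ.* suc (s k)
  s-upper k = proj₂ (proj₂ (isqrt (n ℕ.* (suc k ℕ.* suc k))))

  ι : ℕ → ℚ
  ι m = + m ℚ./ 1

  0<ι : ∀ k → 0ℚ ℚ.< ι (suc k)
  0<ι k = /1-mono-< {+ 0} {+ suc k} (ℤ.+<+ (ℕ.s≤s ℕ.z≤n))

  r : ℕ → ℚ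
  r k = ℚ.1/_ (ι (suc k)) {{ℚ.>-nonZero (0<ι k)}}

  ι*r : ∀ k → ι (suc k) ℚ.* r k ≡ 1ℚ
  ι*r k = ℚ.*-inverseʳ (ι (suc k)) {{ℚ.>-nonZero (0<ι k)}}

  0<r : ∀ k → 0ℚ ℚ.< r k
  0<r k = ℚ.positive⁻¹ (r k) {{ℚ.1/pos⇒pos (ι (suc k)) {{ℚ.positive (0<ι k)}}}}

  approx : ℕ → ℚ
  approx k = ι (s k) ℚ.* r k

  -- Any lower approximation of √n lies below any upper one. Neither √n nor a quotient is mentioned:
  -- after cross-multiplication the squares are compared.
  cross : ∀ i j → s i ℕ.* suc j ℕ.< suc (s j) ℕ.* suc i
  cross i j = sq-cancel-< (begin-strict
    s i ℕ.* suc j ℕ.* (s i ℕ.* suc j) ≡⟨ ℕ-shuffle (s i) (suc j) ⟩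
    s i ℕ.* s i ℕ.* (suc j ℕ.* suc j) ≤⟨ ℕ.*-monoˡ-≤ (suc j ℕ.* suc j) (s-lower i) ⟩
    n ℕ.* (suc i ℕ.* suc i) ℕ.* (suc j ℕ.* suc j) ≡⟨ ℕ-swap n (suc i ℕ.* suc i) (suc j ℕ.* suc j) ⟩
    n ℕ.* (suc j ℕ.* suc j) ℕ.* (suc i ℕ.* suc i) <⟨ ℕ.*-monoˡ-< (suc i ℕ.* suc i) (s-upper j) ⟩
    suc (s j) ℕ.* suc (s j) ℕ.* (suc i ℕ.* suc i) ≡⟨ ℕ-shuffle (suc (s j)) (suc i) ⟨
    suc (s j) ℕ.* suc i ℕ.* (suc (s j) ℕ.* suc i) ∎)
    where
    open ℕ.≤-Reasoning
    ℕ-shuffle : ∀ a b → a ℕ.* b ℕ.* (a ℕ.* b) ≡ a ℕ.* a ℕ.* (b ℕ.* b)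
    ℕ-shuffle = ℕ-Solver.solve-∀
    ℕ-swap : ∀ a b c → a ℕ.* b ℕ.* c ≡ a ℕ.* c ℕ.* b
    ℕ-swap = ℕ-Solver.solve-∀

  ι-* : ∀ a b → ι (a ℕ.* b) ≡ ι a ℚ.* ι b
  ι-* a b = trans (cong (ℚ._/ 1) (ℤ.pos-* a b)) (/1-* (+ a) (+ b))

  ι-suc : ∀ a → ι (suc a) ≡ 1ℚ ℚ.+ ι a
  ι-suc a = /1-+ (+ 1) (+ a)

  ι-+ : ∀ a b → ι (a ℕ.+ b) ≡ ι a ℚ.+ ι b
  ι-+ a b = /1-+ (+ a) (+ b)

  ι-mono-< : ∀ {a b} → a ℕ.< b → ι a ℚ.< ι b
  ι-mono-< a<b = /1-mono-< (ℤ.+<+ a<b)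

  -- Used for both orders of `i` and `j`, this bounds the distance of two approximations by the
  -- reciprocals of i + 1 and j + 1, which is the Cauchy property.
  approx-cross : ∀ i j → approx i ℚ.< approx j ℚ.+ r j
  approx-cross i j = subst₂ ℚ._<_ left right
    (ℚ.*-monoˡ-<-pos (r i ℚ.* r j) {{ℚ.positive 0<rr}} (ι-mono-< (cross i j)))
    where
    0<rr : 0ℚ ℚ.< r i ℚ.* r j
    0<rr = subst (ℚ._< r i ℚ.* r j) (ℚ.*-zeroʳ (r i)) (ℚ.*-monoʳ-<-pos (r i) {{ℚ.positive (0<r i)}} (0<r j))
    open ≡-Reasoning
    regroup : ∀ a b p q → a ℚ.* b ℚ.* (p ℚ.* q) ≡ a ℚ.* p ℚ.* (b ℚ.* q)
    regroup = ℚₛ.solve 4 (λ a b p q → a ℚₛ.:* b ℚₛ.:* (p ℚₛ.:* q) ℚₛ.:= a ℚₛ.:* p ℚₛ.:* (b ℚₛ.:* q)) refl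
    regroup′ : ∀ a b p q → (1ℚ ℚ.+ a) ℚ.* b ℚ.* (p ℚ.* q) ≡ (a ℚ.* q ℚ.+ q) ℚ.* (b ℚ.* p)
    regroup′ = ℚₛ.solve 4 (λ a b p q → (ℚₛ.con 1ℚ ℚₛ.:+ a) ℚₛ.:* b ℚₛ.:* (p ℚₛ.:* q) ℚₛ.:= (a ℚₛ.:* q ℚₛ.:+ q) ℚₛ.:* (b ℚₛ.:* p)) refl
    left : ι (s i ℕ.* suc j) ℚ.* (r i ℚ.* r j) ≡ approx i
    left = begin
      ι (s i ℕ.* suc j) ℚ.* (r i ℚ.* r j) ≡⟨ cong (ℚ._* (r i ℚ.* r j)) (ι-* (s i) (suc j)) ⟩
      ι (s i) ℚ.* ι (suc j) ℚ.* (r i ℚ.* r j) ≡⟨ regroup (ι (s i)) (ι (suc j)) (r i) (r j) ⟩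
      approx i ℚ.* (ι (suc j) ℚ.* r j) ≡⟨ cong (approx i ℚ.*_) (ι*r j) ⟩
      approx i ℚ.* 1ℚ ≡⟨ ℚ.*-identityʳ (approx i) ⟩
      approx i ∎
    right : ι (suc (s j) ℕ.* suc i) ℚ.* (r i ℚ.* r j) ≡ approx j ℚ.+ r j
    right = begin
      ι (suc (s j) ℕ.* suc i) ℚ.* (r i ℚ.* r j) ≡⟨ cong (ℚ._* (r i ℚ.* r j)) (ι-* (suc (s j)) (suc i)) ⟩
      ι (suc (s j)) ℚ.* ι (suc i) ℚ.* (r i ℚ.* r j) ≡⟨ cong (λ z → z ℚ.* ι (suc i) ℚ.* (r i ℚ.* r j)) (ι-suc (s j)) ⟩
      (1ℚ ℚ.+ ι (s j)) ℚ.* ι (suc i) ℚ.* (r i ℚ.* r j) ≡⟨ regroup′ (ι (s j)) (ι (suc i)) (r i) (r j) ⟩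
      (approx j ℚ.+ r j) ℚ.* (ι (suc i) ℚ.* r i) ≡⟨ cong ((approx j ℚ.+ r j) ℚ.*_) (ι*r i) ⟩
      (approx j ℚ.+ r j) ℚ.* 1ℚ ≡⟨ ℚ.*-identityʳ _ ⟩
      approx j ℚ.+ r j ∎

  -- ι c · r k < ε as soon as k exceeds c times the denominator of ε.
  small : ∀ c {ε} → 0ℚ ℚ.< ε → ∃ λ N → ∀ {k} → N ℕ.≤ k → ι c ℚ.* r k ℚ.< ε
  small c {ε} 0<ε = c ℕ.* d , λ {k} N≤k → let
      scaled : ι c ℚ.* ι d ℚ.< ι (suc k)
      scaled = subst (ℚ._< ι (suc k)) (ι-* c d) (ι-mono-< (ℕ.s≤s N≤k))
      1≤εd : ι (suc k) ℚ.≤ ι (suc k) ℚ.* (ε ℚ.* ι d)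
      1≤εd = subst (ℚ._≤ ι (suc k) ℚ.* (ε ℚ.* ι d)) (ℚ.*-identityʳ (ι (suc k)))
        (ℚ.*-monoˡ-≤-nonNeg (ι (suc k)) {{ℚ.nonNegative (ℚ.<⇒≤ (0<ι k))}} 1≤)
      lt : ι c ℚ.* ι d ℚ.< ι (suc k) ℚ.* (ε ℚ.* ι d)
      lt = ℚ.<-≤-trans scaled 1≤εd
      lt′ : ι c ℚ.* ι d ℚ.* r k ℚ.< ι (suc k) ℚ.* (ε ℚ.* ι d) ℚ.* r k
      lt′ = ℚ.*-monoˡ-<-pos (r k) {{ℚ.positive (0<r k)}} lt
    in ℚ.*-cancelʳ-<-nonNeg (ι d) {{ℚ.nonNegative (ℚ.<⇒≤ (0<ι (ℚ.denominator-1 ε)))}} (subst₂ ℚ._<_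
      (regroup (ι c) (ι d) (r k))
      (trans (regroup′ (ι (suc k)) ε (ι d) (r k)) (trans (cong (ε ℚ.* ι d ℚ.*_) (ι*r k)) (ℚ.*-identityʳ _))) lt′)
    where
    d : ℕ
    d = suc (ℚ.denominator-1 ε)
    regroup : ∀ a b p → a ℚ.* b ℚ.* p ≡ a ℚ.* p ℚ.* b
    regroup = ℚₛ.solve 3 (λ a b p → a ℚₛ.:* b ℚₛ.:* p ℚₛ.:= a ℚₛ.:* p ℚₛ.:* b) refl
    regroup′ : ∀ a b c p → a ℚ.* (b ℚ.* c) ℚ.* p ≡ b ℚ.* c ℚ.* (a ℚ.* p)
    regroup′ = ℚₛ.solve 4 (λ a b c p → a ℚₛ.:* (b ℚₛ.:* c) ℚₛ.:* p ℚₛ.:= b ℚₛ.:* c ℚₛ.:* (a ℚₛ.:* p)) refl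
    ε*d : ε ℚ.* ι d ≡ ℚ.numerator ε ℚ./ 1
    ε*d = p*denominator ε
    -- `ε` times its denominator is its numerator, a positive integer.
    1≤ : 1ℚ ℚ.≤ ε ℚ.* ι d
    1≤ = subst (1ℚ ℚ.≤_) (sym ε*d) (/1-mono-≤ (ℤ.i<j⇒suc[i]≤j
      (subst₂ ℤ._<_ (ℤ.*-zeroˡ (ℚ.denominator ε)) (ℤ.*-identityʳ (ℚ.numerator ε)) (ℚ.drop-*<* 0<ε))))

  0<r² : ∀ k → 0ℚ ℚ.< r k ℚ.* r k
  0<r² k = subst (ℚ._< r k ℚ.* r k) (ℚ.*-zeroʳ (r k)) (ℚ.*-monoʳ-<-pos (r k) {{ℚ.positive (0<r k)}} (0<r k))

  ι*r*ι*r : ∀ a k → ι a ℚ.* (ι (suc k) ℚ.* ι (suc k)) ℚ.* (r k ℚ.* r k) ≡ ι a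
  ι*r*ι*r a k = begin
    ι a ℚ.* (ι (suc k) ℚ.* ι (suc k)) ℚ.* (r k ℚ.* r k) ≡⟨ regroup (ι a) (ι (suc k)) (r k) ⟩
    ι a ℚ.* ((ι (suc k) ℚ.* r k) ℚ.* (ι (suc k) ℚ.* r k)) ≡⟨ cong (λ z → ι a ℚ.* (z ℚ.* z)) (ι*r k) ⟩
    ι a ℚ.* (1ℚ ℚ.* 1ℚ) ≡⟨ ℚ.*-identityʳ (ι a) ⟩
    ι a ∎
    where
    open ≡-Reasoning
    regroup : ∀ a b p → a ℚ.* (b ℚ.* b) ℚ.* (p ℚ.* p) ≡ a ℚ.* ((b ℚ.* p) ℚ.* (b ℚ.* p))
    regroup = ℚₛ.solve 3 (λ a b p → a ℚₛ.:* (b ℚₛ.:* b) ℚₛ.:* (p ℚₛ.:* p) ℚₛ.:= a ℚₛ.:* ((b ℚₛ.:* p) ℚₛ.:* (b ℚₛ.:* p))) refl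

  approx² : ∀ k → ι (s k ℕ.* s k) ℚ.* (r k ℚ.* r k) ≡ approx k ℚ.* approx k
  approx² k = trans (cong (ℚ._* (r k ℚ.* r k)) (ι-* (s k) (s k))) (regroup (ι (s k)) (r k))
    where
    regroup : ∀ a p → a ℚ.* a ℚ.* (p ℚ.* p) ≡ a ℚ.* p ℚ.* (a ℚ.* p)
    regroup = ℚₛ.solve 2 (λ a p → a ℚₛ.:* a ℚₛ.:* (p ℚₛ.:* p) ℚₛ.:= a ℚₛ.:* p ℚₛ.:* (a ℚₛ.:* p)) refl

  approx²≤n : ∀ k → approx k ℚ.* approx k ℚ.≤ ι n
  approx²≤n k = subst₂ ℚ._≤_ (approx² k)
    (trans (cong (ℚ._* (r k ℚ.* r k)) (trans (ι-* n (suc k ℕ.* suc k)) (cong (ι n ℚ.*_) (ι-* (suc k) (suc k))))) (ι*r*ι*r n k))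
    (ℚ.*-monoʳ-≤-nonNeg (r k ℚ.* r k) {{ℚ.nonNegative (ℚ.<⇒≤ (0<r² k))}} (/1-mono-≤ (ℤ.+≤+ (s-lower k))))

  -- The crude estimate √n ≤ n suffices: it makes the error 2s + 1 of the square linear in k + 1, so
  -- that it tends to 0 after division by (k + 1)².
  s-bound : ∀ k → s k ℕ.≤ n ℕ.* suc k
  s-bound k = ℕ.s≤s⁻¹ (sq-cancel-< (ℕ.≤-<-trans (s-lower k) (ℕ.≤-<-trans (square n) (ℕ.*-mono-< (ℕ.n<1+n (n ℕ.* suc k)) (ℕ.n<1+n (n ℕ.* suc k))))))
    where
    regroup : ∀ a b → a ℕ.* a ℕ.* (b ℕ.* b) ≡ a ℕ.* b ℕ.* (a ℕ.* b)
    regroup = ℕ-Solver.solve-∀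
    square : ∀ n → n ℕ.* (suc k ℕ.* suc k) ℕ.≤ n ℕ.* suc k ℕ.* (n ℕ.* suc k)
    square zero      = ℕ.z≤n
    square n@(suc _) = subst (n ℕ.* (suc k ℕ.* suc k) ℕ.≤_) (regroup n (suc k))
      (ℕ.*-monoˡ-≤ (suc k ℕ.* suc k) (ℕ.m≤m*n n n))

  error-bound : ∀ k → n ℕ.* (suc k ℕ.* suc k) ℕ.< s k ℕ.* s k ℕ.+ suc (2 ℕ.* n) ℕ.* suc k
  error-bound k = ℕ.<-≤-trans (s-upper k) (begin
    suc (s k) ℕ.* suc (s k) ≡⟨ expand (s k) ⟩
    s k ℕ.* s k ℕ.+ (2 ℕ.* s k ℕ.+ 1) ≤⟨ ℕ.+-monoʳ-≤ (s k ℕ.* s k) (ℕ.+-mono-≤ (ℕ.*-monoʳ-≤ 2 (s-bound k)) (ℕ.s≤s (ℕ.z≤n {k}))) ⟩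
    s k ℕ.* s k ℕ.+ (2 ℕ.* (n ℕ.* suc k) ℕ.+ suc k) ≡⟨ cong (s k ℕ.* s k ℕ.+_) (collect n (suc k)) ⟩
    s k ℕ.* s k ℕ.+ suc (2 ℕ.* n) ℕ.* suc k ∎)
    where
    open ℕ.≤-Reasoning
    expand : ∀ a → suc a ℕ.* suc a ≡ a ℕ.* a ℕ.+ (2 ℕ.* a ℕ.+ 1)
    expand = ℕ-Solver.solve-∀
    collect : ∀ a b → 2 ℕ.* (a ℕ.* b) ℕ.+ b ≡ suc (2 ℕ.* a) ℕ.* b
    collect = ℕ-Solver.solve-∀

  n<approx²+ : ∀ k → ι n ℚ.< approx k ℚ.* approx k ℚ.+ ι (suc (2 ℕ.* n)) ℚ.* r k
  n<approx²+ k = subst₂ ℚ._<_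
    (trans (cong (ℚ._* (r k ℚ.* r k)) (trans (ι-* n (suc k ℕ.* suc k)) (cong (ι n ℚ.*_) (ι-* (suc k) (suc k))))) (ι*r*ι*r n k))
    (begin
      ι (s k ℕ.* s k ℕ.+ suc (2 ℕ.* n) ℕ.* suc k) ℚ.* (r k ℚ.* r k)
        ≡⟨ cong (ℚ._* (r k ℚ.* r k)) (ι-+ (s k ℕ.* s k) (suc (2 ℕ.* n) ℕ.* suc k)) ⟩
      (ι (s k ℕ.* s k) ℚ.+ ι (suc (2 ℕ.* n) ℕ.* suc k)) ℚ.* (r k ℚ.* r k)
        ≡⟨ ℚ.*-distribʳ-+ (r k ℚ.* r k) (ι (s k ℕ.* s k)) (ι (suc (2 ℕ.* n) ℕ.* suc k)) ⟩
      ι (s k ℕ.* s k) ℚ.* (r k ℚ.* r k) ℚ.+ ι (suc (2 ℕ.* n) ℕ.* suc k) ℚ.* (r k ℚ.* r k)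
        ≡⟨ cong₂ ℚ._+_ (approx² k) (begin
          ι (suc (2 ℕ.* n) ℕ.* suc k) ℚ.* (r k ℚ.* r k) ≡⟨ cong (ℚ._* (r k ℚ.* r k)) (ι-* (suc (2 ℕ.* n)) (suc k)) ⟩
          ι (suc (2 ℕ.* n)) ℚ.* ι (suc k) ℚ.* (r k ℚ.* r k) ≡⟨ regroup (ι (suc (2 ℕ.* n))) (ι (suc k)) (r k) ⟩
          ι (suc (2 ℕ.* n)) ℚ.* r k ℚ.* (ι (suc k) ℚ.* r k) ≡⟨ cong (ι (suc (2 ℕ.* n)) ℚ.* r k ℚ.*_) (ι*r k) ⟩
          ι (suc (2 ℕ.* n)) ℚ.* r k ℚ.* 1ℚ ≡⟨ ℚ.*-identityʳ _ ⟩
          ι (suc (2 ℕ.* n)) ℚ.* r k ∎) ⟩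
      approx k ℚ.* approx k ℚ.+ ι (suc (2 ℕ.* n)) ℚ.* r k ∎)
    (ℚ.*-monoˡ-<-pos (r k ℚ.* r k) {{ℚ.positive (0<r² k)}} (ι-mono-< (error-bound k)))
    where
    open ≡-Reasoning
    regroup : ∀ a b p → a ℚ.* b ℚ.* (p ℚ.* p) ≡ a ℚ.* p ℚ.* (b ℚ.* p)
    regroup = ℚₛ.solve 3 (λ a b p → a ℚₛ.:* b ℚₛ.:* (p ℚₛ.:* p) ℚₛ.:= a ℚₛ.:* p ℚₛ.:* (b ℚₛ.:* p)) refl

  p<q+r⇒p-q<r : ∀ {p q r} → p ℚ.< q ℚ.+ r → p ℚ.- q ℚ.< r
  p<q+r⇒p-q<r {p} {q} {r} lt = 0<q-p⇒p<q (subst (0ℚ ℚ.<_) (regroup p q r) (p<q⇒0<q-p lt))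
    where
    regroup : ∀ p q r → q ℚ.+ r ℚ.- p ≡ r ℚ.- (p ℚ.- q)
    regroup = ℚₛ.solve 3 (λ p q r → q ℚₛ.:+ r ℚₛ.:- p ℚₛ.:= r ℚₛ.:- (p ℚₛ.:- q)) refl

  neg-minus : ∀ p q → q ℚ.- p ≡ ℚ.- (p ℚ.- q)
  neg-minus = ℚₛ.solve 2 (λ p q → q ℚₛ.:- p ℚₛ.:= ℚₛ.:- (p ℚₛ.:- q)) refl

  approx-cauchy : IsCauchy approx
  approx-cauchy {ε} 0<ε = case small 1 0<ε of λ where
    (N , tiny) → N , λ {i} {j} N≤i N≤j → ∣p∣<r (approx i ℚ.- approx j)
      (ℚ.<-trans (p<q+r⇒p-q<r (approx-cross i j)) (subst (ℚ._< ε) (ℚ.*-identityˡ (r j)) (tiny N≤j)))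
      (subst (ℚ._< ε) (neg-minus (approx i) (approx j))
        (ℚ.<-trans (p<q+r⇒p-q<r (approx-cross j i)) (subst (ℚ._< ε) (ℚ.*-identityˡ (r i)) (tiny N≤i))))

  root : ℝ
  root = mkℝ approx approx-cauchy

  root-isSqrt : IsSqrt (fromℕ n) root
  root-isSqrt = pointwise-≤ (λ k → subst (ℚ._≤ approx k) (ℚ.*-zeroˡ (r k))
      (ℚ.*-monoʳ-≤-nonNeg (r k) {{ℚ.nonNegative (ℚ.<⇒≤ (0<r k))}} (/1-mono-≤ {+ 0} {+ s k} (ℤ.+≤+ ℕ.z≤n)))) ,
    mk≈ λ {ε} 0<ε → case small (suc (2 ℕ.* n)) 0<ε of λ where
      (N , tiny) → N , λ {k} N≤k → ∣p∣<r (approx k ℚ.* approx k ℚ.- ι n)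
        (p<q+r⇒p-q<r (ℚ.≤-<-trans (approx²≤n k) (subst (ℚ._< ι n ℚ.+ ε) (ℚ.+-identityʳ (ι n)) (ℚ.+-monoʳ-< (ι n) 0<ε))))
        (subst (ℚ._< ε) (neg-minus (approx k ℚ.* approx k) (ι n)) (ℚ.<-trans (p<q+r⇒p-q<r (n<approx²+ k)) (tiny N≤k)))

-- Arithmetic of Z[ω]

infix  9 _∧_
infixr 7 _•_
infixl 6 _⊕_ _⊖_

_⊕_ _⊖_ : ℤ[ω] → ℤ[ω] → ℤ[ω]
(a , b) ⊕ (c , d) = a ℤ.+ c , b ℤ.+ d
(a , b) ⊖ (c , d) = a ℤ.- c , b ℤ.- d

⊝_ : ℤ[ω] → ℤ[ω]
⊝ (a , b) = ℤ.- a , ℤ.- b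

_•_ : ℤ → ℤ[ω] → ℤ[ω]
k • (a , b) = k ℤ.* a , k ℤ.* b

0ω : ℤ[ω]
0ω = + 0 , + 0

_∧_ : ℤ[ω] → ℤ[ω] → ℤ
v ∧ w = proj₁ v ℤ.* proj₂ w ℤ.- proj₂ v ℤ.* proj₁ w

-- Twice the inner product.
tr : ℤ[ω] → ℤ[ω] → ℤ
tr (a , b) (c , d) = + 2 ℤ.* (a ℤ.* c) ℤ.- a ℤ.* d ℤ.- b ℤ.* c ℤ.+ + 2 ℤ.* (b ℤ.* d)

square : ∀ i → i ℤ.* i ≡ + (ℤ.∣ i ∣ ℕ.* ℤ.∣ i ∣)
square (+ n)    = sym (ℤ.pos-* n n)
square -[1+ n ] = refl

0≤square : ∀ i → + 0 ℤ.≤ i ℤ.* i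
0≤square i = subst (+ 0 ℤ.≤_) (sym (square i)) (ℤ.+≤+ ℕ.z≤n)

-- Multiplicativity of the norm for the conjugate of `v` times `w`: twice this product has real part
-- `tr v w` and imaginary part √3 times `v ∧ w`.
norm-identity : ∀ v w → + 4 ℤ.* (norm v ℤ.* norm w) ≡ tr v w ℤ.* tr v w ℤ.+ + 3 ℤ.* (v ∧ w ℤ.* v ∧ w)
norm-identity (a , b) (c , d) = identity a b c d
  where
  identity : ∀ a b c d → + 4 ℤ.* ((a ℤ.* a ℤ.- a ℤ.* b ℤ.+ b ℤ.* b) ℤ.* (c ℤ.* c ℤ.- c ℤ.* d ℤ.+ d ℤ.* d)) ≡
    (+ 2 ℤ.* (a ℤ.* c) ℤ.- a ℤ.* d ℤ.- b ℤ.* c ℤ.+ + 2 ℤ.* (b ℤ.* d)) ℤ.*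
    (+ 2 ℤ.* (a ℤ.* c) ℤ.- a ℤ.* d ℤ.- b ℤ.* c ℤ.+ + 2 ℤ.* (b ℤ.* d)) ℤ.+
    + 3 ℤ.* ((a ℤ.* d ℤ.- b ℤ.* c) ℤ.* (a ℤ.* d ℤ.- b ℤ.* c))
  identity = ℤ-Solver.solve-∀

N : ℤ[ω] → ℕ
N v = ℤ.∣ norm v ∣

norm≡N : ∀ v → norm v ≡ + N v
norm≡N v@(a , b) = sym (ℤ.0≤i⇒+∣i∣≡i (ℤ.*-cancelˡ-≤-pos (+ 0) (norm v) (+ 4) (subst (+ 0 ℤ.≤_)
  (sym (completed a b)) (ℤ.+-mono-≤ (ℤ.*-monoˡ-≤-nonNeg (+ 3) (0≤square a)) (0≤square (+ 2 ℤ.* b ℤ.- a))))))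
  where
  completed : ∀ a b → + 4 ℤ.* (a ℤ.* a ℤ.- a ℤ.* b ℤ.+ b ℤ.* b) ≡
    + 3 ℤ.* (a ℤ.* a) ℤ.+ (+ 2 ℤ.* b ℤ.- a) ℤ.* (+ 2 ℤ.* b ℤ.- a)
  completed = ℤ-Solver.solve-∀

+3* : ∀ m → + 3 ℤ.* + m ≡ + (3 ℕ.* m)
+3* m = sym (ℤ.pos-* 3 m)

N-identity : ∀ v w → 4 ℕ.* (N v ℕ.* N w) ≡ ℤ.∣ tr v w ∣ ℕ.* ℤ.∣ tr v w ∣ ℕ.+ 3 ℕ.* (ℤ.∣ v ∧ w ∣ ℕ.* ℤ.∣ v ∧ w ∣)
N-identity v w = ℤ.+-injective (begin
  + (4 ℕ.* (N v ℕ.* N w)) ≡⟨ ℤ.pos-* 4 (N v ℕ.* N w) ⟩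
  + 4 ℤ.* + (N v ℕ.* N w) ≡⟨ cong (+ 4 ℤ.*_) (ℤ.pos-* (N v) (N w)) ⟩
  + 4 ℤ.* (+ N v ℤ.* + N w) ≡⟨ cong₂ (λ m n → + 4 ℤ.* (m ℤ.* n)) (norm≡N v) (norm≡N w) ⟨
  + 4 ℤ.* (norm v ℤ.* norm w) ≡⟨ norm-identity v w ⟩
  tr v w ℤ.* tr v w ℤ.+ + 3 ℤ.* (v ∧ w ℤ.* v ∧ w)
    ≡⟨ cong₂ ℤ._+_ (square (tr v w)) (trans (cong (+ 3 ℤ.*_) (square (v ∧ w))) (+3* (ℤ.∣ v ∧ w ∣ ℕ.* ℤ.∣ v ∧ w ∣))) ⟩
  + (ℤ.∣ tr v w ∣ ℕ.* ℤ.∣ tr v w ∣ ℕ.+ 3 ℕ.* (ℤ.∣ v ∧ w ∣ ℕ.* ℤ.∣ v ∧ w ∣)) ∎)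
  where open ≡-Reasoning

-- N-identity with w = ω, for which v ∧ w = a.
N-bound₁ : ∀ a b → 3 ℕ.* (ℤ.∣ a ∣ ℕ.* ℤ.∣ a ∣) ℕ.≤ 4 ℕ.* N (a , b)
N-bound₁ a b = begin
  3 ℕ.* (ℤ.∣ a ∣ ℕ.* ℤ.∣ a ∣) ≡⟨ cong (λ z → 3 ℕ.* (ℤ.∣ z ∣ ℕ.* ℤ.∣ z ∣)) (identity a b) ⟩
  3 ℕ.* (ℤ.∣ (a , b) ∧ ω′ ∣ ℕ.* ℤ.∣ (a , b) ∧ ω′ ∣) ≤⟨ ℕ.m≤n+m _ (ℤ.∣ tr (a , b) ω′ ∣ ℕ.* ℤ.∣ tr (a , b) ω′ ∣) ⟩
  _ ≡⟨ N-identity (a , b) ω′ ⟨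
  4 ℕ.* (N (a , b) ℕ.* 1) ≡⟨ cong (4 ℕ.*_) (ℕ.*-identityʳ (N (a , b))) ⟩
  4 ℕ.* N (a , b) ∎
  where
  open ℕ.≤-Reasoning
  ω′ : ℤ[ω]
  ω′ = + 0 , + 1
  identity : ∀ a b → a ≡ a ℤ.* + 1 ℤ.- b ℤ.* + 0
  identity = ℤ-Solver.solve-∀

N-bound₂ : ∀ a b → 3 ℕ.* (ℤ.∣ b ∣ ℕ.* ℤ.∣ b ∣) ℕ.≤ 4 ℕ.* N (a , b)
N-bound₂ a b = subst (λ z → 3 ℕ.* (ℤ.∣ b ∣ ℕ.* ℤ.∣ b ∣) ℕ.≤ 4 ℕ.* ℤ.∣ z ∣) (identity a b) (N-bound₁ b a)
  where
  identity : ∀ a b → b ℤ.* b ℤ.- b ℤ.* a ℤ.+ a ℤ.* a ≡ a ℤ.* a ℤ.- a ℤ.* b ℤ.+ b ℤ.* b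
  identity = ℤ-Solver.solve-∀

N≡0⇒≡0 : ∀ v → N v ≡ 0 → v ≡ 0ω
N≡0⇒≡0 (a , b) eq = cong₂ _,_
  (vanishes a (subst (λ z → 3 ℕ.* (ℤ.∣ a ∣ ℕ.* ℤ.∣ a ∣) ℕ.≤ 4 ℕ.* z) eq (N-bound₁ a b)))
  (vanishes b (subst (λ z → 3 ℕ.* (ℤ.∣ b ∣ ℕ.* ℤ.∣ b ∣) ℕ.≤ 4 ℕ.* z) eq (N-bound₂ a b)))
  where
  vanishes : ∀ i → 3 ℕ.* (ℤ.∣ i ∣ ℕ.* ℤ.∣ i ∣) ℕ.≤ 0 → i ≡ + 0
  vanishes (+ 0) _ = refl

N>0 : ∀ {v} → v ≢ 0ω → 0 ℕ.< N v
N>0 {v} v≢0 = ℕ.n≢0⇒n>0 (v≢0 ∘ N≡0⇒≡0 v)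

-- 3a² ≤ 4 and 3b² ≤ 4 leave only the coordinates -1, 0 and 1, and six of the nine pairs have norm
-- 1.
norm≡1⇒∈units : ∀ v → norm v ≡ + 1 → v ∈ units
norm≡1⇒∈units (a , b) eq = check a b
  (subst (λ z → 3 ℕ.* (ℤ.∣ a ∣ ℕ.* ℤ.∣ a ∣) ℕ.≤ 4 ℕ.* ℤ.∣ z ∣) eq (N-bound₁ a b))
  (subst (λ z → 3 ℕ.* (ℤ.∣ b ∣ ℕ.* ℤ.∣ b ∣) ℕ.≤ 4 ℕ.* ℤ.∣ z ∣) eq (N-bound₂ a b)) eq
  where
  large : ∀ m → ¬ (3 ℕ.* (suc (suc m) ℕ.* suc (suc m)) ℕ.≤ 4)
  large m le = ℕ.<⇒≱ (ℕ.s≤s (ℕ.s≤s (ℕ.s≤s (ℕ.s≤s (ℕ.s≤s (ℕ.z≤n {7})))))) (ℕ.≤-trans (ℕ.*-monoʳ-≤ 3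
    (ℕ.*-mono-≤ {2} {suc (suc m)} {2} {suc (suc m)} (ℕ.s≤s (ℕ.s≤s ℕ.z≤n)) (ℕ.s≤s (ℕ.s≤s ℕ.z≤n)))) le)
  check : ∀ a b → 3 ℕ.* (ℤ.∣ a ∣ ℕ.* ℤ.∣ a ∣) ℕ.≤ 4 → 3 ℕ.* (ℤ.∣ b ∣ ℕ.* ℤ.∣ b ∣) ℕ.≤ 4 →
    norm (a , b) ≡ + 1 → (a , b) ∈ units
  check (+ suc (suc m)) _ p _ _ = ⊥-elim (large m p)
  check -[1+ suc m ] _ p _ _ = ⊥-elim (large m p)
  check _ (+ suc (suc m)) _ p _ = ⊥-elim (large m p)
  check _ -[1+ suc m ] _ p _ = ⊥-elim (large m p)
  check (+ 1) (+ 0) _ _ _ = here refl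
  check -[1+ 0 ] (+ 0) _ _ _ = there (here refl)
  check (+ 0) (+ 1) _ _ _ = there (there (here refl))
  check (+ 0) -[1+ 0 ] _ _ _ = there (there (there (here refl)))
  check -[1+ 0 ] -[1+ 0 ] _ _ _ = there (there (there (there (here refl))))
  check (+ 1) (+ 1) _ _ _ = there (there (there (there (there (here refl)))))
  check (+ 0) (+ 0) _ _ ()
  check (+ 1) -[1+ 0 ] _ _ ()
  check -[1+ 0 ] (+ 1) _ _ ()

-- Units and association

-- Complex conjugation, as the conjugate of ω is -1 - ω. On elements of norm 1 it gives the inverse.
conj : ℤ[ω] → ℤ[ω]
conj (a , b) = a ℤ.- b , ℤ.- b

norm-⊗ : ∀ v w → norm (v ⊗ w) ≡ norm v ℤ.* norm w
norm-⊗ (a , b) (c , d) = identity a b c d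
  where
  identity : ∀ a b c d →
    (a ℤ.* c ℤ.- b ℤ.* d) ℤ.* (a ℤ.* c ℤ.- b ℤ.* d)
    ℤ.- (a ℤ.* c ℤ.- b ℤ.* d) ℤ.* (a ℤ.* d ℤ.+ b ℤ.* c ℤ.- b ℤ.* d)
    ℤ.+ (a ℤ.* d ℤ.+ b ℤ.* c ℤ.- b ℤ.* d) ℤ.* (a ℤ.* d ℤ.+ b ℤ.* c ℤ.- b ℤ.* d) ≡
    (a ℤ.* a ℤ.- a ℤ.* b ℤ.+ b ℤ.* b) ℤ.* (c ℤ.* c ℤ.- c ℤ.* d ℤ.+ d ℤ.* d)
  identity = ℤ-Solver.solve-∀

∧-⊗ : ∀ u v w → (u ⊗ v) ∧ (u ⊗ w) ≡ norm u ℤ.* v ∧ w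
∧-⊗ (a , b) (c , d) (e , f) = identity a b c d e f
  where
  identity : ∀ a b c d e f →
    (a ℤ.* c ℤ.- b ℤ.* d) ℤ.* (a ℤ.* f ℤ.+ b ℤ.* e ℤ.- b ℤ.* f) ℤ.-
    (a ℤ.* d ℤ.+ b ℤ.* c ℤ.- b ℤ.* d) ℤ.* (a ℤ.* e ℤ.- b ℤ.* f) ≡
    (a ℤ.* a ℤ.- a ℤ.* b ℤ.+ b ℤ.* b) ℤ.* (c ℤ.* f ℤ.- d ℤ.* e)
  identity = ℤ-Solver.solve-∀

⊗-assoc : ∀ u v w → u ⊗ (v ⊗ w) ≡ (u ⊗ v) ⊗ w
⊗-assoc (a , b) (c , d) (e , f) = cong₂ _,_ (identity₁ a b c d e f) (identity₂ a b c d e f)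
  where
  identity₁ : ∀ a b c d e f → a ℤ.* (c ℤ.* e ℤ.- d ℤ.* f) ℤ.- b ℤ.* (c ℤ.* f ℤ.+ d ℤ.* e ℤ.- d ℤ.* f) ≡
    (a ℤ.* c ℤ.- b ℤ.* d) ℤ.* e ℤ.- (a ℤ.* d ℤ.+ b ℤ.* c ℤ.- b ℤ.* d) ℤ.* f
  identity₁ = ℤ-Solver.solve-∀
  identity₂ : ∀ a b c d e f →
    a ℤ.* (c ℤ.* f ℤ.+ d ℤ.* e ℤ.- d ℤ.* f) ℤ.+ b ℤ.* (c ℤ.* e ℤ.- d ℤ.* f) ℤ.- b ℤ.* (c ℤ.* f ℤ.+ d ℤ.* e ℤ.- d ℤ.* f) ≡
    (a ℤ.* c ℤ.- b ℤ.* d) ℤ.* f ℤ.+ (a ℤ.* d ℤ.+ b ℤ.* c ℤ.- b ℤ.* d) ℤ.* e ℤ.- (a ℤ.* d ℤ.+ b ℤ.* c ℤ.- b ℤ.* d) ℤ.* f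
  identity₂ = ℤ-Solver.solve-∀

conj-⊗ : ∀ u v → norm u ≡ + 1 → conj u ⊗ (u ⊗ v) ≡ v
conj-⊗ u@(a , b) (c , d) eq = cong₂ _,_
  (trans (identity₁ a b c d) (trans (cong (ℤ._* c) eq) (ℤ.*-identityˡ c)))
  (trans (identity₂ a b c d) (trans (cong (ℤ._* d) eq) (ℤ.*-identityˡ d)))
  where
  identity₁ : ∀ a b c d → (a ℤ.- b) ℤ.* (a ℤ.* c ℤ.- b ℤ.* d) ℤ.- (ℤ.- b) ℤ.* (a ℤ.* d ℤ.+ b ℤ.* c ℤ.- b ℤ.* d) ≡
    (a ℤ.* a ℤ.- a ℤ.* b ℤ.+ b ℤ.* b) ℤ.* c
  identity₁ = ℤ-Solver.solve-∀
  identity₂ : ∀ a b c d →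
    (a ℤ.- b) ℤ.* (a ℤ.* d ℤ.+ b ℤ.* c ℤ.- b ℤ.* d) ℤ.+ (ℤ.- b) ℤ.* (a ℤ.* c ℤ.- b ℤ.* d)
    ℤ.- (ℤ.- b) ℤ.* (a ℤ.* d ℤ.+ b ℤ.* c ℤ.- b ℤ.* d) ≡ (a ℤ.* a ℤ.- a ℤ.* b ℤ.+ b ℤ.* b) ℤ.* d
  identity₂ = ℤ-Solver.solve-∀

norm-conj : ∀ u → norm (conj u) ≡ norm u
norm-conj (a , b) = identity a b
  where
  identity : ∀ a b → (a ℤ.- b) ℤ.* (a ℤ.- b) ℤ.- (a ℤ.- b) ℤ.* (ℤ.- b) ℤ.+ (ℤ.- b) ℤ.* (ℤ.- b) ≡ a ℤ.* a ℤ.- a ℤ.* b ℤ.+ b ℤ.* b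
  identity = ℤ-Solver.solve-∀

-- Once a unit is known through its norm alone, symmetry and transitivity of association are algebra
-- instead of a case analysis over six units.
Associated⇒unit : ∀ {v w} → Associated v w → ∃ λ u → norm u ≡ + 1 × w ≡ u ⊗ v
Associated⇒unit v~w = Any.lookup v~w , All.lookupAny unit-norms v~w
  where
  unit-norms : All (λ u → norm u ≡ + 1) units
  unit-norms = refl ∷ refl ∷ refl ∷ refl ∷ refl ∷ refl ∷ []

unit⇒Associated : ∀ {v w} u → norm u ≡ + 1 → w ≡ u ⊗ v → Associated v w
unit⇒Associated {v} u norm≡1 eq = Any.map (λ u≡u′ → subst (λ u → _ ≡ u ⊗ v) u≡u′ eq) (norm≡1⇒∈units u norm≡1)

associated-refl : ∀ {v} → Associated v v
associated-refl {a , b} = here (cong₂ _,_ (identity₁ a b) (identity₂ a b))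
  where
  identity₁ : ∀ a b → a ≡ + 1 ℤ.* a ℤ.- + 0 ℤ.* b
  identity₁ = ℤ-Solver.solve-∀
  identity₂ : ∀ a b → b ≡ + 1 ℤ.* b ℤ.+ + 0 ℤ.* a ℤ.- + 0 ℤ.* b
  identity₂ = ℤ-Solver.solve-∀

associated-sym : ∀ {v w} → Associated v w → Associated w v
associated-sym {v} v~w = case Associated⇒unit v~w of λ where
  (u , norm≡1 , refl) → unit⇒Associated (conj u) (trans (norm-conj u) norm≡1) (sym (conj-⊗ u v norm≡1))

associated-trans : ∀ {v w x} → Associated v w → Associated w x → Associated v x
associated-trans {v} v~w w~x = case Associated⇒unit v~w , Associated⇒unit w~x of λ where
  ((u , p , refl) , (u′ , q , refl)) →
    unit⇒Associated (u′ ⊗ u) (trans (norm-⊗ u′ u) (cong₂ ℤ._*_ q p)) (⊗-assoc u′ u v)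

associated-N : ∀ {v w} → Associated v w → N v ≡ N w
associated-N {v} v~w = case Associated⇒unit v~w of λ where
  (u , p , refl) → sym (cong ℤ.∣_∣ (trans (norm-⊗ u v) (trans (cong (ℤ._* norm v) p) (ℤ.*-identityˡ (norm v)))))

unit-∧ : ∀ u v w → norm u ≡ + 1 → (u ⊗ v) ∧ (u ⊗ w) ≡ v ∧ w
unit-∧ u v w p = trans (∧-⊗ u v w) (trans (cong (ℤ._* v ∧ w) p) (ℤ.*-identityˡ (v ∧ w)))

⊝-Associated : ∀ v → Associated v (⊝ v)
⊝-Associated (a , b) = there (here (cong₂ _,_ (identity₁ a b) (identity₂ a b)))
  where
  identity₁ : ∀ a b → ℤ.- a ≡ -[1+ 0 ] ℤ.* a ℤ.- + 0 ℤ.* b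
  identity₁ = ℤ-Solver.solve-∀
  identity₂ : ∀ a b → ℤ.- b ≡ -[1+ 0 ] ℤ.* b ℤ.+ + 0 ℤ.* a ℤ.- + 0 ℤ.* b
  identity₂ = ℤ-Solver.solve-∀

-- Primitive vectors and partners

-- Cramer's rule: for `v ∧ w` equal to 1 it yields the coordinates of `y` in the basis `v`, `w`.
∧⊗-expand : ∀ v w y → (v ∧ w) • y ≡ (y ∧ w) • v ⊕ (v ∧ y) • w
∧⊗-expand (a , b) (c , d) (e , f) = cong₂ _,_ (identity₁ a b c d e f) (identity₂ a b c d e f)
  where
  identity₁ : ∀ a b c d e f → (a ℤ.* d ℤ.- b ℤ.* c) ℤ.* e ≡ (e ℤ.* d ℤ.- f ℤ.* c) ℤ.* a ℤ.+ (a ℤ.* f ℤ.- b ℤ.* e) ℤ.* c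
  identity₁ = ℤ-Solver.solve-∀
  identity₂ : ∀ a b c d e f → (a ℤ.* d ℤ.- b ℤ.* c) ℤ.* f ≡ (e ℤ.* d ℤ.- f ℤ.* c) ℤ.* b ℤ.+ (a ℤ.* f ℤ.- b ℤ.* e) ℤ.* d
  identity₂ = ℤ-Solver.solve-∀

1•_ : ∀ v → + 1 • v ≡ v
1• (a , b) = cong₂ _,_ (ℤ.*-identityˡ a) (ℤ.*-identityˡ b)

0•_ : ∀ v → + 0 • v ≡ 0ω
0• (a , b) = refl

⊕-identityʳ : ∀ v → v ⊕ 0ω ≡ v
⊕-identityʳ (a , b) = cong₂ _,_ (ℤ.+-identityʳ a) (ℤ.+-identityʳ b)

⊕-identityˡ : ∀ v → 0ω ⊕ v ≡ v
⊕-identityˡ (a , b) = cong₂ _,_ (ℤ.+-identityˡ a) (ℤ.+-identityˡ b)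

⊕-⊖-cancel : ∀ v w → (v ⊖ w) ⊕ w ≡ v
⊕-⊖-cancel (a , b) (c , d) = cong₂ _,_ (identity a c) (identity b d)
  where
  identity : ∀ a c → a ℤ.- c ℤ.+ c ≡ a
  identity = ℤ-Solver.solve-∀

∧-⊖ : ∀ v w x → v ∧ (w ⊖ x) ≡ v ∧ w ℤ.- v ∧ x
∧-⊖ (a , b) (c , d) (e , f) = identity a b c d e f
  where
  identity : ∀ a b c d e f → a ℤ.* (d ℤ.- f) ℤ.- b ℤ.* (c ℤ.- e) ≡ (a ℤ.* d ℤ.- b ℤ.* c) ℤ.- (a ℤ.* f ℤ.- b ℤ.* e)
  identity = ℤ-Solver.solve-∀

∧-⊕• : ∀ v w x k l → v ∧ (k • w ⊕ l • x) ≡ k ℤ.* v ∧ w ℤ.+ l ℤ.* v ∧ x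
∧-⊕• (a , b) (c , d) (e , f) k l = identity a b c d e f k l
  where
  identity : ∀ a b c d e f k l → a ℤ.* (k ℤ.* d ℤ.+ l ℤ.* f) ℤ.- b ℤ.* (k ℤ.* c ℤ.+ l ℤ.* e) ≡
    k ℤ.* (a ℤ.* d ℤ.- b ℤ.* c) ℤ.+ l ℤ.* (a ℤ.* f ℤ.- b ℤ.* e)
  identity = ℤ-Solver.solve-∀

∧-•ʳ : ∀ v k w → v ∧ (k • w) ≡ k ℤ.* v ∧ w
∧-•ʳ (a , b) k (c , d) = identity a b k c d
  where
  identity : ∀ a b k c d → a ℤ.* (k ℤ.* d) ℤ.- b ℤ.* (k ℤ.* c) ≡ k ℤ.* (a ℤ.* d ℤ.- b ℤ.* c)
  identity = ℤ-Solver.solve-∀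

∧-self : ∀ v → v ∧ v ≡ + 0
∧-self (a , b) = identity a b
  where
  identity : ∀ a b → a ℤ.* b ℤ.- b ℤ.* a ≡ + 0
  identity = ℤ-Solver.solve-∀

zero-∧ : ∀ v → v ∧ 0ω ≡ + 0
zero-∧ (a , b) = identity a b
  where
  identity : ∀ a b → a ℤ.* + 0 ℤ.- b ℤ.* + 0 ≡ + 0
  identity = ℤ-Solver.solve-∀

∧-reduced : ∀ v w t k → v ∧ w ≡ + 1 → v ∧ (t • v ⊕ k • w) ≡ k
∧-reduced v w t k vw≡1 = trans (∧-⊕• v v w t k)
  (trans (cong₂ (λ i j → t ℤ.* i ℤ.+ k ℤ.* j) (∧-self v) vw≡1) (simplify t k))
  where
  simplify : ∀ t k → t ℤ.* + 0 ℤ.+ k ℤ.* + 1 ≡ k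
  simplify = ℤ-Solver.solve-∀

∧-swap : ∀ v w → v ∧ w ≡ ℤ.- w ∧ v
∧-swap (a , b) (c , d) = identity a b c d
  where
  identity : ∀ a b c d → a ℤ.* d ℤ.- b ℤ.* c ≡ ℤ.- (c ℤ.* b ℤ.- d ℤ.* a)
  identity = ℤ-Solver.solve-∀

∧-⊝ : ∀ v w → v ∧ (⊝ w) ≡ ℤ.- v ∧ w
∧-⊝ (a , b) (c , d) = identity a b c d
  where
  identity : ∀ a b c d → a ℤ.* (ℤ.- d) ℤ.- b ℤ.* (ℤ.- c) ≡ ℤ.- (a ℤ.* d ℤ.- b ℤ.* c)
  identity = ℤ-Solver.solve-∀

-- The reason why traces against `v` can be reduced modulo 2N(v) by adding multiples of `v`.
tr-⊕• : ∀ v w k → tr v (k • v ⊕ w) ≡ + 2 ℤ.* norm v ℤ.* k ℤ.+ tr v w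
tr-⊕• (a , b) (c , d) k = identity a b c d k
  where
  identity : ∀ a b c d k →
    + 2 ℤ.* (a ℤ.* (k ℤ.* a ℤ.+ c)) ℤ.- a ℤ.* (k ℤ.* b ℤ.+ d) ℤ.- b ℤ.* (k ℤ.* a ℤ.+ c) ℤ.+ + 2 ℤ.* (b ℤ.* (k ℤ.* b ℤ.+ d)) ≡
    + 2 ℤ.* (a ℤ.* a ℤ.- a ℤ.* b ℤ.+ b ℤ.* b) ℤ.* k ℤ.+
    (+ 2 ℤ.* (a ℤ.* c) ℤ.- a ℤ.* d ℤ.- b ℤ.* c ℤ.+ + 2 ℤ.* (b ℤ.* d))
  identity = ℤ-Solver.solve-∀

tr-•ʳ : ∀ v k w → tr v (k • w) ≡ k ℤ.* tr v w
tr-•ʳ (a , b) k (c , d) = identity a b k c d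
  where
  identity : ∀ a b k c d → + 2 ℤ.* (a ℤ.* (k ℤ.* c)) ℤ.- a ℤ.* (k ℤ.* d) ℤ.- b ℤ.* (k ℤ.* c) ℤ.+ + 2 ℤ.* (b ℤ.* (k ℤ.* d)) ≡
    k ℤ.* (+ 2 ℤ.* (a ℤ.* c) ℤ.- a ℤ.* d ℤ.- b ℤ.* c ℤ.+ + 2 ℤ.* (b ℤ.* d))
  identity = ℤ-Solver.solve-∀

tr-⊝ : ∀ v w → tr v (⊝ w) ≡ ℤ.- tr v w
tr-⊝ (a , b) (c , d) = identity a b c d
  where
  identity : ∀ a b c d →
    + 2 ℤ.* (a ℤ.* (ℤ.- c)) ℤ.- a ℤ.* (ℤ.- d) ℤ.- b ℤ.* (ℤ.- c) ℤ.+ + 2 ℤ.* (b ℤ.* (ℤ.- d)) ≡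
    ℤ.- (+ 2 ℤ.* (a ℤ.* c) ℤ.- a ℤ.* d ℤ.- b ℤ.* c ℤ.+ + 2 ℤ.* (b ℤ.* d))
  identity = ℤ-Solver.solve-∀

norm-⊝ : ∀ v → norm (⊝ v) ≡ norm v
norm-⊝ (a , b) = identity a b
  where
  identity : ∀ a b → (ℤ.- a) ℤ.* (ℤ.- a) ℤ.- (ℤ.- a) ℤ.* (ℤ.- b) ℤ.+ (ℤ.- b) ℤ.* (ℤ.- b) ≡ a ℤ.* a ℤ.- a ℤ.* b ℤ.+ b ℤ.* b
  identity = ℤ-Solver.solve-∀

norm-• : ∀ k v → norm (k • v) ≡ k ℤ.* k ℤ.* norm v
norm-• k (a , b) = identity k a b
  where
  identity : ∀ k a b → (k ℤ.* a) ℤ.* (k ℤ.* a) ℤ.- (k ℤ.* a) ℤ.* (k ℤ.* b) ℤ.+ (k ℤ.* b) ℤ.* (k ℤ.* b) ≡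
    k ℤ.* k ℤ.* (a ℤ.* a ℤ.- a ℤ.* b ℤ.+ b ℤ.* b)
  identity = ℤ-Solver.solve-∀

signed : ∀ i → ∃ λ σ → σ ℤ.* i ≡ + ℤ.∣ i ∣
signed i = case ℤ.+∣i∣≡i⊎+∣i∣≡-i i of λ where
  (inj₁ eq) → + 1 , trans (ℤ.*-identityˡ i) (sym eq)
  (inj₂ eq) → -[1+ 0 ] , trans (ℤ.-1*i≡-i i) (sym eq)

-- Bézout for the absolute values of the coordinates, with the signs put back by σ and ρ. The two
-- cases are the two sides on which the 1 of a Bézout identity in ℕ can stand.
primitive⇒∧≡1 : ∀ v → Primitive v → ∃ λ w → v ∧ w ≡ + 1
primitive⇒∧≡1 (a , b) prim
  with signed a | signed b | Coprime.coprime-Bézout (Coprime.gcd≡1⇒coprime (ℤ.+-injective prim))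
... | σ , σa | ρ , ρb | ℕ.Bézout.+- x y eq = (+ y ℤ.* ρ , + x ℤ.* σ) , (begin
  a ℤ.* (+ x ℤ.* σ) ℤ.- b ℤ.* (+ y ℤ.* ρ) ≡⟨ identity a b (+ x) (+ y) σ ρ ⟩
  + x ℤ.* (σ ℤ.* a) ℤ.- + y ℤ.* (ρ ℤ.* b) ≡⟨ cong₂ (λ p q → + x ℤ.* p ℤ.- + y ℤ.* q) σa ρb ⟩
  + x ℤ.* + ℤ.∣ a ∣ ℤ.- + y ℤ.* + ℤ.∣ b ∣ ≡⟨ cong₂ ℤ._-_ (ℤ.pos-* x ℤ.∣ a ∣) (ℤ.pos-* y ℤ.∣ b ∣) ⟨
  + (x ℕ.* ℤ.∣ a ∣) ℤ.- + (y ℕ.* ℤ.∣ b ∣) ≡⟨ cong (λ z → + z ℤ.- + (y ℕ.* ℤ.∣ b ∣)) eq ⟨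
  + 1 ℤ.+ + (y ℕ.* ℤ.∣ b ∣) ℤ.- + (y ℕ.* ℤ.∣ b ∣) ≡⟨ cancel (+ (y ℕ.* ℤ.∣ b ∣)) ⟩
  + 1 ∎)
  where
  open ≡-Reasoning
  identity : ∀ a b x y σ ρ → a ℤ.* (x ℤ.* σ) ℤ.- b ℤ.* (y ℤ.* ρ) ≡ x ℤ.* (σ ℤ.* a) ℤ.- y ℤ.* (ρ ℤ.* b)
  identity = ℤ-Solver.solve-∀
  cancel : ∀ z → + 1 ℤ.+ z ℤ.- z ≡ + 1
  cancel = ℤ-Solver.solve-∀
... | σ , σa | ρ , ρb | ℕ.Bézout.-+ x y eq = (ℤ.- (+ y ℤ.* ρ) , ℤ.- (+ x ℤ.* σ)) , (begin
  a ℤ.* (ℤ.- (+ x ℤ.* σ)) ℤ.- b ℤ.* (ℤ.- (+ y ℤ.* ρ)) ≡⟨ identity a b (+ x) (+ y) σ ρ ⟩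
  + y ℤ.* (ρ ℤ.* b) ℤ.- + x ℤ.* (σ ℤ.* a) ≡⟨ cong₂ (λ p q → + y ℤ.* q ℤ.- + x ℤ.* p) σa ρb ⟩
  + y ℤ.* + ℤ.∣ b ∣ ℤ.- + x ℤ.* + ℤ.∣ a ∣ ≡⟨ cong₂ ℤ._-_ (ℤ.pos-* y ℤ.∣ b ∣) (ℤ.pos-* x ℤ.∣ a ∣) ⟨
  + (y ℕ.* ℤ.∣ b ∣) ℤ.- + (x ℕ.* ℤ.∣ a ∣) ≡⟨ cong (λ z → + z ℤ.- + (x ℕ.* ℤ.∣ a ∣)) eq ⟨
  + 1 ℤ.+ + (x ℕ.* ℤ.∣ a ∣) ℤ.- + (x ℕ.* ℤ.∣ a ∣) ≡⟨ cancel (+ (x ℕ.* ℤ.∣ a ∣)) ⟩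
  + 1 ∎)
  where
  open ≡-Reasoning
  identity : ∀ a b x y σ ρ → a ℤ.* (ℤ.- (x ℤ.* σ)) ℤ.- b ℤ.* (ℤ.- (y ℤ.* ρ)) ≡ y ℤ.* (ρ ℤ.* b) ℤ.- x ℤ.* (σ ℤ.* a)
  identity = ℤ-Solver.solve-∀
  cancel : ∀ z → + 1 ℤ.+ z ℤ.- z ≡ + 1
  cancel = ℤ-Solver.solve-∀

∧≡0⇒multiple : ∀ v w y → v ∧ w ≡ + 1 → v ∧ y ≡ + 0 → y ≡ (y ∧ w) • v
∧≡0⇒multiple v w y vw≡1 vy≡0 = begin
  y ≡⟨ 1• y ⟨
  + 1 • y ≡⟨ cong (_• y) vw≡1 ⟨
  (v ∧ w) • y ≡⟨ ∧⊗-expand v w y ⟩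
  (y ∧ w) • v ⊕ (v ∧ y) • w ≡⟨ cong (λ k → (y ∧ w) • v ⊕ k • w) vy≡0 ⟩
  (y ∧ w) • v ⊕ + 0 • w ≡⟨ cong ((y ∧ w) • v ⊕_) (0• w) ⟩
  (y ∧ w) • v ⊕ 0ω ≡⟨ ⊕-identityʳ ((y ∧ w) • v) ⟩
  (y ∧ w) • v ∎
  where open ≡-Reasoning

content : ∀ v → ∃ λ v₀ → v ≡ (+ ℕ.gcd ℤ.∣ proj₁ v ∣ ℤ.∣ proj₂ v ∣) • v₀
content (a , b)
  with ℤ∣.∣ᵤ⇒∣ {+ ℕ.gcd ℤ.∣ a ∣ ℤ.∣ b ∣} {a} (ℕ.gcd[m,n]∣m ℤ.∣ a ∣ ℤ.∣ b ∣)
     | ℤ∣.∣ᵤ⇒∣ {+ ℕ.gcd ℤ.∣ a ∣ ℤ.∣ b ∣} {b} (ℕ.gcd[m,n]∣n ℤ.∣ a ∣ ℤ.∣ b ∣)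
... | divides p eq | divides q eq′ = (p , q) , cong₂ _,_ (trans eq (ℤ.*-comm p _)) (trans eq′ (ℤ.*-comm q _))

gcd∣∧ : ∀ v w → ℕ.gcd ℤ.∣ proj₁ v ∣ ℤ.∣ proj₂ v ∣ ℕ.∣ ℤ.∣ v ∧ w ∣
gcd∣∧ (a , b) (c , d) = ℤ∣.∣⇒∣ᵤ {+ ℕ.gcd ℤ.∣ a ∣ ℤ.∣ b ∣} (ℤ∣.∣m∣n⇒∣m-n
  (ℤ∣.∣m⇒∣m*n d (ℤ∣.∣ᵤ⇒∣ {+ ℕ.gcd ℤ.∣ a ∣ ℤ.∣ b ∣} {a} (ℕ.gcd[m,n]∣m ℤ.∣ a ∣ ℤ.∣ b ∣)))
  (ℤ∣.∣m⇒∣m*n c (ℤ∣.∣ᵤ⇒∣ {+ ℕ.gcd ℤ.∣ a ∣ ℤ.∣ b ∣} {b} (ℕ.gcd[m,n]∣n ℤ.∣ a ∣ ℤ.∣ b ∣))))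

N-• : ∀ k v → N ((+ k) • v) ≡ k ℕ.* k ℕ.* N v
N-• k v = trans (cong ℤ.∣_∣ (norm-• (+ k) v)) (trans (ℤ.abs-* (+ k ℤ.* + k) (norm v)) (cong (ℕ._* N v) (ℤ.abs-* (+ k) (+ k))))

-- Dividing y + n instead of y by 2n turns the remainder, which lies between 0 and 2n, into one
-- centred at 0.
nearest-multiple : ∀ n .{{_ : ℕ.NonZero n}} y → ∃ λ t → ℤ.∣ + 2 ℤ.* + n ℤ.* t ℤ.+ y ∣ ℕ.≤ n
nearest-multiple n@(suc n-1) y = ℤ.- q , subst (λ z → ℤ.∣ z ∣ ℕ.≤ n) (sym eq) bound
  where
  instance
    2n≢0 : ℕ.NonZero (n ℕ.+ n)
    2n≢0 = _
  q : ℤ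
  q = (y ℤ.+ + n) ℤ./ℕ (n ℕ.+ n)
  r : ℕ
  r = (y ℤ.+ + n) ℤ.%ℕ (n ℕ.+ n)
  eq : + 2 ℤ.* + n ℤ.* ℤ.- q ℤ.+ y ≡ + r ℤ.- + n
  eq = begin
    + 2 ℤ.* + n ℤ.* ℤ.- q ℤ.+ y ≡⟨ identity (+ n) q y ⟩
    (y ℤ.+ + n) ℤ.- q ℤ.* (+ n ℤ.+ + n) ℤ.- + n ≡⟨ cong (λ z → z ℤ.- q ℤ.* (+ n ℤ.+ + n) ℤ.- + n)
                                                               (ℤ.a≡a%ℕn+[a/ℕn]*n (y ℤ.+ + n) (n ℕ.+ n)) ⟩
    + r ℤ.+ q ℤ.* + (n ℕ.+ n) ℤ.- q ℤ.* (+ n ℤ.+ + n) ℤ.- + n ≡⟨ cancel (+ r) (q ℤ.* + (n ℕ.+ n)) (+ n) ⟩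
    + r ℤ.- + n ∎
    where
    open ≡-Reasoning
    identity : ∀ n q y → + 2 ℤ.* n ℤ.* ℤ.- q ℤ.+ y ≡ (y ℤ.+ n) ℤ.- q ℤ.* (n ℤ.+ n) ℤ.- n
    identity = ℤ-Solver.solve-∀
    cancel : ∀ r p n → r ℤ.+ p ℤ.- p ℤ.- n ≡ r ℤ.- n
    cancel = ℤ-Solver.solve-∀
  r<2n : r ℕ.< n ℕ.+ n
  r<2n = ℤ.n%ℕd<d (y ℤ.+ + n) (n ℕ.+ n)
  bound : ℤ.∣ + r ℤ.- + n ∣ ℕ.≤ n
  bound = subst (λ z → ℤ.∣ z ∣ ℕ.≤ n) (sym (ℤ.m-n≡m⊖n r n)) (case ℕ.≤-total n r of λ where
    (inj₁ n≤r) → subst (λ z → ℤ.∣ z ∣ ℕ.≤ n) (sym (ℤ.⊖-≥ n≤r)) (ℕ.m≤n+o⇒m∸n≤o r n (ℕ.<⇒≤ r<2n))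
    (inj₂ r≤n) → subst (ℕ._≤ n) (sym (ℤ.∣⊖∣-≤ r≤n)) (ℕ.m∸n≤m n r))

-- Gauss reduction of the basis `v`, ℓ`w` by one rounding; the second vector of the algorithm
-- satisfies the same bound.
reduced-vector : ∀ ℓ v w .{{_ : ℕ.NonZero (N v)}} →
  ∃ λ t → ℤ.∣ tr v (t • v ⊕ + ℓ • w) ∣ ℕ.≤ N v
reduced-vector ℓ v w with nearest-multiple (N v) (tr v (+ ℓ • w))
... | t , bound = t , subst (λ z → ℤ.∣ z ∣ ℕ.≤ N v)
  (trans (cong (λ z → + 2 ℤ.* z ℤ.* t ℤ.+ tr v (+ ℓ • w)) (sym (norm≡N v))) (sym (tr-⊕• v (+ ℓ • w) t))) bound

∣i∣≡∣j∣⇒i≡±j : ∀ i j → ℤ.∣ i ∣ ≡ ℤ.∣ j ∣ → i ≡ j ⊎ i ≡ ℤ.- j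
∣i∣≡∣j∣⇒i≡±j (+ m)    (+ n)    refl = inj₁ refl
∣i∣≡∣j∣⇒i≡±j (+ m)    -[1+ n ] refl = inj₂ refl
∣i∣≡∣j∣⇒i≡±j -[1+ m ] (+ suc n) refl = inj₂ refl
∣i∣≡∣j∣⇒i≡±j -[1+ m ] -[1+ n ] refl = inj₁ refl

-- If 4nm = x² + 3ℓ² with n ≤ x and m ≤ ℓ, then 4nℓ ≥ n² + 3ℓ², which fails because (ℓ - n)(3ℓ - n) > 0.
discriminant-bound : ∀ {ℓ n m x} → 4 ℕ.* (n ℕ.* m) ≡ x ℕ.* x ℕ.+ 3 ℕ.* (ℓ ℕ.* ℓ) → n ℕ.< ℓ → m ℕ.≤ ℓ → x ℕ.< n
discriminant-bound {ℓ} {n} {m} {x} eq n<ℓ m≤ℓ = ℕ.≰⇒> λ n≤x → ℕ.<-irrefl refl (begin-strict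
  4 ℕ.* (n ℕ.* ℓ) ≡⟨ cong (λ z → 4 ℕ.* (n ℕ.* z)) ℓ≡ ⟨
  4 ℕ.* (n ℕ.* (suc n ℕ.+ e)) <⟨ ℕ.m<m+n _ (ℕ.s≤s (ℕ.z≤n {2 ℕ.* n ℕ.+ 6 ℕ.* e ℕ.+ 2 ℕ.* n ℕ.* e ℕ.+ 3 ℕ.* (e ℕ.* e) ℕ.+ 2})) ⟩
  4 ℕ.* (n ℕ.* (suc n ℕ.+ e)) ℕ.+ suc (2 ℕ.* n ℕ.+ 6 ℕ.* e ℕ.+ 2 ℕ.* n ℕ.* e ℕ.+ 3 ℕ.* (e ℕ.* e) ℕ.+ 2) ≡⟨ identity n e ⟩
  n ℕ.* n ℕ.+ 3 ℕ.* ((suc n ℕ.+ e) ℕ.* (suc n ℕ.+ e)) ≡⟨ cong (λ z → n ℕ.* n ℕ.+ 3 ℕ.* (z ℕ.* z)) ℓ≡ ⟩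
  n ℕ.* n ℕ.+ 3 ℕ.* (ℓ ℕ.* ℓ) ≤⟨ ℕ.+-monoˡ-≤ (3 ℕ.* (ℓ ℕ.* ℓ)) (ℕ.*-mono-≤ n≤x n≤x) ⟩
  x ℕ.* x ℕ.+ 3 ℕ.* (ℓ ℕ.* ℓ) ≡⟨ eq ⟨
  4 ℕ.* (n ℕ.* m) ≤⟨ ℕ.*-monoʳ-≤ 4 (ℕ.*-monoʳ-≤ n m≤ℓ) ⟩
  4 ℕ.* (n ℕ.* ℓ) ∎)
  where
  open ℕ.≤-Reasoning
  e : ℕ
  e = ℓ ℕ.∸ suc n
  ℓ≡ : suc n ℕ.+ e ≡ ℓ
  ℓ≡ = ℕ.m+[n∸m]≡n n<ℓ
  identity : ∀ n e → 4 ℕ.* (n ℕ.* (suc n ℕ.+ e)) ℕ.+ suc (2 ℕ.* n ℕ.+ 6 ℕ.* e ℕ.+ 2 ℕ.* n ℕ.* e ℕ.+ 3 ℕ.* (e ℕ.* e) ℕ.+ 2) ≡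
    n ℕ.* n ℕ.+ 3 ℕ.* ((suc n ℕ.+ e) ℕ.* (suc n ℕ.+ e))
  identity = ℕ-Solver.solve-∀

-- Dropping x² leaves 3ℓ² ≤ 4nm, and n is less than ℓ. This is where the lower limit ¾ℓ of the table
-- comes from.
complementary-bound : ∀ {ℓ n m x} → 4 ℕ.* (n ℕ.* m) ≡ x ℕ.* x ℕ.+ 3 ℕ.* (ℓ ℕ.* ℓ) → n ℕ.< ℓ → 3 ℕ.* ℓ ℕ.≤ 4 ℕ.* m
complementary-bound {ℓ@(suc _)} {n} {m} {x} eq n<ℓ = ℕ.≮⇒≥ λ 4m<3ℓ → ℕ.<-irrefl refl (begin-strict
  ℓ ℕ.* (3 ℕ.* ℓ) ≡⟨ identity ℓ ⟩
  3 ℕ.* (ℓ ℕ.* ℓ) ≤⟨ ℕ.m≤n+m _ (x ℕ.* x) ⟩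
  x ℕ.* x ℕ.+ 3 ℕ.* (ℓ ℕ.* ℓ) ≡⟨ eq ⟨
  4 ℕ.* (n ℕ.* m) ≡⟨ identity′ n m ⟩
  n ℕ.* (4 ℕ.* m) ≤⟨ ℕ.*-monoˡ-≤ (4 ℕ.* m) (ℕ.<⇒≤ n<ℓ) ⟩
  ℓ ℕ.* (4 ℕ.* m) <⟨ ℕ.*-monoʳ-< ℓ 4m<3ℓ ⟩
  ℓ ℕ.* (3 ℕ.* ℓ) ∎)
  where
  open ℕ.≤-Reasoning
  identity : ∀ ℓ → ℓ ℕ.* (3 ℕ.* ℓ) ≡ 3 ℕ.* (ℓ ℕ.* ℓ)
  identity = ℕ-Solver.solve-∀
  identity′ : ∀ n m → 4 ℕ.* (n ℕ.* m) ≡ n ℕ.* (4 ℕ.* m)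
  identity′ = ℕ-Solver.solve-∀

-- (2n - x)(2n + x) = 3ℓ² forces one of the factors, which lie between n and 3n < 3ℓ, to be ℓ or 2ℓ.
no-isosceles : ∀ {ℓ n x} → Prime ℓ → n ℕ.< ℓ → x ℕ.< n → ¬ (4 ℕ.* (n ℕ.* n) ≡ x ℕ.* x ℕ.+ 3 ℕ.* (ℓ ℕ.* ℓ))
no-isosceles {ℓ} {n} {x} ℓ-prime n<ℓ x<n eq =
  [ (λ ℓ∣X → factor X Y X<3ℓ Y<3ℓ X*Y X+Y 0<X ℓ∣X) , (λ ℓ∣Y → factor Y X Y<3ℓ X<3ℓ (trans (ℕ.*-comm Y X) X*Y) (trans (ℕ.+-comm Y X) X+Y) 0<Y ℓ∣Y) ]′
  (euclidsLemma X Y ℓ-prime (ℕ.divides (3 ℕ.* ℓ) (trans X*Y (sym (ℕ.*-assoc 3 ℓ ℓ)))))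
  where
  instance
    ℓ≢0 : ℕ.NonZero ℓ
    ℓ≢0 = prime⇒nonZero ℓ-prime
  e : ℕ
  e = n ℕ.∸ x
  n≡ : x ℕ.+ e ≡ n
  n≡ = ℕ.m+[n∸m]≡n (ℕ.<⇒≤ x<n)
  X Y : ℕ
  X = n ℕ.+ e
  Y = 2 ℕ.* n ℕ.+ x
  0<n : 0 ℕ.< n
  0<n = ℕ.≤-<-trans ℕ.z≤n x<n
  0<X : 0 ℕ.< X
  0<X = ℕ.≤-trans 0<n (ℕ.m≤m+n n e)
  0<Y : 0 ℕ.< Y
  0<Y = ℕ.≤-trans 0<n (ℕ.≤-trans (ℕ.m≤m+n n _) (ℕ.m≤m+n (2 ℕ.* n) x))
  X+Y : X ℕ.+ Y ≡ 4 ℕ.* n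
  X+Y = trans (identity n x e) (trans (cong (λ z → 3 ℕ.* n ℕ.+ z) n≡) (ℕ.+-comm (3 ℕ.* n) n))
    where
    identity : ∀ n x e → n ℕ.+ e ℕ.+ (2 ℕ.* n ℕ.+ x) ≡ 3 ℕ.* n ℕ.+ (x ℕ.+ e)
    identity = ℕ-Solver.solve-∀
  X*Y : X ℕ.* Y ≡ 3 ℕ.* (ℓ ℕ.* ℓ)
  X*Y = ℕ.+-cancelˡ-≡ (x ℕ.* x) (X ℕ.* Y) (3 ℕ.* (ℓ ℕ.* ℓ)) (begin
    x ℕ.* x ℕ.+ (n ℕ.+ e) ℕ.* (2 ℕ.* n ℕ.+ x) ≡⟨ cong (λ z → x ℕ.* x ℕ.+ (z ℕ.+ e) ℕ.* (2 ℕ.* z ℕ.+ x)) n≡ ⟨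
    _ ≡⟨ identity x e ⟩
    4 ℕ.* ((x ℕ.+ e) ℕ.* (x ℕ.+ e)) ≡⟨ cong (λ z → 4 ℕ.* (z ℕ.* z)) n≡ ⟩
    4 ℕ.* (n ℕ.* n) ≡⟨ eq ⟩
    x ℕ.* x ℕ.+ 3 ℕ.* (ℓ ℕ.* ℓ) ∎)
    where
    open ≡-Reasoning
    identity : ∀ x e → x ℕ.* x ℕ.+ (x ℕ.+ e ℕ.+ e) ℕ.* (2 ℕ.* (x ℕ.+ e) ℕ.+ x) ≡ 4 ℕ.* ((x ℕ.+ e) ℕ.* (x ℕ.+ e))
    identity = ℕ-Solver.solve-∀
  3n<3ℓ : 3 ℕ.* n ℕ.< 3 ℕ.* ℓ
  3n<3ℓ = ℕ.*-monoʳ-< 3 n<ℓ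
  X<3ℓ : X ℕ.< 3 ℕ.* ℓ
  X<3ℓ = ℕ.≤-<-trans (ℕ.+-monoʳ-≤ n (ℕ.≤-trans (ℕ.m∸n≤m n x) (ℕ.m≤m+n n (n ℕ.+ 0)))) 3n<3ℓ
  Y<3ℓ : Y ℕ.< 3 ℕ.* ℓ
  Y<3ℓ = ℕ.≤-<-trans (ℕ.≤-trans (ℕ.+-monoʳ-≤ (2 ℕ.* n) (ℕ.<⇒≤ x<n)) (ℕ.≤-reflexive (identity n))) 3n<3ℓ
    where
    identity : ∀ n → 2 ℕ.* n ℕ.+ n ≡ 3 ℕ.* n
    identity = ℕ-Solver.solve-∀
  -- Needed when one factor is 2ℓ: the other is then 3ℓ/2, and their sum 4n is 7ℓ/2. Parity forces ℓ
  -- = 2, and 8n = 14 has no solution.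
  8n≢7ℓ : 8 ℕ.* n ≢ 7 ℕ.* ℓ
  8n≢7ℓ eq = case euclidsLemma 7 ℓ Prime.prime[2] (ℕ.divides (4 ℕ.* n) (trans (sym eq) (identity n))) of λ where
      (inj₁ 2∣7) → ℕ.>⇒∤ (ℕ.s≤s (ℕ.s≤s ℕ.z≤n)) (ℕ.∣m+n∣m⇒∣n {2} {6} {1} 2∣7 (ℕ.divides 3 refl))
      (inj₂ 2∣ℓ) → case Prime.prime⇒irreducible ℓ-prime 2∣ℓ of λ where
        (inj₂ refl) → even n eq
    where
    identity : ∀ n → 8 ℕ.* n ≡ 4 ℕ.* n ℕ.* 2
    identity = ℕ-Solver.solve-∀
    even : ∀ n → 8 ℕ.* n ≢ 14
    even 0 ()
    even 1 ()
    even (suc (suc n)) p = ℕ.<⇒≱ (ℕ.n≤1+n 15) (subst (16 ℕ.≤_) (trans (sym (ℕ.*-distribˡ-+ 8 2 n)) p) (ℕ.m≤m+n 16 (8 ℕ.* n)))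
  factor : ∀ X Y → X ℕ.< 3 ℕ.* ℓ → Y ℕ.< 3 ℕ.* ℓ → X ℕ.* Y ≡ 3 ℕ.* (ℓ ℕ.* ℓ) → X ℕ.+ Y ≡ 4 ℕ.* n → 0 ℕ.< X → ¬ (ℓ ℕ.∣ X)
  factor X Y X<3ℓ Y<3ℓ X*Y X+Y 0<X (ℕ.divides 0 refl) = ℕ.<-irrefl refl 0<X
  factor X Y X<3ℓ Y<3ℓ X*Y X+Y 0<X (ℕ.divides 1 refl) = ℕ.<-irrefl Y≡3ℓ Y<3ℓ
    where
    identity : ∀ ℓ Y → (1 ℕ.* ℓ) ℕ.* Y ≡ ℓ ℕ.* Y
    identity = ℕ-Solver.solve-∀
    identity′ : ∀ ℓ → 3 ℕ.* (ℓ ℕ.* ℓ) ≡ ℓ ℕ.* (3 ℕ.* ℓ)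
    identity′ = ℕ-Solver.solve-∀
    Y≡3ℓ : Y ≡ 3 ℕ.* ℓ
    Y≡3ℓ = ℕ.*-cancelˡ-≡ Y (3 ℕ.* ℓ) ℓ (trans (sym (identity ℓ Y)) (trans X*Y (identity′ ℓ)))
  factor X Y X<3ℓ Y<3ℓ X*Y X+Y 0<X (ℕ.divides 2 refl) = 8n≢7ℓ (begin
    8 ℕ.* n ≡⟨ ℕ.*-assoc 2 4 n ⟩
    2 ℕ.* (4 ℕ.* n) ≡⟨ cong (2 ℕ.*_) X+Y ⟨
    2 ℕ.* (2 ℕ.* ℓ ℕ.+ Y) ≡⟨ ℕ.*-distribˡ-+ 2 (2 ℕ.* ℓ) Y ⟩
    2 ℕ.* (2 ℕ.* ℓ) ℕ.+ 2 ℕ.* Y ≡⟨ cong (2 ℕ.* (2 ℕ.* ℓ) ℕ.+_) 2Y≡3ℓ ⟩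
    2 ℕ.* (2 ℕ.* ℓ) ℕ.+ 3 ℕ.* ℓ ≡⟨ collect ℓ ⟩
    7 ℕ.* ℓ ∎)
    where
    open ≡-Reasoning
    collect : ∀ ℓ → 2 ℕ.* (2 ℕ.* ℓ) ℕ.+ 3 ℕ.* ℓ ≡ 7 ℕ.* ℓ
    collect = ℕ-Solver.solve-∀
    identity : ∀ ℓ Y → (2 ℕ.* ℓ) ℕ.* Y ≡ ℓ ℕ.* (2 ℕ.* Y)
    identity = ℕ-Solver.solve-∀
    identity′ : ∀ ℓ → 3 ℕ.* (ℓ ℕ.* ℓ) ≡ ℓ ℕ.* (3 ℕ.* ℓ)
    identity′ = ℕ-Solver.solve-∀
    2Y≡3ℓ : 2 ℕ.* Y ≡ 3 ℕ.* ℓ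
    2Y≡3ℓ = ℕ.*-cancelˡ-≡ (2 ℕ.* Y) (3 ℕ.* ℓ) ℓ (trans (sym (identity ℓ Y)) (trans X*Y (identity′ ℓ)))
  factor X Y X<3ℓ Y<3ℓ X*Y X+Y 0<X (ℕ.divides (suc (suc (suc k))) refl) =
    ℕ.<⇒≱ X<3ℓ (ℕ.*-monoˡ-≤ ℓ (ℕ.m≤m+n 3 k))

-- For primitive `v` these are the vectors that complete `v` to a basis of the index-ℓ sublattice
-- containing it.
Partner : ℕ → ℤ[ω] → ℤ[ω] → Set
Partner ℓ v p = ℤ.∣ v ∧ p ∣ ≡ ℓ

InRange : ℕ → ℤ[ω] → Set
InRange ℓ v = Primitive v × 3 ℕ.* ℓ ℕ.≤ 4 ℕ.* N v × N v ℕ.< ℓ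

-- v is the shortest vector, up to sign, of the sublattice {y : ℓ ∣ v ∧ y}.
Shortest : ℕ → ℤ[ω] → Set
Shortest ℓ v = ∀ p → Partner ℓ v p → N v ℕ.< N p

partner-identity : ∀ {ℓ v p} → Partner ℓ v p → 4 ℕ.* (N v ℕ.* N p) ≡ ℤ.∣ tr v p ∣ ℕ.* ℤ.∣ tr v p ∣ ℕ.+ 3 ℕ.* (ℓ ℕ.* ℓ)
partner-identity {ℓ} {v} {p} refl = N-identity v p

partner-sym : ∀ {ℓ v p} → Partner ℓ v p → Partner ℓ p v
partner-sym {v = v} {p} eq = trans (trans (cong ℤ.∣_∣ (∧-swap p v)) (ℤ.∣-i∣≡∣i∣ (v ∧ p))) eq

partner-⊗ : ∀ {ℓ v p} u → norm u ≡ + 1 → Partner ℓ v p → Partner ℓ (u ⊗ v) (u ⊗ p)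
partner-⊗ {v = v} {p} u norm≡1 eq = trans (cong ℤ.∣_∣ (unit-∧ u v p norm≡1)) eq

-- Partners of norm below ℓ

module _ {ℓ : ℕ} (ℓ-prime : Prime ℓ) where

  private instance
    ℓ≢0 : ℕ.NonZero ℓ
    ℓ≢0 = prime⇒nonZero ℓ-prime

  0<ℓ : 0 ℕ.< ℓ
  0<ℓ = ℕ.>-nonZero⁻¹ ℓ

  partner-N>0 : ∀ {v p} → Partner ℓ v p → 0 ℕ.< N v
  partner-N>0 {v} {p} eq = N>0 {v} λ where
    refl → ℕ.<-irrefl eq 0<ℓ

  partner-tr : ∀ {v p} → Partner ℓ v p → N v ℕ.< ℓ → N p ℕ.< ℓ → ℤ.∣ tr v p ∣ ℕ.< N v
  partner-tr {v} {p} eq v<ℓ p<ℓ = discriminant-bound (partner-identity {ℓ} {v} {p} eq) v<ℓ (ℕ.<⇒≤ p<ℓ)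

  partner-N≢ : ∀ {v p} → Partner ℓ v p → N v ℕ.< ℓ → N v ≢ N p
  partner-N≢ {v} {p} eq v<ℓ v≡p = no-isosceles ℓ-prime v<ℓ (partner-tr {v} {p} eq v<ℓ (subst (ℕ._< ℓ) v≡p v<ℓ))
    (subst (λ z → 4 ℕ.* (N v ℕ.* z) ≡ ℤ.∣ tr v p ∣ ℕ.* ℤ.∣ tr v p ∣ ℕ.+ 3 ℕ.* (ℓ ℕ.* ℓ)) (sym v≡p) (partner-identity {ℓ} {v} {p} eq))

  -- The gcd of the coordinates divides `v ∧ p`, thus is 1 or ℓ; but a nonzero vector divisible by ℓ
  -- has norm at least ℓ².
  partner-primitive : ∀ {v p} → Partner ℓ v p → N p ℕ.< ℓ → Primitive p
  partner-primitive {v} {p} eq p<ℓ =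
    case Prime.prime⇒irreducible ℓ-prime (subst (g ℕ.∣_) (partner-sym {ℓ} {v} {p} eq) (gcd∣∧ p v)) of λ where
      (inj₁ g≡1) → cong +_ g≡1
      (inj₂ g≡ℓ) → contradiction p<ℓ (ℕ.≤⇒≯ (ℓ≤N g≡ℓ))
    where
    g : ℕ
    g = ℕ.gcd ℤ.∣ proj₁ p ∣ ℤ.∣ proj₂ p ∣
    ℓ≤N : g ≡ ℓ → ℓ ℕ.≤ N p
    ℓ≤N g≡ℓ = case content p of λ where
      (p₀ , p≡) → let
          N≡ : N p ≡ ℓ ℕ.* ℓ ℕ.* N p₀
          N≡ = trans (cong N p≡) (trans (N-• g p₀) (cong (λ z → z ℕ.* z ℕ.* N p₀) g≡ℓ))
          N₀≢0 : N p₀ ≢ 0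
          N₀≢0 N₀≡0 = ℕ.<-irrefl (sym (trans N≡ (trans (cong (ℓ ℕ.* ℓ ℕ.*_) N₀≡0) (ℕ.*-zeroʳ (ℓ ℕ.* ℓ)))))
            (partner-N>0 {p} {v} (partner-sym {ℓ} {v} {p} eq))
        in subst (ℓ ℕ.≤_) (sym N≡) (ℕ.≤-trans (ℕ.m≤m*n ℓ ℓ) (ℕ.m≤m*n (ℓ ℕ.* ℓ) (N p₀) {{ℕ.≢-nonZero N₀≢0}}))

  partner-inRange : ∀ {v p} → Partner ℓ v p → N v ℕ.< ℓ → N p ℕ.< ℓ → InRange ℓ p
  partner-inRange {v} {p} eq v<ℓ p<ℓ =
    partner-primitive {v} {p} eq p<ℓ , complementary-bound {x = ℤ.∣ tr v p ∣} (partner-identity {ℓ} {v} {p} eq) v<ℓ , p<ℓ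

  -- The two vectors differ by k times `v`, so their traces differ by 2N(v)k. As one of the trace
  -- bounds is strict, this is less than 2N(v) in absolute value and k vanishes.
  same-∧⇒≡ : ∀ {v p q} → Primitive v → 0 ℕ.< N v → v ∧ q ≡ v ∧ p → ℤ.∣ tr v p ∣ ℕ.< N v → ℤ.∣ tr v q ∣ ℕ.≤ N v → q ≡ p
  same-∧⇒≡ {v} {p} {q} prim 0<N same p-small q-small = case primitive⇒∧≡1 v prim of λ where
    (w , vw≡1) → let
        k : ℤ
        k = (q ⊖ p) ∧ w
        q≡ : q ≡ k • v ⊕ p
        q≡ = trans (sym (⊕-⊖-cancel q p)) (cong (_⊕ p) (∧≡0⇒multiple v w (q ⊖ p) vw≡1
          (trans (∧-⊖ v q p) (trans (cong (ℤ._- v ∧ p) same) (ℤ.+-inverseʳ (v ∧ p))))))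
        tr≡ : + 2 ℤ.* norm v ℤ.* k ≡ tr v q ℤ.- tr v p
        tr≡ = trans (cancel (+ 2 ℤ.* norm v ℤ.* k) (tr v p)) (cong (ℤ._- tr v p) (sym (trans (cong (tr v) q≡) (tr-⊕• v p k))))
        size : 2 ℕ.* N v ℕ.* ℤ.∣ k ∣ ℕ.< 2 ℕ.* N v
        size = subst₂ ℕ._<_
          (sym (trans (cong (ℕ._* ℤ.∣ k ∣) (sym (ℤ.abs-* (+ 2) (norm v)))) (trans (sym (ℤ.abs-* (+ 2 ℤ.* norm v) k)) (cong ℤ.∣_∣ tr≡))))
          (cong (N v ℕ.+_) (sym (ℕ.+-identityʳ (N v))))
          (ℕ.≤-<-trans (ℤ.∣i-j∣≤∣i∣+∣j∣ (tr v q) (tr v p)) (ℕ.+-mono-≤-< q-small p-small))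
      in trans q≡ (trans (cong (λ k → k • v ⊕ p) (vanishes k size)) (trans (cong (_⊕ p) (0• v)) (⊕-identityˡ p)))
   where
    cancel : ∀ a b → a ≡ a ℤ.+ b ℤ.- b
    cancel = ℤ-Solver.solve-∀
    instance
      N≢0 : ℕ.NonZero (2 ℕ.* N v)
      N≢0 = ℕ.>-nonZero (ℕ.≤-trans 0<N (ℕ.m≤m+n (N v) _))
    vanishes : ∀ k → 2 ℕ.* N v ℕ.* ℤ.∣ k ∣ ℕ.< 2 ℕ.* N v → k ≡ + 0
    vanishes k lt = ℤ.∣i∣≡0⇒i≡0 (ℕ.n<1⇒n≡0 (ℕ.*-cancelˡ-< (2 ℕ.* N v) ℤ.∣ k ∣ 1 (subst (2 ℕ.* N v ℕ.* ℤ.∣ k ∣ ℕ.<_) (sym (ℕ.*-identityʳ (2 ℕ.* N v))) lt)))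

  -- A partner of norm below ℓ has trace strictly inside the reduced range. Therefore even a `q` on
  -- the boundary of that range, which the rounding in the algorithm does not exclude, agrees with
  -- it up to sign.
  partner-unique : ∀ {v p q} → Primitive v → N v ℕ.< ℓ → Partner ℓ v p → N p ℕ.< ℓ →
    Partner ℓ v q → ℤ.∣ tr v q ∣ ℕ.≤ N v → q ≡ p ⊎ q ≡ ⊝ p
  partner-unique {v} {p} {q} prim v<ℓ vp p<ℓ vq q-small = Sum.map
    (λ same → same-∧⇒≡ {v} {p} {q} prim 0<N same p-small q-small)
    (λ opposite → same-∧⇒≡ {v} {⊝ p} {q} prim 0<N (trans opposite (sym (∧-⊝ v p)))
      (subst (ℕ._< N v) (sym (trans (cong ℤ.∣_∣ (tr-⊝ v p)) (ℤ.∣-i∣≡∣i∣ (tr v p)))) p-small) q-small)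
    (∣i∣≡∣j∣⇒i≡±j (v ∧ q) (v ∧ p) (trans vq (sym vp)))
    where
    0<N : 0 ℕ.< N v
    0<N = partner-N>0 {v} {p} vp
    p-small : ℤ.∣ tr v p ∣ ℕ.< N v
    p-small = partner-tr {v} {p} vp v<ℓ p<ℓ

-- The algorithm

-- An orbit is present in a column through one representative, hence the test up to association.
Uncrossed : ℤ[ω] → List Column → Set
Uncrossed v = Any (λ col → Any (Associated v) (proj₂ col))

uncrossed-crossOut⁺ : ∀ {v} x table → ¬ Associated x v → Uncrossed v table → Uncrossed v (crossOut x table)
uncrossed-crossOut⁺ {v} x table x≁v = Any.map⁺ ∘ Any.map (λ {col} → keep {col})
  where
  keep : ∀ {col : Column} → Any (Associated v) (proj₂ col) → Any (Associated v) (filter (¬? ∘ associated? x) (proj₂ col))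
  keep v∈col = case ∈.find v∈col of λ where
    (e , e∈ , v~e) → ∈.lose (∈.∈-filter⁺ (¬? ∘ associated? x) e∈ (λ x~e → x≁v (associated-trans {x} x~e (associated-sym {v} v~e)))) v~e

uncrossed-crossOut⁻ : ∀ {v} x table → Uncrossed v (crossOut x table) → Uncrossed v table × ¬ Associated x v
uncrossed-crossOut⁻ {v} x table uncrossed = Any.map (λ {col} → proj₁ ∘ find {col}) (Any.map⁻ uncrossed) ,
  proj₂ (find {Any.lookup (Any.map⁻ uncrossed)} (Any.lookup-result (Any.map⁻ uncrossed)))
  where
  find : ∀ {col : Column} → Any (Associated v) (filter (¬? ∘ associated? x) (proj₂ col)) →
    Any (Associated v) (proj₂ col) × ¬ Associated x v
  find {col} p = case ∈.find p of λ where
    (e , e∈ , v~e) → case ∈.∈-filter⁻ (¬? ∘ associated? x) {xs = proj₂ col} e∈ of λ where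
      (e∈col , x≁e) → ∈.lose e∈col v~e , λ x~v → x≁e (associated-trans {x} x~v v~e)

uncrossed-delete⁺ : ∀ {v} table → Uncrossed v table → Uncrossed v (deleteEmptyColumns table)
uncrossed-delete⁺ {v} table uncrossed = case ∈.find uncrossed of λ where
    (col , col∈ , v∈col) → ∈.lose (∈.∈-filter⁺ nonEmpty? col∈ (nonEmpty v∈col)) v∈col
  where
  nonEmpty : ∀ {es} → Any (Associated v) es → es ≢ []
  nonEmpty () refl

uncrossed-delete⁻ : ∀ {v} table → Uncrossed v (deleteEmptyColumns table) → Uncrossed v table
uncrossed-delete⁻ table = Any.filter⁻ nonEmpty?

-- An entry that is dropped is associated to the `x` that displaced it, so by transitivity no orbit
-- is lost.
deduplicate-complete : ∀ {v vs} → v ∈ vs → Any (Associated v) (deduplicate associated? vs)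
deduplicate-complete {v} {x ∷ vs} (here refl)  = here (associated-refl {v})
deduplicate-complete {v} {x ∷ vs} (there v∈vs) = case ∈.find (deduplicate-complete v∈vs) of λ where
  (e , e∈ , v~e) → case associated? x e of λ where
    (yes x~e) → here (associated-trans {v} v~e (associated-sym {x} x~e))
    (no  x≁e) → there (∈.lose (∈.∈-filter⁺ (¬? ∘ associated? x) e∈ x≁e) v~e)

module _ {P : ℕ → Set} (P? : ∀ n → Dec (P n)) where

  ∈-dropWhile⁺ : ∀ {n ns} → n ∈ ns → ¬ P n → n ∈ dropWhile P? ns
  ∈-dropWhile⁺ {n} {m ∷ ns} n∈ ¬Pn with P? m | n∈
  ... | no  _  | _          = n∈
  ... | yes Pm | here refl  = contradiction Pm ¬Pn
  ... | yes _  | there n∈ns = ∈-dropWhile⁺ n∈ns ¬Pn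

  ∈-dropWhile⁻ : ∀ {n} ns → n ∈ dropWhile P? ns → n ∈ ns
  ∈-dropWhile⁻ (m ∷ ns) n∈ with P? m
  ... | yes _ = there (∈-dropWhile⁻ ns n∈)
  ... | no  _ = n∈

  -- `dropWhile` only looks for the first failure; it removes every element of `P` here because the
  -- list increases and `P` is downward closed.
  dropWhile-sorted : (∀ {m n} → m ℕ.< n → P n → P m) → ∀ {ns} → AllPairs ℕ._<_ ns → All (¬_ ∘ P) (dropWhile P? ns)
  dropWhile-sorted down [] = []
  dropWhile-sorted down {m ∷ ns} (m< ∷ sorted) with P? m
  ... | yes _  = dropWhile-sorted down sorted
  ... | no ¬Pm = ¬Pm ∷ All.map (λ m<n Pn → ¬Pm (down m<n Pn)) m<

normsInRange-sound : ∀ ℓ {β} → β ∈ normsInRange ℓ → 3 ℕ.* ℓ ℕ.≤ 4 ℕ.* β × β ℕ.< ℓ × IsPrimitiveNorm β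
normsInRange-sound ℓ {β} β∈ = ℕ.≮⇒≥ (All.lookup (dropWhile-sorted below? down sorted) β∈) ,
  ∈.∈-upTo⁻ (proj₁ β∈upTo) , proj₂ β∈upTo
  where
  below? : ∀ β → Dec (4 ℕ.* β ℕ.< 3 ℕ.* ℓ)
  below? β = 4 ℕ.* β ℕ.<? 3 ℕ.* ℓ
  down : ∀ {m n} → m ℕ.< n → 4 ℕ.* n ℕ.< 3 ℕ.* ℓ → 4 ℕ.* m ℕ.< 3 ℕ.* ℓ
  down m<n = ℕ.≤-<-trans (ℕ.*-monoʳ-≤ 4 (ℕ.<⇒≤ m<n))
  sorted : AllPairs ℕ._<_ (normsBelow ℓ)
  sorted = AllPairs.filter⁺ isPrimitiveNorm? (AllPairs.applyUpTo⁺₁ id ℓ λ i<j _ → i<j)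
  β∈upTo : β ∈ upTo ℓ × IsPrimitiveNorm β
  β∈upTo = ∈.∈-filter⁻ isPrimitiveNorm? {xs = upTo ℓ} (∈-dropWhile⁻ below? (normsBelow ℓ) β∈)

normsInRange-complete : ∀ {ℓ v} → InRange ℓ v → N v ∈ normsInRange ℓ
normsInRange-complete {ℓ} {v} (prim , ≥¾ , <ℓ) = ∈-dropWhile⁺ (λ β → 4 ℕ.* β ℕ.<? 3 ℕ.* ℓ)
  (∈.∈-filter⁺ isPrimitiveNorm? (∈.∈-upTo⁺ <ℓ) (v , prim , norm≡N v)) (ℕ.≤⇒≯ ≥¾)

-- Invariants and termination of a run

record WellFormed (ℓ : ℕ) (col : Column) : Set where
  field
    lower   : 3 ℕ.* ℓ ℕ.≤ 4 ℕ.* proj₁ col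
    upper   : proj₁ col ℕ.< ℓ
    entries : All (HasPrimitiveNorm (proj₁ col)) (proj₂ col)

open WellFormed

wellFormed-entry : ∀ {ℓ col v} → WellFormed ℓ col → Any (Associated v) (proj₂ col) → N v ≡ proj₁ col
wellFormed-entry {v = v} wf v∈col = case ∈.find v∈col of λ where
  (e , e∈ , v~e) → trans (associated-N {v} v~e) (cong ℤ.∣_∣ (proj₂ (All.lookup (entries wf) e∈)))

wellFormed-crossOut : ∀ {ℓ} x {table} → All (WellFormed ℓ) table → All (WellFormed ℓ) (crossOut x table)
wellFormed-crossOut x = All.map⁺ ∘ All.map λ wf → record
  { lower = lower wf ; upper = upper wf ; entries = All.filter⁺ (¬? ∘ associated? x) (entries wf) }

-- The termination measure, counting the entries that are left. A pass need not empty a column, but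
-- it always removes the orbit of the chosen vector.
size : List Column → ℕ
size []          = 0
size (col ∷ cols) = length (proj₂ col) ℕ.+ size cols

size-crossOut : ∀ x table → size (crossOut x table) ℕ.≤ size table
size-crossOut x []           = ℕ.z≤n
size-crossOut x (col ∷ cols) = ℕ.+-mono-≤ (List.length-filter (¬? ∘ associated? x) (proj₂ col)) (size-crossOut x cols)

size-crossOut-< : ∀ x {table} → Uncrossed x table → size (crossOut x table) ℕ.< size table
size-crossOut-< x {col ∷ cols} (here x∈)  = ℕ.+-mono-<-≤
  (List.filter-notAll (¬? ∘ associated? x) (proj₂ col) (Any.map (λ x~e x≁e → x≁e x~e) x∈)) (size-crossOut x cols)
size-crossOut-< x {col ∷ cols} (there x∈) = ℕ.+-mono-≤-<
  (List.length-filter (¬? ∘ associated? x) (proj₂ col)) (size-crossOut-< x x∈)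

size-delete : ∀ table → size (deleteEmptyColumns table) ℕ.≤ size table
size-delete []                  = ℕ.z≤n
size-delete ((β , [])     ∷ cols) = size-delete cols
size-delete ((β , e ∷ es) ∷ cols) = ℕ.+-monoʳ-≤ (suc (length es)) (size-delete cols)

minimal-column : ∀ (col : Column) cols → ∃ λ c → c ∈ col ∷ cols × All (λ c′ → proj₁ c ℕ.≤ proj₁ c′) (col ∷ cols)
minimal-column col []          = col , here refl , ℕ.≤-refl ∷ []
minimal-column col (col′ ∷ cols) = case minimal-column col′ cols of λ where
  (c , c∈ , c≤) → case ℕ.≤-total (proj₁ col) (proj₁ c) of λ where
    (inj₁ col≤c) → col , here refl , ℕ.≤-refl ∷ All.map (ℕ.≤-trans col≤c) c≤
    (inj₂ c≤col) → c , there c∈ , c≤col ∷ c≤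

-- The two hypotheses are all that the combinatorics has to know about the real construction of ŵ:
-- each such vector is a reduced partner of `v`, and one exists.
module Algorithm {ℓ : ℕ} (ℓ-prime : Prime ℓ)
  (second⇒partner : ∀ {v ŵ} → SecondVector ℓ v ŵ → Partner ℓ v ŵ × ℤ.∣ tr v ŵ ∣ ℕ.≤ N v)
  (second-exists : ∀ v → Primitive v → ∃ (SecondVector ℓ v))
  where

  record Invariant (σ : State) : Set where
    open State σ
    field
      wellFormed : All (WellFormed ℓ) table
      nonEmpty   : All NonEmpty table
      sound      : All (λ β → ∃ λ v → InRange ℓ v × Shortest ℓ v × N v ≡ β) output
      complete   : ∀ v → InRange ℓ v → Shortest ℓ v → Uncrossed v table ⊎ N v ∈ output
      -- The orbits of two partners are crossed out in the same pass.
      paired     : ∀ v p → InRange ℓ v → N p ℕ.< ℓ → Partner ℓ v p → Uncrossed v table → Uncrossed p table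

  open Invariant

  start-uncrossed : ∀ v → InRange ℓ v → Uncrossed v (State.table (start ℓ))
  start-uncrossed v v∈@(prim , _) = ∈.lose {P = λ col → Any (Associated v) (proj₂ col)} (∈.∈-map⁺ column (normsInRange-complete {ℓ} {v} v∈))
    (deduplicate-complete (Equivalence.from ∈-primitivesOfNorm (prim , norm≡N v)))

  start-invariant : Invariant (start ℓ)
  start-invariant = record
    { wellFormed = All.map⁺ (All.tabulate λ β∈ → record
      { lower   = proj₁ (normsInRange-sound ℓ β∈)
      ; upper   = proj₁ (proj₂ (normsInRange-sound ℓ β∈))
      ; entries = All.deduplicate⁺ associated? (All.tabulate (Equivalence.to ∈-primitivesOfNorm))
      })
    ; nonEmpty   = All.map⁺ (All.tabulate λ β∈ → case proj₂ (proj₂ (normsInRange-sound ℓ β∈)) of λ where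
        (v , has) → occupied {v} (deduplicate-complete (Equivalence.from ∈-primitivesOfNorm has)))
    ; sound      = []
    ; complete   = λ v v∈ _ → inj₁ (start-uncrossed v v∈)
    ; paired     = λ v p (prim , ≥¾ , <ℓ) p<ℓ vp _ → start-uncrossed p (partner-inRange ℓ-prime {v} {p} vp <ℓ p<ℓ)
    }
    where
    occupied : ∀ {v es} → Any (Associated v) es → es ≢ []
    occupied () refl

  module Pass {table : List Column} {T : List ℕ} {β : ℕ} {es : List ℤ[ω]} {v ŵ : ℤ[ω]} (invariant : Invariant (state table T))
    (col∈ : (β , es) ∈ table) (minimal : All (λ col → β ℕ.≤ proj₁ col) table)
    (v∈es : Any (Associated v) es) (second : SecondVector ℓ v ŵ) where

    wf : WellFormed ℓ (β , es)
    wf = All.lookup (wellFormed invariant) col∈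

    N≡β : N v ≡ β
    N≡β = wellFormed-entry wf v∈es

    v<ℓ : N v ℕ.< ℓ
    v<ℓ = subst (ℕ._< ℓ) (sym N≡β) (upper wf)

    ≥¾ : 3 ℕ.* ℓ ℕ.≤ 4 ℕ.* N v
    ≥¾ = subst (λ z → 3 ℕ.* ℓ ℕ.≤ 4 ℕ.* z) (sym N≡β) (lower wf)

    vŵ : Partner ℓ v ŵ
    vŵ = proj₁ (second⇒partner second)

    ŵ-small : ℤ.∣ tr v ŵ ∣ ℕ.≤ N v
    ŵ-small = proj₂ (second⇒partner second)

    v-primitive : Primitive v
    v-primitive = partner-primitive ℓ-prime {ŵ} {v} (partner-sym {ℓ} {v} {ŵ} vŵ) v<ℓ

    v-inRange : InRange ℓ v
    v-inRange = v-primitive , ≥¾ , v<ℓ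

    v-uncrossed : Uncrossed v table
    v-uncrossed = ∈.lose col∈ v∈es

    -- A partner that is not longer has norm below ℓ and, ties being excluded, is strictly shorter.
    -- By `paired` it would still stand in the table, under a norm smaller than the minimal one.
    v-shortest : Shortest ℓ v
    v-shortest p vp = ℕ.≰⇒> λ p≤v → let
        p<ℓ = ℕ.≤-<-trans p≤v v<ℓ
        p<v = ℕ.≤∧≢⇒< p≤v (partner-N≢ ℓ-prime {v} {p} vp v<ℓ ∘ sym)
      in case ∈.find (paired invariant v p v-inRange p<ℓ vp v-uncrossed) of λ where
        (col , col∈ , p∈col) → ℕ.<⇒≱ p<v (subst₂ ℕ._≤_ (sym N≡β)
          (sym (wellFormed-entry (All.lookup (wellFormed invariant) col∈) p∈col)) (All.lookup minimal col∈))

    table′ : List Column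
    table′ = deleteEmptyColumns (crossOut ŵ (crossOut v table))

    uncrossed⁺ : ∀ {x} → ¬ Associated v x → ¬ Associated ŵ x → Uncrossed x table → Uncrossed x table′
    uncrossed⁺ v≁x ŵ≁x = uncrossed-delete⁺ (crossOut ŵ (crossOut v table)) ∘
      uncrossed-crossOut⁺ ŵ (crossOut v table) ŵ≁x ∘ uncrossed-crossOut⁺ v table v≁x

    uncrossed⁻ : ∀ {x} → Uncrossed x table′ → Uncrossed x table × ¬ Associated v x × ¬ Associated ŵ x
    uncrossed⁻ uncrossed =
      case uncrossed-crossOut⁻ ŵ (crossOut v table) (uncrossed-delete⁻ (crossOut ŵ (crossOut v table)) uncrossed) of λ where
        (u , ŵ≁x) → case uncrossed-crossOut⁻ v table u of λ where
          (u′ , v≁x) → u′ , v≁x , ŵ≁x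

    ±⇒associated : ∀ {x y z} → Associated x z → (y ≡ x ⊎ y ≡ ⊝ x) → Associated y z
    ±⇒associated x~z (inj₁ refl) = x~z
    ±⇒associated {x} x~z (inj₂ refl) = associated-trans {⊝ x} (associated-sym {x} (⊝-Associated x)) x~z

    -- Multiplying both members of a pair by the same unit preserves partnership, so a pair that
    -- contains an associate of `x` can be rotated to one that contains `x`.
    unit-back : ∀ {x y z} → Associated x y → Partner ℓ z y → ∃ λ z′ → Associated z′ z × Partner ℓ x z′
    unit-back {x} {y} {z} x~y zy = case Associated⇒unit x~y of λ where
      (u , norm≡1 , refl) → conj u ⊗ z ,
        associated-sym {z} (unit⇒Associated (conj u) (trans (norm-conj u) norm≡1) refl) ,
        subst (λ x → Partner ℓ x (conj u ⊗ z)) (conj-⊗ u x norm≡1)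
          (partner-⊗ {ℓ} {y} {z} (conj u) (trans (norm-conj u) norm≡1) (partner-sym {ℓ} {z} {y} zy))

    next : Invariant (state table′ (β ∷ T))
    next = record
      { wellFormed = All.filter⁺ nonEmpty? (wellFormed-crossOut ŵ (wellFormed-crossOut v (wellFormed invariant)))
      ; nonEmpty   = All.all-filter nonEmpty? (crossOut ŵ (crossOut v table))
      ; sound      = (v , v-inRange , v-shortest , N≡β) ∷ sound invariant
      ; complete   = complete′
      ; paired     = paired′
      }
      where
      complete′ : ∀ x → InRange ℓ x → Shortest ℓ x → Uncrossed x table′ ⊎ N x ∈ β ∷ T
      complete′ x x∈ x-shortest = case complete invariant x x∈ x-shortest of λ where
        (inj₂ x∈T) → inj₂ (there x∈T)
        (inj₁ uncrossed) → case associated? v x of λ where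
          (yes v~x) → inj₂ (here (trans (sym (associated-N {v} v~x)) N≡β))
          (no  v≁x) → case associated? ŵ x of λ where
            (no  ŵ≁x) → inj₁ (uncrossed⁺ v≁x ŵ≁x uncrossed)
            -- The orbit of ŵ contains no shortest vector: `x` would be shorter than its partner
            -- `u ⊗ v`, while `v` is shorter than ŵ.
            (yes ŵ~x) → case Associated⇒unit ŵ~x of λ where
              (u , norm≡1 , refl) → contradiction (v-shortest ŵ vŵ) (ℕ.<⇒≯ (subst₂ ℕ._<_
                (sym (associated-N {ŵ} ŵ~x))
                (sym (associated-N {v} (unit⇒Associated u norm≡1 refl)))
                (x-shortest (u ⊗ v) (partner-⊗ {ℓ} {ŵ} {v} u norm≡1 (partner-sym {ℓ} {v} {ŵ} vŵ)))))

      paired′ : ∀ x p → InRange ℓ x → N p ℕ.< ℓ → Partner ℓ x p → Uncrossed x table′ → Uncrossed p table′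
      paired′ x p x∈@(_ , _ , x<ℓ) p<ℓ xp uncrossed = case uncrossed⁻ uncrossed of λ where
          (before , v≁x , ŵ≁x) → uncrossed⁺
            -- If `p` is in the orbit of `v`, rotating the pair makes `x` associated to a short
            -- partner of `v`. By uniqueness that partner is ŵ up to sign, but `x` was not crossed
            -- out with ŵ.
            (λ v~p → case unit-back {v} {p} {x} v~p xp of λ where
              (x′ , x′~x , vx′) → ŵ≁x (±⇒associated {x′} x′~x (partner-unique ℓ-prime {v} {x′} {ŵ}
                v-primitive v<ℓ vx′ (subst (ℕ._< ℓ) (sym (associated-N {x′} x′~x)) x<ℓ) vŵ ŵ-small)))
            -- Now ŵ has norm below ℓ, so uniqueness applies with ŵ in the place of `v`; the trace
            -- bound for `v` comes from `partner-tr`.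
            (λ ŵ~p → case unit-back {ŵ} {p} {x} ŵ~p xp of λ where
              (x′ , x′~x , ŵx′) → let
                  ŵ<ℓ = subst (ℕ._< ℓ) (sym (associated-N {ŵ} ŵ~p)) p<ℓ
                  ŵv = partner-sym {ℓ} {v} {ŵ} vŵ
                in v≁x (±⇒associated {x′} x′~x (partner-unique ℓ-prime {ŵ} {x′} {v}
                  (partner-primitive ℓ-prime {v} {ŵ} vŵ ŵ<ℓ) ŵ<ℓ ŵx′ (subst (ℕ._< ℓ) (sym (associated-N {x′} x′~x)) x<ℓ)
                  ŵv (ℕ.<⇒≤ (partner-tr ℓ-prime {ŵ} {v} ŵv ŵ<ℓ v<ℓ)))))
            (paired invariant x p x∈ p<ℓ xp before)

  step-invariant : ∀ {σ σ′} → ℓ ⊢ σ ⟶ σ′ → Invariant σ → Invariant σ′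
  step-invariant (pass col∈ minimal v∈es second) invariant = Pass.next invariant col∈ minimal v∈es second

  run-invariant : ∀ {σ σ′} → Star (ℓ ⊢_⟶_) σ σ′ → Invariant σ → Invariant σ′
  run-invariant done           = id
  run-invariant (step ◅ steps) = run-invariant steps ∘ step-invariant step

  output-spec : ∀ {T β} → Outputs ℓ T → β ∈ T ⇔ (∃ λ v → InRange ℓ v × Shortest ℓ v × N v ≡ β)
  output-spec {T} {β} run = mk⇔ (All.lookup (sound final))
    λ { (v , v∈ , v-shortest , refl) → [ (λ ()) , id ]′ (complete final v v∈ v-shortest) }
    where
    final : Invariant (state [] T)
    final = run-invariant run start-invariant

  progress : ∀ {col cols T} → Invariant (state (col ∷ cols) T) → ∃ (ℓ ⊢ state (col ∷ cols) T ⟶_)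
  progress {col} {cols} invariant = case minimal-column col cols of λ where
    ((β , []) , c∈ , _) → contradiction refl (All.lookup (nonEmpty invariant) c∈)
    ((β , e ∷ es) , c∈ , minimal) →
      case second-exists e (proj₁ (All.head (entries (All.lookup (wellFormed invariant) c∈)))) of λ where
        (ŵ , second) → _ , pass c∈ minimal (here (associated-refl {e})) second

  step-size : ∀ {σ σ′} → ℓ ⊢ σ ⟶ σ′ → size (State.table σ′) ℕ.< size (State.table σ)
  step-size (pass {table} {v = v} {ŵ = ŵ} col∈ _ v∈es _) = ℕ.≤-<-trans
    (size-delete (crossOut ŵ (crossOut v table)))
    (ℕ.≤-<-trans (size-crossOut ŵ (crossOut v table)) (size-crossOut-< v (∈.lose col∈ v∈es)))

  halts : ∀ σ → Acc ℕ._<_ (size (State.table σ)) → Invariant σ → Halts ℓ σ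
  halts (state [] T)           _        _         = stop
  halts σ@(state (_ ∷ _) T) (acc rec) invariant =
    go (progress invariant) λ step → halts _ (rec (step-size step)) (step-invariant step invariant)

  start-halts : Halts ℓ (start ℓ)
  start-halts = halts (start ℓ) (<-wellFounded _) start-invariant

-- Hexagonal frames

2ℝ : ℝ
2ℝ = fromℤ (+ 2)

fromℤ-norm : ∀ a b → fromℤ (norm (a , b)) ≈ fromℤ a * fromℤ a - fromℤ a * fromℤ b + fromℤ b * fromℤ b
fromℤ-norm a b = ≈-trans (fromℤ-+ (a ℤ.* a ℤ.- a ℤ.* b) (b ℤ.* b))
  (+-cong (≈-trans (fromℤ-- (a ℤ.* a) (a ℤ.* b)) (minus-cong (fromℤ-* a a) (fromℤ-* a b))) (fromℤ-* b b))

fromℤ-2* : ∀ i j → fromℤ (+ 2 ℤ.* (i ℤ.* j)) ≈ 2ℝ * (fromℤ i * fromℤ j)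
fromℤ-2* i j = ≈-trans (fromℤ-* (+ 2) (i ℤ.* j)) (*-cong (≈-refl {2ℝ}) (fromℤ-* i j))

fromℤ-tr : ∀ a b c d → fromℤ (tr (a , b) (c , d)) ≈
  2ℝ * (fromℤ a * fromℤ c) - fromℤ a * fromℤ d - fromℤ b * fromℤ c + 2ℝ * (fromℤ b * fromℤ d)
fromℤ-tr a b c d =
  ≈-trans (fromℤ-+ (+ 2 ℤ.* (a ℤ.* c) ℤ.- a ℤ.* d ℤ.- b ℤ.* c) (+ 2 ℤ.* (b ℤ.* d))) (+-cong
    (≈-trans (fromℤ-- (+ 2 ℤ.* (a ℤ.* c) ℤ.- a ℤ.* d) (b ℤ.* c)) (minus-cong
      (≈-trans (fromℤ-- (+ 2 ℤ.* (a ℤ.* c)) (a ℤ.* d)) (minus-cong (fromℤ-2* a c) (fromℤ-* a d)))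
      (fromℤ-* b c)))
    (fromℤ-2* b d))

fromℤ-∧ : ∀ v w → fromℤ (v ∧ w) ≈ fromℤ (proj₁ v) * fromℤ (proj₂ w) - fromℤ (proj₂ v) * fromℤ (proj₁ w)
fromℤ-∧ (a , b) (c , d) = ≈-trans (fromℤ-- (a ℤ.* d) (b ℤ.* c)) (minus-cong (fromℤ-* a d) (fromℤ-* b c))

≈₂-refl : ∀ {x} → x ≈₂ x
≈₂-refl = ≈-refl , ≈-refl

≈₂-sym : ∀ {x y} → x ≈₂ y → y ≈₂ x
≈₂-sym (p , q) = ≈-sym p , ≈-sym q

≈₂-trans : ∀ {x y z} → x ≈₂ y → y ≈₂ z → x ≈₂ z
≈₂-trans (p , q) (p′ , q′) = ≈-trans p p′ , ≈-trans q q′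

+₂-cong : ∀ {x x′ y y′} → x ≈₂ x′ → y ≈₂ y′ → x +₂ y ≈₂ x′ +₂ y′
+₂-cong {x₁ , x₂} {x₁′ , x₂′} {y₁ , y₂} {y₁′ , y₂′} (p , q) (p′ , q′) =
  +-cong {x₁} {x₁′} {y₁} {y₁′} p p′ , +-cong {x₂} {x₂′} {y₂} {y₂′} q q′

-₂-cong : ∀ {x y} → x ≈₂ y → -₂ x ≈₂ -₂ y
-₂-cong (p , q) = -‿cong p , -‿cong q

·-cong : ∀ r {x y} → x ≈₂ y → r · x ≈₂ r · y
·-cong r (p , q) = *-cong (≈-refl {r}) p , *-cong (≈-refl {r}) q

A-cong : ∀ {x y} → x ≈₂ y → A x ≈ A y
A-cong {x₁ , x₂} {y₁ , y₂} (p , q) = +-cong (*-cong p p) (*-cong q q)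

-- Here ℤ[ω] serves as the group ℤ² of coordinates, for arbitrary vectors: the module is used both
-- for hexagonal frames and for the given basis of a lattice.
module Coordinates (e₁ e₂ : ℝ²) where

  E : ℤ[ω] → ℝ²
  E (a , b) = fromℤ a · e₁ +₂ fromℤ b · e₂

  E-cong : ∀ {v w} → v ≡ w → E v ≈₂ E w
  E-cong refl = ≈-refl , ≈-refl

  E-⊕ : ∀ v w → E (v ⊕ w) ≈₂ E v +₂ E w
  E-⊕ (a , b) (c , d) = component (proj₁ e₁) (proj₁ e₂) , component (proj₂ e₁) (proj₂ e₂)
    where
    identity : ∀ a b c d x y → (a + c) * x + (b + d) * y ≈ (a * x + b * y) + (c * x + d * y)
    identity = solve 6 (λ a b c d x y → (a :+ c) :* x :+ (b :+ d) :* y := (a :* x :+ b :* y) :+ (c :* x :+ d :* y)) ≈-refl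
    component : ∀ x y → fromℤ (a ℤ.+ c) * x + fromℤ (b ℤ.+ d) * y ≈
      (fromℤ a * x + fromℤ b * y) + (fromℤ c * x + fromℤ d * y)
    component x y = ≈-trans (+-cong (*-cong (fromℤ-+ a c) (≈-refl {x})) (*-cong (fromℤ-+ b d) (≈-refl {y})))
      (identity (fromℤ a) (fromℤ b) (fromℤ c) (fromℤ d) x y)

  E-• : ∀ k v → E (k • v) ≈₂ fromℤ k · E v
  E-• k (a , b) = component (proj₁ e₁) (proj₁ e₂) , component (proj₂ e₁) (proj₂ e₂)
    where
    identity : ∀ k a b x y → (k * a) * x + (k * b) * y ≈ k * (a * x + b * y)
    identity = solve 5 (λ k a b x y → (k :* a) :* x :+ (k :* b) :* y := k :* (a :* x :+ b :* y)) ≈-refl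
    component : ∀ x y → fromℤ (k ℤ.* a) * x + fromℤ (k ℤ.* b) * y ≈ fromℤ k * (fromℤ a * x + fromℤ b * y)
    component x y = ≈-trans (+-cong (*-cong (fromℤ-* k a) (≈-refl {x})) (*-cong (fromℤ-* k b) (≈-refl {y})))
      (identity (fromℤ k) (fromℤ a) (fromℤ b) x y)

  E-⊝ : ∀ v → E (⊝ v) ≈₂ -₂ E v
  E-⊝ (a , b) = component (proj₁ e₁) (proj₁ e₂) , component (proj₂ e₁) (proj₂ e₂)
    where
    identity : ∀ a b x y → (- a) * x + (- b) * y ≈ - (a * x + b * y)
    identity = solve 4 (λ a b x y → (:- a) :* x :+ (:- b) :* y := :- (a :* x :+ b :* y)) ≈-refl
    component : ∀ x y → fromℤ (ℤ.- a) * x + fromℤ (ℤ.- b) * y ≈ - (fromℤ a * x + fromℤ b * y)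
    component x y = ≈-trans (+-cong (*-cong (fromℤ-neg a) (≈-refl {x})) (*-cong (fromℤ-neg b) (≈-refl {y})))
      (identity (fromℤ a) (fromℤ b) x y)

  E-⊖ : ∀ v w → E (v ⊖ w) ≈₂ E v -₂ E w
  E-⊖ v w = ≈₂-trans (E-⊕ v (⊝ w)) (+₂-cong (≈₂-refl {E v}) (E-⊝ w))

  E-0 : E 0ω ≈₂ 0₂
  E-0 = zeros (proj₁ e₁) (proj₁ e₂) , zeros (proj₂ e₁) (proj₂ e₂)
    where
    zeros : ∀ x y → fromℤ (+ 0) * x + fromℤ (+ 0) * y ≈ 0ℝ
    zeros = solve 2 (λ x y → con 0ℚ :* x :+ con 0ℚ :* y := con 0ℚ) ≈-refl

  det-E : ∀ v w → det (E v) (E w) ≈ fromℤ (v ∧ w) * det e₁ e₂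
  det-E v w = ≈-trans
    (expand (fromℤ (proj₁ v)) (fromℤ (proj₂ v)) (fromℤ (proj₁ w)) (fromℤ (proj₂ w)) (proj₁ e₁) (proj₂ e₁) (proj₁ e₂) (proj₂ e₂))
    (*-cong (≈-sym (fromℤ-∧ v w)) (≈-refl {det e₁ e₂}))
    where
    expand : ∀ a b c d x₁ y₁ x₂ y₂ →
      (a * x₁ + b * x₂) * (c * y₁ + d * y₂) - (a * y₁ + b * y₂) * (c * x₁ + d * x₂) ≈ (a * d - b * c) * (x₁ * y₂ - y₁ * x₂)
    expand = solve 8 (λ a b c d x₁ y₁ x₂ y₂ →
      (a :* x₁ :+ b :* x₂) :* (c :* y₁ :+ d :* y₂) :- (a :* y₁ :+ b :* y₂) :* (c :* x₁ :+ d :* x₂) :=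
      (a :* d :- b :* c) :* (x₁ :* y₂ :- y₁ :* x₂)) ≈-refl

-- Unit vectors at an angle of 120°, the position of 1 and ω. Doubling the inner product avoids the
-- fraction -½.
record HexagonalFrame (e₁ e₂ : ℝ²) : Set where
  field
    unit₁ : ⟨ e₁ , e₁ ⟩ ≈ 1ℝ
    unit₂ : ⟨ e₂ , e₂ ⟩ ≈ 1ℝ
    angle : ⟨ e₁ , e₂ ⟩ + ⟨ e₁ , e₂ ⟩ ≈ - 1ℝ

module Frame {e₁ e₂ : ℝ²} (frame : HexagonalFrame e₁ e₂) where
  open HexagonalFrame frame

  open Coordinates e₁ e₂ public

  A-E : ∀ v → A (E v) ≈ fromℤ (norm v)
  A-E (a , b) = begin
    A (E (a , b))
      ≈⟨ expand (fromℤ a) (fromℤ b) (proj₁ e₁) (proj₂ e₁) (proj₁ e₂) (proj₂ e₂) ⟩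
    fromℤ a * fromℤ a * ⟨ e₁ , e₁ ⟩ + fromℤ a * fromℤ b * (⟨ e₁ , e₂ ⟩ + ⟨ e₁ , e₂ ⟩) + fromℤ b * fromℤ b * ⟨ e₂ , e₂ ⟩
      ≈⟨ +-cong (+-cong (*-cong (≈-refl {fromℤ a * fromℤ a}) unit₁) (*-cong (≈-refl {fromℤ a * fromℤ b}) angle))
                (*-cong (≈-refl {fromℤ b * fromℤ b}) unit₂) ⟩
    fromℤ a * fromℤ a * 1ℝ + fromℤ a * fromℤ b * (- 1ℝ) + fromℤ b * fromℤ b * 1ℝ
      ≈⟨ simplify (fromℤ a) (fromℤ b) ⟩
    fromℤ a * fromℤ a - fromℤ a * fromℤ b + fromℤ b * fromℤ b
      ≈⟨ fromℤ-norm a b ⟨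
    fromℤ (norm (a , b)) ∎
    where
    open ℝ-Reasoning
    expand : ∀ a b x₁ y₁ x₂ y₂ →
      (a * x₁ + b * x₂) * (a * x₁ + b * x₂) + (a * y₁ + b * y₂) * (a * y₁ + b * y₂) ≈
      a * a * (x₁ * x₁ + y₁ * y₁) + a * b * ((x₁ * x₂ + y₁ * y₂) + (x₁ * x₂ + y₁ * y₂)) + b * b * (x₂ * x₂ + y₂ * y₂)
    expand = solve 6 (λ a b x₁ y₁ x₂ y₂ →
      (a :* x₁ :+ b :* x₂) :* (a :* x₁ :+ b :* x₂) :+ (a :* y₁ :+ b :* y₂) :* (a :* y₁ :+ b :* y₂) :=
      a :* a :* (x₁ :* x₁ :+ y₁ :* y₁) :+ a :* b :* ((x₁ :* x₂ :+ y₁ :* y₂) :+ (x₁ :* x₂ :+ y₁ :* y₂))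
        :+ b :* b :* (x₂ :* x₂ :+ y₂ :* y₂)) ≈-refl
    simplify : ∀ a b → a * a * 1ℝ + a * b * (- 1ℝ) + b * b * 1ℝ ≈ a * a - a * b + b * b
    simplify = solve 2 (λ a b →
        a :* a :* con 1ℚ :+ a :* b :* (:- con 1ℚ) :+ b :* b :* con 1ℚ :=
        a :* a :- a :* b :+ b :* b)
        ≈-refl

  -- The squared length of `E v` is the integer `norm v`, and integers remain distinct in ℝ.
  E-injective₀ : ∀ v → E v ≈₂ 0₂ → v ≡ 0ω
  E-injective₀ v Ev≈0 = N≡0⇒≡0 v (cong ℤ.∣_∣ (fromℤ-injective {norm v} {+ 0}
    (≈-trans (≈-sym (A-E v)) (≈-trans (A-cong Ev≈0) zero²))))
    where
    zero² : 0ℝ * 0ℝ + 0ℝ * 0ℝ ≈ 0ℝ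
    zero² = solve 0 (con 0ℚ :* con 0ℚ :+ con 0ℚ :* con 0ℚ := con 0ℚ) ≈-refl

  E-injective : ∀ v w → E v ≈₂ E w → v ≡ w
  E-injective v w (p , q) = trans (sym (⊕-⊖-cancel v w)) (trans (cong (_⊕ w)
    (E-injective₀ (v ⊖ w) (≈₂-trans (E-⊖ v w) (cancels (proj₁ (E v)) (proj₁ (E w)) p , cancels (proj₂ (E v)) (proj₂ (E w)) q))))
    (⊕-identityˡ w))
    where
    cancels : ∀ x y → x ≈ y → x - y ≈ 0ℝ
    cancels x y x≈y = ≈-trans (minus-cong x≈y (≈-refl {y})) (x-x≈0 y)

  2⟨E,E⟩ : ∀ v w → ⟨ E v , E w ⟩ + ⟨ E v , E w ⟩ ≈ fromℤ (tr v w)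
  2⟨E,E⟩ (a , b) (c , d) = begin
    ⟨ E (a , b) , E (c , d) ⟩ + ⟨ E (a , b) , E (c , d) ⟩
      ≈⟨ expand (fromℤ a) (fromℤ b) (fromℤ c) (fromℤ d) (proj₁ e₁) (proj₂ e₁) (proj₁ e₂) (proj₂ e₂) ⟩
    2ℝ * (fromℤ a * fromℤ c) * ⟨ e₁ , e₁ ⟩ + (fromℤ a * fromℤ d + fromℤ b * fromℤ c) * (⟨ e₁ , e₂ ⟩ + ⟨ e₁ , e₂ ⟩)
      + 2ℝ * (fromℤ b * fromℤ d) * ⟨ e₂ , e₂ ⟩
      ≈⟨ +-cong (+-cong (*-cong (≈-refl {2ℝ * (fromℤ a * fromℤ c)}) unit₁)
                        (*-cong (≈-refl {fromℤ a * fromℤ d + fromℤ b * fromℤ c}) angle))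
                (*-cong (≈-refl {2ℝ * (fromℤ b * fromℤ d)}) unit₂) ⟩
    2ℝ * (fromℤ a * fromℤ c) * 1ℝ + (fromℤ a * fromℤ d + fromℤ b * fromℤ c) * (- 1ℝ) + 2ℝ * (fromℤ b * fromℤ d) * 1ℝ
      ≈⟨ simplify (fromℤ a) (fromℤ b) (fromℤ c) (fromℤ d) ⟩
    2ℝ * (fromℤ a * fromℤ c) - fromℤ a * fromℤ d - fromℤ b * fromℤ c + 2ℝ * (fromℤ b * fromℤ d)
      ≈⟨ fromℤ-tr a b c d ⟨
    fromℤ (tr (a , b) (c , d)) ∎
    where
    open ℝ-Reasoning
    2ℚ : ℚ
    2ℚ = + 2 ℚ./ 1
    expand : ∀ a b c d x₁ y₁ x₂ y₂ →
      ((a * x₁ + b * x₂) * (c * x₁ + d * x₂) + (a * y₁ + b * y₂) * (c * y₁ + d * y₂)) +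
      ((a * x₁ + b * x₂) * (c * x₁ + d * x₂) + (a * y₁ + b * y₂) * (c * y₁ + d * y₂)) ≈
      2ℝ * (a * c) * (x₁ * x₁ + y₁ * y₁) + (a * d + b * c) * ((x₁ * x₂ + y₁ * y₂) + (x₁ * x₂ + y₁ * y₂))
        + 2ℝ * (b * d) * (x₂ * x₂ + y₂ * y₂)
    expand = solve 8 (λ a b c d x₁ y₁ x₂ y₂ →
      ((a :* x₁ :+ b :* x₂) :* (c :* x₁ :+ d :* x₂) :+ (a :* y₁ :+ b :* y₂) :* (c :* y₁ :+ d :* y₂)) :+
      ((a :* x₁ :+ b :* x₂) :* (c :* x₁ :+ d :* x₂) :+ (a :* y₁ :+ b :* y₂) :* (c :* y₁ :+ d :* y₂)) :=
      con 2ℚ :* (a :* c) :* (x₁ :* x₁ :+ y₁ :* y₁) :+ (a :* d :+ b :* c) :* ((x₁ :* x₂ :+ y₁ :* y₂) :+ (x₁ :* x₂ :+ y₁ :* y₂))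
        :+ con 2ℚ :* (b :* d) :* (x₂ :* x₂ :+ y₂ :* y₂)) ≈-refl
    simplify : ∀ a b c d → 2ℝ * (a * c) * 1ℝ + (a * d + b * c) * (- 1ℝ) + 2ℝ * (b * d) * 1ℝ ≈
      2ℝ * (a * c) - a * d - b * c + 2ℝ * (b * d)
    simplify = solve 4 (λ a b c d → con 2ℚ :* (a :* c) :* con 1ℚ :+ (a :* d :+ b :* c) :* (:- con 1ℚ) :+ con 2ℚ :* (b :* d) :* con 1ℚ :=
      con 2ℚ :* (a :* c) :- a :* d :- b :* c :+ con 2ℚ :* (b :* d)) ≈-refl

-- The second vector

¾ : ℚ
¾ = 1ℚ ℚ.- ¼

ω-frame : ∀ {√3} → IsSqrt (fromℕ 3) √3 → HexagonalFrame (1ℝ , 0ℝ) (fromℚ (ℚ.- ½) , fromℚ ½ * √3)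
ω-frame {√3} (_ , √3²≈3) = record
  { unit₁ = solve 0 (con 1ℚ :* con 1ℚ :+ con 0ℚ :* con 0ℚ := con 1ℚ) ≈-refl
  ; unit₂ = ≈-trans (expand √3) (≈-trans (+-cong (≈-refl {fromℚ ¼}) (*-cong (≈-refl {fromℚ ¼}) √3²≈3)) quarter)
  ; angle = solve 1 (λ s →
      (con 1ℚ :* con (ℚ.- ½) :+ con 0ℚ :* (con ½ :* s)) :+ (con 1ℚ :* con (ℚ.- ½) :+ con 0ℚ :* (con ½ :* s)) :=
      :- con 1ℚ)
      ≈-refl √3
  }
  where
  expand : ∀ s → fromℚ (ℚ.- ½) * fromℚ (ℚ.- ½) + (fromℚ ½ * s) * (fromℚ ½ * s) ≈ fromℚ ¼ + fromℚ ¼ * (s * s)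
  expand = solve 1 (λ s → con (ℚ.- ½) :* con (ℚ.- ½) :+ (con ½ :* s) :* (con ½ :* s) := con ¼ :+ con ¼ :* (s :* s)) ≈-refl
  quarter : fromℚ ¼ + fromℚ ¼ * fromℕ 3 ≈ 1ℝ
  quarter = solve 0 (con ¼ :+ con ¼ :* con (+ 3 ℚ./ 1) := con 1ℚ) ≈-refl

ω-det : ∀ √3 → det (1ℝ , 0ℝ) (fromℚ (ℚ.- ½) , fromℚ ½ * √3) ≈ fromℚ ½ * √3
ω-det = solve 1 (λ s → con 1ℚ :* (con ½ :* s) :- con 0ℚ :* con (ℚ.- ½) := con ½ :* s) ≈-refl

ω-det² : ∀ {√3} → IsSqrt (fromℕ 3) √3 → (fromℚ ½ * √3) * (fromℚ ½ * √3) ≈ fromℚ ¾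
ω-det² {√3} √3-eq = ≈-trans (collect √3) (≈-trans (*-cong (≈-refl {fromℚ ¼}) (proj₂ √3-eq))
  (solve 0 (con ¼ :* con (+ 3 ℚ./ 1) := con ¾) ≈-refl))
  where
  collect : ∀ s → (fromℚ ½ * s) * (fromℚ ½ * s) ≈ fromℚ ¼ * (s * s)
  collect = solve 1 (λ s → (con ½ :* s) :* (con ½ :* s) := con ¼ :* (s :* s)) ≈-refl

x+x≈0⇒x≈0 : ∀ x → x + x ≈ 0ℝ → x ≈ 0ℝ
x+x≈0⇒x≈0 x x+x≈0 = ≈-trans (halve x) (≈-trans (*-cong (≈-refl {fromℚ ½}) x+x≈0) (x*0≈0 (fromℚ ½)))
  where
  halve : ∀ x → x ≈ fromℚ ½ * (x + x)
  halve = solve 1 (λ x → x := con ½ :* (x :+ x)) ≈-refl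

⟨,⟩-congˡ : ∀ {x x′} y → x ≈₂ x′ → ⟨ x , y ⟩ ≈ ⟨ x′ , y ⟩
⟨,⟩-congˡ (y₁ , y₂) (p , q) = +-cong (*-cong p (≈-refl {y₁})) (*-cong q (≈-refl {y₂}))

-i≤x≤i⇒∣x∣≤i : ∀ x n → ℤ.- + n ℤ.≤ x → x ℤ.≤ + n → ℤ.∣ x ∣ ℕ.≤ n
-i≤x≤i⇒∣x∣≤i (+ m)    n       _   m≤n = ℤ.drop‿+≤+ m≤n
-i≤x≤i⇒∣x∣≤i -[1+ m ] (suc n) -n≤ _   = ℕ.s≤s (ℤ.drop‿-≤- -n≤)

-- It is enough to compare t with its two neighbours: if 2d < -1, then d + 1 and -(d + 1) both lie
-- below -d, so that t + 1 would be nearer; the other side is symmetric.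
nearest⇒half : ∀ t₀ t → (∀ m → ∣ fromℤ t - t₀ ∣ ≤ ∣ fromℤ m - t₀ ∣) →
  - 1ℝ ≤ (fromℤ t - t₀) + (fromℤ t - t₀) × (fromℤ t - t₀) + (fromℤ t - t₀) ≤ 1ℝ
nearest⇒half t₀ t nearest = above , below
  where
  d : ℝ
  d = fromℤ t - t₀
  shift : ∀ i → fromℤ (t ℤ.+ i) - t₀ ≈ d + fromℤ i
  shift i = ≈-trans (minus-cong (fromℤ-+ t i) (≈-refl {t₀})) (identity (fromℤ t) (fromℤ i) t₀)
    where
    identity : ∀ t i s → (t + i) - s ≈ (t - s) + i
    identity = solve 3 (λ t i s → (t :+ i) :- s := (t :- s) :+ i) ≈-refl
  above : - 1ℝ ≤ d + d
  above d+d<-1 = nearest (t ℤ.+ + 1) (<-≤-trans (∣x∣<y {fromℤ (t ℤ.+ + 1) - t₀} { - d}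
      (0<-⇒< (0<-resp-≈ { - 1ℝ - (d + d)} { - d - (fromℤ (t ℤ.+ + 1) - t₀)}
        (≈-trans (identity₁ d) (minus-cong (≈-refl { - d}) (≈-sym (shift (+ 1))))) (<⇒0<- d+d<-1)))
      (0<-⇒< (0<-resp-≈ {1ℝ} { - d - - (fromℤ (t ℤ.+ + 1) - t₀)}
        (≈-trans (identity₂ d) (minus-cong (≈-refl { - d}) (-‿cong (≈-sym (shift (+ 1)))))) (fromℚ-pos 0<1))))
      (-x≤∣x∣ d))
    where
    0<1 : 0ℚ ℚ.< 1ℚ
    0<1 = ℚ.positive⁻¹ 1ℚ
    identity₁ : ∀ d → - 1ℝ - (d + d) ≈ - d - (d + fromℤ (+ 1))
    identity₁ = solve 1 (λ d → :- con 1ℚ :- (d :+ d) := :- d :- (d :+ con 1ℚ)) ≈-refl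
    identity₂ : ∀ d → 1ℝ ≈ - d - - (d + fromℤ (+ 1))
    identity₂ = solve 1 (λ d → con 1ℚ := :- d :- :- (d :+ con 1ℚ)) ≈-refl
  below : d + d ≤ 1ℝ
  below 1<d+d = nearest (t ℤ.+ -[1+ 0 ]) (<-≤-trans (∣x∣<y {fromℤ (t ℤ.+ -[1+ 0 ]) - t₀} {d}
      (0<-⇒< (0<-resp-≈ {1ℝ} {d - (fromℤ (t ℤ.+ -[1+ 0 ]) - t₀)}
        (≈-trans (identity₂ d) (minus-cong (≈-refl {d}) (≈-sym (shift -[1+ 0 ])))) (fromℚ-pos 0<1)))
      (0<-⇒< (0<-resp-≈ {(d + d) - 1ℝ} {d - - (fromℤ (t ℤ.+ -[1+ 0 ]) - t₀)}
        (≈-trans (identity₁ d) (minus-cong (≈-refl {d}) (-‿cong (≈-sym (shift -[1+ 0 ]))))) (<⇒0<- 1<d+d))))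
      (x≤∣x∣ d))
    where
    0<1 : 0ℚ ℚ.< 1ℚ
    0<1 = ℚ.positive⁻¹ 1ℚ
    identity₁ : ∀ d → (d + d) - 1ℝ ≈ d - - (d + fromℤ -[1+ 0 ])
    identity₁ = solve 1 (λ d → (d :+ d) :- con 1ℚ := d :- :- (d :+ con (ℚ.- 1ℚ))) ≈-refl
    identity₂ : ∀ d → 1ℝ ≈ d - (d + fromℤ -[1+ 0 ])
    identity₂ = solve 1 (λ d → con 1ℚ := d :- (d :+ con (ℚ.- 1ℚ))) ≈-refl

-- Perpendicularity fixes t₀⟨v,v⟩ = -ℓ⟨v,w⟩. The trace of `v` and ŵ therefore equals 2(t - t₀)⟨v,v⟩,
-- and the rounding error of at most ½ bounds it by N(v).
second⇒partner : ∀ {ℓ v ŵ} → SecondVector ℓ v ŵ → Partner ℓ v ŵ × ℤ.∣ tr v ŵ ∣ ℕ.≤ N v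
second⇒partner {ℓ} {v} {ŵ} second = trans (cong ℤ.∣_∣ v∧ŵ) refl , -i≤x≤i⇒∣x∣≤i (tr v ŵ) (N v)
    (fromℤ-cancel-≤ (≤-resp-≈ (≈-trans (-x*y n) (≈-sym (≈-trans (fromℤ-neg (+ N v)) (-‿cong N≈n)))) scaled
      (0≤-⇒≤ { - 1ℝ * n} {(d + d) * n} (≤-resp-≈ (≈-refl {0ℝ}) (factor (d + d) (- 1ℝ) n) (0≤* (≤⇒0≤- (proj₁ half)) 0≤n)))))
    (fromℤ-cancel-≤ (≤-resp-≈ scaled (≈-trans (1*x≈x n) (≈-sym N≈n))
      (0≤-⇒≤ {(d + d) * n} {1ℝ * n} (≤-resp-≈ (≈-refl {0ℝ}) (factor 1ℝ (d + d) n) (0≤* (≤⇒0≤- (proj₂ half)) 0≤n)))))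
  where
  open SecondVector second
  frame : HexagonalFrame (1ℝ , 0ℝ) (fromℚ (ℚ.- ½) , fromℚ ½ * √3)
  frame = ω-frame √3-eq
  open Frame frame
  ŵ≡ : ŵ ≡ t • v ⊕ + ℓ • w
  ŵ≡ = trans ŵ-eq (cong₂ _,_ (ℤ.+-comm (+ ℓ ℤ.* proj₁ w) (t ℤ.* proj₁ v)) (ℤ.+-comm (+ ℓ ℤ.* proj₂ w) (t ℤ.* proj₂ v)))
  v∧ŵ : v ∧ ŵ ≡ + ℓ
  v∧ŵ = trans (cong (v ∧_) ŵ≡) (∧-reduced v w t (+ ℓ) det≡1)
  n d : ℝ
  n = ⟨ v′ , v′ ⟩
  d = fromℤ t - t₀
  half : - 1ℝ ≤ d + d × d + d ≤ 1ℝ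
  half = nearest⇒half t₀ t nearest
  N≈n : fromℤ (+ N v) ≈ n
  N≈n = ≈-sym (≈-trans (A-E v) (≈-reflexive (cong fromℤ (norm≡N v))))
    where
    ≈-reflexive : ∀ {x y} → x ≡ y → x ≈ y
    ≈-reflexive refl = ≈-refl
  0≤n : 0ℝ ≤ n
  0≤n = 0≤+ (0≤x*x (proj₁ v′)) (0≤x*x (proj₂ v′))
  -x*y : ∀ x → - 1ℝ * x ≈ - x
  -x*y = solve 1 (λ x → :- con 1ℚ :* x := :- x) ≈-refl
  factor : ∀ x y z → (x - y) * z ≈ x * z - y * z
  factor = solve 3 (λ x y z → (x :- y) :* z := x :* z :- y :* z) ≈-refl
  t₀n : t₀ * n ≈ - (fromℕ ℓ * ⟨ v′ , w′ ⟩)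
  t₀n = begin
    t₀ * n ≈⟨ solve 3 (λ t a b →
        t :* (a :* a :+ b :* b) :=
        (t :* a) :* a :+ (t :* b) :* b)
        ≈-refl t₀ (proj₁ v′) (proj₂ v′) ⟩
    ⟨ t₀ · v′ , v′ ⟩ ≈⟨ ⟨,⟩-congˡ v′ t₀-eq ⟩
    ⟨ z -₂ fromℕ ℓ · w′ , v′ ⟩ ≈⟨ solve 7 (λ z₁ z₂ l w₁ w₂ v₁ v₂ →
        (z₁ :+ :- (l :* w₁)) :* v₁ :+ (z₂ :+ :- (l :* w₂)) :* v₂ :=
        (z₁ :* v₁ :+ z₂ :* v₂) :- l :* (v₁ :* w₁ :+ v₂ :* w₂))
        ≈-refl (proj₁ z) (proj₂ z) (fromℕ ℓ) (proj₁ w′) (proj₂ w′) (proj₁ v′) (proj₂ v′) ⟩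
    ⟨ z , v′ ⟩ - fromℕ ℓ * ⟨ v′ , w′ ⟩ ≈⟨ minus-cong perpendicular (≈-refl {fromℕ ℓ * ⟨ v′ , w′ ⟩}) ⟩
    0ℝ - fromℕ ℓ * ⟨ v′ , w′ ⟩ ≈⟨ 0-neg (fromℕ ℓ * ⟨ v′ , w′ ⟩) ⟩
    - (fromℕ ℓ * ⟨ v′ , w′ ⟩) ∎
    where
    open ℝ-Reasoning
  scaled : (d + d) * n ≈ fromℤ (tr v ŵ)
  scaled = begin
    (d + d) * n ≈⟨ solve 3 (λ t s n →
        ((t :- s) :+ (t :- s)) :* n :=
        con (+ 2 ℚ./ 1) :* n :* t :- (s :* n :+ s :* n))
        ≈-refl (fromℤ t) t₀ n ⟩
    2ℝ * n * fromℤ t - (t₀ * n + t₀ * n) ≈⟨ minus-cong (≈-refl {2ℝ * n * fromℤ t}) (+-cong t₀n t₀n) ⟩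
    2ℝ * n * fromℤ t - (- (fromℕ ℓ * ⟨ v′ , w′ ⟩) + - (fromℕ ℓ * ⟨ v′ , w′ ⟩))
      ≈⟨ solve 3 (λ x l y →
          x :- (:- (l :* y) :+ :- (l :* y)) :=
          x :+ l :* (y :+ y))
          ≈-refl (2ℝ * n * fromℤ t) (fromℕ ℓ) ⟨ v′ , w′ ⟩ ⟩
    2ℝ * n * fromℤ t + fromℕ ℓ * (⟨ v′ , w′ ⟩ + ⟨ v′ , w′ ⟩) ≈⟨ +-cong (*-cong (*-cong (≈-refl {2ℝ}) (A-E v)) (≈-refl {fromℤ t}))
                                                                         (*-cong (≈-refl {fromℕ ℓ}) (2⟨E,E⟩ v w)) ⟩
    2ℝ * fromℤ (norm v) * fromℤ t + fromℕ ℓ * fromℤ (tr v w) ≈⟨ homs ⟨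
    fromℤ (tr v ŵ) ∎
    where
    open ℝ-Reasoning
    tr≡ : tr v ŵ ≡ + 2 ℤ.* norm v ℤ.* t ℤ.+ + ℓ ℤ.* tr v w
    tr≡ = trans (cong (tr v) ŵ≡) (trans (tr-⊕• v (+ ℓ • w) t) (cong (λ i → + 2 ℤ.* norm v ℤ.* t ℤ.+ i) (tr-•ʳ v (+ ℓ) w)))
    homs : fromℤ (tr v ŵ) ≈ 2ℝ * fromℤ (norm v) * fromℤ t + fromℕ ℓ * fromℤ (tr v w)
    homs = subst (λ i → fromℤ i ≈ 2ℝ * fromℤ (norm v) * fromℤ t + fromℕ ℓ * fromℤ (tr v w)) (sym tr≡)
      (≈-trans (fromℤ-+ (+ 2 ℤ.* norm v ℤ.* t) (+ ℓ ℤ.* tr v w)) (+-cong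
        (≈-trans (fromℤ-* (+ 2 ℤ.* norm v) t) (*-cong (fromℤ-* (+ 2) (norm v)) (≈-refl {fromℤ t})))
        (fromℤ-* (+ ℓ) (tr v w))))

≡⇒≈ : ∀ {x y} → x ≡ y → x ≈ y
≡⇒≈ refl = ≈-refl

∣/1∣ : ∀ i → ℚ.∣ i ℚ./ 1 ∣ ≡ + ℤ.∣ i ∣ ℚ./ 1
∣/1∣ (+ n)    = ℚ.0≤p⇒∣p∣≡p (/1-mono-≤ {+ 0} {+ n} (ℤ.+≤+ ℕ.z≤n))
∣/1∣ -[1+ n ] = trans (cong ℚ.∣_∣ (/1-neg (+ suc n))) (trans (ℚ.∣-p∣≡∣p∣ (+ suc n ℚ./ 1)) (∣/1∣ (+ suc n)))

∣fromℤ*∣-mono : ∀ i j r → ℤ.∣ i ∣ ℕ.≤ ℤ.∣ j ∣ → ∣ fromℤ i * fromℚ r ∣ ≤ ∣ fromℤ j * fromℚ r ∣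
∣fromℤ*∣-mono i j r i≤j = pointwise-≤ λ _ → subst₂ ℚ._≤_ (sym (ℚ.∣p*q∣≡∣p∣*∣q∣ (i ℚ./ 1) r)) (sym (ℚ.∣p*q∣≡∣p∣*∣q∣ (j ℚ./ 1) r))
  (ℚ.*-monoʳ-≤-nonNeg ℚ.∣ r ∣ {{ℚ.∣-∣-nonNeg r}} (subst₂ ℚ._≤_ (sym (∣/1∣ i)) (sym (∣/1∣ j)) (/1-mono-≤ (ℤ.+≤+ i≤j))))

-- For nonzero k the shift has size at least 2n, of which `x` can cancel at most n.
smallest-residue : ∀ n x k → ℤ.∣ x ∣ ℕ.≤ n → ℤ.∣ x ∣ ℕ.≤ ℤ.∣ + 2 ℤ.* + n ℤ.* k ℤ.+ x ∣
smallest-residue n x k x≤n = case k ℤ.≟ + 0 of λ where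
    (yes refl) → ℕ.≤-reflexive (cong ℤ.∣_∣ (sym (trans (cong (ℤ._+ x) (ℤ.*-zeroʳ (+ 2 ℤ.* + n))) (ℤ.+-identityˡ x))))
    (no  k≢0)  → ℕ.≤-trans x≤n (ℕ.+-cancelʳ-≤ n n ℤ.∣ y ∣ (begin
      n ℕ.+ n ≡⟨ cong (n ℕ.+_) (ℕ.+-identityʳ n) ⟨
      2 ℕ.* n ≤⟨ ℕ.m≤m*n (2 ℕ.* n) ℤ.∣ k ∣ {{ℕ.≢-nonZero (k≢0 ∘ ℤ.∣i∣≡0⇒i≡0)}} ⟩
      2 ℕ.* n ℕ.* ℤ.∣ k ∣ ≡⟨ trans (ℤ.abs-* (+ 2 ℤ.* + n) k) (cong (ℕ._* ℤ.∣ k ∣) (ℤ.abs-* (+ 2) (+ n))) ⟨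
      ℤ.∣ + 2 ℤ.* + n ℤ.* k ∣ ≡⟨ cong ℤ.∣_∣ (cancel (+ 2 ℤ.* + n ℤ.* k) x) ⟩
      ℤ.∣ y ℤ.- x ∣ ≤⟨ ℤ.∣i-j∣≤∣i∣+∣j∣ y x ⟩
      ℤ.∣ y ∣ ℕ.+ ℤ.∣ x ∣ ≤⟨ ℕ.+-monoʳ-≤ ℤ.∣ y ∣ x≤n ⟩
      ℤ.∣ y ∣ ℕ.+ n ∎))
  where
  open ℕ.≤-Reasoning
  y : ℤ
  y = + 2 ℤ.* + n ℤ.* k ℤ.+ x
  cancel : ∀ a x → a ≡ a ℤ.+ x ℤ.- x
  cancel = ℤ-Solver.solve-∀

module SecondVectorExists (ℓ : ℕ) {{_ : ℕ.NonZero ℓ}} (v w : ℤ[ω]) (vw≡1 : v ∧ w ≡ + 1)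
  (√3 : ℝ) (√3-eq : IsSqrt (fromℕ 3) √3) (∣v∣ : ℝ) (∣v∣-sqrt : IsSqrt (fromℕ (N v)) ∣v∣) where

  frame : HexagonalFrame (1ℝ , 0ℝ) (fromℚ (ℚ.- ½) , fromℚ ½ * √3)
  frame = ω-frame √3-eq

  open Frame frame

  n : ℕ
  n = N v

  0<n : 0 ℕ.< n
  0<n = N>0 {v} λ v≡0 → contradiction (trans (sym vw≡1) (cong (_∧ w) v≡0)) λ ()

  instance
    n≢0 : ℕ.NonZero n
    n≢0 = ℕ.>-nonZero 0<n

  2n/1>0 : 0ℚ ℚ.< + (2 ℕ.* n) ℚ./ 1
  2n/1>0 = /1-mono-< {+ 0} {+ (2 ℕ.* n)} (ℤ.+<+ (ℕ.≤-trans 0<n (ℕ.m≤m+n n _)))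

  1/2n : ℚ
  1/2n = ℚ.1/_ (+ (2 ℕ.* n) ℚ./ 1) {{ℚ.>-nonZero 2n/1>0}}

  r nℝ ℓℝ T : ℝ
  r  = fromℚ 1/2n
  nℝ = fromℕ n
  ℓℝ = fromℕ ℓ
  T  = fromℤ (tr v w)

  0≤r : 0ℝ ≤ r
  0≤r = <⇒≤ (fromℚ-pos (ℚ.positive⁻¹ 1/2n {{ℚ.1/pos⇒pos (+ (2 ℕ.* n) ℚ./ 1) {{ℚ.positive 2n/1>0}}}}))

  2nr≈1 : 2ℝ * nℝ * r ≈ 1ℝ
  2nr≈1 = ≈-trans (*-cong (≈-trans (≈-sym (fromℤ-* (+ 2) (+ n))) (≡⇒≈ (cong fromℤ (sym (ℤ.pos-* 2 n))))) (≈-refl {r}))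
    (pointwise λ _ → ℚ.*-inverseʳ (+ (2 ℕ.* n) ℚ./ 1) {{ℚ.>-nonZero 2n/1>0}})

  v′ w′ : ℝ²
  v′ = embed √3 v
  w′ = embed √3 w

  ⟨v,v⟩ : ⟨ v′ , v′ ⟩ ≈ nℝ
  ⟨v,v⟩ = ≈-trans (A-E v) (≡⇒≈ (cong fromℤ (norm≡N v)))

  -- The Gram-Schmidt coefficient -ℓ⟨v,w⟩/⟨v,v⟩, as `T` is twice the inner product and `r` is
  -- 1/(2n). It is rational, so a nearest integer can be computed.
  t₀ : ℝ
  t₀ = - (ℓℝ * T * r)

  z : ℝ²
  z = t₀ · v′ +₂ ℓℝ · w′

  t₀-eq : t₀ · v′ ≈₂ z -₂ ℓℝ · w′
  t₀-eq = identity (t₀ * proj₁ v′) (ℓℝ * proj₁ w′) , identity (t₀ * proj₂ v′) (ℓℝ * proj₂ w′)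
    where
    identity : ∀ x y → x ≈ (x + y) + - y
    identity = solve 2 (λ x y → x := (x :+ y) :+ :- y) ≈-refl

  perpendicular : ⟨ z , v′ ⟩ ≈ 0ℝ
  perpendicular = x+x≈0⇒x≈0 ⟨ z , v′ ⟩ (begin
    ⟨ z , v′ ⟩ + ⟨ z , v′ ⟩
      ≈⟨ solve 6 (λ t l v₁ v₂ w₁ w₂ →
          ((t :* v₁ :+ l :* w₁) :* v₁ :+ (t :* v₂ :+ l :* w₂) :* v₂) :+ ((t :* v₁ :+ l :* w₁) :* v₁ :+ (t :* v₂ :+ l :* w₂) :* v₂) :=
          con (+ 2 ℚ./ 1) :* (v₁ :* v₁ :+ v₂ :* v₂) :* t :+ l :* ((v₁ :* w₁ :+ v₂ :* w₂) :+ (v₁ :* w₁ :+ v₂ :* w₂)))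
          ≈-refl t₀ ℓℝ (proj₁ v′) (proj₂ v′) (proj₁ w′) (proj₂ w′) ⟩
    2ℝ * ⟨ v′ , v′ ⟩ * t₀ + ℓℝ * (⟨ v′ , w′ ⟩ + ⟨ v′ , w′ ⟩)
      ≈⟨ +-cong (*-cong (*-cong (≈-refl {2ℝ}) ⟨v,v⟩) (≈-refl {t₀})) (*-cong (≈-refl {ℓℝ}) (2⟨E,E⟩ v w)) ⟩
    2ℝ * nℝ * t₀ + ℓℝ * T
      ≈⟨ regroup (2ℝ * nℝ) ℓℝ T r ⟩
    ℓℝ * T - ℓℝ * T * (2ℝ * nℝ * r)
      ≈⟨ minus-cong (≈-refl {ℓℝ * T}) (*-cong (≈-refl {ℓℝ * T}) 2nr≈1) ⟩
    ℓℝ * T - ℓℝ * T * 1ℝ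
      ≈⟨ solve 1 (λ x → x :- x :* con 1ℚ := con 0ℚ) ≈-refl (ℓℝ * T) ⟩
    0ℝ ∎)
    where
    open ℝ-Reasoning
    regroup : ∀ m l s r → m * - (l * s * r) + l * s ≈ l * s - l * s * (m * r)
    regroup = solve 4 (λ m l s r → m :* :- (l :* s :* r) :+ l :* s := l :* s :- l :* s :* (m :* r)) ≈-refl

  D : ℝ
  D = det v′ w′

  D² : D * D ≈ fromℚ ¾
  D² = ≈-trans (*-cong D≈ D≈) (ω-det² √3-eq)
    where
    D≈ : D ≈ fromℚ ½ * √3
    D≈ = ≈-trans (det-E v w) (≈-trans (*-cong (≡⇒≈ (cong fromℤ vw≡1)) (ω-det √3)) (1*x≈x (fromℚ ½ * √3)))

  det-z : det v′ z ≈ ℓℝ * D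
  det-z = identity t₀ ℓℝ (proj₁ v′) (proj₂ v′) (proj₁ w′) (proj₂ w′)
    where
    identity : ∀ t l v₁ v₂ w₁ w₂ → v₁ * (t * v₂ + l * w₂) - v₂ * (t * v₁ + l * w₁) ≈ l * (v₁ * w₂ - v₂ * w₁)
    identity = solve 6 (λ t l v₁ v₂ w₁ w₂ →
        v₁ :* (t :* v₂ :+ l :* w₂) :- v₂ :* (t :* v₁ :+ l :* w₁) :=
        l :* (v₁ :* w₂ :- v₂ :* w₁))
        ≈-refl

  sameSide : 0ℝ < det v′ z * det v′ w′
  sameSide = 0<-resp-≈ {ℓℝ * fromℚ ¾} {det v′ z * D}
    (≈-sym (≈-trans (*-cong det-z (≈-refl {D})) (≈-trans (assoc ℓℝ D) (*-cong (≈-refl {ℓℝ}) D²))))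
    (0<* (fromℤ-mono-< {+ 0} {+ ℓ} (ℤ.+<+ (ℕ.>-nonZero⁻¹ ℓ))) (fromℚ-pos (ℚ.positive⁻¹ ¾)))
    where
    assoc : ∀ l d → (l * d) * d ≈ l * (d * d)
    assoc = solve 2 (λ l d → (l :* d) :* d := l :* (d :* d)) ≈-refl

  -- The prescribed length √3ℓ/(2|v|) in the form √3ℓ|v|/(2n), where only a rational number has to
  -- be inverted.
  ∣z∣ : ℝ
  ∣z∣ = √3 * (ℓℝ * r) * ∣v∣

  ∣v∣-eq : IsSqrt ⟨ v′ , v′ ⟩ ∣v∣
  ∣v∣-eq = proj₁ ∣v∣-sqrt , ≈-trans (proj₂ ∣v∣-sqrt) (≈-sym ⟨v,v⟩)

  ⟨z,z⟩ : A z ≈ 2ℝ * fromℚ ¾ * (ℓℝ * ℓℝ) * r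
  ⟨z,z⟩ = begin
    A z ≈⟨ 1*x≈x (A z) ⟨
    1ℝ * A z ≈⟨ *-cong 2nr≈1 (≈-refl {A z}) ⟨
    2ℝ * nℝ * r * A z ≈⟨ regroup nℝ r (A z) ⟩
    2ℝ * r * (A z * nℝ) ≈⟨ *-cong (≈-refl {2ℝ * r}) z²n ⟩
    2ℝ * r * (ℓℝ * ℓℝ * fromℚ ¾) ≈⟨ regroup′ r (ℓℝ * ℓℝ) ⟩
    2ℝ * fromℚ ¾ * (ℓℝ * ℓℝ) * r ∎
    where
    open ℝ-Reasoning
    regroup : ∀ n r x → 2ℝ * n * r * x ≈ 2ℝ * r * (x * n)
    regroup = solve 3 (λ n r x → con (+ 2 ℚ./ 1) :* n :* r :* x := con (+ 2 ℚ./ 1) :* r :* (x :* n)) ≈-refl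
    regroup′ : ∀ r l → 2ℝ * r * (l * fromℚ ¾) ≈ 2ℝ * fromℚ ¾ * l * r
    regroup′ = solve 2 (λ r l → con (+ 2 ℚ./ 1) :* r :* (l :* con ¾) := con (+ 2 ℚ./ 1) :* con ¾ :* l :* r) ≈-refl
    -- Lagrange's identity for `z` and `v′`: their inner product is 0 and their determinant is ℓ`D`,
    -- with `D`² = ¾.
    z²n : A z * nℝ ≈ ℓℝ * ℓℝ * fromℚ ¾
    z²n = begin
      A z * nℝ ≈⟨ *-cong (≈-refl {A z}) ⟨v,v⟩ ⟨
      A z * ⟨ v′ , v′ ⟩ ≈⟨ solve 4 (λ a b c d →
          (a :* a :+ b :* b) :* (c :* c :+ d :* d) :=
          (a :* c :+ b :* d) :* (a :* c :+ b :* d) :+ (c :* b :- d :* a) :* (c :* b :- d :* a))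
          ≈-refl (proj₁ z) (proj₂ z) (proj₁ v′) (proj₂ v′) ⟩
      ⟨ z , v′ ⟩ * ⟨ z , v′ ⟩ + det v′ z * det v′ z ≈⟨ +-cong (*-cong perpendicular perpendicular) (*-cong det-z det-z) ⟩
      0ℝ * 0ℝ + (ℓℝ * D) * (ℓℝ * D) ≈⟨ solve 2 (λ l d →
          con 0ℚ :* con 0ℚ :+ (l :* d) :* (l :* d) :=
          l :* l :* (d :* d))
          ≈-refl ℓℝ D ⟩
      ℓℝ * ℓℝ * (D * D) ≈⟨ *-cong (≈-refl {ℓℝ * ℓℝ}) D² ⟩
      ℓℝ * ℓℝ * fromℚ ¾ ∎

  ∣z∣-eq : IsSqrt (A z) ∣z∣
  ∣z∣-eq = 0≤* (0≤* (proj₁ √3-eq) (0≤* (fromℤ-mono-≤ {+ 0} {+ ℓ} (ℤ.+≤+ ℕ.z≤n)) 0≤r)) (proj₁ ∣v∣-sqrt) , (begin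
    ∣z∣ * ∣z∣ ≈⟨ regroup √3 ℓℝ r ∣v∣ ⟩
    √3 * √3 * (ℓℝ * ℓℝ) * (r * r) * (∣v∣ * ∣v∣)
      ≈⟨ *-cong (*-cong (*-cong (proj₂ √3-eq) (≈-refl {ℓℝ * ℓℝ})) (≈-refl {r * r})) (proj₂ ∣v∣-sqrt) ⟩
    fromℕ 3 * (ℓℝ * ℓℝ) * (r * r) * nℝ ≈⟨ regroup′ (ℓℝ * ℓℝ) r nℝ ⟩
    2ℝ * fromℚ ¾ * (ℓℝ * ℓℝ) * r * (2ℝ * nℝ * r) ≈⟨ *-cong (≈-refl {2ℝ * fromℚ ¾ * (ℓℝ * ℓℝ) * r}) 2nr≈1 ⟩
    2ℝ * fromℚ ¾ * (ℓℝ * ℓℝ) * r * 1ℝ ≈⟨ x*1≈x (2ℝ * fromℚ ¾ * (ℓℝ * ℓℝ) * r) ⟩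
    2ℝ * fromℚ ¾ * (ℓℝ * ℓℝ) * r ≈⟨ ⟨z,z⟩ ⟨
    A z ∎)
    where
    open ℝ-Reasoning
    regroup : ∀ s l r u → (s * (l * r) * u) * (s * (l * r) * u) ≈ s * s * (l * l) * (r * r) * (u * u)
    regroup = solve 4 (λ s l r u →
        (s :* (l :* r) :* u) :* (s :* (l :* r) :* u) :=
        s :* s :* (l :* l) :* (r :* r) :* (u :* u))
        ≈-refl
    regroup′ : ∀ l r n → fromℕ 3 * l * (r * r) * n ≈ 2ℝ * fromℚ ¾ * l * r * (2ℝ * n * r)
    regroup′ = solve 3 (λ l r n → con (+ 3 ℚ./ 1) :* l :* (r :* r) :* n :=
      con (+ 2 ℚ./ 1) :* con ¾ :* l :* r :* (con (+ 2 ℚ./ 1) :* n :* r)) ≈-refl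

  length-eq : ∣z∣ * (fromℕ 2 * ∣v∣) ≈ √3 * fromℕ ℓ
  length-eq = begin
    ∣z∣ * (fromℕ 2 * ∣v∣) ≈⟨ regroup √3 ℓℝ r ∣v∣ ⟩
    √3 * ℓℝ * (2ℝ * (∣v∣ * ∣v∣) * r) ≈⟨ *-cong (≈-refl {√3 * ℓℝ}) (*-cong (*-cong (≈-refl {2ℝ}) (proj₂ ∣v∣-sqrt)) (≈-refl {r})) ⟩
    √3 * ℓℝ * (2ℝ * nℝ * r) ≈⟨ *-cong (≈-refl {√3 * ℓℝ}) 2nr≈1 ⟩
    √3 * ℓℝ * 1ℝ ≈⟨ x*1≈x (√3 * ℓℝ) ⟩
    √3 * ℓℝ ∎
    where
    open ℝ-Reasoning
    regroup : ∀ s l r u → s * (l * r) * u * (fromℕ 2 * u) ≈ s * l * (2ℝ * (u * u) * r)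
    regroup = solve 4 (λ s l r u →
        s :* (l :* r) :* u :* (con (+ 2 ℚ./ 1) :* u) :=
        s :* l :* (con (+ 2 ℚ./ 1) :* (u :* u) :* r))
        ≈-refl

  t : ℤ
  t = proj₁ (reduced-vector ℓ v w)

  ŵ : ℤ[ω]
  ŵ = t • v ⊕ + ℓ • w

  -- This is 2n(m - t₀), the trace of `v` and m`v` + ℓ`w`. It turns the comparison of distances to
  -- t₀ into one of integers.
  offset : ℤ → ℤ
  offset m = + 2 ℤ.* + n ℤ.* m ℤ.+ + ℓ ℤ.* tr v w

  distance : ∀ m → fromℤ m - t₀ ≈ fromℤ (offset m) * r
  distance m = begin
    fromℤ m - t₀ ≈⟨ solve 4 (λ m l s r →
        m :- :- (l :* s :* r) :=
        m :* con 1ℚ :+ l :* s :* r)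
        ≈-refl (fromℤ m) ℓℝ T r ⟩
    fromℤ m * 1ℝ + ℓℝ * T * r ≈⟨ +-cong (*-cong (≈-refl {fromℤ m}) 2nr≈1) (≈-refl {ℓℝ * T * r}) ⟨
    fromℤ m * (2ℝ * nℝ * r) + ℓℝ * T * r ≈⟨ regroup (fromℤ m) nℝ r (ℓℝ * T) ⟩
    (2ℝ * nℝ * fromℤ m + ℓℝ * T) * r ≈⟨ *-cong homs (≈-refl {r}) ⟨
    fromℤ (offset m) * r ∎
    where
    open ℝ-Reasoning
    regroup : ∀ m n r y → m * (2ℝ * n * r) + y * r ≈ (2ℝ * n * m + y) * r
    regroup = solve 4 (λ m n r y →
        m :* (con (+ 2 ℚ./ 1) :* n :* r) :+ y :* r :=
        (con (+ 2 ℚ./ 1) :* n :* m :+ y) :* r)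
        ≈-refl
    homs : fromℤ (offset m) ≈ 2ℝ * nℝ * fromℤ m + ℓℝ * T
    homs = ≈-trans (fromℤ-+ (+ 2 ℤ.* + n ℤ.* m) (+ ℓ ℤ.* tr v w)) (+-cong
      (≈-trans (fromℤ-* (+ 2 ℤ.* + n) m) (*-cong (fromℤ-* (+ 2) (+ n)) (≈-refl {fromℤ m})))
      (fromℤ-* (+ ℓ) (tr v w)))

  nearest : ∀ m → ∣ fromℤ t - t₀ ∣ ≤ ∣ fromℤ m - t₀ ∣
  nearest m = ≤-trans (∣∣-cong (distance t)) (≤-trans (∣fromℤ*∣-mono (offset t) (offset m) 1/2n closer) (∣∣-cong (≈-sym (distance m))))
    where
    small : ℤ.∣ offset t ∣ ℕ.≤ n
    small = subst (λ i → ℤ.∣ i ∣ ℕ.≤ n) (trans (tr-⊕• v (+ ℓ • w) t)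
      (cong₂ (λ i j → + 2 ℤ.* i ℤ.* t ℤ.+ j) (norm≡N v) (tr-•ʳ v (+ ℓ) w))) (proj₂ (reduced-vector ℓ v w))
    identity : ∀ n m t y → + 2 ℤ.* n ℤ.* (m ℤ.- t) ℤ.+ (+ 2 ℤ.* n ℤ.* t ℤ.+ y) ≡ + 2 ℤ.* n ℤ.* m ℤ.+ y
    identity = ℤ-Solver.solve-∀
    closer : ℤ.∣ offset t ∣ ℕ.≤ ℤ.∣ offset m ∣
    closer = subst (λ i → ℤ.∣ offset t ∣ ℕ.≤ ℤ.∣ i ∣) (identity (+ n) m t (+ ℓ ℤ.* tr v w))
      (smallest-residue n (offset t) (m ℤ.- t) small)

  second : SecondVector ℓ v ŵ
  second = record
    { w = w ; det≡1 = vw≡1 ; √3 = √3 ; √3-eq = √3-eq ; z = z ; perpendicular = perpendicular ; sameSide = sameSide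
    ; ∣v∣ = ∣v∣ ; ∣z∣ = ∣z∣ ; ∣v∣-eq = ∣v∣-eq ; ∣z∣-eq = ∣z∣-eq ; length = length-eq
    ; t₀ = t₀ ; t₀-eq = t₀-eq ; t = t ; nearest = nearest
    ; ŵ-eq = cong₂ _,_ (ℤ.+-comm (t ℤ.* proj₁ v) (+ ℓ ℤ.* proj₁ w)) (ℤ.+-comm (t ℤ.* proj₂ v) (+ ℓ ℤ.* proj₂ w))
    }

second-exists : ∀ ℓ .{{_ : ℕ.NonZero ℓ}} v → Primitive v → ∃ (SecondVector ℓ v)
second-exists ℓ@(suc _) v prim = SV.ŵ , SV.second
  where
  w : ∃ λ w → v ∧ w ≡ + 1
  w = primitive⇒∧≡1 v prim
  module SV = SecondVectorExists ℓ v (proj₁ w) (proj₂ w) (√.root 3) (√.root-isSqrt 3) (√.root (N v)) (√.root-isSqrt (N v))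

-- The sublattice of a shortest vector

norm-⊕• : ∀ i j v w → norm (i • v ⊕ j • w) ≡ i ℤ.* i ℤ.* norm v ℤ.+ i ℤ.* j ℤ.* tr v w ℤ.+ j ℤ.* j ℤ.* norm w
norm-⊕• i j (a , b) (c , d) = identity i j a b c d
  where
  identity : ∀ i j a b c d →
    (i ℤ.* a ℤ.+ j ℤ.* c) ℤ.* (i ℤ.* a ℤ.+ j ℤ.* c) ℤ.- (i ℤ.* a ℤ.+ j ℤ.* c) ℤ.* (i ℤ.* b ℤ.+ j ℤ.* d)
    ℤ.+ (i ℤ.* b ℤ.+ j ℤ.* d) ℤ.* (i ℤ.* b ℤ.+ j ℤ.* d) ≡
    i ℤ.* i ℤ.* (a ℤ.* a ℤ.- a ℤ.* b ℤ.+ b ℤ.* b)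
    ℤ.+ i ℤ.* j ℤ.* (+ 2 ℤ.* (a ℤ.* c) ℤ.- a ℤ.* d ℤ.- b ℤ.* c ℤ.+ + 2 ℤ.* (b ℤ.* d))
    ℤ.+ j ℤ.* j ℤ.* (c ℤ.* c ℤ.- c ℤ.* d ℤ.+ d ℤ.* d)
  identity = ℤ-Solver.solve-∀

∣z∣≤k⇒0≤z+k : ∀ z k → ℤ.∣ z ∣ ℕ.≤ k → + 0 ℤ.≤ z ℤ.+ + k
∣z∣≤k⇒0≤z+k (+ m)    k m≤k = ℤ.+≤+ ℕ.z≤n
∣z∣≤k⇒0≤z+k -[1+ m ] k m<k = subst (+ 0 ℤ.≤_) (sym (ℤ.⊖-≥ m<k)) (ℤ.+≤+ ℕ.z≤n)

-- The mixed term of the quadratic form i²N(v) + ij tr(v,w) + j²N(w) is estimated by |tr(v,w)| ≤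
-- N(v). It stands on the right because subtraction in ℕ truncates.
norm-lower-bound : ∀ {v w} i j → ℤ.∣ tr v w ∣ ℕ.≤ N v →
  N v ℕ.* (ℤ.∣ i ∣ ℕ.* ℤ.∣ i ∣) ℕ.+ N w ℕ.* (ℤ.∣ j ∣ ℕ.* ℤ.∣ j ∣) ℕ.≤ N (i • v ⊕ j • w) ℕ.+ N v ℕ.* (ℤ.∣ i ∣ ℕ.* ℤ.∣ j ∣)
norm-lower-bound {v} {w} i j small = ℤ.drop‿+≤+ (ℤ.0≤i-j⇒j≤i (subst (+ 0 ℤ.≤_) (sym difference)
  (∣z∣≤k⇒0≤z+k (i ℤ.* j ℤ.* tr v w) (N v ℕ.* IJ) bound)))
  where
  II JJ IJ : ℕ
  II = ℤ.∣ i ∣ ℕ.* ℤ.∣ i ∣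
  JJ = ℤ.∣ j ∣ ℕ.* ℤ.∣ j ∣
  IJ = ℤ.∣ i ∣ ℕ.* ℤ.∣ j ∣
  bound : ℤ.∣ i ℤ.* j ℤ.* tr v w ∣ ℕ.≤ N v ℕ.* IJ
  bound = begin
    ℤ.∣ i ℤ.* j ℤ.* tr v w ∣ ≡⟨ trans (ℤ.abs-* (i ℤ.* j) (tr v w)) (cong (ℕ._* ℤ.∣ tr v w ∣) (ℤ.abs-* i j)) ⟩
    IJ ℕ.* ℤ.∣ tr v w ∣ ≤⟨ ℕ.*-monoʳ-≤ IJ small ⟩
    IJ ℕ.* N v ≡⟨ ℕ.*-comm IJ (N v) ⟩
    N v ℕ.* IJ ∎
    where open ℕ.≤-Reasoning
  cast : ∀ k u → k ℤ.* k ℤ.* norm u ≡ + (N u ℕ.* (ℤ.∣ k ∣ ℕ.* ℤ.∣ k ∣))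
  cast k u = begin
    k ℤ.* k ℤ.* norm u ≡⟨ cong₂ ℤ._*_ (square k) (norm≡N u) ⟩
    + (ℤ.∣ k ∣ ℕ.* ℤ.∣ k ∣) ℤ.* + N u ≡⟨ ℤ.*-comm (+ (ℤ.∣ k ∣ ℕ.* ℤ.∣ k ∣)) (+ N u) ⟩
    + N u ℤ.* + (ℤ.∣ k ∣ ℕ.* ℤ.∣ k ∣) ≡⟨ ℤ.pos-* (N u) (ℤ.∣ k ∣ ℕ.* ℤ.∣ k ∣) ⟨
    + (N u ℕ.* (ℤ.∣ k ∣ ℕ.* ℤ.∣ k ∣)) ∎
    where open ≡-Reasoning
  difference : + (N (i • v ⊕ j • w) ℕ.+ N v ℕ.* IJ) ℤ.- + (N v ℕ.* II ℕ.+ N w ℕ.* JJ) ≡ i ℤ.* j ℤ.* tr v w ℤ.+ + (N v ℕ.* IJ)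
  difference = begin
    + N (i • v ⊕ j • w) ℤ.+ + (N v ℕ.* IJ) ℤ.- (+ (N v ℕ.* II) ℤ.+ + (N w ℕ.* JJ))
      ≡⟨ cong (λ z → z ℤ.+ + (N v ℕ.* IJ) ℤ.- (+ (N v ℕ.* II) ℤ.+ + (N w ℕ.* JJ)))
           (trans (sym (norm≡N (i • v ⊕ j • w))) (trans (norm-⊕• i j v w)
             (cong₂ (λ p q → p ℤ.+ i ℤ.* j ℤ.* tr v w ℤ.+ q) (cast i v) (cast j w)))) ⟩
    + (N v ℕ.* II) ℤ.+ i ℤ.* j ℤ.* tr v w ℤ.+ + (N w ℕ.* JJ) ℤ.+ + (N v ℕ.* IJ) ℤ.- (+ (N v ℕ.* II) ℤ.+ + (N w ℕ.* JJ))
      ≡⟨ identity (+ (N v ℕ.* II)) (i ℤ.* j ℤ.* tr v w) (+ (N w ℕ.* JJ)) (+ (N v ℕ.* IJ)) ⟩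
    i ℤ.* j ℤ.* tr v w ℤ.+ + (N v ℕ.* IJ) ∎
    where
    open ≡-Reasoning
    identity : ∀ p x q k → p ℤ.+ x ℤ.+ q ℤ.+ k ℤ.- (p ℤ.+ q) ≡ x ℤ.+ k
    identity = ℤ-Solver.solve-∀

xy<x²+y² : ∀ x y → y ≢ 0 → x ℕ.* y ℕ.< x ℕ.* x ℕ.+ y ℕ.* y
xy<x²+y² x y y≢0 = case ℕ.≤-total x y of λ where
    (inj₂ y≤x) → ℕ.≤-<-trans (ℕ.*-monoʳ-≤ x y≤x) (ℕ.m<m+n (x ℕ.* x) (0<square y y≢0))
    (inj₁ x≤y) → case x ℕ.≟ 0 of λ where
      (yes refl) → 0<square y y≢0
      (no  x≢0)  → ℕ.≤-<-trans (ℕ.*-monoˡ-≤ y x≤y) (ℕ.m<n+m (y ℕ.* y) (0<square x x≢0))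
  where
  0<square : ∀ n → n ≢ 0 → 0 ℕ.< n ℕ.* n
  0<square zero    n≢0 = contradiction refl n≢0
  0<square (suc n) _   = ℕ.s≤s ℕ.z≤n

∣i∣≡1⇒i≡±1 : ∀ i → ℤ.∣ i ∣ ≡ 1 → i ≡ + 1 ⊎ i ≡ -[1+ 0 ]
∣i∣≡1⇒i≡±1 (+ 1)    refl = inj₁ refl
∣i∣≡1⇒i≡±1 -[1+ 0 ] refl = inj₂ refl

-1•_ : ∀ v → -[1+ 0 ] • v ≡ ⊝ v
-1• (a , b) = cong₂ _,_ (ℤ.-1*i≡-i a) (ℤ.-1*i≡-i b)

-- A reduced basis v, ŵ of the sublattice {y : ℓ ∣ v ∧ y}.
module Reduced {ℓ : ℕ} {v : ℤ[ω]} (ℓ-prime : Prime ℓ) (v∈ : InRange ℓ v) (v-shortest : Shortest ℓ v) where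

  -- From 4N(v) ≥ 3ℓ ≥ 6. It keeps the units, and with them the set `S` of the form, out of the
  -- sublattice.
  1<N : 1 ℕ.< N v
  1<N = ℕ.≰⇒> λ N≤1 → ℕ.<⇒≱ (ℕ.s≤s (ℕ.s≤s (ℕ.s≤s (ℕ.s≤s (ℕ.s≤s (ℕ.z≤n {1})))))) (ℕ.≤-trans
    (ℕ.*-monoʳ-≤ 3 {2} {ℓ} (ℕ.nonTrivial⇒n>1 ℓ {{prime⇒nonTrivial ℓ-prime}}))
    (ℕ.≤-trans (proj₁ (proj₂ v∈)) (ℕ.*-monoʳ-≤ 4 N≤1)))

  v≢0 : v ≢ 0ω
  v≢0 refl = contradiction 1<N λ ()

  private instance
    N≢0 : ℕ.NonZero (N v)
    N≢0 = ℕ.>-nonZero (ℕ.<⇒≤ 1<N)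

  w : ℤ[ω]
  w = proj₁ (primitive⇒∧≡1 v (proj₁ v∈))

  v∧w : v ∧ w ≡ + 1
  v∧w = proj₂ (primitive⇒∧≡1 v (proj₁ v∈))

  t : ℤ
  t = proj₁ (reduced-vector ℓ v w)

  ŵ : ℤ[ω]
  ŵ = t • v ⊕ + ℓ • w

  v∧ŵ : v ∧ ŵ ≡ + ℓ
  v∧ŵ = ∧-reduced v w t (+ ℓ) v∧w

  N<Nŵ : N v ℕ.< N ŵ
  N<Nŵ = v-shortest ŵ (cong ℤ.∣_∣ v∧ŵ)

  -- The quotient of `v ∧ y` by ℓ is the coordinate along ŵ; after subtracting that part the
  -- determinant with `v` vanishes, which leaves a multiple of `v`.
  decompose : ∀ y → + ℓ ∣ v ∧ y → ∃₂ λ i j → y ≡ i • v ⊕ j • ŵ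
  decompose y (divides j eq) = (y ⊖ j • ŵ) ∧ w , j , (begin
    y ≡⟨ ⊕-⊖-cancel y (j • ŵ) ⟨
    (y ⊖ j • ŵ) ⊕ j • ŵ ≡⟨ cong (_⊕ j • ŵ) (∧≡0⇒multiple v w (y ⊖ j • ŵ) v∧w vanishes) ⟩
    ((y ⊖ j • ŵ) ∧ w) • v ⊕ j • ŵ ∎)
    where
    open ≡-Reasoning
    v∧j•ŵ : v ∧ (j • ŵ) ≡ j ℤ.* + ℓ
    v∧j•ŵ = trans (∧-•ʳ v j ŵ) (cong (j ℤ.*_) v∧ŵ)
    vanishes : v ∧ (y ⊖ j • ŵ) ≡ + 0
    vanishes = trans (∧-⊖ v y (j • ŵ)) (trans (cong₂ ℤ._-_ eq v∧j•ŵ) (ℤ.+-inverseʳ (j ℤ.* + ℓ)))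

  combination∈ : ∀ i j → + ℓ ∣ v ∧ (i • v ⊕ j • ŵ)
  combination∈ i j = divides j (begin
    v ∧ (i • v ⊕ j • ŵ) ≡⟨ ∧-⊕• v v ŵ i j ⟩
    i ℤ.* v ∧ v ℤ.+ j ℤ.* v ∧ ŵ ≡⟨ cong₂ (λ p q → i ℤ.* p ℤ.+ j ℤ.* q) (∧-self v) v∧ŵ ⟩
    i ℤ.* + 0 ℤ.+ j ℤ.* + ℓ ≡⟨ simplify i (j ℤ.* + ℓ) ⟩
    j ℤ.* + ℓ ∎)
    where
    open ≡-Reasoning
    simplify : ∀ i l → i ℤ.* + 0 ℤ.+ l ≡ l
    simplify = ℤ-Solver.solve-∀

  -- For j ≠ 0, replacing N(ŵ) by the smaller N(v) in `norm-lower-bound` leaves N(v)(i² - |ij| +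
  -- j²), whose bracket is at least 1. For j = 0, all multiples of `v` except 0 and ±`v` are longer.
  -- So `Shortest`, which only tests partners, controls the whole sublattice.
  minimal : ∀ y → + ℓ ∣ v ∧ y → y ≢ 0ω → y ≢ v → y ≢ ⊝ v → N v ℕ.< N y
  minimal y ℓ∣ y≢0 y≢v y≢-v = case decompose y ℓ∣ of λ where
      (i , j , refl) → case ℤ.∣ j ∣ ℕ.≟ 0 of λ where
        (yes ∣j∣≡0) → multiple i j (ℤ.∣i∣≡0⇒i≡0 ∣j∣≡0) y≢0 y≢v y≢-v
        (no  ∣j∣≢0) → ℕ.+-cancelʳ-< (N v ℕ.* (ℤ.∣ i ∣ ℕ.* ℤ.∣ j ∣)) (N v) _ (begin-strict
          N v ℕ.+ N v ℕ.* (ℤ.∣ i ∣ ℕ.* ℤ.∣ j ∣)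
            ≡⟨ ℕ.*-suc (N v) (ℤ.∣ i ∣ ℕ.* ℤ.∣ j ∣) ⟨
          N v ℕ.* suc (ℤ.∣ i ∣ ℕ.* ℤ.∣ j ∣)
            ≤⟨ ℕ.*-monoʳ-≤ (N v) (xy<x²+y² ℤ.∣ i ∣ ℤ.∣ j ∣ ∣j∣≢0) ⟩
          N v ℕ.* (ℤ.∣ i ∣ ℕ.* ℤ.∣ i ∣ ℕ.+ ℤ.∣ j ∣ ℕ.* ℤ.∣ j ∣)
            ≡⟨ ℕ.*-distribˡ-+ (N v) (ℤ.∣ i ∣ ℕ.* ℤ.∣ i ∣) (ℤ.∣ j ∣ ℕ.* ℤ.∣ j ∣) ⟩
          N v ℕ.* (ℤ.∣ i ∣ ℕ.* ℤ.∣ i ∣) ℕ.+ N v ℕ.* (ℤ.∣ j ∣ ℕ.* ℤ.∣ j ∣)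
            <⟨ ℕ.+-monoʳ-< (N v ℕ.* (ℤ.∣ i ∣ ℕ.* ℤ.∣ i ∣)) (ℕ.*-monoˡ-< (ℤ.∣ j ∣ ℕ.* ℤ.∣ j ∣) {{jj≢0 ∣j∣≢0}} N<Nŵ) ⟩
          N v ℕ.* (ℤ.∣ i ∣ ℕ.* ℤ.∣ i ∣) ℕ.+ N ŵ ℕ.* (ℤ.∣ j ∣ ℕ.* ℤ.∣ j ∣)
            ≤⟨ norm-lower-bound {v} {ŵ} i j (proj₂ (reduced-vector ℓ v w)) ⟩
          N (i • v ⊕ j • ŵ) ℕ.+ N v ℕ.* (ℤ.∣ i ∣ ℕ.* ℤ.∣ j ∣) ∎)
    where
    open ℕ.≤-Reasoning
    jj≢0 : ∀ {n} → n ≢ 0 → ℕ.NonZero (n ℕ.* n)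
    jj≢0 {zero}  n≢0 = contradiction refl n≢0
    jj≢0 {suc n} _   = _
    multiple : ∀ i j → j ≡ + 0 → let y = i • v ⊕ j • ŵ in y ≢ 0ω → y ≢ v → y ≢ ⊝ v → N v ℕ.< N y
    multiple i _ refl y≢0 y≢v y≢-v = subst (N v ℕ.<_) (sym N≡) (bound ℤ.∣ i ∣ refl)
      where
      y≡ : i • v ⊕ + 0 • ŵ ≡ i • v
      y≡ = ⊕-identityʳ (i • v)
      N≡ : N (i • v ⊕ + 0 • ŵ) ≡ ℤ.∣ i ∣ ℕ.* ℤ.∣ i ∣ ℕ.* N v
      N≡ = trans (cong N y≡) (trans (cong ℤ.∣_∣ (norm-• i v)) (trans (ℤ.abs-* (i ℤ.* i) (norm v)) (cong (ℕ._* N v) (ℤ.abs-* i i))))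
      bound : ∀ k → ℤ.∣ i ∣ ≡ k → N v ℕ.< k ℕ.* k ℕ.* N v
      bound 0 eq = contradiction (trans y≡ (cong (_• v) (ℤ.∣i∣≡0⇒i≡0 {i} eq))) y≢0
      bound 1 eq = case ∣i∣≡1⇒i≡±1 i eq of λ where
        (inj₁ i≡1)  → contradiction (trans y≡ (trans (cong (_• v) i≡1) (1• v))) y≢v
        (inj₂ i≡-1) → contradiction (trans y≡ (trans (cong (_• v) i≡-1) (-1• v))) y≢-v
      bound (suc (suc k)) _ = ℕ.<-≤-trans (ℕ.m<m+n (N v) {N v ℕ.+ 0} (ℕ.≤-trans (ℕ.<⇒≤ 1<N) (ℕ.m≤m+n (N v) 0)))
        (ℕ.*-monoˡ-≤ (N v) {2} {suc (suc k) ℕ.* suc (suc k)} (ℕ.≤-trans (ℕ.s≤s (ℕ.s≤s ℕ.z≤n)) (ℕ.m≤m*n (suc (suc k)) (suc (suc k)))))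

-- The 3-and-1 form of a shortest vector

open ℝ-Solver using (Polynomial)

-- Cramer's rule. The inverse of the determinant is an argument, since a merely negative statement
-- that the determinant is nonzero does not produce one constructively.
det-invertible⇒basis : ∀ {b₁ b₂} r → r * det b₁ b₂ ≈ 1ℝ → IsBasis b₁ b₂
det-invertible⇒basis {b₁@(x₁ , y₁)} {b₂@(x₂ , y₂)} r inverse = record
  { spanning    = λ x → r * det x b₂ , r * det b₁ x ,
      (span₁ (proj₁ x) (proj₂ x) , span₂ (proj₁ x) (proj₂ x))
  ; independent = λ p q (eq₁ , eq₂) →
      ≈-trans (cramer p (det (p · b₁ +₂ q · b₂) b₂) (identity₃ p q x₁ y₁ x₂ y₂)) (kill (vanish₁ eq₁ eq₂)) ,
      ≈-trans (cramer q (det b₁ (p · b₁ +₂ q · b₂)) (identity₄ p q x₁ y₁ x₂ y₂)) (kill (vanish₂ eq₁ eq₂))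
  }
  where
  open ℝ-Reasoning
  D : ℝ
  D = det b₁ b₂
  identity₁ : ∀ r x y x₁ y₁ x₂ y₂ → r * (x₁ * y₂ - y₁ * x₂) * x ≈ (r * (x * y₂ - y * x₂)) * x₁ + (r * (x₁ * y - y₁ * x)) * x₂
  identity₁ = solve 7 (λ r x y x₁ y₁ x₂ y₂ → r :* (x₁ :* y₂ :- y₁ :* x₂) :* x :=
    (r :* (x :* y₂ :- y :* x₂)) :* x₁ :+ (r :* (x₁ :* y :- y₁ :* x)) :* x₂) ≈-refl
  identity₂ : ∀ r x y x₁ y₁ x₂ y₂ → r * (x₁ * y₂ - y₁ * x₂) * y ≈ (r * (x * y₂ - y * x₂)) * y₁ + (r * (x₁ * y - y₁ * x)) * y₂
  identity₂ = solve 7 (λ r x y x₁ y₁ x₂ y₂ → r :* (x₁ :* y₂ :- y₁ :* x₂) :* y :=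
    (r :* (x :* y₂ :- y :* x₂)) :* y₁ :+ (r :* (x₁ :* y :- y₁ :* x)) :* y₂) ≈-refl
  span₁ : ∀ x y → x ≈ (r * det (x , y) b₂) * x₁ + (r * det b₁ (x , y)) * x₂
  span₁ x y = ≈-trans (≈-sym (1*x≈x x)) (≈-trans (*-cong (≈-sym inverse) (≈-refl {x})) (identity₁ r x y x₁ y₁ x₂ y₂))
  span₂ : ∀ x y → y ≈ (r * det (x , y) b₂) * y₁ + (r * det b₁ (x , y)) * y₂
  span₂ x y = ≈-trans (≈-sym (1*x≈x y)) (≈-trans (*-cong (≈-sym inverse) (≈-refl {y})) (identity₂ r x y x₁ y₁ x₂ y₂))
  identity₃ : ∀ p q x₁ y₁ x₂ y₂ → (x₁ * y₂ - y₁ * x₂) * p ≈ (p * x₁ + q * x₂) * y₂ - (p * y₁ + q * y₂) * x₂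
  identity₃ = solve 6 (λ p q x₁ y₁ x₂ y₂ → (x₁ :* y₂ :- y₁ :* x₂) :* p :=
    (p :* x₁ :+ q :* x₂) :* y₂ :- (p :* y₁ :+ q :* y₂) :* x₂) ≈-refl
  identity₄ : ∀ p q x₁ y₁ x₂ y₂ → (x₁ * y₂ - y₁ * x₂) * q ≈ x₁ * (p * y₁ + q * y₂) - y₁ * (p * x₁ + q * x₂)
  identity₄ = solve 6 (λ p q x₁ y₁ x₂ y₂ → (x₁ :* y₂ :- y₁ :* x₂) :* q :=
    x₁ :* (p :* y₁ :+ q :* y₂) :- y₁ :* (p :* x₁ :+ q :* x₂)) ≈-refl
  cramer : ∀ p y → D * p ≈ y → p ≈ r * y
  cramer p y Dp≈y = ≈-trans (≈-sym (1*x≈x p)) (≈-trans (*-cong (≈-sym inverse) (≈-refl {p}))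
    (≈-trans (*-assoc r D p) (*-cong (≈-refl {r}) Dp≈y)))
    where
    *-assoc : ∀ x y z → (x * y) * z ≈ x * (y * z)
    *-assoc = solve 3 (λ x y z → (x :* y) :* z := x :* (y :* z)) ≈-refl
  zeros : ∀ x y → 0ℝ * x - 0ℝ * y ≈ 0ℝ
  zeros = solve 2 (λ x y → con 0ℚ :* x :- con 0ℚ :* y := con 0ℚ) ≈-refl
  zeros′ : ∀ x y → x * 0ℝ - y * 0ℝ ≈ 0ℝ
  zeros′ = solve 2 (λ x y → x :* con 0ℚ :- y :* con 0ℚ := con 0ℚ) ≈-refl
  vanish₁ : ∀ {x y} → x ≈ 0ℝ → y ≈ 0ℝ → x * y₂ - y * x₂ ≈ 0ℝ
  vanish₁ x≈0 y≈0 = ≈-trans (minus-cong (*-cong x≈0 (≈-refl {y₂})) (*-cong y≈0 (≈-refl {x₂}))) (zeros y₂ x₂)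
  vanish₂ : ∀ {x y} → x ≈ 0ℝ → y ≈ 0ℝ → x₁ * y - y₁ * x ≈ 0ℝ
  vanish₂ x≈0 y≈0 = ≈-trans (minus-cong (*-cong (≈-refl {x₁}) y≈0) (*-cong (≈-refl {y₁}) x≈0)) (zeros′ x₁ y₁)
  kill : ∀ {x} → x ≈ 0ℝ → r * x ≈ 0ℝ
  kill x≈0 = ≈-trans (*-cong (≈-refl {r}) x≈0) (x*0≈0 r)

A-⊝ : ∀ x → A (-₂ x) ≈ A x
A-⊝ (x , y) = solve 2 (λ x y → (:- x) :* (:- x) :+ (:- y) :* (:- y) := x :* x :+ y :* y) ≈-refl x y

-- 1, ω and 1 + ω = -ω²
hexagon : Fin 3 → ℤ[ω]
hexagon zero             = + 1 , + 0
hexagon (suc zero)       = + 0 , + 1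
hexagon (suc (suc zero)) = + 1 , + 1

hexagon-norm : ∀ i → norm (hexagon i) ≡ + 1
hexagon-norm zero             = refl
hexagon-norm (suc zero)       = refl
hexagon-norm (suc (suc zero)) = refl

hexagon-distinct : ∀ i j → i ≢ j → ¬ (hexagon i ≡ hexagon j ⊎ hexagon i ≡ ⊝ hexagon j)
hexagon-distinct zero             zero             i≢j _ = i≢j refl
hexagon-distinct (suc zero)       (suc zero)       i≢j _ = i≢j refl
hexagon-distinct (suc (suc zero)) (suc (suc zero)) i≢j _ = i≢j refl
hexagon-distinct zero             (suc zero)       _ (inj₁ ())
hexagon-distinct zero             (suc zero)       _ (inj₂ ())
hexagon-distinct zero             (suc (suc zero)) _ (inj₁ ())
hexagon-distinct zero             (suc (suc zero)) _ (inj₂ ())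
hexagon-distinct (suc zero)       zero             _ (inj₁ ())
hexagon-distinct (suc zero)       zero             _ (inj₂ ())
hexagon-distinct (suc zero)       (suc (suc zero)) _ (inj₁ ())
hexagon-distinct (suc zero)       (suc (suc zero)) _ (inj₂ ())
hexagon-distinct (suc (suc zero)) zero             _ (inj₁ ())
hexagon-distinct (suc (suc zero)) zero             _ (inj₂ ())
hexagon-distinct (suc (suc zero)) (suc zero)       _ (inj₁ ())
hexagon-distinct (suc (suc zero)) (suc zero)       _ (inj₂ ())

norm≡1⇒hexagon : ∀ v → norm v ≡ + 1 → ∃ λ i → v ≡ hexagon i ⊎ v ≡ ⊝ hexagon i
norm≡1⇒hexagon v eq = All.lookup cases (norm≡1⇒∈units v eq)
  where
  cases : All (λ v → ∃ λ i → v ≡ hexagon i ⊎ v ≡ ⊝ hexagon i) units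
  cases = (zero , inj₁ refl) ∷ (zero , inj₂ refl) ∷ (suc zero , inj₁ refl) ∷ (suc zero , inj₂ refl)
    ∷ (suc (suc zero) , inj₂ refl) ∷ (suc (suc zero) , inj₁ refl) ∷ []

v≡⊝v⇒≡0 : ∀ v → v ≡ ⊝ v → v ≡ 0ω
v≡⊝v⇒≡0 (a , b) eq = cong₂ _,_ (vanishes a (cong proj₁ eq)) (vanishes b (cong proj₂ eq))
  where
  vanishes : ∀ i → i ≡ ℤ.- i → i ≡ + 0
  vanishes (+ 0)        _ = refl
  vanishes (ℤ.+[1+ _ ]) ()
  vanishes -[1+ _ ]     ()

open √ using (root; root-isSqrt)

module Construct {ℓ : ℕ} {v : ℤ[ω]} (ℓ-prime : Prime ℓ) (v∈ : InRange ℓ v) (v-shortest : Shortest ℓ v)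
  (√3 : ℝ) (√3-eq : IsSqrt (fromℕ 3) √3) (τ : ℝ) (τ-sqrt : IsSqrt (fromℕ (N v)) τ) where

  open Reduced {ℓ} {v} ℓ-prime v∈ v-shortest

  e₁ e₂ : ℝ²
  e₁ = 1ℝ , 0ℝ
  e₂ = fromℚ (ℚ.- ½) , fromℚ ½ * √3

  frame : HexagonalFrame e₁ e₂
  frame = ω-frame √3-eq

  open Frame frame

  -- `S` and `S′` are written in the shape that `ConsistsOfPairs` demands, with `Fin 1` for the
  -- single pair, so that both pair conditions hold by identity.
  L M S S′ : Subset
  L = ℤ-Span e₁ e₂
  M x  = ∃ λ y → + ℓ ∣ v ∧ y × x ≈₂ E y
  S x  = ∃ λ i → x ≈₂ E (hexagon i) ⊎ x ≈₂ -₂ E (hexagon i)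
  S′ x = ∃ λ (i : Fin 1) → x ≈₂ E v ⊎ x ≈₂ -₂ E v

  E-injective′ : ∀ {y z x} → x ≈₂ E y → x ≈₂ E z → y ≡ z
  E-injective′ {y} {z} x≈y x≈z = E-injective y z (≈₂-trans (≈₂-sym x≈y) x≈z)

  ≈⊝ : ∀ {x y} → x ≈₂ -₂ E y → x ≈₂ E (⊝ y)
  ≈⊝ {y = y} x≈ = ≈₂-trans x≈ (≈₂-sym (E-⊝ y))

  A≈norm : ∀ {x y} → x ≈₂ E y → A x ≈ fromℕ (N y)
  A≈norm {y = y} x≈ = ≈-trans (A-cong x≈) (≈-trans (A-E y) (≡⇒≈ (cong fromℤ (norm≡N y))))

  1·_ : ∀ x → 1ℝ · x ≈₂ x
  1· (x , y) = 1*x≈x x , 1*x≈x y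

  D² : det e₁ e₂ * det e₁ e₂ ≈ fromℚ ¾
  D² = ≈-trans (*-cong (ω-det √3) (ω-det √3)) (ω-det² √3-eq)

  L-basis : IsBasis e₁ e₂
  -- The determinant has square ¾, so its inverse is 4/3 times itself.
  L-basis = det-invertible⇒basis (fromℚ (+ 4 ℚ./ 3) * det e₁ e₂)
    (≈-trans (assoc (det e₁ e₂)) (≈-trans (*-cong (≈-refl {fromℚ (+ 4 ℚ./ 3)}) D²)
      (solve 0 (con (+ 4 ℚ./ 3) :* con ¾ := con 1ℚ) ≈-refl)))
    where
    assoc : ∀ d → fromℚ (+ 4 ℚ./ 3) * d * d ≈ fromℚ (+ 4 ℚ./ 3) * (d * d)
    assoc = solve 1 (λ d → con (+ 4 ℚ./ 3) :* d :* d := con (+ 4 ℚ./ 3) :* (d :* d)) ≈-refl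

  0<ℓ/1 : 0ℚ ℚ.< + ℓ ℚ./ 1
  0<ℓ/1 = /1-mono-< {+ 0} {+ ℓ} (ℤ.+<+ (0<ℓ ℓ-prime))

  1/ℓ : ℚ
  1/ℓ = ℚ.1/_ (+ ℓ ℚ./ 1) {{ℚ.>-nonZero 0<ℓ/1}}

  M-basis : IsBasis (E v) (E ŵ)
  M-basis = det-invertible⇒basis (fromℚ 1/ℓ * (fromℚ (+ 4 ℚ./ 3) * det e₁ e₂)) (begin
    fromℚ 1/ℓ * (fromℚ (+ 4 ℚ./ 3) * det e₁ e₂) * det (E v) (E ŵ)
      ≈⟨ *-cong (≈-refl {fromℚ 1/ℓ * (fromℚ (+ 4 ℚ./ 3) * det e₁ e₂)})
           (≈-trans (det-E v ŵ) (*-cong (≡⇒≈ (cong fromℤ v∧ŵ)) (≈-refl {det e₁ e₂}))) ⟩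
    fromℚ 1/ℓ * (fromℚ (+ 4 ℚ./ 3) * det e₁ e₂) * (fromℕ ℓ * det e₁ e₂)
      ≈⟨ solve 3 (λ r l d →
          r :* (con (+ 4 ℚ./ 3) :* d) :* (l :* d) :=
          l :* r :* (con (+ 4 ℚ./ 3) :* (d :* d)))
          ≈-refl (fromℚ 1/ℓ) (fromℕ ℓ) (det e₁ e₂) ⟩
    fromℕ ℓ * fromℚ 1/ℓ * (fromℚ (+ 4 ℚ./ 3) * (det e₁ e₂ * det e₁ e₂))
      ≈⟨ *-cong (pointwise λ _ → ℚ.*-inverseʳ (+ ℓ ℚ./ 1) {{ℚ.>-nonZero 0<ℓ/1}}) (*-cong (≈-refl {fromℚ (+ 4 ℚ./ 3)}) D²) ⟩
    1ℝ * (fromℚ (+ 4 ℚ./ 3) * fromℚ ¾)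
      ≈⟨ solve 0 (con 1ℚ :* (con (+ 4 ℚ./ 3) :* con ¾) := con 1ℚ) ≈-refl ⟩
    1ℝ ∎)
    where
    open ℝ-Reasoning

  E-combination : ∀ i j → E (i • v ⊕ j • ŵ) ≈₂ fromℤ i · E v +₂ fromℤ j · E ŵ
  E-combination i j = ≈₂-trans (E-⊕ (i • v) (j • ŵ)) (+₂-cong (E-• i v) (E-• j ŵ))

  M⇔span : ∀ x → M x ⇔ ℤ-Span (E v) (E ŵ) x
  M⇔span x = mk⇔
    (λ (y , ℓ∣ , x≈) → case decompose y ℓ∣ of λ where
      (i , j , y≡) → i , j , ≈₂-trans x≈ (≈₂-trans (E-cong y≡) (E-combination i j)))
    (λ (i , j , x≈) → i • v ⊕ j • ŵ , combination∈ i j , ≈₂-trans x≈ (≈₂-sym (E-combination i j)))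

  M⊆L : ∀ {x} → M x → L x
  M⊆L ((a , b) , _ , x≈) = a , b , x≈

  private instance
    ℓ≢0 : ℕ.NonZero ℓ
    ℓ≢0 = prime⇒nonZero ℓ-prime

  -- As `v ∧ w` is 1, taking the determinant with `v` sends these multiples of `w` to 0, ..., ℓ - 1,
  -- which identifies the cosets with the residues modulo ℓ.
  representative : Fin ℓ → ℤ[ω]
  representative i = + toℕ i • w

  v∧shift : ∀ y i → v ∧ (y ⊖ representative i) ≡ v ∧ y ℤ.- + toℕ i
  v∧shift y i = trans (∧-⊖ v y (representative i)) (cong (λ z → v ∧ y ℤ.- z)
    (trans (∧-•ʳ v (+ toℕ i) w) (trans (cong (+ toℕ i ℤ.*_) v∧w) (ℤ.*-identityʳ (+ toℕ i)))))

  residue : ℤ[ω] → Fin ℓ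
  residue y = fromℕ< {v ∧ y ℤ.%ℕ ℓ} (ℤ.n%ℕd<d (v ∧ y) ℓ)

  residue-correct : ∀ y → + ℓ ∣ v ∧ (y ⊖ representative (residue y))
  residue-correct y = divides (v ∧ y ℤ./ℕ ℓ) (trans (v∧shift y (residue y)) (trans
    (cong (λ k → v ∧ y ℤ.- + k) (Fin.toℕ-fromℕ< (ℤ.n%ℕd<d (v ∧ y) ℓ)))
    (trans (cong (ℤ._- + (v ∧ y ℤ.%ℕ ℓ)) (ℤ.a≡a%ℕn+[a/ℕn]*n (v ∧ y) ℓ))
      (cancel (+ (v ∧ y ℤ.%ℕ ℓ)) (v ∧ y ℤ./ℕ ℓ ℤ.* + ℓ)))))
    where
    cancel : ∀ a b → a ℤ.+ b ℤ.- a ≡ b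
    cancel = ℤ-Solver.solve-∀

  residue-unique : ∀ y i j → + ℓ ∣ v ∧ (y ⊖ representative i) → + ℓ ∣ v ∧ (y ⊖ representative j) → i ≡ j
  residue-unique y i j ℓ∣i ℓ∣j = Fin.toℕ-injective (ℤ.+-injective (ℤ.i-j≡0⇒i≡j (+ toℕ i) (+ toℕ j)
    (ℤ.∣i∣≡0⇒i≡0 (case ℤ.∣ + toℕ i ℤ.- + toℕ j ∣ ℕ.≟ 0 of λ where
      (yes ≡0) → ≡0
      (no  ≢0) → contradiction (ℕ.∣⇒≤ {{ℕ.≢-nonZero ≢0}} (ℤ∣.∣⇒∣ᵤ {+ ℓ} {+ toℕ i ℤ.- + toℕ j} ℓ∣i-j)) (ℕ.<⇒≱ small)))))
    where
    identity : ∀ q i j → (q ℤ.- j) ℤ.- (q ℤ.- i) ≡ i ℤ.- j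
    identity = ℤ-Solver.solve-∀
    ℓ∣i-j : + ℓ ∣ + toℕ i ℤ.- + toℕ j
    ℓ∣i-j = subst (+ ℓ ∣_) (trans (cong₂ ℤ._-_ (v∧shift y j) (v∧shift y i)) (identity (v ∧ y) (+ toℕ i) (+ toℕ j)))
      (ℤ∣.∣m∣n⇒∣m-n ℓ∣j ℓ∣i)
    small : ℤ.∣ + toℕ i ℤ.- + toℕ j ∣ ℕ.< ℓ
    small = ℕ.≤-<-trans (subst (λ z → ℤ.∣ z ∣ ℕ.≤ toℕ i ℕ.⊔ toℕ j) (sym (ℤ.m-n≡m⊖n (toℕ i) (toℕ j))) (ℤ.∣m⊝n∣≤m⊔n (toℕ i) (toℕ j)))
      (ℕ.⊔-lub (Fin.toℕ<n i) (Fin.toℕ<n j))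

  index : HasIndex L M ℓ
  index = (λ i → E (representative i)) ,
    (λ i → proj₁ (representative i) , proj₂ (representative i) , ≈₂-refl) ,
    λ x (a , b , x≈) → let
        difference : ∀ i → x -₂ E (representative i) ≈₂ E ((a , b) ⊖ representative i)
        difference i = ≈₂-trans (+₂-cong x≈ (≈₂-refl { -₂ E (representative i)})) (≈₂-sym (E-⊖ (a , b) (representative i)))
      in residue (a , b) ,
         ((a , b) ⊖ representative (residue (a , b)) , residue-correct (a , b) , difference (residue (a , b))) ,
         λ {j} (y , ℓ∣y , eq) → residue-unique (a , b) (residue (a , b)) j (residue-correct (a , b))
           (subst (λ y → + ℓ ∣ v ∧ y) (E-injective′ {y} {(a , b) ⊖ representative j} eq (difference j)) ℓ∣y)

  L₁⇒ : ∀ {x} → scale 1ℝ L x → ∃ λ y → x ≈₂ E y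
  L₁⇒ (z , (a , b , z≈) , x≈) = (a , b) , ≈₂-trans x≈ (≈₂-trans (1· z) z≈)

  M₁⇒ : ∀ {x} → scale 1ℝ M x → ∃ λ y → + ℓ ∣ v ∧ y × x ≈₂ E y
  M₁⇒ (z , (y , ℓ∣ , z≈) , x≈) = y , ℓ∣ , ≈₂-trans x≈ (≈₂-trans (1· z) z≈)

  ⇒L₁ : ∀ {x} y → x ≈₂ E y → scale 1ℝ L x
  ⇒L₁ {x} (a , b) x≈ = x , (a , b , x≈) , ≈₂-sym (1· x)

  ⇒M₁ : ∀ {x} y → + ℓ ∣ v ∧ y → x ≈₂ E y → scale 1ℝ M x
  ⇒M₁ {x} y ℓ∣ x≈ = x , (y , ℓ∣ , x≈) , ≈₂-sym (1· x)

  S⇒ : ∀ {x} → S x → ∃ λ y → norm y ≡ + 1 × x ≈₂ E y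
  S⇒ (i , inj₁ x≈) = hexagon i , hexagon-norm i , x≈
  S⇒ (i , inj₂ x≈) = ⊝ hexagon i , trans (norm-⊝ (hexagon i)) (hexagon-norm i) , ≈⊝ {y = hexagon i} x≈

  S′⇒ : ∀ {x} → S′ x → ∃ λ y → (y ≡ v ⊎ y ≡ ⊝ v) × x ≈₂ E y
  S′⇒ (_ , inj₁ x≈) = v , inj₁ refl , x≈
  S′⇒ (_ , inj₂ x≈) = ⊝ v , inj₂ refl , ≈⊝ {y = v} x≈

  ≡v⇒S′ : ∀ {x y} → y ≡ v → x ≈₂ E y → S′ x
  ≡v⇒S′ refl x≈ = zero , inj₁ x≈

  ≡⊝v⇒S′ : ∀ {x y} → y ≡ ⊝ v → x ≈₂ E y → S′ x
  ≡⊝v⇒S′ refl x≈ = zero , inj₂ (≈₂-trans x≈ (E-⊝ v))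

  ±v-divisible : ∀ {y} → y ≡ v ⊎ y ≡ ⊝ v → + ℓ ∣ v ∧ y
  ±v-divisible (inj₁ refl) = divides (+ 0) (∧-self v)
  ±v-divisible (inj₂ refl) = divides (+ 0) (trans (∧-⊝ v v) (cong ℤ.-_ (∧-self v)))

  N±v : ∀ {y} → y ≡ v ⊎ y ≡ ⊝ v → N y ≡ N v
  N±v (inj₁ refl) = refl
  N±v (inj₂ refl) = cong ℤ.∣_∣ (norm-⊝ v)

  N≡1⇒∤ : ∀ {y} → N y ≡ 1 → ¬ (+ ℓ ∣ v ∧ y)
  N≡1⇒∤ {y} N≡1 ℓ∣ = ℕ.<-asym 1<N (subst (N v ℕ.<_) N≡1 (minimal y ℓ∣
    (λ y≡0 → contradiction (trans (sym N≡1) (cong N y≡0)) λ ())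
    (λ y≡v → ℕ.<-irrefl (trans (sym N≡1) (cong N y≡v)) 1<N)
    (λ y≡-v → ℕ.<-irrefl (trans (sym N≡1) (N±v (inj₂ y≡-v))) 1<N)))

  S-respects : ∀ {x y} → x ≈₂ y → S x → S y
  S-respects x≈y (i , p) = i , Sum.map (≈₂-trans (≈₂-sym x≈y)) (≈₂-trans (≈₂-sym x≈y)) p

  S′-respects : ∀ {x y} → x ≈₂ y → S′ x → S′ y
  S′-respects x≈y (i , p) = i , Sum.map (≈₂-trans (≈₂-sym x≈y)) (≈₂-trans (≈₂-sym x≈y)) p

  L₁-S : ∀ x → S x → scale 1ℝ L x × ¬ scale 1ℝ M x
  L₁-S x x∈S = case S⇒ x∈S of λ where
    (y , norm≡1 , x≈) → ⇒L₁ y x≈ , λ x∈M → case M₁⇒ x∈M of λ where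
      (z , ℓ∣z , x≈z) → N≡1⇒∤ {z} (trans (cong N (E-injective′ {z} {y} x≈z x≈)) (cong ℤ.∣_∣ norm≡1)) ℓ∣z

  M₁-S′ : ∀ x → S′ x → scale 1ℝ M x × ¬ (x ≈₂ 0₂)
  M₁-S′ x x∈S′ = case S′⇒ x∈S′ of λ where
    (y , y≡ , x≈) → ⇒M₁ y (±v-divisible y≡) x≈ ,
      λ x≈0 → ℕ.<-irrefl (sym (trans (sym (N±v y≡))
        (cong N (E-injective₀ y (≈₂-trans (≈₂-sym x≈) x≈0))))) (ℕ.<-trans (ℕ.s≤s ℕ.z≤n) 1<N)

  satisfies : Satisfies (scale 1ℝ L) (scale 1ℝ M) S S′ A (fromℕ (N v))
  satisfies = record
    { on-S = λ x x∈S → case S⇒ x∈S of λ where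
        (y , norm≡1 , x≈) → ≈-trans (A≈norm {y = y} x≈) (≡⇒≈ (cong fromℕ (cong ℤ.∣_∣ norm≡1)))
    ; off-S = λ x x∈L x∉M x∉S → case L₁⇒ x∈L of λ where
        (y , x≈) → <-resp-≈ (≈-refl {1ℝ}) (≈-sym (A≈norm {y = y} x≈))
          (fromℤ-mono-< {+ 1} {+ N y} (ℤ.+<+ (1<Ny y x≈ x∉M x∉S)))
    ; on-S′ = fromℤ-mono-≤ {+ 1} {+ N v} (ℤ.+≤+ (ℕ.<⇒≤ 1<N)) , λ x x∈S′ → case S′⇒ x∈S′ of λ where
        (y , y≡ , x≈) → ≈-trans (A≈norm {y = y} x≈) (≡⇒≈ (cong fromℕ (N±v y≡)))
    ; off-S′ = λ x x∈M x≉0 x∉S′ → case M₁⇒ x∈M of λ where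
        (y , ℓ∣y , x≈) → <-resp-≈ (≈-refl {fromℕ (N v)}) (≈-sym (A≈norm {y = y} x≈))
          (fromℤ-mono-< {+ N v} {+ N y} (ℤ.+<+ (minimal y ℓ∣y
            (λ y≡0 → x≉0 (≈₂-trans x≈ (≈₂-trans (E-cong y≡0) (E-0))))
            (λ y≡v → x∉S′ (≡v⇒S′ y≡v x≈))
            (λ y≡-v → x∉S′ (≡⊝v⇒S′ y≡-v x≈)))))
    }
    where
    1<Ny : ∀ {x} y → x ≈₂ E y → ¬ scale 1ℝ M x → ¬ S x → 1 ℕ.< N y
    1<Ny y x≈ x∉M x∉S = ℕ.≤∧≢⇒<
      (N>0 {y} λ y≡0 → x∉M (⇒M₁ y (subst (λ y → + ℓ ∣ v ∧ y) (sym y≡0) (divides (+ 0) (zero-∧ v))) x≈))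
      (λ 1≡N → x∉S (case norm≡1⇒hexagon y (trans (norm≡N y) (cong +_ (sym 1≡N))) of λ where
        (i , inj₁ refl) → i , inj₁ x≈
        (i , inj₂ refl) → i , inj₂ (≈₂-trans x≈ (E-⊝ (hexagon i)))))

  -- The three coefficients of a form are determined by its values at 1, ω and 1 + ω: a is the first
  -- value, while 3b and 3c come from the difference and the sum of the other two.
  perfect : ∀ B u′ → PositiveDefinite B → Satisfies (scale 1ℝ L) (scale 1ℝ M) S S′ (eval B) u′ →
    (∀ x → eval B x ≈ A x) × u′ ≈ fromℕ (N v)
  perfect B@(a , b , c) u′ _ sat = B≈A ,
    ≈-trans (≈-sym (proj₂ (Satisfies.on-S′ sat) (E v) v∈S′)) (≈-trans (B≈A (E v)) (proj₂ (Satisfies.on-S′ satisfies) (E v) v∈S′))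
    where
    v∈S′ : S′ (E v)
    v∈S′ = zero , inj₁ ≈₂-refl
    on-hexagon : ∀ i → eval B (E (hexagon i)) ≈ 1ℝ
    on-hexagon i = Satisfies.on-S sat (E (hexagon i)) (i , inj₁ ≈₂-refl)
    X Y Z : ℝ
    X = eval B (E (hexagon zero))
    Y = eval B (E (hexagon (suc zero)))
    Z = eval B (E (hexagon (suc (suc zero))))
    3ℚ : ℚ
    3ℚ = + 3 ℚ./ 1
    -- The value of the form at `E (p , q)`, spelled out so that the solver sees a polynomial in its
    -- coefficients and √3.
    expand : ℝ → ℝ → ℝ → ℝ → ℝ → ℝ → ℝ
    expand a b c s p q = a * ((p * 1ℝ + q * fromℚ (ℚ.- ½)) * (p * 1ℝ + q * fromℚ (ℚ.- ½)))
      + b * ((p * 1ℝ + q * fromℚ (ℚ.- ½)) * (p * 0ℝ + q * (fromℚ ½ * s)))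
      + c * ((p * 0ℝ + q * (fromℚ ½ * s)) * (p * 0ℝ + q * (fromℚ ½ * s)))
    poly : ∀ {n} (a b c s p q : Polynomial n) → Polynomial n
    poly a b c s p q = a :* ((p :* con 1ℚ :+ q :* con (ℚ.- ½)) :* (p :* con 1ℚ :+ q :* con (ℚ.- ½)))
        :+ b :* ((p :* con 1ℚ :+ q :* con (ℚ.- ½)) :* (p :* con 0ℚ :+ q :* (con ½ :* s)))
        :+ c :* ((p :* con 0ℚ :+ q :* (con ½ :* s)) :* (p :* con 0ℚ :+ q :* (con ½ :* s)))
    a-identity : ∀ a b c s → a ≈ expand a b c s (fromℤ (+ 1)) (fromℤ (+ 0))
    a-identity = solve 4 (λ a b c s → a := poly a b c s (con 1ℚ) (con 0ℚ)) ≈-refl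
    b-identity : ∀ a b c s → b * (s * s) ≈ 2ℝ * s * (expand a b c s (fromℤ (+ 1)) (fromℤ (+ 1)) - expand a b c s (fromℤ (+ 0)) (fromℤ (+ 1)))
    b-identity = solve 4 (λ a b c s →
        b :* (s :* s) :=
        con (+ 2 ℚ./ 1) :* s :* (poly a b c s (con 1ℚ) (con 1ℚ) :- poly a b c s (con 0ℚ) (con 1ℚ)))
        ≈-refl
    c-identity : ∀ a b c s → c * (s * s) ≈ 2ℝ * (expand a b c s (fromℤ (+ 0)) (fromℤ (+ 1)) + expand a b c s (fromℤ (+ 1)) (fromℤ (+ 1))) - a
    c-identity = solve 4 (λ a b c s →
        c :* (s :* s) :=
        con (+ 2 ℚ./ 1) :* (poly a b c s (con 0ℚ) (con 1ℚ) :+ poly a b c s (con 1ℚ) (con 1ℚ)) :- a)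
        ≈-refl
    a≈1 : a ≈ 1ℝ
    a≈1 = ≈-trans (a-identity a b c √3) (on-hexagon zero)
    third : ∀ x y → x * (√3 * √3) ≈ y → x ≈ fromℚ (+ 1 ℚ./ 3) * y
    third x y eq = ≈-trans (divide x) (*-cong (≈-refl {fromℚ (+ 1 ℚ./ 3)})
      (≈-trans (*-cong (≈-refl {x}) (≈-sym (proj₂ √3-eq))) eq))
      where
      divide : ∀ x → x ≈ fromℚ (+ 1 ℚ./ 3) * (x * fromℕ 3)
      divide = solve 1 (λ x → x := con (+ 1 ℚ./ 3) :* (x :* con 3ℚ)) ≈-refl
    b≈0 : b ≈ 0ℝ
    b≈0 = ≈-trans (third b (2ℝ * √3 * (Z - Y)) (b-identity a b c √3)) (≈-trans
      (*-cong (≈-refl {fromℚ (+ 1 ℚ./ 3)}) (*-cong (≈-refl {2ℝ * √3}) (minus-cong (on-hexagon (suc (suc zero))) (on-hexagon (suc zero)))))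
      (vanishes √3))
      where
      vanishes : ∀ s → fromℚ (+ 1 ℚ./ 3) * (2ℝ * s * (1ℝ - 1ℝ)) ≈ 0ℝ
      vanishes = solve 1 (λ s → con (+ 1 ℚ./ 3) :* (con (+ 2 ℚ./ 1) :* s :* (con 1ℚ :- con 1ℚ)) := con 0ℚ) ≈-refl
    c≈1 : c ≈ 1ℝ
    c≈1 = ≈-trans (third c (2ℝ * (Y + Z) - a) (c-identity a b c √3)) (≈-trans
      (*-cong (≈-refl {fromℚ (+ 1 ℚ./ 3)}) (minus-cong (*-cong (≈-refl {2ℝ}) (+-cong (on-hexagon (suc zero)) (on-hexagon (suc (suc zero))))) a≈1))
      (solve 0 (con (+ 1 ℚ./ 3) :* (con (+ 2 ℚ./ 1) :* (con 1ℚ :+ con 1ℚ) :- con 1ℚ) := con 1ℚ) ≈-refl))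
    B≈A : ∀ x → eval B x ≈ A x
    B≈A (x , y) = ≈-trans (+-cong (+-cong (*-cong a≈1 (≈-refl {x * x})) (*-cong b≈0 (≈-refl {x * y}))) (*-cong c≈1 (≈-refl {y * y})))
      (identity x y)
      where
      identity : ∀ x y → 1ℝ * (x * x) + 0ℝ * (x * y) + 1ℝ * (y * y) ≈ x * x + y * y
      identity = solve 2 (λ x y → con 1ℚ :* (x :* x) :+ con 0ℚ :* (x :* y) :+ con 1ℚ :* (y :* y) := x :* x :+ y :* y) ≈-refl

  form : TemperedPerfect ℓ L M
  form = record
    { L-isLattice = e₁ , e₂ , L-basis , λ x → mk⇔ id id
    ; M-isLattice = E v , E ŵ , M-basis , M⇔span
    ; M⊆L         = M⊆L
    ; index       = index
    ; scalar      = 1ℝ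
    ; 0<scalar    = fromℚ-pos (ℚ.positive⁻¹ 1ℚ)
    ; S = S ; S′ = S′ ; S-respects = S-respects ; S′-respects = S′-respects
    ; S-nonempty  = E (hexagon zero) , zero , inj₁ ≈₂-refl
    ; S′-nonempty = E v , zero , inj₁ ≈₂-refl
    ; S⊆L−M = L₁-S ; S′⊆M−0 = M₁-S′
    ; u = fromℕ (N v) ; satisfies = satisfies ; perfect = perfect
    }

  nonzero-pair : ∀ y → y ≢ 0ω → ¬ (E y ≈₂ -₂ E y)
  nonzero-pair y y≢0 eq = y≢0 (v≡⊝v⇒≡0 y (E-injective′ {y} {⊝ y} ≈₂-refl (≈⊝ {y = y} eq)))

  hexagon≢0 : ∀ i → hexagon i ≢ 0ω
  hexagon≢0 i eq = contradiction (trans (sym (hexagon-norm i)) (cong norm eq)) λ ()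

  S-pairs : ConsistsOfPairs 3 S
  S-pairs = (λ i → E (hexagon i)) , (λ i → nonzero-pair (hexagon i) (hexagon≢0 i)) ,
    (λ i j i≢j → hexagon-distinct i j i≢j ∘ Sum.map
      (E-injective (hexagon i) (hexagon j))
      (λ eq → E-injective′ {hexagon i} {⊝ hexagon j} ≈₂-refl (≈⊝ {y = hexagon j} eq))) ,
    λ x → mk⇔ id id

  S′-pairs : ConsistsOfPairs 1 S′
  S′-pairs = (λ _ → E v) , (λ _ → nonzero-pair v v≢0) ,
    (λ { zero zero i≢j _ → i≢j refl }) , λ x → mk⇔ id id

  temperament : IsTemperament 3 1 ℓ τ
  temperament = L , M , form , S-pairs , S′-pairs , τ-sqrt

shortest⇒temperament : ∀ {ℓ v x} → Prime ℓ → InRange ℓ v → Shortest ℓ v → x ≈ fromℕ (N v) →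
  Σ[ τ ∈ ℝ ] IsTemperament 3 1 ℓ τ × x ≈ τ * τ
shortest⇒temperament {ℓ} {v} ℓ-prime v∈ v-shortest x≈N = root (N v) ,
  Construct.temperament {ℓ} {v} ℓ-prime v∈ v-shortest (root 3) (root-isSqrt 3) (root (N v)) (root-isSqrt (N v)) ,
  ≈-trans x≈N (≈-sym (proj₂ (root-isSqrt (N v))))

-- Subgroups of Z[ω] of prime index

⊝-⊝ : ∀ v → ⊝ (⊝ v) ≡ v
⊝-⊝ (a , b) = cong₂ _,_ (ℤ.neg-involutive a) (ℤ.neg-involutive b)

module ∑ = FiniteSum ℤ.+-0-commutativeMonoid

sum-shift : ∀ {n} (f g : Fin n → ℤ) x → ∑.sum (λ i → f i ℤ.+ x ℤ.- g i) ≡ ∑.sum f ℤ.+ + n ℤ.* x ℤ.- ∑.sum g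
sum-shift {zero}  f g x = sym (trans (ℤ.+-identityʳ (+ 0 ℤ.+ + 0 ℤ.* x)) (trans (ℤ.+-identityˡ (+ 0 ℤ.* x)) (ℤ.*-zeroˡ x)))
sum-shift {suc n} f g x = trans (cong (λ z → f zero ℤ.+ x ℤ.- g zero ℤ.+ z) (sum-shift (f ∘ suc) (g ∘ suc) x))
  (identity (f zero) x (g zero) (∑.sum (f ∘ suc)) (+ n) (∑.sum (g ∘ suc)))
  where
  identity : ∀ f x g F n G → f ℤ.+ x ℤ.- g ℤ.+ (F ℤ.+ n ℤ.* x ℤ.- G) ≡ f ℤ.+ F ℤ.+ (+ 1 ℤ.+ n) ℤ.* x ℤ.- (g ℤ.+ G)
  identity = ℤ-Solver.solve-∀

record FiniteIndex (P : ℤ[ω] → Set) (k : ℕ) : Set where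
  field
    ∋0           : P 0ω
    ∋-⊖          : ∀ {x y} → P x → P y → P (x ⊖ y)
    coset        : Fin k → ℤ[ω]
    class        : ℤ[ω] → Fin k
    class-spec   : ∀ y → P (y ⊖ coset (class y))
    class-unique : ∀ {y i} → P (y ⊖ coset i) → class y ≡ i

  ∋-⊝ : ∀ {x} → P x → P (⊝ x)
  ∋-⊝ {x} Px = subst P (zero-⊖ x) (∋-⊖ ∋0 Px)
    where
    zero-⊖ : ∀ x → 0ω ⊖ x ≡ ⊝ x
    zero-⊖ (a , b) = cong₂ _,_ (ℤ.+-identityˡ (ℤ.- a)) (ℤ.+-identityˡ (ℤ.- b))

  ∋-⊕ : ∀ {x y} → P x → P y → P (x ⊕ y)
  ∋-⊕ {x} {y} Px Py = subst P (cong (x ⊕_) (⊝-⊝ y)) (∋-⊖ Px (∋-⊝ Py))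

  ∋-+• : ∀ n {x} → P x → P (+ n • x)
  ∋-+• zero {x} Px = subst P (sym (0• x)) ∋0
  ∋-+• (suc n) {x} Px = subst P (suc-• n x) (∋-⊕ Px (∋-+• n Px))
    where
    suc-• : ∀ n x → x ⊕ + n • x ≡ + suc n • x
    suc-• n (a , b) = cong₂ _,_ (sym (ℤ.suc-* (+ n) a)) (sym (ℤ.suc-* (+ n) b))

  ∋-• : ∀ i {x} → P x → P (i • x)
  ∋-• (+ n)    Px = ∋-+• n Px
  ∋-• -[1+ n ] {x} Px = subst P (neg-• n x) (∋-⊝ (∋-+• (suc n) Px))
    where
    neg-• : ∀ n x → ⊝ (+ suc n • x) ≡ -[1+ n ] • x
    neg-• n (a , b) = cong₂ _,_ (ℤ.neg-distribˡ-* (+ suc n) a) (ℤ.neg-distribˡ-* (+ suc n) b)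

  ∋-sum : ∀ {n} (f : Fin n → ℤ[ω]) → (∀ i → P (f i)) → P (∑.sum (proj₁ ∘ f) , ∑.sum (proj₂ ∘ f))
  ∋-sum {zero}  f Pf = ∋0
  ∋-sum {suc n} f Pf = ∋-⊕ (Pf zero) (∋-sum (f ∘ suc) (Pf ∘ suc))

  -- Lagrange's theorem: translation by x permutes the cosets, so their sum gives k • x ≡ 0.
  ∋-index• : ∀ x → P (+ k • x)
  ∋-index• x@(a , b) = subst P (cong₂ _,_ (total proj₁ a) (total proj₂ b))
    (∋-sum (λ i → (coset i ⊕ x) ⊖ coset (σ i)) (λ i → class-spec (coset i ⊕ x)))
    where
    σ σ⁻¹ : Fin k → Fin k
    σ i   = class (coset i ⊕ x)
    σ⁻¹ i = class (coset i ⊖ x)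
    swap-⊖ : ∀ r s → ⊝ ((r ⊖ x) ⊖ s) ≡ (s ⊕ x) ⊖ r
    swap-⊖ (r₁ , r₂) (s₁ , s₂) = cong₂ _,_ (identity r₁ a s₁) (identity r₂ b s₂)
      where
      identity : ∀ r x s → ℤ.- (r ℤ.- x ℤ.- s) ≡ s ℤ.+ x ℤ.- r
      identity = ℤ-Solver.solve-∀
    swap-⊕ : ∀ r s → ⊝ ((r ⊕ x) ⊖ s) ≡ (s ⊖ x) ⊖ r
    swap-⊕ (r₁ , r₂) (s₁ , s₂) = cong₂ _,_ (identity r₁ a s₁) (identity r₂ b s₂)
      where
      identity : ∀ r x s → ℤ.- (r ℤ.+ x ℤ.- s) ≡ s ℤ.- x ℤ.- r
      identity = ℤ-Solver.solve-∀
    σσ⁻¹ : ∀ i → σ (σ⁻¹ i) ≡ i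
    σσ⁻¹ i = class-unique (subst P (swap-⊖ (coset i) (coset (σ⁻¹ i))) (∋-⊝ (class-spec (coset i ⊖ x))))
    σ⁻¹σ : ∀ i → σ⁻¹ (σ i) ≡ i
    σ⁻¹σ i = class-unique (subst P (swap-⊕ (coset i) (coset (σ i))) (∋-⊝ (class-spec (coset i ⊕ x))))
    total : ∀ (π : ℤ[ω] → ℤ) c → ∑.sum (λ i → π (coset i) ℤ.+ c ℤ.- π (coset (σ i))) ≡ + k ℤ.* c
    total π c = trans (sum-shift (π ∘ coset) (π ∘ coset ∘ σ) c) (trans
      (cong (λ z → ∑.sum (π ∘ coset) ℤ.+ + k ℤ.* c ℤ.- z)
        (sym (∑.sum-permute (π ∘ coset) (mk↔ₛ′ σ σ⁻¹ σσ⁻¹ σ⁻¹σ))))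
      (cancel (∑.sum (π ∘ coset)) (+ k ℤ.* c)))
      where
      cancel : ∀ s x → s ℤ.+ x ℤ.- s ≡ x
      cancel = ℤ-Solver.solve-∀

module MinimalVector {ℓ : ℕ} (ℓ-prime : Prime ℓ) {P : ℤ[ω] → Set} (finite : FiniteIndex P ℓ) {v : ℤ[ω]} (v≢0 : v ≢ 0ω) (v∈P : P v)
  (minimal : ∀ y → P y → y ≢ 0ω → y ≢ v → y ≢ ⊝ v → N v ℕ.< N y) (v≤ℓ : N v ℕ.≤ ℓ) where
  open FiniteIndex finite

  private instance
    ℓ≢0 : ℕ.NonZero ℓ
    ℓ≢0 = prime⇒nonZero ℓ-prime
    N≢0 : ℕ.NonZero (N v)
    N≢0 = ℕ.>-nonZero (N>0 {v} v≢0)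

  g : ℕ
  g = ℕ.gcd ℤ.∣ proj₁ v ∣ ℤ.∣ proj₂ v ∣

  v₀ : ℤ[ω]
  v₀ = proj₁ (content v)

  v≡ : v ≡ + g • v₀
  v≡ = proj₂ (content v)

  N≡ : N v ≡ g ℕ.* g ℕ.* N v₀
  N≡ = trans (cong N v≡) (N-• g v₀)

  v₀≢0 : v₀ ≢ 0ω
  v₀≢0 v₀≡0 = v≢0 (trans v≡ (trans (cong (+ g •_) v₀≡0) (cong₂ _,_ (ℤ.*-zeroʳ (+ g)) (ℤ.*-zeroʳ (+ g)))))

  -- Both g`v₀` = `v` and ℓ`v₀` lie in `P`, the latter by Lagrange's theorem. Bézout for g and ℓ is
  -- obtained by reading the pair (g, ℓ) as a primitive element of ℤ[ω].
  coprime⇒v₀∈P : ℕ.gcd g ℓ ≡ 1 → P v₀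
  coprime⇒v₀∈P gcd≡1 = case primitive⇒∧≡1 (+ g , + ℓ) (cong +_ gcd≡1) of λ where
    ((c , d) , eq) → subst P (combine c d eq v₀) (∋-⊖ (∋-• d (subst P v≡ v∈P)) (∋-• c (∋-index• v₀)))
   where
    identity : ∀ g l c d a → d ℤ.* (g ℤ.* a) ℤ.- c ℤ.* (l ℤ.* a) ≡ (g ℤ.* d ℤ.- l ℤ.* c) ℤ.* a
    identity = ℤ-Solver.solve-∀
    combine : ∀ c d → + g ℤ.* d ℤ.- + ℓ ℤ.* c ≡ + 1 → ∀ v → d • + g • v ⊖ c • + ℓ • v ≡ v
    combine c d eq (a , b) = cong₂ _,_
      (trans (identity (+ g) (+ ℓ) c d a) (trans (cong (ℤ._* a) eq) (ℤ.*-identityˡ a)))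
      (trans (identity (+ g) (+ ℓ) c d b) (trans (cong (ℤ._* b) eq) (ℤ.*-identityˡ b)))

  1<ℓ : 1 ℕ.< ℓ
  1<ℓ = ℕ.nonTrivial⇒n>1 ℓ {{prime⇒nonTrivial ℓ-prime}}

  g≢0 : g ≢ 0
  g≢0 g≡0 = ℕ.≢-nonZero⁻¹ (N v) (trans N≡ (cong (λ z → z ℕ.* z ℕ.* N v₀) g≡0))

  -- If ℓ divides g, then N(v) ≥ ℓ² > ℓ. Otherwise `v₀` lies in `P` and would, for g > 1, be a
  -- nonzero vector shorter than `v`.
  g≡1 : g ≡ 1
  g≡1 = case Prime.prime⇒irreducible ℓ-prime (ℕ.gcd[m,n]∣n g ℓ) of λ where
      (inj₂ gcd≡ℓ) → contradiction v≤ℓ (ℕ.<⇒≱ (ℕ.<-≤-trans (ℕ.m<m*n ℓ ℓ 1<ℓ) (ℕ.≤-trans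
        (ℕ.*-mono-≤ (ℓ≤g gcd≡ℓ) (ℓ≤g gcd≡ℓ))
        (ℕ.≤-trans (ℕ.m≤m*n (g ℕ.* g) (N v₀) {{ℕ.>-nonZero (N>0 {v₀} v₀≢0)}}) (ℕ.≤-reflexive (sym N≡))))))
      (inj₁ gcd≡1) → case g ℕ.≟ 1 of λ where
        (yes eq)  → eq
        (no  g≢1) → contradiction (minimal v₀ (coprime⇒v₀∈P gcd≡1) v₀≢0
            (λ eq → ℕ.<-irrefl (cong N eq) (smaller g≢1))
            (λ eq → ℕ.<-irrefl (trans (cong N eq) (cong ℤ.∣_∣ (norm-⊝ v))) (smaller g≢1)))
          (ℕ.<⇒≯ (smaller g≢1))
    where
    ℓ≤g : ℕ.gcd g ℓ ≡ ℓ → ℓ ℕ.≤ g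
    ℓ≤g gcd≡ℓ = ℕ.∣⇒≤ {{ℕ.≢-nonZero g≢0}} (subst (ℕ._∣ g) gcd≡ℓ (ℕ.gcd[m,n]∣m g ℓ))
    smaller : g ≢ 1 → N v₀ ℕ.< N v
    smaller g≢1 = subst₂ ℕ._<_ (ℕ.*-identityˡ (N v₀)) (sym N≡) (ℕ.*-monoˡ-< (N v₀) {{ℕ.>-nonZero (N>0 {v₀} v₀≢0)}}
      (ℕ.<-≤-trans 1<g (ℕ.m≤m*n g g {{ℕ.≢-nonZero g≢0}})))
      where
      1<g : 1 ℕ.< g
      1<g = ℕ.≤∧≢⇒< (ℕ.n≢0⇒n>0 g≢0) (g≢1 ∘ sym)

  v-primitive : Primitive v
  v-primitive = cong +_ g≡1

  w : ℤ[ω]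
  w = proj₁ (primitive⇒∧≡1 v v-primitive)

  v∧w : v ∧ w ≡ + 1
  v∧w = proj₂ (primitive⇒∧≡1 v v-primitive)

  -- With j the quotient of `v ∧ y` by ℓ, the vector y - jℓw is a multiple of `v`, and ℓw is in `P`
  -- by Lagrange's theorem. In particular `P` contains all partners of `v`.
  divisible⇒∈P : ∀ y → + ℓ ∣ v ∧ y → P y
  divisible⇒∈P y (divides j eq) = subst P (⊕-⊖-cancel y (j • + ℓ • w)) (∋-⊕
    (subst P (sym (∧≡0⇒multiple v w (y ⊖ j • + ℓ • w) v∧w vanishes)) (∋-• ((y ⊖ j • + ℓ • w) ∧ w) v∈P))
    (∋-• j (∋-index• w)))
    where
    vanishes : v ∧ (y ⊖ j • + ℓ • w) ≡ + 0
    vanishes = trans (∧-⊖ v y (j • + ℓ • w)) (trans (cong₂ ℤ._-_ eq (trans (∧-•ʳ v j (+ ℓ • w)) (cong (j ℤ.*_)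
      (trans (∧-•ʳ v (+ ℓ) w) (trans (cong (+ ℓ ℤ.*_) v∧w) (ℤ.*-identityʳ (+ ℓ))))))) (ℤ.+-inverseʳ (j ℤ.* + ℓ)))

  shortest : Shortest ℓ v
  shortest p vp = minimal p (divisible⇒∈P p (ℤ∣.∣ᵤ⇒∣ {+ ℓ} {v ∧ p} (ℕ.∣-reflexive (sym vp))))
    (λ p≡0 → v∧p≢0 (trans (cong (v ∧_) p≡0) (zero-∧ v)))
    (λ p≡v → v∧p≢0 (trans (cong (v ∧_) p≡v) (∧-self v)))
    (λ p≡-v → v∧p≢0 (trans (cong (v ∧_) p≡-v) (trans (∧-⊝ v v) (cong ℤ.-_ (∧-self v)))))
    where
    v∧p≢0 : v ∧ p ≢ + 0
    v∧p≢0 eq = ℕ.≢-nonZero⁻¹ ℓ (trans (sym vp) (cong ℤ.∣_∣ eq))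

  -- The upper end of the interval is never attained: for N(v) = ℓ a reduced partner, being longer
  -- than `v`, gives 4ℓ² < 4N(v)N(ŵ) = tr(v,ŵ)² + 3ℓ² ≤ 4ℓ².
  v<ℓ : N v ℕ.< ℓ
  v<ℓ = ℕ.≤∧≢⇒< v≤ℓ λ v≡ℓ → ℕ.<-irrefl refl (begin-strict
      4 ℕ.* (N v ℕ.* N v) <⟨ ℕ.*-monoʳ-< 4 (ℕ.*-monoʳ-< (N v) (shortest ŵ vŵ)) ⟩
      4 ℕ.* (N v ℕ.* N ŵ) ≡⟨ partner-identity {ℓ} {v} {ŵ} vŵ ⟩
      ℤ.∣ tr v ŵ ∣ ℕ.* ℤ.∣ tr v ŵ ∣ ℕ.+ 3 ℕ.* (ℓ ℕ.* ℓ) ≤⟨ ℕ.+-monoˡ-≤ (3 ℕ.* (ℓ ℕ.* ℓ)) (ℕ.*-mono-≤ small small) ⟩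
      N v ℕ.* N v ℕ.+ 3 ℕ.* (ℓ ℕ.* ℓ) ≡⟨ cong (λ z → N v ℕ.* N v ℕ.+ 3 ℕ.* (z ℕ.* z)) v≡ℓ ⟨
      4 ℕ.* (N v ℕ.* N v) ∎)
    where
    open ℕ.≤-Reasoning
    t : ℤ
    t = proj₁ (reduced-vector ℓ v w)
    ŵ : ℤ[ω]
    ŵ = t • v ⊕ + ℓ • w
    small : ℤ.∣ tr v ŵ ∣ ℕ.≤ N v
    small = proj₂ (reduced-vector ℓ v w)
    vŵ : Partner ℓ v ŵ
    vŵ = cong ℤ.∣_∣ (∧-reduced v w t (+ ℓ) v∧w)

-- Three pairs of minimal vectors make the lattice hexagonal

2⟨_,_⟩ : ℝ² → ℝ² → ℝ
2⟨ x , y ⟩ = ⟨ x , y ⟩ + ⟨ x , y ⟩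

A-+₂ : ∀ x y → A (x +₂ y) ≈ A x + A y + 2⟨ x , y ⟩
A-+₂ (x₁ , x₂) (y₁ , y₂) = solve 4 (λ a b c d →
    (a :+ c) :* (a :+ c) :+ (b :+ d) :* (b :+ d) :=
    (a :* a :+ b :* b) :+ (c :* c :+ d :* d) :+ ((a :* c :+ b :* d) :+ (a :* c :+ b :* d)))
    ≈-refl x₁ x₂ y₁ y₂

A--₂ : ∀ x y → A (x -₂ y) ≈ A x + A y - 2⟨ x , y ⟩
A--₂ (x₁ , x₂) (y₁ , y₂) = solve 4 (λ a b c d →
    (a :+ :- c) :* (a :+ :- c) :+ (b :+ :- d) :* (b :+ :- d) :=
    (a :* a :+ b :* b) :+ (c :* c :+ d :* d) :- ((a :* c :+ b :* d) :+ (a :* c :+ b :* d)))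
    ≈-refl x₁ x₂ y₁ y₂

lagrange : ∀ p q → fromℕ 4 * (A p * A q) - 2⟨ p , q ⟩ * 2⟨ p , q ⟩ ≈ fromℕ 4 * (det p q * det p q)
lagrange (a , b) (c , d) = solve 4 (λ a b c d →
    con (+ 4 ℚ./ 1) :* ((a :* a :+ b :* b) :* (c :* c :+ d :* d)) :- ((a :* c :+ b :* d) :+ (a :* c :+ b :* d)) :* ((a :* c :+ b :* d) :+ (a :* c :+ b :* d)) :=
    con (+ 4 ℚ./ 1) :* ((a :* d :- b :* c) :* (a :* d :- b :* c)))
    ≈-refl a b c d

-- The Gram determinant of three vectors in the plane vanishes.
gram : ∀ x y z → A x ≈ 1ℝ → A y ≈ 1ℝ → A z ≈ 1ℝ →
  let α = 2⟨ x , y ⟩ ; β = 2⟨ x , z ⟩ ; γ = 2⟨ y , z ⟩ in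
  (fromℕ 4 - α * α) * (fromℕ 4 - β * β) ≈ (γ + γ - α * β) * (γ + γ - α * β)
gram x@(x₁ , x₂) y@(y₁ , y₂) z@(z₁ , z₂) x≈1 y≈1 z≈1 = begin
  (fromℕ 4 - α * α) * (fromℕ 4 - β * β)
    ≈⟨ *-cong (unit-lagrange x y x≈1 y≈1) (unit-lagrange x z x≈1 z≈1) ⟩
  (fromℕ 4 * (det x y * det x y)) * (fromℕ 4 * (det x z * det x z))
    ≈⟨ solve 2 (λ d e →
        (con 4ℚ :* (d :* d)) :* (con 4ℚ :* (e :* e)) :=
        (con 4ℚ :* (d :* e)) :* (con 4ℚ :* (d :* e)))
        ≈-refl (det x y) (det x z) ⟩
  (fromℕ 4 * (det x y * det x z)) * (fromℕ 4 * (det x y * det x z))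
    ≈⟨ *-cong (≈-sym cross) (≈-sym cross) ⟩
  (γ + γ - α * β) * (γ + γ - α * β) ∎
  where
  open ℝ-Reasoning
  4ℚ : ℚ
  4ℚ = + 4 ℚ./ 1
  α β γ : ℝ
  α = 2⟨ x , y ⟩
  β = 2⟨ x , z ⟩
  γ = 2⟨ y , z ⟩
  scale-up : ∀ w → fromℕ 4 - w ≈ fromℕ 4 * (1ℝ * 1ℝ) - w
  scale-up = solve 1 (λ w → con 4ℚ :- w := con 4ℚ :* (con 1ℚ :* con 1ℚ) :- w) ≈-refl
  unit-lagrange : ∀ p q → A p ≈ 1ℝ → A q ≈ 1ℝ → fromℕ 4 - 2⟨ p , q ⟩ * 2⟨ p , q ⟩ ≈ fromℕ 4 * (det p q * det p q)
  unit-lagrange p q p≈1 q≈1 = ≈-trans (scale-up (2⟨ p , q ⟩ * 2⟨ p , q ⟩)) (≈-trans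
    (minus-cong (*-cong (≈-refl {fromℕ 4}) (*-cong (≈-sym p≈1) (≈-sym q≈1))) (≈-refl {2⟨ p , q ⟩ * 2⟨ p , q ⟩}))
    (lagrange p q))
  cross-identity : ∀ a b c d e f →
    (a * a + b * b) * (((c * e + d * f) + (c * e + d * f)) + ((c * e + d * f) + (c * e + d * f))) -
    ((a * c + b * d) + (a * c + b * d)) * ((a * e + b * f) + (a * e + b * f)) ≈ fromℕ 4 * ((a * d - b * c) * (a * f - b * e))
  cross-identity = solve 6 (λ a b c d e f →
    (a :* a :+ b :* b) :* (((c :* e :+ d :* f) :+ (c :* e :+ d :* f)) :+ ((c :* e :+ d :* f) :+ (c :* e :+ d :* f))) :-
    ((a :* c :+ b :* d) :+ (a :* c :+ b :* d)) :* ((a :* e :+ b :* f) :+ (a :* e :+ b :* f)) := con 4ℚ :* ((a :* d :- b :* c) :* (a :* f :- b :* e))) ≈-refl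
  scale-up′ : ∀ g w → g - w ≈ 1ℝ * g - w
  scale-up′ = solve 2 (λ g w → g :- w := con 1ℚ :* g :- w) ≈-refl
  -- The polarised form of `lagrange`. It makes both sides of the claim the square of 4 det(x,y)
  -- det(x,z).
  cross : γ + γ - α * β ≈ fromℕ 4 * (det x y * det x z)
  cross = ≈-trans (scale-up′ (γ + γ) (α * β)) (≈-trans
    (minus-cong (*-cong (≈-sym x≈1) (≈-refl {γ + γ})) (≈-refl {α * β}))
    (cross-identity x₁ x₂ y₁ y₂ z₁ z₂))

-- (9 - (2γ - αβ)²) + 3(1 - β²) + (1 - α²)(4 - β²) = 0 has only nonnegative terms.
gram⇒extremal : ∀ α β γ → - 1ℝ ≤ α → α ≤ 1ℝ → - 1ℝ ≤ β → β ≤ 1ℝ → - 1ℝ ≤ γ → γ ≤ 1ℝ →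
  (fromℕ 4 - α * α) * (fromℕ 4 - β * β) ≈ (γ + γ - α * β) * (γ + γ - α * β) → (1ℝ + α) * (1ℝ - α) ≈ 0ℝ
gram⇒extremal α β γ -1≤α α≤1 -1≤β β≤1 -1≤γ γ≤1 eq = ≤-antisym ≤0 (0≤* 0≤1+α 0≤1-α)
  where
  3ℚ 4ℚ : ℚ
  3ℚ = + 3 ℚ./ 1
  4ℚ = + 4 ℚ./ 1
  neg-neg′ : ∀ x → x - - 1ℝ ≈ 1ℝ + x
  neg-neg′ = solve 1 (λ x → x :- :- con 1ℚ := con 1ℚ :+ x) ≈-refl
  plus : ∀ {x} → - 1ℝ ≤ x → 0ℝ ≤ 1ℝ + x
  plus {x} -1≤x = ≤-resp-≈ (≈-refl {0ℝ}) (neg-neg′ x) (≤⇒0≤- -1≤x)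
  0≤1+α : 0ℝ ≤ 1ℝ + α
  0≤1+α = plus -1≤α
  0≤1-α : 0ℝ ≤ 1ℝ - α
  0≤1-α = ≤⇒0≤- α≤1
  0≤1+β : 0ℝ ≤ 1ℝ + β
  0≤1+β = plus -1≤β
  0≤1-β : 0ℝ ≤ 1ℝ - β
  0≤1-β = ≤⇒0≤- β≤1
  halve : ∀ {x} → 0ℝ ≤ x → 0ℝ ≤ fromℚ ½ * x
  halve 0≤x = 0≤* (<⇒≤ (fromℚ-pos (ℚ.positive⁻¹ ½))) 0≤x
  -- The signs of α and β are unknown, so 1 - αβ and 1 + αβ are written as averages of products of
  -- nonnegative factors.
  0≤1-αβ : 0ℝ ≤ fromℚ ½ * ((1ℝ - α) * (1ℝ + β) + (1ℝ + α) * (1ℝ - β))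
  0≤1-αβ = halve (0≤+ (0≤* 0≤1-α 0≤1+β) (0≤* 0≤1+α 0≤1-β))
  0≤1+αβ : 0ℝ ≤ fromℚ ½ * ((1ℝ - α) * (1ℝ - β) + (1ℝ + α) * (1ℝ + β))
  0≤1+αβ = halve (0≤+ (0≤* 0≤1-α 0≤1-β) (0≤* 0≤1+α 0≤1+β))
  -- This is 3 - (2γ - αβ), and `three-plus` is 3 + (2γ - αβ); their product is the first of the
  -- nonnegative terms.
  three-minus : 0ℝ ≤ ((1ℝ - γ) + (1ℝ - γ)) + fromℚ ½ * ((1ℝ - α) * (1ℝ - β) + (1ℝ + α) * (1ℝ + β))
  three-minus = 0≤+ (0≤+ (≤⇒0≤- γ≤1) (≤⇒0≤- γ≤1)) 0≤1+αβ
  three-plus : 0ℝ ≤ ((1ℝ + γ) + (1ℝ + γ)) + fromℚ ½ * ((1ℝ - α) * (1ℝ + β) + (1ℝ + α) * (1ℝ - β))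
  three-plus = 0≤+ (0≤+ (plus -1≤γ) (plus -1≤γ)) 0≤1-αβ
  rest : ℝ
  rest = ((((1ℝ - γ) + (1ℝ - γ)) + fromℚ ½ * ((1ℝ - α) * (1ℝ - β) + (1ℝ + α) * (1ℝ + β))) *
          (((1ℝ + γ) + (1ℝ + γ)) + fromℚ ½ * ((1ℝ - α) * (1ℝ + β) + (1ℝ + α) * (1ℝ - β))))
         + fromℕ 3 * ((1ℝ + β) * (1ℝ - β))
  0≤rest : 0ℝ ≤ rest
  0≤rest = 0≤+ (0≤* three-minus three-plus)
    (0≤* (fromℤ-mono-≤ {+ 0} {+ 3} (ℤ.+≤+ ℕ.z≤n)) (0≤* 0≤1+β 0≤1-β))
  last : ℝ
  last = ((1ℝ + α) * (1ℝ - α)) * (fromℕ 3 + (1ℝ + β) * (1ℝ - β))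
  identity : ∀ a b c → ((((1ℝ - c) + (1ℝ - c)) + fromℚ ½ * ((1ℝ - a) * (1ℝ - b) + (1ℝ + a) * (1ℝ + b))) *
          (((1ℝ + c) + (1ℝ + c)) + fromℚ ½ * ((1ℝ - a) * (1ℝ + b) + (1ℝ + a) * (1ℝ - b))))
         + fromℕ 3 * ((1ℝ + b) * (1ℝ - b)) + ((1ℝ + a) * (1ℝ - a)) * (fromℕ 3 + (1ℝ + b) * (1ℝ - b)) ≈
    (fromℕ 4 - a * a) * (fromℕ 4 - b * b) - (c + c - a * b) * (c + c - a * b)
  identity = solve 3 (λ a b c → let 1ₚ = con 1ℚ in
    (((1ₚ :- c) :+ (1ₚ :- c)) :+ con ½ :* ((1ₚ :- a) :* (1ₚ :- b) :+ (1ₚ :+ a) :* (1ₚ :+ b))) :*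
    (((1ₚ :+ c) :+ (1ₚ :+ c)) :+ con ½ :* ((1ₚ :- a) :* (1ₚ :+ b) :+ (1ₚ :+ a) :* (1ₚ :- b)))
    :+ con 3ℚ :* ((1ₚ :+ b) :* (1ₚ :- b)) :+ ((1ₚ :+ a) :* (1ₚ :- a)) :* (con 3ℚ :+ (1ₚ :+ b) :* (1ₚ :- b)) :=
    (con 4ℚ :- a :* a) :* (con 4ℚ :- b :* b) :- (c :+ c :- a :* b) :* (c :+ c :- a :* b)) ≈-refl
  total : rest + last ≈ 0ℝ
  total = ≈-trans (identity α β γ) (≈-trans (minus-cong eq (≈-refl {(γ + γ - α * β) * (γ + γ - α * β)}))
    (x-x≈0 ((γ + γ - α * β) * (γ + γ - α * β))))
  ≤0 : (1ℝ + α) * (1ℝ - α) ≤ 0ℝ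
  ≤0 0<[1+α][1-α] = <-irrefl (≈-sym total) (<-≤-trans 0<last (≤-resp-≈ (0+x≈x last) (≈-refl {rest + last}) (+-monoˡ-≤ last 0≤rest)))
    where
    0<last : 0ℝ < last
    0<last = 0<* 0<[1+α][1-α] (<-≤-trans (fromℤ-mono-< {+ 0} {+ 3} (ℤ.+<+ (ℕ.s≤s ℕ.z≤n)))
      (≤-resp-≈ (x+0≈x (fromℕ 3)) (≈-refl {fromℕ 3 + (1ℝ + β) * (1ℝ - β)}) (+-monoʳ-≤ (fromℕ 3) (0≤* 0≤1+β 0≤1-β))))
      where
      x+0≈x : ∀ x → x + 0ℝ ≈ x
      x+0≈x = solve 1 (λ x → x :+ con 0ℚ := x) ≈-refl
      +-monoʳ-≤ : ∀ z {x y} → x ≤ y → z + x ≤ z + y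
      +-monoʳ-≤ z {x} {y} x≤y = 0≤-⇒≤ {z + x} {z + y} (≤-resp-≈ (≈-refl {0ℝ}) (cancel x y z) (≤⇒0≤- x≤y))
        where
        cancel : ∀ x y z → y - x ≈ (z + y) - (z + x)
        cancel = solve 3 (λ x y z → y :- x := (z :+ y) :- (z :+ x)) ≈-refl
    +-monoˡ-≤ : ∀ z {x y} → x ≤ y → x + z ≤ y + z
    +-monoˡ-≤ z {x} {y} x≤y = 0≤-⇒≤ {x + z} {y + z} (≤-resp-≈ (≈-refl {0ℝ}) (cancel x y z) (≤⇒0≤- x≤y))
      where
      cancel : ∀ x y z → y - x ≈ (y + z) - (x + z)
      cancel = solve 3 (λ x y z → y :- x := (y :+ z) :- (x :+ z)) ≈-refl

-- The angle between two shortest vectors of equal length is at least 60°.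
unit-angle-bounds : ∀ x y → A x ≈ 1ℝ → A y ≈ 1ℝ → 1ℝ ≤ A (x +₂ y) → 1ℝ ≤ A (x -₂ y) → - 1ℝ ≤ 2⟨ x , y ⟩ × 2⟨ x , y ⟩ ≤ 1ℝ
unit-angle-bounds x y x≈1 y≈1 1≤+ 1≤- =
  0≤-⇒≤ (≤-resp-≈ (≈-refl {0ℝ}) (≈-trans (minus-cong (≈-trans (A-+₂ x y) (+-cong (+-cong x≈1 y≈1) (≈-refl {2⟨ x , y ⟩}))) (≈-refl {1ℝ}))
    (identity₁ 2⟨ x , y ⟩)) (≤⇒0≤- 1≤+)) ,
  0≤-⇒≤ (≤-resp-≈ (≈-refl {0ℝ}) (≈-trans (minus-cong (≈-trans (A--₂ x y) (minus-cong (+-cong x≈1 y≈1) (≈-refl {2⟨ x , y ⟩}))) (≈-refl {1ℝ}))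
    (identity₂ 2⟨ x , y ⟩)) (≤⇒0≤- 1≤-))
  where
  identity₁ : ∀ g → (1ℝ + 1ℝ + g) - 1ℝ ≈ g - - 1ℝ
  identity₁ = solve 1 (λ g → (con 1ℚ :+ con 1ℚ :+ g) :- con 1ℚ := g :- :- con 1ℚ) ≈-refl
  identity₂ : ∀ g → (1ℝ + 1ℝ - g) - 1ℝ ≈ 1ℝ - g
  identity₂ = solve 1 (λ g → (con 1ℚ :+ con 1ℚ :- g) :- con 1ℚ := con 1ℚ :- g) ≈-refl

-- In general one cannot tell which factor of a vanishing product is zero. Here -1 < 1 and
-- cotransitivity make one of the two factors positive, so the other is 0.
extremal⇒±1 : ∀ α → (1ℝ + α) * (1ℝ - α) ≈ 0ℝ → α ≈ 1ℝ ⊎ α ≈ - 1ℝ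
extremal⇒±1 α product≈0 = Sum.map
    (λ -1<α → from-zero₁ (0<x∧x*y≈0⇒y≈0 {1ℝ + α} {1ℝ - α} (0<-resp-≈ {α - - 1ℝ} {1ℝ + α} (identity₁ α) (<⇒0<- -1<α)) product≈0))
    (λ α<1 → from-zero₂ (0<x∧x*y≈0⇒y≈0 {1ℝ - α} {1ℝ + α} (<⇒0<- α<1) (≈-trans (*-comm (1ℝ - α) (1ℝ + α)) product≈0)))
    (<-cotrans -1<1 α)
  where
  -1<1 : - 1ℝ < 1ℝ
  -1<1 = 0<-⇒< (0<-resp-≈ {fromℕ 2} {1ℝ - - 1ℝ} (solve 0 (con (+ 2 ℚ./ 1) := con 1ℚ :- :- con 1ℚ) ≈-refl)
    (fromℤ-mono-< {+ 0} {+ 2} (ℤ.+<+ (ℕ.s≤s ℕ.z≤n))))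
  identity₁ : ∀ α → α - - 1ℝ ≈ 1ℝ + α
  identity₁ = solve 1 (λ x → x :- :- con 1ℚ := con 1ℚ :+ x) ≈-refl
  *-comm : ∀ x y → x * y ≈ y * x
  *-comm = solve 2 (λ x y → x :* y := y :* x) ≈-refl
  from-zero₁ : 1ℝ - α ≈ 0ℝ → α ≈ 1ℝ
  from-zero₁ eq = ≈-trans (identity₂ α) (≈-trans (minus-cong (≈-refl {1ℝ}) eq) (x-0≈x 1ℝ))
    where
    identity₂ : ∀ α → α ≈ 1ℝ - (1ℝ - α)
    identity₂ = solve 1 (λ x → x := con 1ℚ :- (con 1ℚ :- x)) ≈-refl
  from-zero₂ : 1ℝ + α ≈ 0ℝ → α ≈ - 1ℝ
  from-zero₂ eq = ≈-trans (identity₃ α) (≈-trans (minus-cong eq (≈-refl {1ℝ})) (0-neg 1ℝ))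
    where
    identity₃ : ∀ α → α ≈ (1ℝ + α) - 1ℝ
    identity₃ = solve 1 (λ x → x := (con 1ℚ :+ x) :- con 1ℚ) ≈-refl

-- The third vector acts through the Gram determinant, which forces α = ±1. For α = 1 the angle is
-- 60°, and reversing `y` produces the 120° of a frame.
three-units⇒hexagonal : ∀ x y z → A x ≈ 1ℝ → A y ≈ 1ℝ → A z ≈ 1ℝ →
  1ℝ ≤ A (x +₂ y) → 1ℝ ≤ A (x -₂ y) → 1ℝ ≤ A (x +₂ z) → 1ℝ ≤ A (x -₂ z) → 1ℝ ≤ A (y +₂ z) → 1ℝ ≤ A (y -₂ z) →
  HexagonalFrame x y ⊎ HexagonalFrame x (-₂ y)
three-units⇒hexagonal x y z x≈1 y≈1 z≈1 xy⁺ xy⁻ xz⁺ xz⁻ yz⁺ yz⁻ = swap (Sum.map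
    (λ α≈1 → record { unit₁ = x≈1 ; unit₂ = ≈-trans (A-⊝ y) y≈1 ; angle = ≈-trans (neg-angle x y) (-‿cong α≈1) })
    (λ α≈-1 → record { unit₁ = x≈1 ; unit₂ = y≈1 ; angle = α≈-1 })
    (extremal⇒±1 2⟨ x , y ⟩ (gram⇒extremal 2⟨ x , y ⟩ 2⟨ x , z ⟩ 2⟨ y , z ⟩
      (proj₁ xy) (proj₂ xy) (proj₁ xz) (proj₂ xz) (proj₁ yz) (proj₂ yz) (gram x y z x≈1 y≈1 z≈1))))
  where
  xy : - 1ℝ ≤ 2⟨ x , y ⟩ × 2⟨ x , y ⟩ ≤ 1ℝ
  xy = unit-angle-bounds x y x≈1 y≈1 xy⁺ xy⁻
  xz : - 1ℝ ≤ 2⟨ x , z ⟩ × 2⟨ x , z ⟩ ≤ 1ℝ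
  xz = unit-angle-bounds x z x≈1 z≈1 xz⁺ xz⁻
  yz : - 1ℝ ≤ 2⟨ y , z ⟩ × 2⟨ y , z ⟩ ≤ 1ℝ
  yz = unit-angle-bounds y z y≈1 z≈1 yz⁺ yz⁻
  neg-angle : ∀ x y → 2⟨ x , -₂ y ⟩ ≈ - 2⟨ x , y ⟩
  neg-angle (x₁ , x₂) (y₁ , y₂) = solve 4 (λ a b c d →
      (a :* :- c :+ b :* :- d) :+ (a :* :- c :+ b :* :- d) :=
      :- ((a :* c :+ b :* d) :+ (a :* c :+ b :* d)))
      ≈-refl x₁ x₂ y₁ y₂

-- Rounding for a modulus of either sign: the sign of `D` is absorbed into the multiplier.
centred-residue : ∀ D → D ≢ + 0 → ∀ i → ∃ λ k → 2 ℕ.* ℤ.∣ i ℤ.+ k ℤ.* D ∣ ℕ.≤ ℤ.∣ D ∣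
centred-residue D D≢0 i = case nearest-multiple ℤ.∣ D ∣ {{ℕ.≢-nonZero (D≢0 ∘ ℤ.∣i∣≡0⇒i≡0)}} (+ 2 ℤ.* i) , signed D of λ where
    ((t , bound) , (σ , σD)) → t ℤ.* σ , subst (ℕ._≤ ℤ.∣ D ∣) (trans (cong ℤ.∣_∣ (rearrange t σ σD)) (ℤ.abs-* (+ 2) (i ℤ.+ t ℤ.* σ ℤ.* D))) bound
  where
  identity : ∀ t σ D i → + 2 ℤ.* (σ ℤ.* D) ℤ.* t ℤ.+ + 2 ℤ.* i ≡ + 2 ℤ.* (i ℤ.+ t ℤ.* σ ℤ.* D)
  identity = ℤ-Solver.solve-∀
  rearrange : ∀ t σ → σ ℤ.* D ≡ + ℤ.∣ D ∣ → + 2 ℤ.* + ℤ.∣ D ∣ ℤ.* t ℤ.+ + 2 ℤ.* i ≡ + 2 ℤ.* (i ℤ.+ t ℤ.* σ ℤ.* D)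
  rearrange t σ σD = trans (cong (λ z → + 2 ℤ.* z ℤ.* t ℤ.+ + 2 ℤ.* i) (sym σD)) (identity t σ D i)

-- By the triangle inequality 4N is at most the sum of three products of the doubled coordinates, so
-- N ≤ ¾d². This is the covering estimate for the hexagonal lattice.
N-small : ∀ a b d .{{_ : ℕ.NonZero d}} → 2 ℕ.* ℤ.∣ a ∣ ℕ.≤ d → 2 ℕ.* ℤ.∣ b ∣ ℕ.≤ d → N (a , b) ℕ.< d ℕ.* d
N-small a b d@(suc _) 2a≤d 2b≤d = ℕ.*-cancelˡ-< 4 (N (a , b)) (d ℕ.* d) (begin-strict
  4 ℕ.* N (a , b)
    ≤⟨ ℕ.*-monoʳ-≤ 4 triangle ⟩
  4 ℕ.* (x ℕ.* x ℕ.+ x ℕ.* y ℕ.+ y ℕ.* y)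
    ≡⟨ identity x y ⟩
  2 ℕ.* x ℕ.* (2 ℕ.* x) ℕ.+ 2 ℕ.* x ℕ.* (2 ℕ.* y) ℕ.+ 2 ℕ.* y ℕ.* (2 ℕ.* y)
    ≤⟨ ℕ.+-mono-≤ (ℕ.+-mono-≤ (ℕ.*-mono-≤ 2a≤d 2a≤d) (ℕ.*-mono-≤ 2a≤d 2b≤d)) (ℕ.*-mono-≤ 2b≤d 2b≤d) ⟩
  d ℕ.* d ℕ.+ d ℕ.* d ℕ.+ d ℕ.* d
    <⟨ ℕ.m<m+n (d ℕ.* d ℕ.+ d ℕ.* d ℕ.+ d ℕ.* d) {d ℕ.* d} (ℕ.s≤s ℕ.z≤n) ⟩
  d ℕ.* d ℕ.+ d ℕ.* d ℕ.+ d ℕ.* d ℕ.+ d ℕ.* d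
    ≡⟨ identity′ (d ℕ.* d) ⟩
  4 ℕ.* (d ℕ.* d) ∎)
  where
  open ℕ.≤-Reasoning
  x y : ℕ
  x = ℤ.∣ a ∣
  y = ℤ.∣ b ∣
  identity : ∀ x y → 4 ℕ.* (x ℕ.* x ℕ.+ x ℕ.* y ℕ.+ y ℕ.* y) ≡
    2 ℕ.* x ℕ.* (2 ℕ.* x) ℕ.+ 2 ℕ.* x ℕ.* (2 ℕ.* y) ℕ.+ 2 ℕ.* y ℕ.* (2 ℕ.* y)
  identity = ℕ-Solver.solve-∀
  identity′ : ∀ n → n ℕ.+ n ℕ.+ n ℕ.+ n ≡ 4 ℕ.* n
  identity′ = ℕ-Solver.solve-∀
  triangle : N (a , b) ℕ.≤ x ℕ.* x ℕ.+ x ℕ.* y ℕ.+ y ℕ.* y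
  triangle = ℕ.≤-trans (ℤ.∣i+j∣≤∣i∣+∣j∣ (a ℤ.* a ℤ.- a ℤ.* b) (b ℤ.* b)) (ℕ.+-mono-≤
    (ℕ.≤-trans (ℤ.∣i-j∣≤∣i∣+∣j∣ (a ℤ.* a) (a ℤ.* b)) (ℕ.≤-reflexive (cong₂ ℕ._+_ (ℤ.abs-* a a) (ℤ.abs-* a b))))
    (ℕ.≤-reflexive (ℤ.abs-* b b)))

-- Every 3-and-1 form comes from a shortest vector

·-cancel : ∀ {c x y} → 0ℝ < c → c · x ≈₂ c · y → x ≈₂ y
·-cancel {c} {x₁ , x₂} {y₁ , y₂} 0<c (p , q) = cancel x₁ y₁ p , cancel x₂ y₂ q
  where
  distrib : ∀ c x y → c * (x - y) ≈ c * x - c * y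
  distrib = solve 3 (λ c x y → c :* (x :- y) := c :* x :- c :* y) ≈-refl
  cancel : ∀ x y → c * x ≈ c * y → x ≈ y
  cancel x y eq = ≈-trans (≈-sym (x-y+y≈x x y)) (≈-trans
    (+-cong (0<x∧x*y≈0⇒y≈0 {c} {x - y} 0<c (≈-trans (distrib c x y) (≈-trans (minus-cong eq (≈-refl {c * y})) (x-x≈0 (c * y)))))
      (≈-refl {y}))
    (0+x≈x y))

·-+₂ : ∀ c x y → c · (x +₂ y) ≈₂ c · x +₂ c · y
·-+₂ c (x₁ , x₂) (y₁ , y₂) = identity c x₁ y₁ , identity c x₂ y₂
  where
  identity : ∀ c x y → c * (x + y) ≈ c * x + c * y
  identity = solve 3 (λ c x y → c :* (x :+ y) := c :* x :+ c :* y) ≈-refl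

·--₂ : ∀ c x → c · (-₂ x) ≈₂ -₂ (c · x)
·--₂ c (x₁ , x₂) = x*-y c x₁ , x*-y c x₂

·-· : ∀ c r x → c · (r · x) ≈₂ r · (c · x)
·-· c r (x₁ , x₂) = identity c r x₁ , identity c r x₂
  where
  identity : ∀ c r x → c * (r * x) ≈ r * (c * x)
  identity = solve 3 (λ c r x → c :* (r :* x) := r :* (c :* x)) ≈-refl

A-· : ∀ c x → A (c · x) ≈ c * c * A x
A-· c (x , y) = solve 3 (λ c x y → (c :* x) :* (c :* x) :+ (c :* y) :* (c :* y) := c :* c :* (x :* x :+ y :* y)) ≈-refl c x y

≈₂-stable : ∀ {x y} → ¬ ¬ (x ≈₂ y) → x ≈₂ y
≈₂-stable ¬¬x≈y = ≈-stable (λ p → ¬¬x≈y (p ∘ proj₁)) , ≈-stable (λ p → ¬¬x≈y (p ∘ proj₂))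

x+y≈0⇒x≈-y : ∀ x y → x +₂ y ≈₂ 0₂ → x ≈₂ -₂ y
x+y≈0⇒x≈-y (x₁ , x₂) (y₁ , y₂) (p , q) = solve′ x₁ y₁ p , solve′ x₂ y₂ q
  where
  identity : ∀ x y → x ≈ (x + y) - y
  identity = solve 2 (λ x y → x := (x :+ y) :- y) ≈-refl
  solve′ : ∀ x y → x + y ≈ 0ℝ → x ≈ - y
  solve′ x y eq = ≈-trans (identity x y) (≈-trans (minus-cong eq (≈-refl {y})) (0-neg y))

x-y≈0⇒x≈y : ∀ x y → x -₂ y ≈₂ 0₂ → x ≈₂ y
x-y≈0⇒x≈y (x₁ , x₂) (y₁ , y₂) (p , q) = solve′ x₁ y₁ p , solve′ x₂ y₂ q
  where
  solve′ : ∀ x y → x - y ≈ 0ℝ → x ≈ y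
  solve′ x y eq = ≈-trans (≈-sym (x-y+y≈x x y)) (≈-trans (+-cong eq (≈-refl {y})) (0+x≈x y))

fromℕ-* : ∀ m n → fromℕ (m ℕ.* n) ≈ fromℕ m * fromℕ n
fromℕ-* m n = ≈-trans (≡⇒≈ (cong fromℤ (ℤ.pos-* m n))) (fromℤ-* (+ m) (+ n))

4n-3ℓ : ∀ ℓ n → fromℕ 4 * (fromℕ n - fromℚ (+ 3 / 4) * fromℕ ℓ) ≈ fromℕ (4 ℕ.* n) - fromℕ (3 ℕ.* ℓ)
4n-3ℓ ℓ n = ≈-trans (identity (fromℕ n) (fromℕ ℓ)) (minus-cong (≈-sym (fromℕ-* 4 n)) (≈-sym (fromℕ-* 3 ℓ)))
  where
  identity : ∀ n l → fromℕ 4 * (n - fromℚ (+ 3 / 4) * l) ≈ fromℕ 4 * n - fromℕ 3 * l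
  identity = solve 2 (λ n l →
      con (+ 4 ℚ./ 1) :* (n :- con (+ 3 / 4) :* l) :=
      con (+ 4 ℚ./ 1) :* n :- con (+ 3 ℚ./ 1) :* l)
      ≈-refl

0<4 : 0ℝ < fromℕ 4
0<4 = fromℤ-mono-< {+ 0} {+ 4} (ℤ.+<+ (ℕ.s≤s ℕ.z≤n))

¾ℓ≤n⇒3ℓ≤4n : ∀ ℓ n → fromℚ (+ 3 / 4) * fromℕ ℓ ≤ fromℕ n → 3 ℕ.* ℓ ℕ.≤ 4 ℕ.* n
¾ℓ≤n⇒3ℓ≤4n ℓ n le = ℤ.drop‿+≤+ (fromℤ-cancel-≤ {+ (3 ℕ.* ℓ)} {+ (4 ℕ.* n)} (0≤-⇒≤ {fromℕ (3 ℕ.* ℓ)} {fromℕ (4 ℕ.* n)}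
  (≤-resp-≈ (≈-refl {0ℝ}) (4n-3ℓ ℓ n) (0≤* (<⇒≤ 0<4) (≤⇒0≤- le)))))

3ℓ≤4n⇒¾ℓ≤n : ∀ ℓ n → 3 ℕ.* ℓ ℕ.≤ 4 ℕ.* n → fromℚ (+ 3 / 4) * fromℕ ℓ ≤ fromℕ n
3ℓ≤4n⇒¾ℓ≤n ℓ n le = 0≤-⇒≤ {fromℚ (+ 3 / 4) * fromℕ ℓ} {fromℕ n} (0<x∧0≤x*y⇒0≤y {fromℕ 4} {fromℕ n - fromℚ (+ 3 / 4) * fromℕ ℓ} 0<4
  (≤-resp-≈ (≈-refl {0ℝ}) (≈-sym (4n-3ℓ ℓ n)) (≤⇒0≤- (fromℤ-mono-≤ {+ (3 ℕ.* ℓ)} {+ (4 ℕ.* n)} (ℤ.+≤+ le)))))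

-- Scaled lattices

module _ {c : ℝ} {P : Subset} (lattice : IsLattice P) where

  open Coordinates (c · proj₁ lattice) (c · proj₁ (proj₂ lattice))

  private
    module B = Coordinates (proj₁ lattice) (proj₁ (proj₂ lattice))

    span : ∀ x → P x ⇔ ℤ-Span (proj₁ lattice) (proj₁ (proj₂ lattice)) x
    span = proj₂ (proj₂ (proj₂ lattice))

    scaled : ∀ y → c · B.E y ≈₂ E y
    scaled (a , b) = ≈₂-trans (·-+₂ c (fromℤ a · proj₁ lattice) (fromℤ b · proj₁ (proj₂ lattice)))
      (+₂-cong (·-· c (fromℤ a) (proj₁ lattice)) (·-· c (fromℤ b) (proj₁ (proj₂ lattice))))

  -- A `Subset` need not respect equality of reals; a lattice does, because membership is equivalent
  -- to lying in a span.
  lattice-resp : ∀ {x y} → x ≈₂ y → P x → P y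
  lattice-resp {x} {y} x≈y Px = case Equivalence.to (span x) Px of λ where
    (a , b , x≈) → Equivalence.from (span y) (a , b , ≈₂-trans (≈₂-sym x≈y) x≈)

  scaled-lattice⇒ : ∀ {x} → scale c P x → ∃ λ y → x ≈₂ E y
  scaled-lattice⇒ (z , Pz , x≈cz) = case Equivalence.to (span z) Pz of λ where
    (a , b , z≈) → (a , b) , ≈₂-trans x≈cz (≈₂-trans (·-cong c z≈) (scaled (a , b)))

  ⇒scaled-lattice : ∀ {x} y → x ≈₂ E y → scale c P x
  ⇒scaled-lattice (a , b) x≈ = B.E (a , b) , Equivalence.from (span (B.E (a , b))) (a , b , ≈₂-refl) ,
    ≈₂-trans x≈ (≈₂-sym (scaled (a , b)))

  scaled-resp : ∀ {x y} → x ≈₂ y → scale c P x → scale c P y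
  scaled-resp x≈y (z , Pz , x≈cz) = z , Pz , ≈₂-trans (≈₂-sym x≈y) x≈cz

  scaled-+₂ : ∀ {x y} → scale c P x → scale c P y → scale c P (x +₂ y)
  scaled-+₂ x∈ y∈ = case scaled-lattice⇒ x∈ of λ where
    (p , x≈) → case scaled-lattice⇒ y∈ of λ where
      (q , y≈) → ⇒scaled-lattice (p ⊕ q) (≈₂-trans (+₂-cong x≈ y≈) (≈₂-sym (E-⊕ p q)))

  scaled--₂ : ∀ {x} → scale c P x → scale c P (-₂ x)
  scaled--₂ x∈ = case scaled-lattice⇒ x∈ of λ where
    (p , x≈) → ⇒scaled-lattice (⊝ p) (≈₂-trans (-₂-cong x≈) (≈₂-sym (E-⊝ p)))

  scaled-0 : scale c P 0₂
  scaled-0 = ⇒scaled-lattice 0ω (≈₂-sym E-0)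

  scaled-combination : ∀ {x y} → scale c P x → scale c P y → ∀ i → scale c P (Coordinates.E x y i)
  scaled-combination {x} {y} x∈ y∈ (i , j) = case scaled-lattice⇒ x∈ of λ where
    (p , x≈) → case scaled-lattice⇒ y∈ of λ where
      (q , y≈) → ⇒scaled-lattice (i • p ⊕ j • q) (≈₂-trans
        (+₂-cong (·-cong (fromℤ i) x≈) (·-cong (fromℤ j) y≈))
        (≈₂-sym (≈₂-trans (E-⊕ (i • p) (j • q)) (+₂-cong (E-• i p) (E-• j q)))))

-- A lattice of minimum 1 containing a hexagonal frame is spanned by the frame: an element outside the span would have
-- a nonzero translate of norm < 1.
module Hexagonal {c : ℝ} {P : Subset} (lattice : IsLattice P) (minimum : ∀ x → scale c P x → ¬ (x ≈₂ 0₂) → 1ℝ ≤ A x)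
  {e₁ e₂ : ℝ²} (frame : HexagonalFrame e₁ e₂) (e₁∈ : scale c P e₁) (e₂∈ : scale c P e₂) where

  open HexagonalFrame frame
  open Frame frame

  private
    module F = Coordinates (c · proj₁ lattice) (c · proj₁ (proj₂ lattice))

    y₁ y₂ : ℤ[ω]
    y₁ = proj₁ (scaled-lattice⇒ {c} lattice e₁∈)
    y₂ = proj₁ (scaled-lattice⇒ {c} lattice e₂∈)

    e₁≈ : e₁ ≈₂ F.E y₁
    e₁≈ = proj₂ (scaled-lattice⇒ {c} lattice e₁∈)

    e₂≈ : e₂ ≈₂ F.E y₂
    e₂≈ = proj₂ (scaled-lattice⇒ {c} lattice e₂∈)

    D : ℤ
    D = y₁ ∧ y₂

    -- Lagrange's identity gives 4det² = 4 - 1 = 3.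
    det≉0 : ¬ (det e₁ e₂ ≈ 0ℝ)
    det≉0 det≈0 = <-irrefl (≈-sym (≈-trans (≈-sym 4det²) (≈-trans (*-cong (≈-refl {fromℕ 4}) (*-cong det≈0 det≈0)) zero²)))
        (fromℤ-mono-< {+ 0} {+ 3} (ℤ.+<+ (ℕ.s≤s ℕ.z≤n)))
      where
      zero² : fromℕ 4 * (0ℝ * 0ℝ) ≈ 0ℝ
      zero² = solve 0 (con (+ 4 ℚ./ 1) :* (con 0ℚ :* con 0ℚ) := con 0ℚ) ≈-refl
      4det² : fromℕ 4 * (det e₁ e₂ * det e₁ e₂) ≈ fromℕ 3
      4det² = ≈-trans (≈-sym (lagrange e₁ e₂)) (≈-trans
        (minus-cong (*-cong (≈-refl {fromℕ 4}) (*-cong unit₁ unit₂)) (*-cong angle angle))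
        (solve 0 (con (+ 4 ℚ./ 1) :* (con 1ℚ :* con 1ℚ) :- (:- con 1ℚ) :* (:- con 1ℚ) := con (+ 3 ℚ./ 1)) ≈-refl))

    det-cong : ∀ {x x′ y y′} → x ≈₂ x′ → y ≈₂ y′ → det x y ≈ det x′ y′
    det-cong (p , q) (p′ , q′) = minus-cong (*-cong p q′) (*-cong q p′)

    D≢0 : D ≢ + 0
    D≢0 D≡0 = det≉0 (≈-trans (det-cong {e₁} {F.E y₁} {e₂} {F.E y₂} e₁≈ e₂≈) (≈-trans (F.det-E y₁ y₂)
      (≈-trans (*-cong (≡⇒≈ (cong fromℤ D≡0)) (≈-refl {det (c · proj₁ lattice) (c · proj₁ (proj₂ lattice))}))
        (0*x≈0 (det (c · proj₁ lattice) (c · proj₁ (proj₂ lattice)))))))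

    E≈F : ∀ i j → E (i , j) ≈₂ F.E (i • y₁ ⊕ j • y₂)
    E≈F i j = ≈₂-trans (+₂-cong (·-cong (fromℤ i) e₁≈) (·-cong (fromℤ j) e₂≈))
      (≈₂-sym (≈₂-trans (F.E-⊕ (i • y₁) (j • y₂)) (+₂-cong (F.E-• i y₁) (F.E-• j y₂))))

    -- Cramer's rule: multiplied by `D`, whose absolute value is the index of the span of the frame,
    -- every lattice vector has integer coordinates in the frame.
    multiple : ∀ {x} y → x ≈₂ F.E y → fromℤ D · x ≈₂ E (y ∧ y₂ , y₁ ∧ y)
    multiple {x} y x≈ = ≈₂-trans (·-cong (fromℤ D) x≈) (≈₂-trans (≈₂-sym (F.E-• D y))
      (≈₂-trans (F.E-cong (∧⊗-expand y₁ y₂ y)) (≈₂-sym (E≈F (y ∧ y₂) (y₁ ∧ y)))))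

    -- If `x` were nonzero, D²A(x) = N(y) < D² would contradict the minimum 1. Whether `x` is zero
    -- is undecidable, but equality is stable under double negation.
    small⇒0 : ∀ {x} y → scale c P x → fromℤ D · x ≈₂ E y → N y ℕ.< ℤ.∣ D ∣ ℕ.* ℤ.∣ D ∣ → x ≈₂ 0₂
    small⇒0 {x} y x∈ Dx≈ small = ≈₂-stable λ x≉0 → fromℤ-cancel-contradiction (minimum x x∈ x≉0)
      where
      D²A : fromℤ (D ℤ.* D) * A x ≈ fromℕ (N y)
      D²A = ≈-trans (*-cong (fromℤ-* D D) (≈-refl {A x})) (≈-trans (≈-sym (A-· (fromℤ D) x))
        (≈-trans (A-cong Dx≈) (≈-trans (A-E y) (≡⇒≈ (cong fromℤ (norm≡N y))))))
      0≤D² : 0ℝ ≤ fromℤ (D ℤ.* D)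
      0≤D² = fromℤ-mono-≤ {+ 0} {D ℤ.* D} (0≤square D)
      distrib : ∀ d a → d * (a - 1ℝ) ≈ d * a - d
      distrib = solve 2 (λ d a → d :* (a :- con 1ℚ) := d :* a :- d) ≈-refl
      fromℤ-cancel-contradiction : 1ℝ ≤ A x → ⊥
      fromℤ-cancel-contradiction 1≤A = 0≤-⇒≤ {fromℤ (D ℤ.* D)} {fromℤ (D ℤ.* D) * A x}
        (≤-resp-≈ (≈-refl {0ℝ}) (distrib (fromℤ (D ℤ.* D)) (A x)) (0≤* 0≤D² (≤⇒0≤- 1≤A)))
        (<-resp-≈ (≈-sym D²A) (≡⇒≈ (cong fromℤ (sym (square D)))) (fromℤ-mono-< {+ N y} {+ (ℤ.∣ D ∣ ℕ.* ℤ.∣ D ∣)} (ℤ.+<+ small)))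

  spanned : ∀ {x} → scale c P x → ∃ λ y → x ≈₂ E y
  spanned {x} x∈ = case scaled-lattice⇒ {c} lattice x∈ of λ where
    (y , x≈) → case centred-residue D D≢0 (y ∧ y₂) of λ where
     (k , k-small) → case centred-residue D D≢0 (y₁ ∧ y) of λ where
      -- Translating `x` by k and l times the frame vectors reduces the coordinates of `D` times `x`
      -- to their centred residues. The translate is then so short that it vanishes, and `x` is
      -- minus the combination added.
      (l , l-small) → ⊝ (k , l) , ≈₂-trans
          (x+y≈0⇒x≈-y x (E (k , l)) (small⇒0 (y ∧ y₂ ℤ.+ k ℤ.* D , y₁ ∧ y ℤ.+ l ℤ.* D)
            (scaled-+₂ {c} lattice x∈ (scaled-combination {c} lattice e₁∈ e₂∈ (k , l)))
            (≈₂-trans (·-+₂ (fromℤ D) x (E (k , l))) (≈₂-trans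
              (+₂-cong (multiple y x≈) (≈₂-sym (E-• D (k , l))))
              (≈₂-trans (≈₂-sym (E-⊕ (y ∧ y₂ , y₁ ∧ y) (D • (k , l))))
                (E-cong (cong₂ (λ a b → y ∧ y₂ ℤ.+ a , y₁ ∧ y ℤ.+ b) (ℤ.*-comm D k) (ℤ.*-comm D l))))))
            (N-small (y ∧ y₂ ℤ.+ k ℤ.* D) (y₁ ∧ y ℤ.+ l ℤ.* D) ℤ.∣ D ∣ {{ℕ.≢-nonZero (D≢0 ∘ ℤ.∣i∣≡0⇒i≡0)}} k-small l-small)))
          (≈₂-sym (E-⊝ (k , l)))

-- The shortest vector belonging to a given form

module Analyse {ℓ : ℕ} {L M : Subset} (ℓ-prime : Prime ℓ) (form : TemperedPerfect ℓ L M)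
  (S-pairs : ConsistsOfPairs 3 (TemperedPerfect.S form)) (S′-pairs : ConsistsOfPairs 1 (TemperedPerfect.S′ form)) where

  open TemperedPerfect form

  open Satisfies satisfies

  M₁⊆L₁ : ∀ {x} → M₁ x → L₁ x
  M₁⊆L₁ (z , z∈M , x≈) = z , M⊆L z∈M , x≈

  1≤u : 1ℝ ≤ u
  1≤u = proj₁ on-S′

  -- Membership in `M₁`, `S` and `S′` is undecidable, but the conclusion is a negation, so excluded
  -- middle may be used under a double negation. Vectors of `M₁` obey the bound because u ≥ 1.
  minimum : ∀ x → L₁ x → ¬ (x ≈₂ 0₂) → 1ℝ ≤ A x
  minimum x x∈L x≉0 A<1 = ¬¬-excluded-middle λ where
    (yes x∈M) → ¬¬-excluded-middle λ where
      (yes x∈S′) → 1≤u (<-resp-≈ (proj₂ on-S′ x x∈S′) (≈-refl {1ℝ}) A<1)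
      (no  x∉S′) → 1≤u (<-trans (off-S′ x x∈M x≉0 x∉S′) A<1)
    (no x∉M) → ¬¬-excluded-middle λ where
      (yes x∈S) → <-irrefl (on-S x x∈S) A<1
      (no  x∉S) → <⇒≤ (off-S x x∈L x∉M x∉S) A<1

  s : Fin 3 → ℝ²
  s = proj₁ S-pairs

  s∈S : ∀ i → S (s i)
  s∈S i = Equivalence.from (proj₂ (proj₂ (proj₂ S-pairs)) (s i)) (i , inj₁ ≈₂-refl)

  s∈L₁ : ∀ i → L₁ (s i)
  s∈L₁ i = proj₁ (S⊆L−M (s i) (s∈S i))

  s-unit : ∀ i → A (s i) ≈ 1ℝ
  s-unit i = on-S (s i) (s∈S i)

  s+ : ∀ i j → i ≢ j → 1ℝ ≤ A (s i +₂ s j)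
  s+ i j i≢j = minimum (s i +₂ s j) (scaled-+₂ {scalar} L-isLattice (s∈L₁ i) (s∈L₁ j))
    λ ≈0 → proj₁ (proj₂ (proj₂ S-pairs)) i j i≢j (inj₂ (x+y≈0⇒x≈-y (s i) (s j) ≈0))

  s- : ∀ i j → i ≢ j → 1ℝ ≤ A (s i -₂ s j)
  s- i j i≢j = minimum (s i -₂ s j) (scaled-+₂ {scalar} L-isLattice (s∈L₁ i) (scaled--₂ {scalar} L-isLattice (s∈L₁ j)))
    λ ≈0 → proj₁ (proj₂ (proj₂ S-pairs)) i j i≢j (inj₁ (x-y≈0⇒x≈y (s i) (s j) ≈0))

  hexagonal : ∃₂ λ e₁ e₂ → HexagonalFrame e₁ e₂ × L₁ e₁ × L₁ e₂
  hexagonal = case three-units⇒hexagonal (s zero) (s (suc zero)) (s (suc (suc zero)))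
      (s-unit zero) (s-unit (suc zero)) (s-unit (suc (suc zero)))
      (s+ zero (suc zero) λ ()) (s- zero (suc zero) λ ())
      (s+ zero (suc (suc zero)) λ ()) (s- zero (suc (suc zero)) λ ())
      (s+ (suc zero) (suc (suc zero)) λ ()) (s- (suc zero) (suc (suc zero)) λ ()) of λ where
    (inj₁ frame) → s zero , s (suc zero) , frame , s∈L₁ zero , s∈L₁ (suc zero)
    (inj₂ frame) → s zero , -₂ s (suc zero) , frame , s∈L₁ zero , scaled--₂ {scalar} L-isLattice (s∈L₁ (suc zero))

  module WithFrame {e₁ e₂ : ℝ²} (frame : HexagonalFrame e₁ e₂) (e₁∈ : L₁ e₁) (e₂∈ : L₁ e₂) where

    open Frame frame
    open Hexagonal {scalar} L-isLattice minimum frame e₁∈ e₂∈ using (spanned)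

    E∈L₁ : ∀ y → L₁ (E y)
    E∈L₁ = scaled-combination {scalar} L-isLattice e₁∈ e₂∈

    P : ℤ[ω] → Set
    P y = M₁ (E y)

    r : Fin ℓ → ℝ²
    r = proj₁ index

    c·r∈L₁ : ∀ i → L₁ (scalar · r i)
    c·r∈L₁ i = r i , proj₁ (proj₂ index) i , ≈₂-refl

    coset : Fin ℓ → ℤ[ω]
    coset i = proj₁ (spanned (c·r∈L₁ i))

    coset≈ : ∀ i → scalar · r i ≈₂ E (coset i)
    coset≈ i = proj₂ (spanned (c·r∈L₁ i))

    -- The preimage of E y in the unscaled lattice.
    z : ℤ[ω] → ℝ²
    z y = proj₁ (E∈L₁ y)

    z∈L : ∀ y → L (z y)
    z∈L y = proj₁ (proj₂ (E∈L₁ y))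

    E≈cz : ∀ y → E y ≈₂ scalar · z y
    E≈cz y = proj₂ (proj₂ (E∈L₁ y))

    class : ℤ[ω] → Fin ℓ
    class y = proj₁ (proj₂ (proj₂ index) (z y) (z∈L y))

    difference : ∀ y i → E (y ⊖ coset i) ≈₂ scalar · (z y -₂ r i)
    difference y i = ≈₂-trans (E-⊖ y (coset i)) (≈₂-trans
      (+₂-cong (E≈cz y) (-₂-cong (≈₂-sym (coset≈ i))))
      (≈₂-sym (≈₂-trans (·-+₂ scalar (z y) (-₂ r i)) (+₂-cong (≈₂-refl {scalar · z y}) (·--₂ scalar (r i))))))

    finite-index : FiniteIndex P ℓ
    finite-index = record
      { ∋0           = scaled-resp {scalar} M-isLattice (≈₂-sym E-0) (scaled-0 {scalar} M-isLattice)
      ; ∋-⊖          = λ {x} {y} x∈ y∈ → scaled-resp {scalar} M-isLattice (≈₂-sym (E-⊖ x y))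
                         (scaled-+₂ {scalar} M-isLattice x∈ (scaled--₂ {scalar} M-isLattice y∈))
      ; coset        = coset
      ; class        = class
      ; class-spec   = λ y → z y -₂ r (class y) , proj₁ (proj₂ (proj₂ (proj₂ index) (z y) (z∈L y))) , difference y (class y)
      -- Uniqueness in `HasIndex` concerns the unscaled `M`, so the positive scalar has to be
      -- cancelled.
      ; class-unique = λ {y} {i} (m , m∈M , eq) → proj₂ (proj₂ (proj₂ (proj₂ index) (z y) (z∈L y)))
          (lattice-resp {scalar} M-isLattice (≈₂-sym (·-cancel {scalar} {z y -₂ r i} {m} 0<scalar
            (≈₂-trans (≈₂-sym (difference y i)) eq))) m∈M)
      }

    s′ : ℝ²
    s′ = proj₁ S′-pairs zero

    s′∈S′ : S′ s′
    s′∈S′ = Equivalence.from (proj₂ (proj₂ (proj₂ S′-pairs)) s′) (zero , inj₁ ≈₂-refl)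

    s′∈M₁ : M₁ s′
    s′∈M₁ = proj₁ (S′⊆M−0 s′ s′∈S′)

    v : ℤ[ω]
    v = proj₁ (spanned (M₁⊆L₁ s′∈M₁))

    s′≈v : s′ ≈₂ E v
    s′≈v = proj₂ (spanned (M₁⊆L₁ s′∈M₁))

    v≢0 : v ≢ 0ω
    v≢0 v≡0 = proj₂ (S′⊆M−0 s′ s′∈S′) (≈₂-trans s′≈v (≈₂-trans (E-cong v≡0) E-0))

    v∈P : P v
    v∈P = scaled-resp {scalar} M-isLattice s′≈v s′∈M₁

    A-E-N : ∀ y → A (E y) ≈ fromℕ (N y)
    A-E-N y = ≈-trans (A-E y) (≡⇒≈ (cong fromℤ (norm≡N y)))

    u≈N : u ≈ fromℕ (N v)
    u≈N = ≈-trans (≈-sym (proj₂ on-S′ s′ s′∈S′)) (≈-trans (A-cong s′≈v) (A-E-N v))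

    minimal : ∀ y → P y → y ≢ 0ω → y ≢ v → y ≢ ⊝ v → N v ℕ.< N y
    minimal y y∈P y≢0 y≢v y≢-v = ℤ.drop‿+<+ (fromℤ-cancel-< {+ N v} {+ N y} (<-resp-≈ u≈N (A-E-N y)
      (off-S′ (E y) y∈P (y≢0 ∘ E-injective₀ y) (y∉ ∘ Equivalence.to (proj₂ (proj₂ (proj₂ S′-pairs)) (E y))))))
      where
      y∉ : ¬ (∃ λ i → E y ≈₂ proj₁ S′-pairs i ⊎ E y ≈₂ -₂ proj₁ S′-pairs i)
      y∉ (zero , inj₁ eq) = y≢v (E-injective y v (≈₂-trans eq s′≈v))
      y∉ (zero , inj₂ eq) = y≢-v (E-injective y (⊝ v) (≈₂-trans eq (≈₂-trans (-₂-cong s′≈v) (≈₂-sym (E-⊝ v)))))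

    shortest-vector : fromℚ (+ 3 / 4) * fromℕ ℓ ≤ u → u ≤ fromℕ ℓ → ∃ λ v → InRange ℓ v × Shortest ℓ v × u ≈ fromℕ (N v)
    shortest-vector ¾ℓ≤u u≤ℓ = v , (V.v-primitive , 3ℓ≤4N , V.v<ℓ) , V.shortest , u≈N
      where
      v≤ℓ : N v ℕ.≤ ℓ
      v≤ℓ = ℤ.drop‿+≤+ (fromℤ-cancel-≤ {+ N v} {+ ℓ} (≤-resp-≈ u≈N (≈-refl {fromℕ ℓ}) u≤ℓ))
      module V = MinimalVector ℓ-prime finite-index v≢0 v∈P minimal v≤ℓ
      3ℓ≤4N : 3 ℕ.* ℓ ℕ.≤ 4 ℕ.* N v
      3ℓ≤4N = ¾ℓ≤n⇒3ℓ≤4n ℓ (N v) (≤-resp-≈ (≈-refl {fromℚ (+ 3 / 4) * fromℕ ℓ}) u≈N ¾ℓ≤u)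

  shortest-vector : fromℚ (+ 3 / 4) * fromℕ ℓ ≤ u → u ≤ fromℕ ℓ → ∃ λ v → InRange ℓ v × Shortest ℓ v × u ≈ fromℕ (N v)
  shortest-vector = case hexagonal of λ where
    (e₁ , e₂ , frame , e₁∈ , e₂∈) → WithFrame.shortest-vector frame e₁∈ e₂∈

temperament⇒shortest : ∀ {ℓ L M x} → Prime ℓ → (form : TemperedPerfect ℓ L M) →
  ConsistsOfPairs 3 (TemperedPerfect.S form) → ConsistsOfPairs 1 (TemperedPerfect.S′ form) →
  x ≈ TemperedPerfect.u form → fromℚ (+ 3 / 4) * fromℕ ℓ ≤ x → x ≤ fromℕ ℓ →
  ∃ λ v → InRange ℓ v × Shortest ℓ v × x ≈ fromℕ (N v)
temperament⇒shortest {ℓ} ℓ-prime form S-pairs S′-pairs x≈u ¾ℓ≤x x≤ℓ =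
  case Analyse.shortest-vector ℓ-prime form S-pairs S′-pairs
      (≤-resp-≈ (≈-refl {fromℚ (+ 3 / 4) * fromℕ ℓ}) x≈u ¾ℓ≤x) (≤-resp-≈ x≈u (≈-refl {fromℕ ℓ}) x≤ℓ) of λ where
    (v , v∈ , v-shortest , u≈N) → v , v∈ , v-shortest , ≈-trans x≈u u≈N

mainTheorem2 :
    (ℓ : ℕ) → Prime ℓ →
    Halts ℓ (start ℓ) ×
    (∀ T → Outputs ℓ T → ∀ (x : ℝ) →
      (∃ λ β → β ∈ T × x ≈ fromℕ β) ⇔
      (fromℚ (+ 3 / 4) * fromℕ ℓ ≤ x × x ≤ fromℕ ℓ ×
       (Σ[ τ ∈ ℝ ] IsTemperament 3 1 ℓ τ × x ≈ τ * τ)))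
mainTheorem2 ℓ ℓ-prime = start-halts , λ T run x → mk⇔ (forwards T run x) (backwards T run x)
  where
  open Algorithm ℓ-prime second⇒partner (second-exists ℓ {{prime⇒nonZero ℓ-prime}})

  bounded-square : ∀ v → InRange ℓ v → Shortest ℓ v → ∀ x → x ≈ fromℕ (N v) →
    fromℚ (+ 3 / 4) * fromℕ ℓ ≤ x × x ≤ fromℕ ℓ × (Σ[ τ ∈ ℝ ] IsTemperament 3 1 ℓ τ × x ≈ τ * τ)
  bounded-square v v∈@(_ , 3ℓ≤4N , v<ℓ) v-shortest x x≈N =
    ≤-resp-≈ (≈-refl {fromℚ (+ 3 / 4) * fromℕ ℓ}) (≈-sym x≈N) (3ℓ≤4n⇒¾ℓ≤n ℓ (N v) 3ℓ≤4N) ,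
    ≤-resp-≈ (≈-sym x≈N) (≈-refl {fromℕ ℓ}) (fromℤ-mono-≤ {+ N v} {+ ℓ} (ℤ.+≤+ (ℕ.<⇒≤ v<ℓ))) ,
    shortest⇒temperament {ℓ} {v} ℓ-prime v∈ v-shortest x≈N

  forwards : ∀ T → Outputs ℓ T → ∀ x → (∃ λ β → β ∈ T × x ≈ fromℕ β) →
    fromℚ (+ 3 / 4) * fromℕ ℓ ≤ x × x ≤ fromℕ ℓ × (Σ[ τ ∈ ℝ ] IsTemperament 3 1 ℓ τ × x ≈ τ * τ)
  forwards T run x (β , β∈T , x≈β) = case Equivalence.to (output-spec run) β∈T of λ where
    (v , v∈ , v-shortest , N≡β) → bounded-square v v∈ v-shortest x (subst (λ β → x ≈ fromℕ β) (sym N≡β) x≈β)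

  backwards : ∀ T → Outputs ℓ T → ∀ x →
    fromℚ (+ 3 / 4) * fromℕ ℓ ≤ x × x ≤ fromℕ ℓ × (Σ[ τ ∈ ℝ ] IsTemperament 3 1 ℓ τ × x ≈ τ * τ) →
    ∃ λ β → β ∈ T × x ≈ fromℕ β
  backwards T run x (¾ℓ≤x , x≤ℓ , τ , (L , M , form , S-pairs , S′-pairs , _ , τ²≈u) , x≈τ²) =
    case temperament⇒shortest ℓ-prime form S-pairs S′-pairs (≈-trans x≈τ² τ²≈u) ¾ℓ≤x x≤ℓ of λ where
      (v , v∈ , v-shortest , x≈N) → N v , Equivalence.from (output-spec {T} {N v} run) (v , v∈ , v-shortest , refl) , x≈N
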